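{- There is a universal constant $\kappa>0$ such that for all finite sets $\mathcal X,\mathcal Y$, every $f:\mathcal X\times\mathcal Y\to\{0,1\}$, every distribution $\mu$ on $\mathcal X\times\mathcal Y$, all integers $n,r\ge1$ and every $C>7(r\log r)/\kappa$: if $\mathsf{adv}^r_\mu(C,f)<\kappa$, then $$\mathsf{suc}^r_{\mu^n}\Big(\Big(\frac{\kappa C}{r}-\log r\Big)n,\,f^{n}\Big)<\exp(-\kappa n).$$
   Context: We write $xy$ for $(x,y)$; logs are base 2. $f^n:\mathcal X^n\times\mathcal Y^n\to\{0,1\}^n$ is $f^n(xy)=(f(x_1y_1),\dots,f(x_ny_n))$, and $\mu^n(xy)=\prod_{j=1}^n\mu(x_jy_j)$ on $\mathcal X^n\times\mathcal Y^n$. A randomized two-party communication protocol $\pi$: Alice receives $x$, Bob receives $y$, they have public and private randomness and alternately send messages (Alice sends the odd-numbered ones, Bob the even-numbered ones); it is an $r$-round protocol if $r$ messages are exchanged. The output $\pi(xy)$ is determined by the transcript together with the public randomness. $\|\pi\|$ is the maximum total number of bits exchanged (public randomness not counted). For a distribution $\nu$ on inputs, $$\mathsf{adv}^r_\nu(C,g)=\sup_{\|\pi\|\le C}\mathbb E\big[(-1)^{\pi(xy)+g(xy)}\big]\ (g\text{ Boolean}),\qquad \mathsf{suc}^r_\nu(C,g)=\sup_{\|\pi\|\le C}\Pr[\pi(xy)=g(xy)],$$ where the suprema are over $r$-round protocols and expectation/probability is over $xy\sim\nu$ and the randomness of $\pi$. -}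

module Defs where

open import Data.Bool.Base using (Bool; if_then_else_)
import Data.Bool.Properties as Bool
import Data.Integer.Base as ℤ
import Data.Integer.Properties as ℤ
open import Data.List.Base as List using (List; []; _∷_)
open import Data.List.Membership.Propositional using (_∈_)
open import Data.List.Membership.Propositional.Properties
  using (∈-cartesianProduct⁺; ∈-cartesianProductWith⁺)
open import Data.List.Relation.Unary.All using ([])
open import Data.List.Relation.Unary.AllPairs using ([]; _∷_)
open import Data.List.Relation.Unary.Any using (here)
open import Data.List.Relation.Unary.Unique.Propositional using (Unique)
import Data.List.Relation.Unary.Unique.Propositional.Properties as Unique
open import Data.Nat.Base as ℕ using (ℕ; zero; suc; ⌊_/2⌋)
open import Data.Nat.Logarithm using (⌊log₂_⌋)
open import Data.Nat.Logarithm.Core using (⌊log2⌋)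
import Data.Nat.Properties as ℕ
import Data.Nat.Tactic.RingSolver as ℕRing
open import Data.Product.Base using (Σ-syntax; ∃-syntax; _×_; _,_)
import Data.Rational.Base
open import Data.Rational.Base as ℚ using (ℚ; 0ℚ; 1ℚ)
import Data.Rational.Properties as ℚ
open import Data.Rational.Solver using (module +-*-Solver)
import Data.Rational.Unnormalised.Base as ℚᵘ
import Data.Rational.Unnormalised.Properties as ℚᵘ
open import Data.Sum.Base using (inj₁; inj₂)
open import Data.Vec.Base as Vec using (Vec; []; _∷_)
import Data.Vec.Properties as Vec
open import Induction.WellFounded using (Acc; acc)
open import Relation.Binary.Definitions using (DecidableEquality)
open import Relation.Binary.PropositionalEquality
  using (_≡_; refl; sym; trans; cong; cong₂; subst; subst₂)
open import Relation.Nullary.Decidable.Core using (⌊_⌋)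
open import Relation.Nullary.Negation.Core using (¬_)

------------------------------------------------------------------------
-- Sequences of rationals

IsCauchy : (ℕ → ℚ) → Set
IsCauchy s = ∀ ε → 0ℚ ℚ.< ε →
  ∃[ N ] ∀ m n → N ℕ.≤ m → N ℕ.≤ n → ℚ.∣ s m ℚ.- s n ∣ ℚ.≤ ε

-- q ^ k / k !
expTerm : ℚ → ℕ → ℚ
expTerm q zero    = 1ℚ
expTerm q (suc k) = expTerm q k ℚ.* q ℚ.* (ℤ.+ 1 ℚ./ suc k)

-- The sum of the terms with index < n.
expSum : ℚ → ℕ → ℚ
expSum q zero    = 0ℚ
expSum q (suc n) = expSum q n ℚ.+ expTerm q n

-- ⌊log₂ (r ^ n)⌋ / n with n = suc k, which is within 1 / n of log₂ r.
logApprox : ℕ → ℕ → ℚ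
logApprox r k = ℤ.+ ⌊log₂ (r ℕ.^ suc k) ⌋ ℚ./ suc k

module CauchyProofs where

  open Data.Rational.Base

  module S = +-*-Solver

  -- Arguments that unification could recover are explicit throughout: the
  -- operations of ℚ reduce, so recovering them is slow.

  *-monoʳ : ∀ a b c → 0ℚ ≤ c → a ≤ b → a * c ≤ b * c
  *-monoʳ a b c 0≤c = ℚ.*-monoʳ-≤-nonNeg c {{nonNegative 0≤c}} {a} {b}

  *-monoˡ : ∀ a b c → 0ℚ ≤ c → a ≤ b → c * a ≤ c * b
  *-monoˡ a b c 0≤c = ℚ.*-monoˡ-≤-nonNeg c {{nonNegative 0≤c}} {a} {b}

  *-mono : ∀ a b c d → 0ℚ ≤ b → 0ℚ ≤ c → a ≤ b → c ≤ d → a * c ≤ b * d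
  *-mono a b c d 0≤b 0≤c a≤b c≤d =
    ℚ.≤-trans {a * c} {b * c} {b * d} (*-monoʳ a b c 0≤c a≤b) (*-monoˡ c d b 0≤b c≤d)

  +-mono : ∀ a b c d → a ≤ b → c ≤ d → a + c ≤ b + d
  +-mono a b c d = ℚ.+-mono-≤ {a} {b} {c} {d}

  0≤* : ∀ a b → 0ℚ ≤ a → 0ℚ ≤ b → 0ℚ ≤ a * b
  0≤* a b 0≤a 0≤b = subst (_≤ a * b) (ℚ.*-zeroˡ b) (*-monoʳ 0ℚ a b 0≤b 0≤a)

  0≤+ : ∀ a b → 0ℚ ≤ a → 0ℚ ≤ b → 0ℚ ≤ a + b
  0≤+ a b 0≤a 0≤b = subst (_≤ a + b) (ℚ.+-identityˡ 0ℚ) (+-mono 0ℚ a 0ℚ b 0≤a 0≤b)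

  0<+ : ∀ a b → 0ℚ < a → 0ℚ ≤ b → 0ℚ < a + b
  0<+ a b 0<a 0≤b =
    subst (_< a + b) (ℚ.+-identityˡ 0ℚ) (ℚ.+-mono-<-≤ {0ℚ} {a} {0ℚ} {b} 0<a 0≤b)

  0<* : ∀ a b → 0ℚ < a → 0ℚ < b → 0ℚ < a * b
  0<* a b 0<a 0<b =
    subst (_< a * b) (ℚ.*-zeroˡ b) (ℚ.*-monoˡ-<-pos b {{positive 0<b}} {0ℚ} {a} 0<a)

  *-cancel : ∀ a b c → 0ℚ < c → c * a ≤ c * b → a ≤ b
  *-cancel a b c 0<c = ℚ.*-cancelˡ-≤-pos {a} {b} c {{positive 0<c}}

  0<1 : 0ℚ < 1ℚ
  0<1 = ℚ.positive⁻¹ 1ℚ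

  0≤1 : 0ℚ ≤ 1ℚ
  0≤1 = ℚ.<⇒≤ 0<1

  inv : ∀ q → 0ℚ < q → ℚ
  inv q 0<q = (1/ q) {{>-nonZero 0<q}}

  inv-pos : ∀ q 0<q → 0ℚ < inv q 0<q
  inv-pos q 0<q = ℚ.positive⁻¹ (inv q 0<q) {{ℚ.1/pos⇒pos q {{positive 0<q}}}}

  *-inv : ∀ q 0<q → q * inv q 0<q ≡ 1ℚ
  *-inv q 0<q = ℚ.*-inverseʳ q {{>-nonZero 0<q}}

  neg-diff : ∀ p q → - (p - q) ≡ q - p
  neg-diff = S.solve 2 (λ p q → S.:- (p S.:- q) S.:= q S.:- p) refl

  ∣-∣-swap : ∀ p q → ∣ p - q ∣ ≡ ∣ q - p ∣
  ∣-∣-swap p q = trans (sym (ℚ.∣-p∣≡∣p∣ (p - q))) (cong ∣_∣ (neg-diff p q))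

  diff-neg : ∀ p q → q - p ≡ - p - - q
  diff-neg = S.solve 2 (λ p q → q S.:- p S.:= S.:- p S.:- (S.:- q)) refl

  diff-+ : ∀ u v w x → (u + v) - (w + x) ≡ (u - w) + (v - x)
  diff-+ = S.solve 4 (λ u v w x →
    (u S.:+ v) S.:- (w S.:+ x) S.:= (u S.:- w) S.:+ (v S.:- x)) refl

  diff-* : ∀ u v w x → u * v - w * x ≡ u * (v - x) + (u - w) * x
  diff-* = S.solve 4 (λ u v w x →
    u S.:* v S.:- w S.:* x S.:= u S.:* (v S.:- x) S.:+ (u S.:- w) S.:* x) refl

  insert : ∀ u v → u ≡ (u - v) + v
  insert = S.solve 2 (λ u v → u S.:= (u S.:- v) S.:+ v) refl

  rotate : ∀ a b c → a * (b * c) ≡ b * (a * c)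
  rotate = S.solve 3 (λ a b c → a S.:* (b S.:* c) S.:= b S.:* (a S.:* c)) refl

  double : ∀ a → a + a ≡ (1ℚ + 1ℚ) * a
  double a = sym (trans (ℚ.*-distribʳ-+ a 1ℚ 1ℚ) (cong₂ _+_ (ℚ.*-identityˡ a) (ℚ.*-identityˡ a)))

  cancel-inv : ∀ k e 0<k → k * (e * inv k 0<k) ≡ e
  cancel-inv k e 0<k = trans (rotate k e (inv k 0<k))
    (trans (cong (e *_) (*-inv k 0<k)) (ℚ.*-identityʳ e))

  ∣+∣≤ : ∀ a b {A B} → ∣ a ∣ ≤ A → ∣ b ∣ ≤ B → ∣ a + b ∣ ≤ A + B
  ∣+∣≤ a b {A} {B} a≤A b≤B = ℚ.≤-trans {∣ a + b ∣} {∣ a ∣ + ∣ b ∣} {A + B}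
    (ℚ.∣p+q∣≤∣p∣+∣q∣ a b) (+-mono (∣ a ∣) A (∣ b ∣) B a≤A b≤B)

  ∣*∣≤ : ∀ a b {A B} → 0ℚ ≤ A → ∣ a ∣ ≤ A → ∣ b ∣ ≤ B → ∣ a * b ∣ ≤ A * B
  ∣*∣≤ a b {A} {B} 0≤A a≤A b≤B = subst (_≤ A * B) (sym (ℚ.∣p*q∣≡∣p∣*∣q∣ a b))
    (*-mono (∣ a ∣) A (∣ b ∣) B 0≤A (ℚ.0≤∣p∣ b) a≤A b≤B)

  ∣sum-diff∣≤ : ∀ a b c d {A B} → ∣ a - c ∣ ≤ A → ∣ b - d ∣ ≤ B →
                ∣ (a + b) - (c + d) ∣ ≤ A + B
  ∣sum-diff∣≤ a b c d {A} {B} ac bd = subst (λ x → ∣ x ∣ ≤ A + B) (sym (diff-+ a b c d))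
    (∣+∣≤ (a - c) (b - d) ac bd)

  ∣prod-diff∣≤ : ∀ a b c d {A B C D} → 0ℚ ≤ A → 0ℚ ≤ C → ∣ a ∣ ≤ A → ∣ d ∣ ≤ B →
                 ∣ a - c ∣ ≤ C → ∣ b - d ∣ ≤ D → ∣ a * b - c * d ∣ ≤ A * D + C * B
  ∣prod-diff∣≤ a b c d {A} {B} {C} {D} 0≤A 0≤C aA dB ac bd =
    subst (λ x → ∣ x ∣ ≤ A * D + C * B) (sym (diff-* a b c d))
      (∣+∣≤ (a * (b - d)) ((a - c) * d)
        (∣*∣≤ a (b - d) {A} {D} 0≤A aA bd) (∣*∣≤ (a - c) d {C} {B} 0≤C ac dB))

  nonneg-∣∣ : ∀ a → 0ℚ ≤ a → ∣ a ∣ ≤ a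
  nonneg-∣∣ a 0≤a = ℚ.≤-reflexive (ℚ.0≤p⇒∣p∣≡p 0≤a)

  -- It suffices to bound the differences by a fixed multiple of ε.
  scale : ∀ s K → 0ℚ < K →
    (∀ ε → 0ℚ < ε → ∃[ N ] ∀ m n → N ℕ.≤ m → N ℕ.≤ n → ∣ s m - s n ∣ ≤ K * ε) →
    IsCauchy s
  scale s K 0<K h ε 0<ε with h (ε * inv K 0<K) (0<* ε (inv K 0<K) 0<ε (inv-pos K 0<K))
  ... | N , b = N , λ m n N≤m N≤n →
    subst (∣ s m - s n ∣ ≤_) (cancel-inv K ε 0<K) (b m n N≤m N≤n)

  symmetrise : ∀ (s : ℕ → ℚ) {δ} N →
    (∀ m n → N ℕ.≤ m → m ℕ.≤ n → ∣ s m - s n ∣ ≤ δ) →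
    ∀ m n → N ℕ.≤ m → N ℕ.≤ n → ∣ s m - s n ∣ ≤ δ
  symmetrise s {δ} N h m n N≤m N≤n with ℕ.≤-total m n
  ... | inj₁ m≤n = h m n N≤m m≤n
  ... | inj₂ n≤m = subst (_≤ δ) (∣-∣-swap (s n) (s m)) (h n m N≤n n≤m)

  maxˡ : ∀ {M N k} → M ℕ.⊔ N ℕ.≤ k → M ℕ.≤ k
  maxˡ {M} {N} = ℕ.m⊔n≤o⇒m≤o M N

  maxʳ : ∀ {M N k} → M ℕ.⊔ N ℕ.≤ k → N ℕ.≤ k
  maxʳ {M} {N} = ℕ.m⊔n≤o⇒n≤o M N

  -- Abstract, since unfolding the moduli of convergence is slow.
  abstract
    const-cauchy : ∀ q → IsCauchy (λ _ → q)
    const-cauchy q ε 0<ε = 0 , λ _ _ _ _ →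
      subst (λ d → ∣ d ∣ ≤ ε) (sym (ℚ.+-inverseʳ q)) (ℚ.<⇒≤ 0<ε)

  abstract
    neg-cauchy : ∀ s → IsCauchy s → IsCauchy (λ n → - s n)
    neg-cauchy s cs ε 0<ε with cs ε 0<ε
    ... | N , b = N , λ m n N≤m N≤n → subst (_≤ ε)
      (trans (∣-∣-swap (s m) (s n)) (cong ∣_∣ (diff-neg (s m) (s n)))) (b m n N≤m N≤n)

  abstract
    +-cauchy : ∀ s t → IsCauchy s → IsCauchy t → IsCauchy (λ n → s n + t n)
    +-cauchy s t cs ct = scale (λ n → s n + t n) (1ℚ + 1ℚ) (0<+ 1ℚ 1ℚ 0<1 0≤1) λ ε 0<ε →
      let (M , a) = cs ε 0<ε
          (N , b) = ct ε 0<ε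
      in M ℕ.⊔ N , λ m n p q →
        subst (∣ (s m + t m) - (s n + t n) ∣ ≤_) (double ε)
          (∣sum-diff∣≤ (s m) (t m) (s n) (t n) {ε} {ε}
            (a m n (maxˡ {M} {N} p) (maxˡ {M} {N} q)) (b m n (maxʳ {M} {N} p) (maxʳ {M} {N} q)))

  eventually-bounded : ∀ s → IsCauchy s →
    ∃[ B ] 0ℚ < B × ∃[ N ] ∀ n → N ℕ.≤ n → ∣ s n ∣ ≤ B
  eventually-bounded s cs with cs 1ℚ 0<1
  ... | N , b = 1ℚ + ∣ s N ∣ , 0<+ 1ℚ (∣ s N ∣) 0<1 (ℚ.0≤∣p∣ (s N)) , N , λ n N≤n →
    subst (λ x → ∣ x ∣ ≤ 1ℚ + ∣ s N ∣) (sym (insert (s n) (s N)))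
      (∣+∣≤ (s n - s N) (s N) {1ℚ} {∣ s N ∣} (b n N N≤n ℕ.≤-refl) (ℚ.≤-refl {∣ s N ∣}))

  ∣prod-diff∣≤ε : ∀ a b c d A B ε → 0ℚ ≤ A → 0ℚ ≤ ε → ∣ a ∣ ≤ A → ∣ d ∣ ≤ B →
    ∣ a - c ∣ ≤ ε → ∣ b - d ∣ ≤ ε → ∣ a * b - c * d ∣ ≤ (A + B) * ε
  ∣prod-diff∣≤ε a b c d A B ε 0≤A 0≤ε aA dB ac bd =
    subst (∣ a * b - c * d ∣ ≤_) (factor A B ε)
      (∣prod-diff∣≤ a b c d {A} {B} {ε} {ε} 0≤A 0≤ε aA dB ac bd)
    where
    factor : ∀ A B ε → A * ε + ε * B ≡ (A + B) * ε
    factor = S.solve 3 (λ A B ε → A S.:* ε S.:+ ε S.:* B S.:= (A S.:+ B) S.:* ε) refl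

  abstract
    *-cauchy : ∀ s t → IsCauchy s → IsCauchy t → IsCauchy (λ n → s n * t n)
    *-cauchy s t cs ct =
      let (A , 0<A , N₁ , a) = eventually-bounded s cs
          (B , 0<B , N₂ , b) = eventually-bounded t ct
      in scale (λ n → s n * t n) (A + B) (0<+ A B 0<A (ℚ.<⇒≤ 0<B)) λ ε 0<ε →
        let (N₃ , c) = cs ε 0<ε
            (N₄ , d) = ct ε 0<ε
        in (N₁ ℕ.⊔ N₂) ℕ.⊔ (N₃ ℕ.⊔ N₄) , λ m n p q →
          let p₁₂ = maxˡ {N₁ ℕ.⊔ N₂} {N₃ ℕ.⊔ N₄} p
              q₁₂ = maxˡ {N₁ ℕ.⊔ N₂} {N₃ ℕ.⊔ N₄} q
              p₃₄ = maxʳ {N₁ ℕ.⊔ N₂} {N₃ ℕ.⊔ N₄} p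
              q₃₄ = maxʳ {N₁ ℕ.⊔ N₂} {N₃ ℕ.⊔ N₄} q
          in ∣prod-diff∣≤ε (s m) (t m) (s n) (t n) A B ε (ℚ.<⇒≤ 0<A) (ℚ.<⇒≤ 0<ε)
               (a m (maxˡ {N₁} {N₂} p₁₂)) (b n (maxʳ {N₁} {N₂} q₁₂))
               (c m n (maxˡ {N₃} {N₄} p₃₄) (maxˡ {N₃} {N₄} q₃₄))
               (d m n (maxʳ {N₃} {N₄} p₃₄) (maxʳ {N₃} {N₄} q₃₄))

  0<⊔ : ∀ ε q → 0ℚ < ε → 0ℚ < ε ⊔ q
  0<⊔ ε q 0<ε = ℚ.<-≤-trans {0ℚ} {ε} {ε ⊔ q} 0<ε (ℚ.p≤p⊔q ε q)

  invAbove : ∀ ε → 0ℚ < ε → ℚ → ℚ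
  invAbove ε 0<ε q = inv (ε ⊔ q) (0<⊔ ε q 0<ε)

  inv≤inv : ∀ e M 0<e 0<M → e ≤ M → inv M 0<M ≤ inv e 0<e
  inv≤inv e M 0<e 0<M e≤M = *-cancel (inv M 0<M) (inv e 0<e) e 0<e
    (subst (e * inv M 0<M ≤_) (trans (*-inv M 0<M) (sym (*-inv e 0<e)))
      (*-monoʳ e M (inv M 0<M) (ℚ.<⇒≤ (inv-pos M 0<M)) e≤M))

  inv-diff : ∀ a b x y → a * x ≡ 1ℚ → b * y ≡ 1ℚ → x - y ≡ (b - a) * (x * y)
  inv-diff a b x y ax by = sym (trans (expand a b x y)
    (trans (cong₂ (λ u v → u * x - v * y) by ax)
      (cong₂ _-_ (ℚ.*-identityˡ x) (ℚ.*-identityˡ y))))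
    where
    expand : ∀ a b x y → (b - a) * (x * y) ≡ (b * y) * x - (a * x) * y
    expand = S.solve 4 (λ a b x y →
      (b S.:- a) S.:* (x S.:* y) S.:= (b S.:* y) S.:* x S.:- (a S.:* x) S.:* y) refl

  abstract
    inv-cauchy : ∀ s ε (0<ε : 0ℚ < ε) → (∃[ N ] ∀ n → N ℕ.≤ n → ε ≤ s n) →
                 IsCauchy s → IsCauchy (λ n → invAbove ε 0<ε (s n))
    inv-cauchy s ε 0<ε (N₁ , low) cs =
      scale i (j * j) (0<* j j 0<j 0<j) λ δ 0<δ →
      let (N₂ , c) = cs δ 0<δ
      in N₁ ℕ.⊔ N₂ , λ m n p q →
        subst₂ (λ x y → ∣ x ∣ ≤ y)
          (sym (inv-diff (M m) (M n) (i m) (i n) (Mi m) (Mi n))) (ℚ.*-comm δ (j * j))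
          (∣*∣≤ (M n - M m) (i m * i n) {δ} {j * j} (ℚ.<⇒≤ 0<δ)
            (subst₂ (λ x y → ∣ x - y ∣ ≤ δ)
              (sym (ℚ.p≤q⇒p⊔q≡q (low n (maxˡ {N₁} {N₂} q))))
              (sym (ℚ.p≤q⇒p⊔q≡q (low m (maxˡ {N₁} {N₂} p))))
              (c n m (maxʳ {N₁} {N₂} q) (maxʳ {N₁} {N₂} p)))
            (∣*∣≤ (i m) (i n) {j} {j} (ℚ.<⇒≤ 0<j) (∣i∣≤j m) (∣i∣≤j n)))
      where
      j : ℚ
      j = inv ε 0<ε
      0<j : 0ℚ < j
      0<j = inv-pos ε 0<ε
      M : ℕ → ℚ
      M n = ε ⊔ s n
      0<M : ∀ n → 0ℚ < M n
      0<M n = 0<⊔ ε (s n) 0<ε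
      i : ℕ → ℚ
      i n = invAbove ε 0<ε (s n)
      Mi : ∀ n → M n * i n ≡ 1ℚ
      Mi n = *-inv (M n) (0<M n)
      ∣i∣≤j : ∀ n → ∣ i n ∣ ≤ j
      ∣i∣≤j n = ℚ.≤-trans {∣ i n ∣} {i n} {j} (nonneg-∣∣ (i n) (ℚ.<⇒≤ (inv-pos (M n) (0<M n))))
        (inv≤inv ε (M n) 0<ε (0<M n) (ℚ.p≤p⊔q ε (s n)))

  ratio-* : ∀ p q → fromℚᵘ p * fromℚᵘ q ≡ fromℚᵘ (p ℚᵘ.* q)
  ratio-* p q = ℚ.toℚᵘ-injective (ℚᵘ.≃-trans (ℚ.toℚᵘ-homo-* (fromℚᵘ p) (fromℚᵘ q))
    (ℚᵘ.≃-trans (ℚᵘ.*-cong (ℚ.toℚᵘ-fromℚᵘ p) (ℚ.toℚᵘ-fromℚᵘ q))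
      (ℚᵘ.≃-sym (ℚ.toℚᵘ-fromℚᵘ (p ℚᵘ.* q)))))

  ratio-+ : ∀ p q → fromℚᵘ p + fromℚᵘ q ≡ fromℚᵘ (p ℚᵘ.+ q)
  ratio-+ p q = ℚ.toℚᵘ-injective (ℚᵘ.≃-trans (ℚ.toℚᵘ-homo-+ (fromℚᵘ p) (fromℚᵘ q))
    (ℚᵘ.≃-trans (ℚᵘ.+-cong (ℚ.toℚᵘ-fromℚᵘ p) (ℚ.toℚᵘ-fromℚᵘ q))
      (ℚᵘ.≃-sym (ℚ.toℚᵘ-fromℚᵘ (p ℚᵘ.+ q)))))

  ratio-≤ : ∀ p q → p ℚᵘ.≤ q → fromℚᵘ p ≤ fromℚᵘ q
  ratio-≤ p q p≤q = ℚ.toℚᵘ-cancel-≤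
    (ℚᵘ.≤-respˡ-≃ (ℚᵘ.≃-sym (ℚ.toℚᵘ-fromℚᵘ p))
      (ℚᵘ.≤-respʳ-≃ (ℚᵘ.≃-sym (ℚ.toℚᵘ-fromℚᵘ q)) p≤q))

  natᵘ : ℕ → ℚᵘ.ℚᵘ
  natᵘ n = ℚᵘ.mkℚᵘ (ℤ.+ n) 0

  nat : ℕ → ℚ
  nat n = ℤ.+ n / 1

  u : ℕ → ℚ
  u k = ℤ.+ 1 / suc k

  nat-≤ : ∀ {m n} → m ℕ.≤ n → nat m ≤ nat n
  nat-≤ {m} {n} m≤n = ratio-≤ (natᵘ m) (natᵘ n)
    (ℚᵘ.*≤* (ℤ.*-monoʳ-≤-nonNeg (ℤ.+ 1) (ℤ.+≤+ m≤n)))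

  nat-+ : ∀ m n → nat m + nat n ≡ nat (m ℕ.+ n)
  nat-+ m n = trans (ratio-+ (natᵘ m) (natᵘ n)) (ℚ.fromℚᵘ-cong
    {natᵘ m ℚᵘ.+ natᵘ n} {natᵘ (m ℕ.+ n)} (ℚᵘ.*≡* (cong (ℤ._* ℤ.+ 1)
      (cong₂ ℤ._+_ (ℤ.*-identityʳ (ℤ.+ m)) (ℤ.*-identityʳ (ℤ.+ n))))))

  nat-* : ∀ m n → nat m * nat n ≡ nat (m ℕ.* n)
  nat-* m n = trans (ratio-* (natᵘ m) (natᵘ n)) (ℚ.fromℚᵘ-cong
    {natᵘ m ℚᵘ.* natᵘ n} {natᵘ (m ℕ.* n)} (ℚᵘ.*≡* (cong (ℤ._* ℤ.+ 1) (sym (ℤ.pos-* m n)))))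

  nat-u : ∀ k → nat (suc k) * u k ≡ 1ℚ
  nat-u k = trans (ratio-* (natᵘ (suc k)) (ℚᵘ.mkℚᵘ (ℤ.+ 1) k)) (ℚ.fromℚᵘ-cong
    {natᵘ (suc k) ℚᵘ.* ℚᵘ.mkℚᵘ (ℤ.+ 1) k} {natᵘ 1} (ℚᵘ.*≡*
      (trans (ℤ.*-identityʳ (ℤ.+ suc k ℤ.* ℤ.+ 1)) (trans (ℤ.*-identityʳ (ℤ.+ suc k))
        (sym (trans (ℤ.*-identityˡ (ℤ.+ (1 ℕ.* suc k))) (cong ℤ.+_ (ℕ.*-identityˡ (suc k)))))))))

  nat-nonneg : ∀ n → 0ℚ ≤ nat n
  nat-nonneg n = nat-≤ {0} {n} ℕ.z≤n

  nat-pos : ∀ n → 0ℚ < nat (suc n)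
  nat-pos n = ℚ.<-≤-trans {0ℚ} {1ℚ} {nat (suc n)} 0<1 (nat-≤ {1} {suc n} (ℕ.s≤s ℕ.z≤n))

  u-nonneg : ∀ k → 0ℚ ≤ u k
  u-nonneg k = ratio-≤ (natᵘ 0) (ℚᵘ.mkℚᵘ (ℤ.+ 1) k) (ℚᵘ.*≤* (ℤ.+≤+ ℕ.z≤n))

  archimedean : ∀ q → ∃[ N ] q ≤ nat N
  archimedean q@record{} = ℤ.∣ ↥ q ∣ , subst (_≤ nat ℤ.∣ ↥ q ∣) (ℚ.fromℚᵘ-toℚᵘ q)
    (ratio-≤ (toℚᵘ q) (natᵘ ℤ.∣ ↥ q ∣) (ℚᵘ.*≤* (bound (↥ q) (↧ₙ q))))
    where
    bound : ∀ i d .{{_ : ℕ.NonZero d}} → i ℤ.* ℤ.+ 1 ℤ.≤ ℤ.+ ℤ.∣ i ∣ ℤ.* ℤ.+ d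
    bound (ℤ.+ n) d = subst₂ ℤ._≤_ (ℤ.pos-* n 1) (ℤ.pos-* n d)
      (ℤ.+≤+ (ℕ.*-monoʳ-≤ n (ℕ.>-nonZero⁻¹ d)))
    bound (ℤ.-[1+ n ]) (suc d) = ℤ.-≤+

  archimedean-* : ∀ c ε → 0ℚ < ε → ∃[ N ] c ≤ ε * nat N
  archimedean-* c ε 0<ε =
    let (N , b) = archimedean (c * inv ε 0<ε)
    in N , subst (_≤ ε * nat N) (cancel-inv ε c 0<ε)
         (*-monoˡ (c * inv ε 0<ε) (nat N) ε (ℚ.<⇒≤ 0<ε) b)

  T = expTerm
  E = expSum

  T-nonneg : ∀ B → 0ℚ ≤ B → ∀ k → 0ℚ ≤ T B k
  T-nonneg B 0≤B zero    = 0≤1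
  T-nonneg B 0≤B (suc k) =
    0≤* (T B k * B) (u k) (0≤* (T B k) B (T-nonneg B 0≤B k) 0≤B) (u-nonneg k)

  E-nonneg : ∀ B → 0ℚ ≤ B → ∀ n → 0ℚ ≤ E B n
  E-nonneg B 0≤B zero    = ℚ.≤-refl {0ℚ}
  E-nonneg B 0≤B (suc n) = 0≤+ (E B n) (T B n) (E-nonneg B 0≤B n) (T-nonneg B 0≤B n)

  T-abs : ∀ q B → 0ℚ ≤ B → ∣ q ∣ ≤ B → ∀ k → ∣ T q k ∣ ≤ T B k
  T-abs q B 0≤B qB zero    = ℚ.≤-refl {1ℚ}
  T-abs q B 0≤B qB (suc k) =
    ∣*∣≤ (T q k * q) (u k) {T B k * B} {u k} (0≤* (T B k) B (T-nonneg B 0≤B k) 0≤B)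
      (∣*∣≤ (T q k) q {T B k} {B} (T-nonneg B 0≤B k) (T-abs q B 0≤B qB k) qB)
      (nonneg-∣∣ (u k) (u-nonneg k))

  T-shift : ∀ B k → T B (suc k) * nat (suc k) ≡ T B k * B
  T-shift B k = trans (ℚ.*-assoc (T B k * B) (u k) (nat (suc k)))
    (trans (cong (T B k * B *_) (trans (ℚ.*-comm (u k) (nat (suc k))) (nat-u k)))
      (ℚ.*-identityʳ (T B k * B)))

  step-eq : ∀ D t₀ t₁ B n v → t₁ * n ≡ t₀ * B → (1ℚ + n) * v ≡ 1ℚ →
            (t₁ * D + (D * t₀) * B) * v ≡ D * t₁
  step-eq D t₀ t₁ B n v shift unit =
    trans (cong (λ x → (t₁ * D + x) * v) (trans (ℚ.*-assoc D t₀ B) (cong (D *_) (sym shift))))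
      (trans (cong (λ x → (x + D * (t₁ * n)) * v) (sym (ℚ.*-identityʳ (t₁ * D))))
        (trans (collect D t₁ n v 1ℚ) (trans (cong (D * t₁ *_) unit) (ℚ.*-identityʳ (D * t₁)))))
    where
    collect : ∀ D t n v o → (t * D * o + D * (t * n)) * v ≡ D * t * ((o + n) * v)
    collect = S.solve 5 (λ D t n v o →
      (t S.:* D S.:* o S.:+ D S.:* (t S.:* n)) S.:* v
        S.:= D S.:* t S.:* ((o S.:+ n) S.:* v)) refl

  diff-*ʳ : ∀ a b v → a * v - b * v ≡ (a - b) * v
  diff-*ʳ = S.solve 3 (λ a b v → a S.:* v S.:- b S.:* v S.:= (a S.:- b) S.:* v) refl

  T-diff : ∀ p q B → 0ℚ ≤ B → ∣ p ∣ ≤ B → ∣ q ∣ ≤ B → ∀ k →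
           ∣ T p (suc k) - T q (suc k) ∣ ≤ ∣ p - q ∣ * T B k
  T-diff p q B 0≤B pB qB zero =
    ℚ.≤-reflexive (trans (cong₂ (λ x y → ∣ x - y ∣) (unit p) (unit q))
      (sym (ℚ.*-identityʳ (∣ p - q ∣))))
    where
    unit : ∀ q → 1ℚ * q * u 0 ≡ q
    unit q = trans (ℚ.*-identityʳ (1ℚ * q)) (ℚ.*-identityˡ q)
  T-diff p q B 0≤B pB qB (suc k) =
    subst₂ (λ x y → ∣ x ∣ ≤ y)
      (sym (diff-*ʳ (T p (suc k) * p) (T q (suc k) * q) (u (suc k))))
      (step-eq D (T B k) (T B (suc k)) B (nat (suc k)) (u (suc k)) (T-shift B k)
        (trans (cong (_* u (suc k)) (nat-+ 1 (suc k))) (nat-u (suc k))))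
      (∣*∣≤ (T p (suc k) * p - T q (suc k) * q) (u (suc k))
        {T B (suc k) * D + (D * T B k) * B} {u (suc k)}
        (0≤+ (T B (suc k) * D) ((D * T B k) * B)
          (0≤* (T B (suc k)) D (T-nonneg B 0≤B (suc k)) 0≤D)
          (0≤* (D * T B k) B 0≤DT 0≤B))
        (∣prod-diff∣≤ (T p (suc k)) p (T q (suc k)) q {T B (suc k)} {B} {D * T B k} {D}
          (T-nonneg B 0≤B (suc k)) 0≤DT (T-abs p B 0≤B pB (suc k)) qB
          (T-diff p q B 0≤B pB qB k) (ℚ.≤-refl {D}))
        (nonneg-∣∣ (u (suc k)) (u-nonneg (suc k))))
    where
    D = ∣ p - q ∣
    0≤D = ℚ.0≤∣p∣ (p - q)
    0≤DT : 0ℚ ≤ D * T B k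
    0≤DT = 0≤* D (T B k) 0≤D (T-nonneg B 0≤B k)

  E-diff : ∀ p q B → 0ℚ ≤ B → ∣ p ∣ ≤ B → ∣ q ∣ ≤ B → ∀ n →
           ∣ E p (suc n) - E q (suc n) ∣ ≤ ∣ p - q ∣ * E B n
  E-diff p q B 0≤B pB qB zero    = ℚ.≤-reflexive (sym (ℚ.*-zeroʳ (∣ p - q ∣)))
  E-diff p q B 0≤B pB qB (suc n) =
    subst (∣ E p (suc (suc n)) - E q (suc (suc n)) ∣ ≤_)
      (sym (ℚ.*-distribˡ-+ (∣ p - q ∣) (E B n) (T B n)))
      (∣sum-diff∣≤ (E p (suc n)) (T p (suc n)) (E q (suc n)) (T q (suc n))
        {∣ p - q ∣ * E B n} {∣ p - q ∣ * T B n}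
        (E-diff p q B 0≤B pB qB n) (T-diff p q B 0≤B pB qB n))

  drop-term : ∀ a b t → a - (b + t) ≡ (a - b) + (- t)
  drop-term = S.solve 3 (λ a b t → a S.:- (b S.:+ t) S.:= (a S.:- b) S.:+ (S.:- t)) refl

  add-term : ∀ a b t → (a - b) + t ≡ (a + t) - b
  add-term = S.solve 3 (λ a b t → (a S.:- b) S.:+ t S.:= (a S.:+ t) S.:- b) refl

  E-tail : ∀ q B → 0ℚ ≤ B → ∣ q ∣ ≤ B → ∀ m j →
           ∣ E q m - E q (j ℕ.+ m) ∣ ≤ E B (j ℕ.+ m) - E B m
  E-tail q B 0≤B qB m zero = ℚ.≤-reflexive
    (trans (cong ∣_∣ (ℚ.+-inverseʳ (E q m))) (sym (ℚ.+-inverseʳ (E B m))))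
  E-tail q B 0≤B qB m (suc j) =
    subst₂ (λ x y → ∣ x ∣ ≤ y) (sym (drop-term (E q m) (E q n) (T q n)))
      (add-term (E B n) (E B m) (T B n))
      (∣+∣≤ (E q m - E q n) (- T q n) {E B n - E B m} {T B n} (E-tail q B 0≤B qB m j)
        (subst (_≤ T B n) (sym (ℚ.∣-p∣≡∣p∣ (T q n))) (T-abs q B 0≤B qB n)))
    where
    n = j ℕ.+ m

  -- From index 2 b on, the terms at nat b at least halve at each step.
  module Tail (b : ℕ) where

    B = nat b
    0≤B = nat-nonneg b
    k₀ = b ℕ.+ b

    U : ℕ → ℚ
    U n = E B n + (T B n + T B n)

    M = U k₀

    halve : ∀ k → k₀ ℕ.≤ suc k → T B (suc k) + T B (suc k) ≤ T B k
    halve k h = subst₂ _≤_ (collect (T B k) B (u k)) (ℚ.*-identityʳ (T B k))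
      (*-monoˡ ((B + B) * u k) 1ℚ (T B k) (T-nonneg B 0≤B k)
        (subst₂ _≤_ (cong (_* u k) (sym (nat-+ b b))) (nat-u k)
          (*-monoʳ (nat k₀) (nat (suc k)) (u k) (u-nonneg k) (nat-≤ h))))
      where
      collect : ∀ t B v → t * ((B + B) * v) ≡ t * B * v + t * B * v
      collect = S.solve 3 (λ t B v →
        t S.:* ((B S.:+ B) S.:* v) S.:= t S.:* B S.:* v S.:+ t S.:* B S.:* v) refl

    U-step : ∀ k → k₀ ℕ.≤ k → U (suc k) ≤ U k
    U-step k h = subst (U (suc k) ≤_) (ℚ.+-assoc (E B k) (T B k) (T B k))
      (ℚ.+-monoʳ-≤ (E B k + T B k) {T B (suc k) + T B (suc k)} {T B k}
        (halve k (ℕ.m≤n⇒m≤1+n h)))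

    U-anti : ∀ m j → k₀ ℕ.≤ m → U (j ℕ.+ m) ≤ U m
    U-anti m zero    h = ℚ.≤-refl {U m}
    U-anti m (suc j) h = ℚ.≤-trans {U (suc j ℕ.+ m)} {U (j ℕ.+ m)} {U m}
      (U-step (j ℕ.+ m) (ℕ.≤-trans h (ℕ.m≤n+m m j))) (U-anti m j h)

    U≤M : ∀ n → k₀ ℕ.≤ n → U n ≤ M
    U≤M n h = subst (λ x → U x ≤ M) (ℕ.m∸n+n≡m h) (U-anti k₀ (n ℕ.∸ k₀) ℕ.≤-refl)

    0≤T = T-nonneg B 0≤B
    0≤E = E-nonneg B 0≤B

    0≤TT : ∀ n → 0ℚ ≤ T B n + T B n
    0≤TT n = 0≤+ (T B n) (T B n) (0≤T n) (0≤T n)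

    0≤M : 0ℚ ≤ M
    0≤M = 0≤+ (E B k₀) (T B k₀ + T B k₀) (0≤E k₀) (0≤TT k₀)

    E≤U : ∀ n → E B n ≤ U n
    E≤U n = subst (_≤ U n) (ℚ.+-identityʳ (E B n))
      (ℚ.+-monoʳ-≤ (E B n) {0ℚ} {T B n + T B n} (0≤TT n))

    T≤U : ∀ n → T B n ≤ U n
    T≤U n = subst₂ _≤_
      (trans (ℚ.+-identityˡ (T B n + 0ℚ)) (ℚ.+-identityʳ (T B n))) refl
      (+-mono 0ℚ (E B n) (T B n + 0ℚ) (T B n + T B n) (0≤E n)
        (ℚ.+-monoʳ-≤ (T B n) {0ℚ} {T B n} (0≤T n)))

    E≤M : ∀ n → k₀ ℕ.≤ n → E B n ≤ M
    E≤M n h = ℚ.≤-trans {E B n} {U n} {M} (E≤U n) (U≤M n h)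

    T≤M : ∀ n → k₀ ℕ.≤ n → T B n ≤ M
    T≤M n h = ℚ.≤-trans {T B n} {U n} {M} (T≤U n) (U≤M n h)

    -- The tail from index m on is at most 2 T B m.
    E-gap : ∀ m j → k₀ ℕ.≤ m → E B (j ℕ.+ m) - E B m ≤ T B m + T B m
    E-gap m j h = subst (E B (j ℕ.+ m) - E B m ≤_) (cancel (E B m) (T B m + T B m))
      (ℚ.+-monoˡ-≤ (- E B m) {E B (j ℕ.+ m)} {U m}
        (ℚ.≤-trans {E B (j ℕ.+ m)} {U (j ℕ.+ m)} {U m} (E≤U (j ℕ.+ m)) (U-anti m j h)))
      where
      cancel : ∀ a b → (a + b) - a ≡ b
      cancel = S.solve 2 (λ a b → (a S.:+ b) S.:- a S.:= b) refl

    T-small : ∀ ε → 0ℚ < ε → ∃[ N ] ∀ k → k₀ ℕ.≤ k → N ℕ.≤ suc k →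
              T B (suc k) + T B (suc k) ≤ ε
    T-small ε 0<ε =
      let (N , c) = archimedean-* (M * B + M * B) ε 0<ε
      in N , λ k h N≤ →
        *-cancel (T B (suc k) + T B (suc k)) ε (nat (suc k)) (nat-pos k)
          (ℚ.≤-trans {nat (suc k) * (T B (suc k) + T B (suc k))} {M * B + M * B} {nat (suc k) * ε}
            (subst (_≤ M * B + M * B) (sym (collect (T B (suc k)) (nat (suc k)) (T B k * B) (T-shift B k)))
              (+-mono (T B k * B) (M * B) (T B k * B) (M * B)
                (*-monoʳ (T B k) M B 0≤B (T≤M k h)) (*-monoʳ (T B k) M B 0≤B (T≤M k h))))
            (ℚ.≤-trans {M * B + M * B} {ε * nat N} {nat (suc k) * ε} c
              (subst (ε * nat N ≤_) (ℚ.*-comm ε (nat (suc k)))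
                (*-monoˡ (nat N) (nat (suc k)) ε (ℚ.<⇒≤ 0<ε) (nat-≤ N≤)))))
      where
      collect : ∀ t n x → t * n ≡ x → n * (t + t) ≡ x + x
      collect t n x eq = trans (ℚ.*-distribˡ-+ n t t)
        (cong₂ _+_ (trans (ℚ.*-comm n t) eq) (trans (ℚ.*-comm n t) eq))

  split-diff : ∀ a b c → a - c ≡ (a - b) + (b - c)
  split-diff = S.solve 3 (λ a b c → a S.:- c S.:= (a S.:- b) S.:+ (b S.:- c)) refl

  factor-exp : ∀ ε M → ε * M + ε ≡ (1ℚ + M) * ε
  factor-exp ε M = sym (trans (ℚ.*-distribʳ-+ ε 1ℚ M)
    (trans (ℚ.+-comm (1ℚ * ε) (M * ε)) (cong₂ _+_ (ℚ.*-comm M ε) (ℚ.*-identityˡ ε))))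

  abstract
    exp-cauchy : ∀ s → IsCauchy s → IsCauchy (λ n → expSum (s n) n)
    exp-cauchy s cs =
      let (A , 0<A , N₁ , bounded) = eventually-bounded s cs
          (b , A≤B) = archimedean A
          open Tail b
          sB : ∀ n → N₁ ℕ.≤ n → ∣ s n ∣ ≤ B
          sB n h = ℚ.≤-trans {∣ s n ∣} {A} {B} (bounded n h) A≤B
      in scale (λ n → E (s n) n) (1ℚ + M) (0<+ 1ℚ M 0<1 0≤M) λ ε 0<ε →
        let (N₂ , close) = cs ε 0<ε
            (N₃ , small) = T-small ε 0<ε
            N = (N₁ ℕ.⊔ N₂) ℕ.⊔ (N₃ ℕ.⊔ suc k₀)
            near : ∀ m n → N ℕ.≤ m → m ℕ.≤ n → ∣ E (s m) m - E (s n) n ∣ ≤ (1ℚ + M) * ε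
            near = λ where
              zero n N≤m m≤n → case-zero N₁ N₂ N₃ k₀ N≤m
              (suc k) n N≤m m≤n →
                let m   = suc k
                    N≤n = ℕ.≤-trans N≤m m≤n
                    m₁₂ = maxˡ {N₁ ℕ.⊔ N₂} {N₃ ℕ.⊔ suc k₀} N≤m
                    n₁₂ = maxˡ {N₁ ℕ.⊔ N₂} {N₃ ℕ.⊔ suc k₀} N≤n
                    m₃  = maxʳ {N₁ ℕ.⊔ N₂} {N₃ ℕ.⊔ suc k₀} N≤m
                    mB  = sB m (maxˡ {N₁} {N₂} m₁₂)
                    nB  = sB n (maxˡ {N₁} {N₂} n₁₂)
                    k₀≤k = ℕ.s≤s⁻¹ (maxʳ {N₃} {suc k₀} m₃)
                    D   = ∣ s m - s n ∣
                    D≤ε = close m n (maxʳ {N₁} {N₂} m₁₂) (maxʳ {N₁} {N₂} n₁₂)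
                    first : ∣ E (s m) m - E (s n) m ∣ ≤ ε * M
                    first = ℚ.≤-trans {∣ E (s m) m - E (s n) m ∣} {D * E B k} {ε * M}
                      (E-diff (s m) (s n) B 0≤B mB nB k)
                      (*-mono D ε (E B k) M (ℚ.<⇒≤ 0<ε) (0≤E k) D≤ε (E≤M k k₀≤k))
                    gap : ∣ E (s n) m - E (s n) (n ℕ.∸ m ℕ.+ m) ∣ ≤ ε
                    gap = ℚ.≤-trans {∣ E (s n) m - E (s n) (n ℕ.∸ m ℕ.+ m) ∣}
                      {E B (n ℕ.∸ m ℕ.+ m) - E B m} {ε}
                      (E-tail (s n) B 0≤B nB m (n ℕ.∸ m))
                      (ℚ.≤-trans {E B (n ℕ.∸ m ℕ.+ m) - E B m} {T B m + T B m} {ε}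
                        (E-gap m (n ℕ.∸ m) (ℕ.m≤n⇒m≤1+n k₀≤k))
                        (small k k₀≤k (maxˡ {N₃} {suc k₀} m₃)))
                    second : ∣ E (s n) m - E (s n) n ∣ ≤ ε
                    second = subst (λ l → ∣ E (s n) m - E (s n) l ∣ ≤ ε) (ℕ.m∸n+n≡m m≤n) gap
                in subst₂ (λ x y → ∣ x ∣ ≤ y)
                     (sym (split-diff (E (s m) m) (E (s n) m) (E (s n) n))) (factor-exp ε M)
                     (∣+∣≤ (E (s m) m - E (s n) m) (E (s n) m - E (s n) n) {ε * M} {ε} first second)
        in N , symmetrise (λ n → E (s n) n) {(1ℚ + M) * ε} N near
      where
      case-zero : ∀ a b c k {X : Set} → (a ℕ.⊔ b) ℕ.⊔ (c ℕ.⊔ suc k) ℕ.≤ 0 → X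
      case-zero a b c k h with maxʳ {c} {suc k} (maxʳ {a ℕ.⊔ b} {c ℕ.⊔ suc k} h)
      ... | ()

  pow-log-≤ : ∀ n {a : Acc ℕ._<_ n} → .{{ℕ.NonZero n}} → 2 ℕ.^ ⌊log2⌋ n a ℕ.≤ n
  pow-log-≤ 1             {acc _}  = ℕ.≤-refl
  pow-log-≤ (suc (suc n)) {acc rs} = ℕ.≤-trans
    (ℕ.*-monoʳ-≤ 2 (pow-log-≤ (suc ⌊ n /2⌋)))
    (subst (ℕ._≤ suc (suc n)) (sym (double-suc ⌊ n /2⌋)) (ℕ.s≤s (ℕ.s≤s (half-≤ n))))
    where
    double-suc : ∀ h → 2 ℕ.* suc h ≡ suc (suc (h ℕ.+ h))
    double-suc = ℕRing.solve-∀
    half-≤ : ∀ n → ⌊ n /2⌋ ℕ.+ ⌊ n /2⌋ ℕ.≤ n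
    half-≤ n = subst (⌊ n /2⌋ ℕ.+ ⌊ n /2⌋ ℕ.≤_) (ℕ.⌊n/2⌋+⌈n/2⌉≡n n)
      (ℕ.+-monoʳ-≤ ⌊ n /2⌋ (ℕ.⌊n/2⌋≤⌈n/2⌉ n))

  <-pow-log : ∀ n {a : Acc ℕ._<_ n} → n ℕ.< 2 ℕ.^ suc (⌊log2⌋ n a)
  <-pow-log 0             {acc _}  = ℕ.s≤s ℕ.z≤n
  <-pow-log 1             {acc _}  = ℕ.s≤s (ℕ.s≤s ℕ.z≤n)
  <-pow-log (suc (suc n)) {acc rs} = ℕ.≤-trans
    (subst (suc (suc (suc n)) ℕ.≤_) (sym (double-suc² ⌊ n /2⌋))
      (ℕ.s≤s (ℕ.s≤s (ℕ.s≤s (≤-half n)))))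
    (ℕ.*-monoʳ-≤ 2 (<-pow-log (suc ⌊ n /2⌋)))
    where
    double-suc² : ∀ h → 2 ℕ.* suc (suc h) ≡ suc (suc (suc (suc (h ℕ.+ h))))
    double-suc² = ℕRing.solve-∀
    ≤-half : ∀ n → n ℕ.≤ suc (⌊ n /2⌋ ℕ.+ ⌊ n /2⌋)
    ≤-half n = subst₂ ℕ._≤_ (ℕ.⌊n/2⌋+⌈n/2⌉≡n n) (ℕ.+-suc ⌊ n /2⌋ ⌊ n /2⌋)
      (ℕ.+-monoʳ-≤ ⌊ n /2⌋ (ℕ.⌊n/2⌋-mono (ℕ.n≤1+n (suc n))))

  ⌊log⌋ : ℕ → ℕ → ℕ
  ⌊log⌋ r k = ⌊log₂ (r ℕ.^ suc k) ⌋

  -- Both sides compare r ^ (suc m * suc n) with powers of two.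
  cross : ∀ r .{{_ : ℕ.NonZero r}} m n →
          ⌊log⌋ r m ℕ.* suc n ℕ.≤ suc (⌊log⌋ r n) ℕ.* suc m
  cross r m n = ℕ.<⇒≤ (ℕ.≰⇒> λ h → ℕ.<-irrefl refl (ℕ.<-≤-trans upper
    (ℕ.≤-trans (ℕ.^-monoʳ-≤ 2 h) lower)))
    where
    instance
      _ = ℕ.m^n≢0 r (suc m)
    lower : 2 ℕ.^ (⌊log⌋ r m ℕ.* suc n) ℕ.≤ (r ℕ.^ suc m) ℕ.^ suc n
    lower = subst (ℕ._≤ (r ℕ.^ suc m) ℕ.^ suc n) (ℕ.^-*-assoc 2 (⌊log⌋ r m) (suc n))
      (ℕ.^-monoˡ-≤ (suc n) (pow-log-≤ (r ℕ.^ suc m)))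
    upper : (r ℕ.^ suc m) ℕ.^ suc n ℕ.< 2 ℕ.^ (suc (⌊log⌋ r n) ℕ.* suc m)
    upper = subst₂ ℕ._<_
      (trans (ℕ.^-*-assoc r (suc n) (suc m))
        (trans (cong (r ℕ.^_) (ℕ.*-comm (suc n) (suc m))) (sym (ℕ.^-*-assoc r (suc m) (suc n)))))
      (ℕ.^-*-assoc 2 (suc (⌊log⌋ r n)) (suc m))
      (ℕ.^-monoˡ-< (suc m) (<-pow-log (r ℕ.^ suc n)))

  over : ∀ a k → ℤ.+ a / suc k ≡ nat a * u k
  over a k = sym (trans (ratio-* (natᵘ a) (ℚᵘ.mkℚᵘ (ℤ.+ 1) k)) (ℚ.fromℚᵘ-cong
    {natᵘ a ℚᵘ.* ℚᵘ.mkℚᵘ (ℤ.+ 1) k} {ℚᵘ.mkℚᵘ (ℤ.+ a) k} (ℚᵘ.*≡*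
      (cong₂ ℤ._*_ (ℤ.*-identityʳ (ℤ.+ a)) (sym (cong ℤ.+_ (ℕ.*-identityˡ (suc k))))))))

  log-step : ∀ r .{{_ : ℕ.NonZero r}} m n → logApprox r m - logApprox r n ≤ u n
  log-step r m n = subst₂ (λ x y → x - y ≤ u n)
    (sym (over a m)) (sym (over b n))
    (subst (nat a * u m - nat b * u n ≤_) (add-cancel (nat b) 1ℚ (u n) (ℚ.*-identityˡ (u n)))
      (ℚ.+-monoˡ-≤ (- (nat b * u n)) {nat a * u m} {(1ℚ + nat b) * u n}
        (subst₂ _≤_
          (clear (nat a) (nat (suc n)) (u m) (u n) (nat-u n))
          (trans (cong (nat (suc b) * nat (suc m) *_) (ℚ.*-comm (u m) (u n)))
            (trans (clear (nat (suc b)) (nat (suc m)) (u n) (u m) (nat-u m))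
              (cong (_* u n) (sym (nat-+ 1 b)))))
          (*-monoʳ (nat a * nat (suc n)) (nat (suc b) * nat (suc m)) (u m * u n)
            (0≤* (u m) (u n) (u-nonneg m) (u-nonneg n))
            (subst₂ _≤_ (sym (nat-* a (suc n))) (sym (nat-* (suc b) (suc m)))
              (nat-≤ (cross r m n)))))))
    where
    a = ⌊log⌋ r m
    b = ⌊log⌋ r n
    regroup : ∀ x y v w → (x * y) * (v * w) ≡ x * v * (y * w)
    regroup = S.solve 4 (λ x y v w →
      (x S.:* y) S.:* (v S.:* w) S.:= x S.:* v S.:* (y S.:* w)) refl
    clear : ∀ x y v w → y * w ≡ 1ℚ → (x * y) * (v * w) ≡ x * v
    clear x y v w eq = trans (regroup x y v w)
      (trans (cong (x * v *_) eq) (ℚ.*-identityʳ (x * v)))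
    expand : ∀ b o w → (o + b) * w - b * w ≡ o * w
    expand = S.solve 3 (λ b o w →
      (o S.:+ b) S.:* w S.:- b S.:* w S.:= o S.:* w) refl
    add-cancel : ∀ b o w → o * w ≡ w → (o + b) * w - b * w ≡ w
    add-cancel b o w eq = trans (expand b o w) eq

  u-small : ∀ ε → 0ℚ < ε → ∃[ N ] ∀ n → N ℕ.≤ n → u n ≤ ε
  u-small ε 0<ε =
    let (N , 1≤) = archimedean-* 1ℚ ε 0<ε
    in N , λ n N≤n → *-cancel (u n) ε (nat (suc n)) (nat-pos n)
         (subst₂ _≤_ (sym (nat-u n)) (ℚ.*-comm ε (nat (suc n)))
           (ℚ.≤-trans {1ℚ} {ε * nat N} {ε * nat (suc n)} 1≤
             (*-monoˡ (nat N) (nat (suc n)) ε (ℚ.<⇒≤ 0<ε) (nat-≤ (ℕ.m≤n⇒m≤1+n N≤n)))))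

  abs-≤ : ∀ d c → d ≤ c → - d ≤ c → ∣ d ∣ ≤ c
  abs-≤ d c d≤c -d≤c with ℚ.∣p∣≡p∨∣p∣≡-p d
  ... | inj₁ eq = subst (_≤ c) (sym eq) d≤c
  ... | inj₂ eq = subst (_≤ c) (sym eq) -d≤c

  abstract
    log-cauchy : ∀ r .{{_ : ℕ.NonZero r}} → IsCauchy (logApprox r)
    log-cauchy r ε 0<ε =
      let (N , small) = u-small ε 0<ε
          one-sided = λ m n N≤n → ℚ.≤-trans {logApprox r m - logApprox r n} {u n} {ε}
            (log-step r m n) (small n N≤n)
      in N , λ m n N≤m N≤n → abs-≤ (logApprox r m - logApprox r n) ε (one-sided m n N≤n)
           (subst (_≤ ε) (sym (neg-diff (logApprox r m) (logApprox r n))) (one-sided n m N≤m))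

------------------------------------------------------------------------
-- Real numbers

record ℝ : Set where
  constructor real
  field
    seq    : ℕ → ℚ
    cauchy : IsCauchy seq

open ℝ public

infix  8 -_
infixr 8 _^_
infixl 7 _*_ _/ⁿ_
infixl 6 _+_ _-_
infix  4 _<_ _≤_ _≃_

fromℚ : ℚ → ℝ
fromℚ q = real (λ _ → q) (CauchyProofs.const-cauchy q)

fromℕ : ℕ → ℝ
fromℕ n = fromℚ (ℤ.+ n ℚ./ 1)

0ℝ 1ℝ : ℝ
0ℝ = fromℚ 0ℚ
1ℝ = fromℚ 1ℚ

_+_ : ℝ → ℝ → ℝ
x + y = real (λ n → seq x n ℚ.+ seq y n)
  (CauchyProofs.+-cauchy (seq x) (seq y) (cauchy x) (cauchy y))

-_ : ℝ → ℝ
- x = real (λ n → ℚ.- seq x n) (CauchyProofs.neg-cauchy (seq x) (cauchy x))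

_-_ : ℝ → ℝ → ℝ
x - y = x + (- y)

_*_ : ℝ → ℝ → ℝ
x * y = real (λ n → seq x n ℚ.* seq y n)
  (CauchyProofs.*-cauchy (seq x) (seq y) (cauchy x) (cauchy y))

_^_ : ℝ → ℕ → ℝ
x ^ zero  = 1ℝ
x ^ suc n = x * x ^ n

-- Division by a positive natural number.
_/ⁿ_ : ℝ → (n : ℕ) .{{_ : ℕ.NonZero n}} → ℝ
x /ⁿ n = x * fromℚ (ℤ.+ 1 ℚ./ n)

_<_ : ℝ → ℝ → Set
x < y = ∃[ ε ] 0ℚ ℚ.< ε × ∃[ N ] ∀ n → N ℕ.≤ n → ε ℚ.≤ seq y n ℚ.- seq x n

_≤_ : ℝ → ℝ → Set
x ≤ y = ¬ (y < x)

_≃_ : ℝ → ℝ → Set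
x ≃ y = x ≤ y × y ≤ x

-- The maximum with the lower bound ε only changes finitely many terms; it
-- makes every term invertible.
recip : (x : ℝ) → 0ℝ < x → ℝ
recip x (ε , 0<ε , N , low) = real (λ n → CauchyProofs.invAbove ε 0<ε (seq x n))
  (CauchyProofs.inv-cauchy (seq x) ε 0<ε
    (N , λ n N≤n → subst (ε ℚ.≤_) (ℚ.+-identityʳ (seq x n)) (low n N≤n))
    (cauchy x))

exp : ℝ → ℝ
exp x = real (λ n → expSum (seq x n) n) (CauchyProofs.exp-cauchy (seq x) (cauchy x))

log₂ : (r : ℕ) .{{_ : ℕ.NonZero r}} → ℝ
log₂ r = real (logApprox r) (CauchyProofs.log-cauchy r)

-- A supremum over an arbitrary family. It is kept formal, because a bounded
-- set of reals need not have a least upper bound constructively; below, the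
-- bound C on the number of bits is real, so membership in the family is
-- undecidable.
record Sup : Set₂ where
  constructor sup
  field
    {Index} : Set₁
    value   : Index → ℝ

infix 4 _<ˢ_

_<ˢ_ : Sup → ℝ → Set₁
S <ˢ a = Σ[ b ∈ ℝ ] b < a × (∀ i → Sup.value S i ≤ b)

------------------------------------------------------------------------
-- Finite sets and distributions

record FinSet : Set₁ where
  field
    Carrier  : Set
    elements : List Carrier
    complete : ∀ x → x ∈ elements
    unique   : Unique elements

open FinSet public

infixr 2 _×ᶠ_

_×ᶠ_ : FinSet → FinSet → FinSet
A ×ᶠ B = record
  { Carrier  = Carrier A × Carrier B
  ; elements = List.cartesianProduct (elements A) (elements B)
  ; complete = λ (a , b) → ∈-cartesianProduct⁺ (complete A a) (complete B b)
  ; unique   = Unique.cartesianProduct⁺ (unique A) (unique B)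
  }

infixr 8 _^ᶠ_

_^ᶠ_ : FinSet → ℕ → FinSet
A ^ᶠ n = record
  { Carrier  = Vec (Carrier A) n
  ; elements = vecs n
  ; complete = vecs-complete
  ; unique   = vecs-unique n
  }
  where
  vecs : ∀ n → List (Vec (Carrier A) n)
  vecs zero    = [] ∷ []
  vecs (suc n) = List.cartesianProductWith _∷_ (elements A) (vecs n)

  vecs-complete : ∀ {n} (xs : Vec (Carrier A) n) → xs ∈ vecs n
  vecs-complete []       = here refl
  vecs-complete (x ∷ xs) = ∈-cartesianProductWith⁺ _∷_ (complete A x) (vecs-complete xs)

  vecs-unique : ∀ n → Unique (vecs n)
  vecs-unique zero    = [] ∷ []
  vecs-unique (suc n) =
    Unique.cartesianProductWith⁺ _∷_ Vec.∷-injective (unique A) (vecs-unique n)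

∑ : (A : FinSet) → (Carrier A → ℝ) → ℝ
∑ A f = List.foldr _+_ 0ℝ (List.map f (elements A))

max : (A : FinSet) → (Carrier A → ℕ) → ℕ
max A f = List.foldr ℕ._⊔_ 0 (List.map f (elements A))

IsDistribution : (A : FinSet) → (Carrier A → ℝ) → Set
IsDistribution A μ = (∀ a → 0ℝ ≤ μ a) × ∑ A μ ≃ 1ℝ

-- Finite spaces suffice as the randomness of a protocol: on finite inputs and
-- with boundedly many bits there are finitely many deterministic protocols up
-- to behaviour, and averaging leaves the suprema below unchanged.
record ProbSpace : Set₁ where
  field
    space          : FinSet
    mass           : Carrier space → ℝ
    isDistribution : IsDistribution space mass

  Outcome : Set
  Outcome = Carrier space

  𝔼 : (Outcome → ℝ) → ℝ
  𝔼 f = ∑ space (λ ω → mass ω * f ω)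

open ProbSpace public using (Outcome; 𝔼)

------------------------------------------------------------------------
-- Communication protocols

data Player : Set where
  alice bob : Player

other : Player → Player
other alice = bob
other bob   = alice

-- A deterministic protocol with outputs in O in which r messages remain to
-- be sent, the next (or current) one by player p; V p is what p sees besides
-- the transcript. A message is sent bit by bit and is self-delimiting: the
-- bits sent so far determine whether it is finished. It may be empty.
data Tree (V : Player → Set) (O : Set) : Player → ℕ → Set where
  output : ∀ {p} → O → Tree V O p zero
  send   : ∀ {p r} → (V p → Bool) → (Bool → Tree V O p (suc r)) → Tree V O p (suc r)
  finish : ∀ {p r} → Tree V O (other p) r → Tree V O p (suc r)

module _ {V : Player → Set} {O : Set} where

  outcome : ∀ {p r} → Tree V O p r → (∀ q → V q) → O
  outcome (output o)       v = o
  outcome (send {p} b next) v = outcome (next (b (v p))) v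
  outcome (finish t)       v = outcome t v

  bits : ∀ {p r} → Tree V O p r → (∀ q → V q) → ℕ
  bits (output o)       v = 0
  bits (send {p} b next) v = suc (bits (next (b (v p))) v)
  bits (finish t)       v = bits t v

View : (X Y : FinSet) → (Player → ProbSpace) → Player → Set
View X Y coin alice = Carrier X × Outcome (coin alice)
View X Y coin bob   = Carrier Y × Outcome (coin bob)

record Protocol (X Y : FinSet) (O : Set) (r : ℕ) : Set₁ where
  field
    publicCoin  : ProbSpace
    privateCoin : Player → ProbSpace

    tree        : Outcome publicCoin → Tree (View X Y privateCoin) O alice r

  view : Carrier X × Carrier Y → Outcome (privateCoin alice) → Outcome (privateCoin bob) →
         ∀ p → View X Y privateCoin p
  view (x , y) a b alice = x , a
  view (x , y) a b bob   = y , b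

  ‖_‖ : ℕ
  ‖_‖ =
    max (X ×ᶠ Y) λ xy →
    max (ProbSpace.space publicCoin) λ ω →
    max (ProbSpace.space (privateCoin alice)) λ a →
    max (ProbSpace.space (privateCoin bob)) λ b →
    bits (tree ω) (view xy a b)

  -- The expectation of φ (xy , π(xy)) over xy distributed as ν and the
  -- independent public and private randomness of π.
  expect : (Carrier X × Carrier Y → ℝ) → (Carrier X × Carrier Y → O → ℝ) → ℝ
  expect ν φ =
    ∑ (X ×ᶠ Y) λ xy → ν xy *
    (𝔼 publicCoin λ ω →
     𝔼 (privateCoin alice) λ a →
     𝔼 (privateCoin bob) λ b →
     φ xy (outcome (tree ω) (view xy a b)))

module _ (r : ℕ) (X Y : FinSet) (ν : Carrier X × Carrier Y → ℝ) (C : ℝ) where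

  Bounded : Set → Set₁
  Bounded O = Σ[ π ∈ Protocol X Y O r ] fromℕ (Protocol.‖_‖ π) ≤ C

  bit : Bool → ℕ
  bit b = if b then 1 else 0

  adv : (Carrier X × Carrier Y → Bool) → Sup
  adv g = sup {Bounded Bool} λ (π , _) →
    Protocol.expect π ν λ xy o → (- 1ℝ) ^ (bit o ℕ.+ bit (g xy))

  succ : {O : Set} → DecidableEquality O → (Carrier X × Carrier Y → O) → Sup
  succ {O} _≟_ g = sup {Bounded O} λ (π , _) →
    Protocol.expect π ν λ xy o → if ⌊ o ≟ g xy ⌋ then 1ℝ else 0ℝ

------------------------------------------------------------------------
-- n independent copies

module _ {X Y : Set} where

  mapⁿ : (X × Y → Bool) → ∀ n → Vec X n × Vec Y n → Vec Bool n
  mapⁿ f n (xs , ys) = Vec.map f (Vec.zip xs ys)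

  massⁿ : (X × Y → ℝ) → ∀ n → Vec X n × Vec Y n → ℝ
  massⁿ μ n (xs , ys) = Vec.foldr′ _*_ 1ℝ (Vec.map μ (Vec.zip xs ys))

_≟ⁿ_ : ∀ {n} → DecidableEquality (Vec Bool n)
_≟ⁿ_ = Vec.≡-dec Bool._≟_

-- Condition μⁿ on the success of a protocol for fⁿ that is right with
-- probability at least (19/20)ⁿ. The entropy deficiency of the inputs and the
-- information revealed by the transcript are then O(n) and O(T), T being the
-- number of bits exchanged. Both telescope over the copies when the public
-- part of copy i consists of the coordinates of x before i and those of y
-- after i. Hence a single copy has, on average, a transcript that determines
-- f, costs little divergence from μ, and whose messages the receiver can
-- predict almost as well as the sender. Hashed rejection sampling produces such
-- a transcript with O(T/n + log r) bits per round, and this contradicts the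
-- hardness of f.
--
-- To avoid logarithms, an entropy is represented by 2 to its D-th multiple, an
-- integer product, and Jensen's inequality by that of the arithmetic and
-- geometric means. Since only finitely many strict inequalities are needed, all
-- reals can be replaced by rational approximations at one index, and a common
-- denominator makes the masses natural numbers.

module Submission where

-- Conditioned on success, a message may depend on the receiver's coordinate even when the sender's
-- coordinate and the past are given, but the players can only sample from the sender's conditional
-- law. Two defects must be paid for. A message may be far less likely given both inputs than given
-- the sender's alone; Markov's inequality makes this rare. Or it may be far more likely given both
-- inputs than given the receiver's alone; each such informative message is charged `5 * N` bits of
-- information. Were both rare and the divergence small, a copy would give a protocol right with
-- probability above 11/20. Hence a copy has divergence at least log(3/2) minus 5 times its expected
-- number of informative messages. Summing over the copies, for success probability p and T bits, n
-- log(3/2) is at most (1 + 1/N) log(1/p) + 2 (T + 1)/N. With N of order 1 + T/n the last term is at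
-- most n/4, whence p is at most (9/10)^n. A simulated round costs 2 + 5 N + 2 e bits with 2^e of
-- order r. The simulation always sends a bit, so the case of one round and C < 1 needs an argument
-- of its own, by counting leaves.

-- Finite sums, products and indicators over the natural numbers.

module Sums where

  open import Data.List.Base using (List; []; _∷_; length; map; _++_; cartesianProductWith)
  open import Data.List.Membership.Propositional using (_∈_)
  open import Data.List.Relation.Unary.All using (All; []; _∷_)
  open import Data.List.Relation.Unary.AllPairs using ([]; _∷_)
  open import Data.List.Relation.Unary.Any using (here; there)
  open import Data.List.Relation.Unary.Unique.Propositional using (Unique)
  open import Data.Nat.Base
  open import Data.Nat.Properties
  open import Data.Nat.Tactic.RingSolver using (solve-∀)
  open import Data.Product.Base using (∃-syntax; _,_)
  open import Data.Empty using (⊥-elim)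
  open import Relation.Binary.PropositionalEquality
  open import Relation.Nullary.Decidable.Core using (Dec; yes; no)
  open import Relation.Nullary.Negation.Core using (¬_)

  private variable
    A B C : Set

  ∑ : List A → (A → ℕ) → ℕ
  ∑ []       f = 0
  ∑ (x ∷ xs) f = f x + ∑ xs f

  ∏ : List A → (A → ℕ) → ℕ
  ∏ []       f = 1
  ∏ (x ∷ xs) f = f x * ∏ xs f

  module _ {f g : A → ℕ} where

    ∑-cong : ∀ xs → (∀ x → f x ≡ g x) → ∑ xs f ≡ ∑ xs g
    ∑-cong []       h = refl
    ∑-cong (x ∷ xs) h = cong₂ _+_ (h x) (∑-cong xs h)

    ∑-mono : ∀ xs → (∀ x → f x ≤ g x) → ∑ xs f ≤ ∑ xs g
    ∑-mono []       h = z≤n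
    ∑-mono (x ∷ xs) h = +-mono-≤ (h x) (∑-mono xs h)

    ∏-cong : ∀ xs → (∀ x → f x ≡ g x) → ∏ xs f ≡ ∏ xs g
    ∏-cong []       h = refl
    ∏-cong (x ∷ xs) h = cong₂ _*_ (h x) (∏-cong xs h)

    ∏-mono : ∀ xs → (∀ x → f x ≤ g x) → ∏ xs f ≤ ∏ xs g
    ∏-mono []       h = ≤-refl
    ∏-mono (x ∷ xs) h = *-mono-≤ (h x) (∏-mono xs h)

    ∑-+ : ∀ xs → ∑ xs (λ x → f x + g x) ≡ ∑ xs f + ∑ xs g
    ∑-+ []       = refl
    ∑-+ (x ∷ xs) = trans (cong (f x + g x +_) (∑-+ xs)) (shuffle (f x) (g x) (∑ xs f) (∑ xs g))
      where
      shuffle : ∀ a b c d → a + b + (c + d) ≡ a + c + (b + d)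
      shuffle = solve-∀

    ∏-* : ∀ xs → ∏ xs (λ x → f x * g x) ≡ ∏ xs f * ∏ xs g
    ∏-* []       = refl
    ∏-* (x ∷ xs) = trans (cong (f x * g x *_) (∏-* xs)) (shuffle (f x) (g x) (∏ xs f) (∏ xs g))
      where
      shuffle : ∀ a b c d → a * b * (c * d) ≡ a * c * (b * d)
      shuffle = solve-∀

  ∑-*ˡ : ∀ (xs : List A) {f} c → ∑ xs (λ x → c * f x) ≡ c * ∑ xs f
  ∑-*ˡ []           c = sym (*-zeroʳ c)
  ∑-*ˡ (x ∷ xs) {f} c = trans (cong (c * f x +_) (∑-*ˡ xs c)) (sym (*-distribˡ-+ c (f x) (∑ xs f)))

  ∑-*ʳ : ∀ (xs : List A) {f} c → ∑ xs (λ x → f x * c) ≡ ∑ xs f * c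
  ∑-*ʳ []           c = refl
  ∑-*ʳ (x ∷ xs) {f} c = trans (cong (f x * c +_) (∑-*ʳ xs c)) (sym (*-distribʳ-+ c (f x) (∑ xs f)))

  ∑-const : ∀ (xs : List A) c → ∑ xs (λ _ → c) ≡ length xs * c
  ∑-const []       c = refl
  ∑-const (x ∷ xs) c = cong (c +_) (∑-const xs c)

  ∏-const : ∀ (xs : List A) c → ∏ xs (λ _ → c) ≡ c ^ length xs
  ∏-const []       c = refl
  ∏-const (x ∷ xs) c = cong (c *_) (∏-const xs c)

  ∑-0 : ∀ (xs : List A) → ∑ xs (λ _ → 0) ≡ 0
  ∑-0 xs = trans (∑-const xs 0) (*-zeroʳ (length xs))

  ∏-1 : ∀ (xs : List A) → ∏ xs (λ _ → 1) ≡ 1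
  ∏-1 xs = trans (∏-const xs 1) (^-zeroˡ (length xs))

  ∑-swap : ∀ (xs : List A) (ys : List B) (f : A → B → ℕ) →
           ∑ xs (λ x → ∑ ys (f x)) ≡ ∑ ys (λ y → ∑ xs (λ x → f x y))
  ∑-swap []       ys f = sym (∑-0 ys)
  ∑-swap (x ∷ xs) ys f = trans (cong (∑ ys (f x) +_) (∑-swap xs ys f)) (sym (∑-+ ys))

  ∏-swap : ∀ (xs : List A) (ys : List B) (f : A → B → ℕ) →
           ∏ xs (λ x → ∏ ys (f x)) ≡ ∏ ys (λ y → ∏ xs (λ x → f x y))
  ∏-swap []       ys f = sym (∏-1 ys)
  ∏-swap (x ∷ xs) ys f = trans (cong (∏ ys (f x) *_) (∏-swap xs ys f)) (sym (∏-* ys))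

  ∑-++ : ∀ (xs ys : List A) {f} → ∑ (xs ++ ys) f ≡ ∑ xs f + ∑ ys f
  ∑-++ []       ys     = refl
  ∑-++ (x ∷ xs) ys {f} = trans (cong (f x +_) (∑-++ xs ys)) (sym (+-assoc (f x) _ _))

  ∑-map : ∀ (h : A → B) xs {f : B → ℕ} → ∑ (map h xs) f ≡ ∑ xs (λ x → f (h x))
  ∑-map h []       = refl
  ∑-map h (x ∷ xs) = cong (_ +_) (∑-map h xs)

  ∑-cartesianProductWith : ∀ (h : A → B → C) xs ys {f} →
    ∑ (cartesianProductWith h xs ys) f ≡ ∑ xs (λ x → ∑ ys (λ y → f (h x y)))
  ∑-cartesianProductWith h []       ys = refl
  ∑-cartesianProductWith h (x ∷ xs) ys = trans (∑-++ (map (h x) ys) _)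
    (cong₂ _+_ (∑-map (h x) ys) (∑-cartesianProductWith h xs ys))

  ∑-∈ : ∀ {xs : List A} {x} (f : A → ℕ) → x ∈ xs → f x ≤ ∑ xs f
  ∑-∈ f (here refl) = m≤m+n (f _) _
  ∑-∈ f (there x∈)  = ≤-trans (∑-∈ f x∈) (m≤n+m _ _)

  ∑-above-average : ∀ (xs : List A) {f} c → length xs * c < ∑ xs f → ∃[ x ] c < f x
  ∑-above-average (x ∷ xs) {f} c h with c <? f x
  ... | yes c<fx = x , c<fx
  ... | no  c≮fx = ∑-above-average xs c (+-cancelˡ-< c _ _
        (<-≤-trans h (+-monoˡ-≤ (∑ xs f) (≮⇒≥ c≮fx))))

  𝟙 : ∀ {p} {P : Set p} → Dec P → ℕ
  𝟙 (yes _) = 1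
  𝟙 (no _)  = 0

  module _ {p q} {P : Set p} {Q : Set q} where

    𝟙-mono : (d : Dec P) (e : Dec Q) → (P → Q) → 𝟙 d ≤ 𝟙 e
    𝟙-mono (no _)  e       h = z≤n
    𝟙-mono (yes p) (yes _) h = ≤-refl
    𝟙-mono (yes p) (no ¬q) h = ⊥-elim (¬q (h p))

    𝟙-cong : (d : Dec P) (e : Dec Q) → (P → Q) → (Q → P) → 𝟙 d ≡ 𝟙 e
    𝟙-cong (yes p) (yes q) _ _ = refl
    𝟙-cong (no _)  (no _)  _ _ = refl
    𝟙-cong (yes p) (no ¬q) h _ = ⊥-elim (¬q (h p))
    𝟙-cong (no ¬p) (yes q) _ h = ⊥-elim (¬p (h q))

  module _ {p} {P : Set p} where

    𝟙-yes : (d : Dec P) → P → 𝟙 d ≡ 1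
    𝟙-yes (yes _) _ = refl
    𝟙-yes (no ¬p) p = ⊥-elim (¬p p)

    𝟙-no : (d : Dec P) → ¬ P → 𝟙 d ≡ 0
    𝟙-no (yes p) ¬p = ⊥-elim (¬p p)
    𝟙-no (no _)  _  = refl

    𝟙≤1 : (d : Dec P) → 𝟙 d ≤ 1
    𝟙≤1 (yes _) = ≤-refl
    𝟙≤1 (no _)  = z≤n

    𝟙-guard : (d : Dec P) → ∀ {a b} → (P → a ≡ b) → 𝟙 d * a ≡ 𝟙 d * b
    𝟙-guard (yes p) h = cong (1 *_) (h p)
    𝟙-guard (no _)  h = refl

  -- Without repetitions at most one term survives; it is an inequality because `x` may be absent
  -- from the list.
  ∑-unique-≤ : ∀ {xs : List A} (_≟_ : ∀ x y → Dec (x ≡ y)) (g : A → ℕ) x → Unique xs →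
               ∑ xs (λ y → 𝟙 (x ≟ y) * g y) ≤ g x
  ∑-unique-≤ {xs = []}     _≟_ g x _        = z≤n
  ∑-unique-≤ {xs = y ∷ ys} _≟_ g x (y∉ ∷ u) with x ≟ y
  ... | no  _    = ∑-unique-≤ _≟_ g x u
  ... | yes refl = ≤-reflexive (trans (cong₂ _+_ (*-identityˡ (g x)) (absent y∉)) (+-identityʳ (g x)))
    where
    absent : ∀ {zs} → All (λ z → ¬ x ≡ z) zs → ∑ zs (λ z → 𝟙 (x ≟ z) * g z) ≡ 0
    absent []               = refl
    absent (_∷_ {z} x≢z ps) = cong₂ _+_ (cong (_* g z) (𝟙-no (x ≟ z) x≢z)) (absent ps)

  ^-distribʳ-* : ∀ a b n → (a * b) ^ n ≡ a ^ n * b ^ n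
  ^-distribʳ-* a b zero    = refl
  ^-distribʳ-* a b (suc n) = trans (cong (a * b *_) (^-distribʳ-* a b n)) (shuffle a b (a ^ n) (b ^ n))
    where
    shuffle : ∀ a b c d → a * b * (c * d) ≡ a * c * (b * d)
    shuffle = solve-∀

  ∏-^ : ∀ (xs : List A) {f} n → ∏ xs (λ x → f x ^ n) ≡ ∏ xs f ^ n
  ∏-^ []           n = sym (^-zeroˡ n)
  ∏-^ (x ∷ xs) {f} n = trans (cong (f x ^ n *_) (∏-^ xs n)) (sym (^-distribʳ-* (f x) (∏ xs f) n))

  ∏-^-∑ : ∀ (xs : List A) {f} c → ∏ xs (λ x → c ^ f x) ≡ c ^ ∑ xs f
  ∏-^-∑ []           c = refl
  ∏-^-∑ (x ∷ xs) {f} c = trans (cong (c ^ f x *_) (∏-^-∑ xs c)) (sym (^-distribˡ-+-* c (f x) (∑ xs f)))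

  ^-cancelˡ-≤ : ∀ {a b} n .{{_ : NonZero n}} → a ^ n ≤ b ^ n → a ≤ b
  ^-cancelˡ-≤ {a} {b} n h = ≮⇒≥ λ b<a → <⇒≱ (^-monoˡ-< n b<a) h

-- The weighted inequality of arithmetic and geometric means, without division.

module AMGM where

  open import Data.List.Base using (List; []; _∷_)
  open import Data.Nat.Base
  open import Data.Nat.Properties
  open import Data.Nat.Tactic.RingSolver using (solve-∀)
  open import Data.Product.Base using (∃-syntax; _,_)
  open import Data.Sum.Base using (inj₁; inj₂)
  open import Relation.Binary.PropositionalEquality
  open Sums

  private variable
    A : Set

  -- The square of the difference is nonnegative; the order of `m` and `a` decides which difference
  -- is a natural number.
  2ma≤m²+a² : ∀ m a → 2 * (m * a) ≤ m * m + a * a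
  2ma≤m²+a² m a with ≤-total m a
  ... | inj₁ m≤a with m≤n⇒∃[o]m+o≡n m≤a
  ...   | d , refl = ≤-trans (m≤m+n _ (d * d)) (≤-reflexive (expand m d))
    where
    expand : ∀ m d → 2 * (m * (m + d)) + d * d ≡ m * m + (m + d) * (m + d)
    expand = solve-∀
  2ma≤m²+a² m a | inj₂ a≤m with m≤n⇒∃[o]m+o≡n a≤m
  ...   | d , refl = ≤-trans (m≤m+n _ (d * d)) (≤-reflexive (expand a d))
    where
    expand : ∀ m d → 2 * ((m + d) * m) + d * d ≡ (m + d) * (m + d) + m * m
    expand = solve-∀

  -- The graph of z ↦ z ^ (n + 1) lies above its tangent at a.
  tangent : ∀ m a n → suc n * m * a ^ n ≤ m ^ suc n + n * a ^ suc n
  tangent m a zero    = ≤-reflexive (base m)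
    where
    base : ∀ m → (1 * m) * 1 ≡ m * 1 + 0
    base = solve-∀
  -- The added term makes the left side (n + 1) a^n times 2 m a, so that the inequality of squares
  -- applies.
  tangent m a (suc n) = +-cancelʳ-≤ (n * m * (a * p)) _ _ (begin
    suc (suc n) * m * (a * p) + n * m * (a * p)   ≡⟨ double n m a p ⟩
    suc n * p * (2 * (m * a))                     ≤⟨ *-monoʳ-≤ (suc n * p) (2ma≤m²+a² m a) ⟩
    suc n * p * (m * m + a * a)                   ≡⟨ split n m a p ⟩
    m * (suc n * m * p) + suc n * (a * (a * p))   ≤⟨ +-monoˡ-≤ _ (*-monoʳ-≤ m (tangent m a n)) ⟩
    m * (M + n * (a * p)) + suc n * (a * (a * p)) ≡⟨ collect n m a p M ⟩
    m * M + suc n * (a * (a * p)) + n * m * (a * p) ∎)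
    where
    open ≤-Reasoning
    p = a ^ n
    M = m ^ suc n
    double : ∀ n m a p → suc (suc n) * m * (a * p) + n * m * (a * p) ≡ suc n * p * (2 * (m * a))
    double = solve-∀
    split : ∀ n m a p →
      suc n * p * (m * m + a * a) ≡ m * (suc n * m * p) + suc n * (a * (a * p))
    split = solve-∀
    collect : ∀ n m a p M →
      m * (M + n * (a * p)) + suc n * (a * (a * p)) ≡ m * M + suc n * (a * (a * p)) + n * m * (a * p)
    collect = solve-∀

  -- AM-GM for `n` numbers equal to x/n and one number `t`. It is the tangent inequality for n (x +
  -- t) at (n + 1) x, which are the new and the old mean up to a common factor.
  amgm-step : ∀ x t n → x ^ n * t * suc n ^ suc n ≤ n ^ n * (x + t) ^ suc n
  amgm-step x t zero = ≤-trans (m≤n+m _ x) (≤-reflexive (base x t))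
    where
    base : ∀ x t → x + 1 * t * 1 ≡ 1 * ((x + t) * 1)
    base = solve-∀
  amgm-step x t n@(suc _) =
    +-cancelˡ-≤ (suc n * x * u * X) _ _ (*-cancelˡ-≤ n (begin
      n * (suc n * x * u * X + X * t * (suc n * u))     ≡⟨ lhs n x t u X ⟩
      suc n * (n * (x + t)) * (u * X)
        ≡⟨ cong (suc n * (n * (x + t)) *_) (sym (^-distribʳ-* (suc n) x n)) ⟩
      suc n * (n * (x + t)) * (suc n * x) ^ n           ≤⟨ tangent (n * (x + t)) (suc n * x) n ⟩
      (n * (x + t)) ^ suc n + n * (suc n * x) ^ suc n
        ≡⟨ cong₂ (λ a b → n * (x + t) * a + n * (suc n * x * b))
             (^-distribʳ-* n (x + t) n) (^-distribʳ-* (suc n) x n) ⟩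
      n * (x + t) * (v * Y) + n * (suc n * x * (u * X)) ≡⟨ rhs n x t u X v Y ⟩
      n * (suc n * x * u * X + v * ((x + t) * Y))       ∎))
    where
    open ≤-Reasoning
    u = suc n ^ n
    X = x ^ n
    v = n ^ n
    Y = (x + t) ^ n
    lhs : ∀ n x t u X →
      n * (suc n * x * u * X + X * t * (suc n * u)) ≡ suc n * (n * (x + t)) * (u * X)
    lhs = solve-∀
    rhs : ∀ n x t u X v Y → n * (x + t) * (v * Y) + n * (suc n * x * (u * X))
                            ≡ n * (suc n * x * u * X + v * ((x + t) * Y))
    rhs = solve-∀

  n^n≢0 : ∀ n → NonZero (n ^ n)
  n^n≢0 zero      = _
  n^n≢0 n@(suc _) = m^n≢0 n n

  -- `x` is the sum of `m` equal numbers, to which `w` copies of `t` are added one at a time.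
  amgm-power : ∀ x t m w → x ^ m * t ^ w * (m + w) ^ (m + w) ≤ m ^ m * (x + w * t) ^ (m + w)
  amgm-power x t m zero = ≤-reflexive (begin-equality
    x ^ m * 1 * (m + 0) ^ (m + 0) ≡⟨ cong₂ _*_ (*-identityʳ (x ^ m)) (cong (λ k → k ^ k) (+-identityʳ m)) ⟩
    x ^ m * m ^ m                 ≡⟨ *-comm (x ^ m) (m ^ m) ⟩
    m ^ m * x ^ m
      ≡⟨ cong₂ (λ a b → m ^ m * a ^ b) (sym (+-identityʳ x)) (sym (+-identityʳ m)) ⟩
    m ^ m * (x + 0) ^ (m + 0) ∎)
    where open ≤-Reasoning
  amgm-power x t m (suc w) = *-cancelʳ-≤ _ _ (k ^ k) {{n^n≢0 k}} (begin
    x ^ m * (t * t ^ w) * (m + suc w) ^ (m + suc w) * k ^ k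
      ≡⟨ cong (λ j → x ^ m * (t * t ^ w) * j ^ j * k ^ k) (+-suc m w) ⟩
    x ^ m * (t * t ^ w) * suc k ^ suc k * k ^ k ≡⟨ lhs (x ^ m) t (t ^ w) (suc k ^ suc k) (k ^ k) ⟩
    x ^ m * t ^ w * k ^ k * (t * suc k ^ suc k)
      ≤⟨ *-monoˡ-≤ (t * suc k ^ suc k) (amgm-power x t m w) ⟩
    m ^ m * y ^ k * (t * suc k ^ suc k)   ≡⟨ mid (m ^ m) (y ^ k) t (suc k ^ suc k) ⟩
    m ^ m * (y ^ k * t * suc k ^ suc k)   ≤⟨ *-monoʳ-≤ (m ^ m) (amgm-step y t k) ⟩
    m ^ m * (k ^ k * (y + t) ^ suc k)     ≡⟨ rhs (m ^ m) (k ^ k) ((y + t) ^ suc k) ⟩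
    m ^ m * (y + t) ^ suc k * k ^ k
      ≡⟨ cong₂ (λ a b → m ^ m * a ^ b * k ^ k) (add x w t) (sym (+-suc m w)) ⟩
    m ^ m * (x + suc w * t) ^ (m + suc w) * k ^ k ∎)
    where
    open ≤-Reasoning
    k = m + w
    y = x + w * t
    lhs : ∀ a t b c d → a * (t * b) * c * d ≡ a * b * d * (t * c)
    lhs = solve-∀
    mid : ∀ a b t c → a * b * (t * c) ≡ a * (b * t * c)
    mid = solve-∀
    rhs : ∀ a b c → a * (b * c) ≡ a * c * b
    rhs = solve-∀
    add : ∀ x w t → x + w * t + t ≡ x + suc w * t
    add = solve-∀

  -- Both sides are raised to the total weight and cleared of denominators. A list element acts as a
  -- block of `w x` equal numbers, added by `amgm-power`.
  amgm : ∀ (xs : List A) (w t : A → ℕ) →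
    ∏ xs (λ x → t x ^ w x) * ∑ xs w ^ ∑ xs w ≤ ∑ xs (λ x → w x * t x) ^ ∑ xs w
  amgm []       w t = ≤-refl
  amgm (x ∷ xs) w t = *-cancelʳ-≤ _ _ (D ^ D) {{n^n≢0 D}} (begin
    b * P * (w x + D) ^ (w x + D) * D ^ D   ≡⟨ lhs b P ((w x + D) ^ (w x + D)) (D ^ D) ⟩
    P * D ^ D * (b * (w x + D) ^ (w x + D)) ≤⟨ *-monoˡ-≤ _ (amgm xs w t) ⟩
    E ^ D * (b * (w x + D) ^ (w x + D))     ≡⟨ sym (*-assoc (E ^ D) b _) ⟩
    E ^ D * b * (w x + D) ^ (w x + D)
      ≡⟨ cong (λ j → E ^ D * b * j ^ j) (+-comm (w x) D) ⟩
    E ^ D * b * (D + w x) ^ (D + w x)       ≤⟨ amgm-power E (t x) D (w x) ⟩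
    D ^ D * (E + w x * t x) ^ (D + w x)
      ≡⟨ cong₂ (λ a b → D ^ D * a ^ b) (+-comm E (w x * t x)) (+-comm D (w x)) ⟩
    D ^ D * (w x * t x + E) ^ (w x + D)     ≡⟨ *-comm (D ^ D) _ ⟩
    (w x * t x + E) ^ (w x + D) * D ^ D     ∎)
    where
    open ≤-Reasoning
    D = ∑ xs w
    E = ∑ xs (λ x → w x * t x)
    P = ∏ xs (λ x → t x ^ w x)
    b = t x ^ w x
    lhs : ∀ b P c d → b * P * c * d ≡ P * d * (b * c)
    lhs = solve-∀

-- Entropy inequalities in multiplicative integer form.

module Entropy where

  open import Data.List.Base using (List; length)
  open import Data.List.Membership.Propositional using (_∈_)
  open import Data.Nat.Base
  open import Data.Nat.Divisibility using (m≤n⇒m!∣n!; ∣-trans; m∣m*n)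
  open import Data.Nat.DivMod using (_/_; m/n*n≤m; m/n*n≡m)
  open import Data.Nat.Properties hiding (_≟_)
  open import Data.Nat.Tactic.RingSolver using (solve-∀)
  open import Data.Product.Base using (_,_; proj₁; proj₂)
  import Data.Product.Properties as Product
  open import Data.Unit.Base using (tt)
  import Data.Unit.Properties as Unit
  open import Relation.Binary.Definitions using (DecidableEquality)
  open import Relation.Binary.PropositionalEquality hiding (J)
  open import Relation.Nullary.Decidable.Core using (yes; no)
  open Sums
  open AMGM

  record RV (Ω : Set) : Set₁ where
    field
      {Label} : Set
      at      : Ω → Label
      _≟_     : DecidableEquality Label

  open RV public using (Label; at)

  infixr 6 _⊗_

  _⊗_ : ∀ {Ω} → RV Ω → RV Ω → RV Ω
  α ⊗ β = record
    { at  = λ ω → at α ω , at β ω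
    ; _≟_ = Product.≡-dec (RV._≟_ α) (RV._≟_ β)
    }

  trivial : ∀ {Ω} → RV Ω
  trivial = record { at = λ _ → tt ; _≟_ = Unit._≟_ }

  _⟶_ : ∀ {Ω} → RV Ω → RV Ω → Set
  α ⟶ β = ∀ ω ω′ → at α ω ≡ at α ω′ → at β ω ≡ at β ω′

  -- Up to normalisation, w is a probability mass function on Ω.
  module Weighted {Ω : Set} (ωs : List Ω) (complete : ∀ ω → ω ∈ ωs) (w : Ω → ℕ) where

    𝔼 : (Ω → ℕ) → ℕ
    𝔼 f = ∑ ωs (λ ω → w ω * f ω)

    D F : ℕ
    D = ∑ ωs w
    F = D !

    -- The D-th power of the geometric mean of f.
    𝔾 : (Ω → ℕ) → ℕ
    𝔾 f = ∏ ωs (λ ω → f ω ^ w ω)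

    -- F is a common multiple of the possible denominators, so that inv c
    -- stands for F / c without rounding.
    inv : ℕ → ℕ
    inv zero      = 0
    inv c@(suc _) = F / c

    *-inv-≤ : ∀ c → c * inv c ≤ F
    *-inv-≤ zero      = z≤n
    *-inv-≤ c@(suc _) = ≤-trans (≤-reflexive (*-comm c (F / c))) (m/n*n≤m F c)

    *-inv : ∀ {c} → 1 ≤ c → c ≤ D → c * inv c ≡ F
    *-inv {c@(suc k)} _ c≤D = trans (*-comm c (F / c))
      (m/n*n≡m {F} {c} (∣-trans (m∣m*n (k !)) (m≤n⇒m!∣n! c≤D)))

    instance
      F≢0 : NonZero F
      F≢0 = D !≢0

    F^≢0 : ∀ n → NonZero (F ^ n)
    F^≢0 n = m^n≢0 F n

    𝔼-mono : ∀ {f g} → (∀ ω → 1 ≤ w ω → f ω ≤ g ω) → 𝔼 f ≤ 𝔼 g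
    𝔼-mono {f} {g} h = ∑-mono ωs λ ω → go (w ω) (h ω)
      where
      go : ∀ {a b} v → (1 ≤ v → a ≤ b) → v * a ≤ v * b
      go zero    _ = z≤n
      go (suc v) h = *-monoʳ-≤ (suc v) (h (s≤s z≤n))

    𝔼-≤ : ∀ {f g} → (∀ ω → f ω ≤ g ω) → 𝔼 f ≤ 𝔼 g
    𝔼-≤ h = 𝔼-mono (λ ω _ → h ω)

    𝔼-cong : ∀ {f g} → (∀ ω → f ω ≡ g ω) → 𝔼 f ≡ 𝔼 g
    𝔼-cong h = ∑-cong ωs (λ ω → cong (w ω *_) (h ω))

    𝔼-+ : ∀ {f g} → 𝔼 (λ ω → f ω + g ω) ≡ 𝔼 f + 𝔼 g
    𝔼-+ {f} {g} = trans (∑-cong ωs (λ ω → *-distribˡ-+ (w ω) (f ω) (g ω))) (∑-+ ωs)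

    𝔼-*ˡ : ∀ c {f} → 𝔼 (λ ω → c * f ω) ≡ c * 𝔼 f
    𝔼-*ˡ c {f} = trans (∑-cong ωs (λ ω → shuffle (w ω) c (f ω))) (∑-*ˡ ωs c)
      where
      shuffle : ∀ a b c → a * (b * c) ≡ b * (a * c)
      shuffle = solve-∀

    𝔼-*ʳ : ∀ c {f} → 𝔼 (λ ω → f ω * c) ≡ 𝔼 f * c
    𝔼-*ʳ c {f} = trans (∑-cong ωs (λ ω → sym (*-assoc (w ω) (f ω) c))) (∑-*ʳ ωs c)

    𝔼-∑ : ∀ {A : Set} (xs : List A) (f : Ω → A → ℕ) →
          𝔼 (λ ω → ∑ xs (f ω)) ≡ ∑ xs (λ x → 𝔼 (λ ω → f ω x))
    𝔼-∑ xs f = trans (∑-cong ωs (λ ω → sym (∑-*ˡ xs (w ω)))) (∑-swap ωs xs _)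

    𝔼-product : ∀ a b e → 𝔼 a * 𝔼 b * e
                ≡ ∑ ωs (λ ω₁ → ∑ ωs (λ ω₂ → w ω₁ * (w ω₂ * (a ω₁ * b ω₂ * e))))
    𝔼-product a b e = sym (begin
      ∑ ωs (λ ω₁ → ∑ ωs (λ ω₂ → w ω₁ * (w ω₂ * (a ω₁ * b ω₂ * e))))
        ≡⟨ ∑-cong ωs (λ ω₁ → ∑-cong ωs (λ ω₂ → regroup (w ω₁) (w ω₂) (a ω₁) (b ω₂) e)) ⟩
      ∑ ωs (λ ω₁ → ∑ ωs (λ ω₂ → w ω₁ * a ω₁ * e * (w ω₂ * b ω₂)))
        ≡⟨ ∑-cong ωs (λ ω₁ → ∑-*ˡ ωs (w ω₁ * a ω₁ * e)) ⟩
      ∑ ωs (λ ω₁ → w ω₁ * a ω₁ * e * 𝔼 b)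
        ≡⟨ trans (∑-*ʳ ωs (𝔼 b)) (cong (_* 𝔼 b) (∑-*ʳ ωs e)) ⟩
      𝔼 a * e * 𝔼 b   ≡⟨ swap (𝔼 a) e (𝔼 b) ⟩
      𝔼 a * 𝔼 b * e   ∎)
      where
      open ≡-Reasoning
      regroup : ∀ v v′ a b e → v * (v′ * (a * b * e)) ≡ v * a * e * (v′ * b)
      regroup = solve-∀
      swap : ∀ a e b → a * e * b ≡ a * b * e
      swap = solve-∀

    𝔼-const : ∀ c → 𝔼 (λ _ → c) ≡ D * c
    𝔼-const c = ∑-*ʳ ωs c

    𝔾-mono : ∀ {f g} → (∀ ω → 1 ≤ w ω → f ω ≤ g ω) → 𝔾 f ≤ 𝔾 g
    𝔾-mono {f} {g} h = ∏-mono ωs λ ω → go (w ω) (h ω)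
      where
      go : ∀ {a b} v → (1 ≤ v → a ≤ b) → a ^ v ≤ b ^ v
      go zero    _ = ≤-refl
      go (suc v) h = ^-monoˡ-≤ (suc v) (h (s≤s z≤n))

    𝔾-cong : ∀ {f g} → (∀ ω → 1 ≤ w ω → f ω ≡ g ω) → 𝔾 f ≡ 𝔾 g
    𝔾-cong h = ≤-antisym (𝔾-mono (λ ω p → ≤-reflexive (h ω p)))
                         (𝔾-mono (λ ω p → ≤-reflexive (sym (h ω p))))

    𝔾-* : ∀ f g → 𝔾 (λ ω → f ω * g ω) ≡ 𝔾 f * 𝔾 g
    𝔾-* f g = trans (∏-cong ωs (λ ω → ^-distribʳ-* (f ω) (g ω) (w ω))) (∏-* ωs)

    𝔾-const : ∀ c → 𝔾 (λ _ → c) ≡ c ^ D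
    𝔾-const c = ∏-^-∑ ωs c

    𝔾-^ : ∀ c f → 𝔾 (λ ω → c ^ f ω) ≡ c ^ 𝔼 f
    𝔾-^ c f = trans (∏-cong ωs (λ ω → trans (^-*-assoc c (f ω) (w ω))
      (cong (c ^_) (*-comm (f ω) (w ω))))) (∏-^-∑ ωs c)

    𝔾-∏ : ∀ {A : Set} (xs : List A) (f : A → Ω → ℕ) →
          𝔾 (λ ω → ∏ xs (λ x → f x ω)) ≡ ∏ xs (λ x → 𝔾 (f x))
    𝔾-∏ xs f = trans (∏-cong ωs (λ ω → sym (∏-^ xs (w ω)))) (∏-swap ωs xs _)

    jensen : ∀ f → 𝔾 f * D ^ D ≤ 𝔼 f ^ D
    jensen f = amgm ωs w f

    -- The weight of the class of ω, that is, D times the probability of the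
    -- event that α has the value it takes at ω.
    cl : RV Ω → Ω → ℕ
    cl α ω = 𝔼 (λ ω′ → 𝟙 (RV._≟_ α (at α ω′) (at α ω)))

    -- J α = 2 ^ (D (log D − H(α))), where H is the entropy.
    J : RV Ω → ℕ
    J α = 𝔾 (cl α)

    cl≤D : ∀ α ω → cl α ω ≤ D
    cl≤D α ω = ≤-trans (𝔼-≤ (λ ω′ → 𝟙≤1 (RV._≟_ α (at α ω′) (at α ω))))
      (≤-reflexive (trans (𝔼-const 1) (*-identityʳ D)))

    1≤cl : ∀ α ω → 1 ≤ w ω → 1 ≤ cl α ω
    1≤cl α ω h = ≤-trans (≤-trans h (≤-reflexive (sym (trans
        (cong (w ω *_) (𝟙-yes (RV._≟_ α (at α ω) (at α ω)) refl)) (*-identityʳ (w ω))))))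
      (∑-∈ _ (complete ω))

    cl-inv : ∀ α ω → 1 ≤ w ω → cl α ω * inv (cl α ω) ≡ F
    cl-inv α ω h = *-inv (1≤cl α ω h) (cl≤D α ω)

    cl-antimono : ∀ α β → α ⟶ β → ∀ ω → cl α ω ≤ cl β ω
    cl-antimono α β h ω = 𝔼-≤ λ ω′ → 𝟙-mono (RV._≟_ α _ _) (RV._≟_ β _ _) (h ω′ ω)

    cl-cong : ∀ α β → α ⟶ β → β ⟶ α → ∀ ω → cl α ω ≡ cl β ω
    cl-cong α β h h′ ω = ≤-antisym (cl-antimono α β h ω) (cl-antimono β α h′ ω)

    J-cong : ∀ α β → α ⟶ β → β ⟶ α → J α ≡ J β
    J-cong α β h h′ = 𝔾-cong (λ ω _ → cl-cong α β h h′ ω)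

    J≢0 : ∀ α → NonZero (J α)
    J≢0 α = >-nonZero (≤-trans (≤-reflexive (sym (trans (𝔾-const 1) (^-zeroˡ D)))) (𝔾-mono (1≤cl α)))

    J-trivial : J trivial ≡ D ^ D
    J-trivial = trans (𝔾-cong (λ _ _ → trans (𝔼-const 1) (*-identityʳ D))) (𝔾-const D)

    -- On the class of `a` the weight is a constant c, and c times 1/c is 1. A class of weight 0
    -- contributes 0, hence only an inequality.
    fibre : ∀ α (a : Label α) → 𝔼 (λ ω → 𝟙 (RV._≟_ α (at α ω) a) * inv (cl α ω)) ≤ F
    fibre α a = begin
      𝔼 (λ ω → 𝟙 (at α ω ≟ a) * inv (cl α ω))
        ≡⟨ 𝔼-cong (λ ω → 𝟙-guard (at α ω ≟ a) λ e →
             cong (λ b → inv (𝔼 λ ω′ → 𝟙 (at α ω′ ≟ b))) e) ⟩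
      𝔼 (λ ω → 𝟙 (at α ω ≟ a) * inv c)         ≡⟨ 𝔼-*ʳ (inv c) ⟩
      c * inv c                                ≤⟨ *-inv-≤ c ⟩
      F                                        ∎
      where
      open ≤-Reasoning
      open RV α using (_≟_)
      c = 𝔼 (λ ω → 𝟙 (at α ω ≟ a))

    -- Dividing `f` by the class weight of `α` divides its geometric mean by `J α`. The entropy
    -- inequalities below reduce to bounding an expectation of this kind.
    jensen-quotient : ∀ f α z → 𝔼 (λ ω → f ω * inv (cl α ω)) ≤ F * z →
                      𝔾 f * D ^ D ≤ J α * z ^ D
    jensen-quotient f α z h = *-cancelʳ-≤ _ _ (F ^ D) {{F^≢0 D}} (begin
      𝔾 f * D ^ D * F ^ D                       ≡⟨ cong (𝔾 f * D ^ D *_) (sym J-inv) ⟩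
      𝔾 f * D ^ D * (J α * 𝔾 i)                 ≡⟨ shuffle (𝔾 f) (D ^ D) (J α) (𝔾 i) ⟩
      J α * (𝔾 f * 𝔾 i * D ^ D)
        ≡⟨ cong (λ x → J α * (x * D ^ D)) (sym (𝔾-* f i)) ⟩
      J α * (𝔾 (λ ω → f ω * i ω) * D ^ D)       ≤⟨ *-monoʳ-≤ (J α) (jensen _) ⟩
      J α * 𝔼 (λ ω → f ω * i ω) ^ D             ≤⟨ *-monoʳ-≤ (J α) (^-monoˡ-≤ D h) ⟩
      J α * (F * z) ^ D                         ≡⟨ cong (J α *_) (^-distribʳ-* F z D) ⟩
      J α * (F ^ D * z ^ D)                     ≡⟨ shuffle′ (J α) (F ^ D) (z ^ D) ⟩
      J α * z ^ D * F ^ D                       ∎)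
      where
      open ≤-Reasoning
      i = λ ω → inv (cl α ω)
      J-inv : J α * 𝔾 i ≡ F ^ D
      J-inv = trans (sym (𝔾-* (cl α) i)) (trans (𝔾-cong (cl-inv α)) (𝔾-const F))
      shuffle : ∀ a b c d → a * b * (c * d) ≡ c * (a * d * b)
      shuffle = solve-∀
      shuffle′ : ∀ a b c → a * (b * c) ≡ a * c * b
      shuffle′ = solve-∀

    jensen-quotient₂ : ∀ f α β z →
      𝔼 (λ ω → f ω * (inv (cl α ω) * inv (cl β ω))) ≤ F * (F * z) →
      𝔾 f * D ^ D ≤ J α * J β * z ^ D
    jensen-quotient₂ f α β z h = *-cancelʳ-≤ _ _ (F ^ D) {{F^≢0 D}} (begin
      𝔾 f * D ^ D * F ^ D                       ≡⟨ cong (𝔾 f * D ^ D *_) (sym J-inv) ⟩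
      𝔾 f * D ^ D * (J β * 𝔾 i)                 ≡⟨ shuffle (𝔾 f) (D ^ D) (J β) (𝔾 i) ⟩
      J β * (𝔾 f * 𝔾 i * D ^ D)
        ≡⟨ cong (λ x → J β * (x * D ^ D)) (sym (𝔾-* f i)) ⟩
      J β * (𝔾 (λ ω → f ω * i ω) * D ^ D)
        ≤⟨ *-monoʳ-≤ (J β) (jensen-quotient _ α (F * z)
             (≤-trans (≤-reflexive (𝔼-cong λ ω → assoc (f ω) (inv (cl α ω)) (i ω))) h)) ⟩
      J β * (J α * (F * z) ^ D)
        ≡⟨ cong (λ x → J β * (J α * x)) (^-distribʳ-* F z D) ⟩
      J β * (J α * (F ^ D * z ^ D))             ≡⟨ shuffle′ (J β) (J α) (F ^ D) (z ^ D) ⟩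
      J α * J β * z ^ D * F ^ D                 ∎)
      where
      open ≤-Reasoning
      i = λ ω → inv (cl β ω)
      J-inv : J β * 𝔾 i ≡ F ^ D
      J-inv = trans (sym (𝔾-* (cl β) i)) (trans (𝔾-cong (cl-inv β)) (𝔾-const F))
      assoc : ∀ a b c → a * c * b ≡ a * (b * c)
      assoc = solve-∀
      shuffle : ∀ a b c d → a * b * (c * d) ≡ c * (a * d * b)
      shuffle = solve-∀
      shuffle′ : ∀ a b c d → a * (b * (c * d)) ≡ b * a * d * c
      shuffle′ = solve-∀

    -- E[p(a,c) p(b,c) / (p(a,b,c) p(c))] ≤ 1.
    shannon : ∀ α β γ →
      𝔼 (λ ω → cl (α ⊗ γ) ω * cl (β ⊗ γ) ω * (inv (cl (α ⊗ β ⊗ γ) ω) * inv (cl γ ω)))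
        ≤ F * (F * D)
    shannon α β γ = begin
      𝔼 (λ ω → cl (α ⊗ γ) ω * cl (β ⊗ γ) ω * (inv (cl (α ⊗ β ⊗ γ) ω) * inv (cl γ ω)))
        ≡⟨ 𝔼-cong (λ ω → expand ω) ⟩
      𝔼 (λ ω → ∑ ωs (λ ω₁ → ∑ ωs (λ ω₂ → w ω₁ * (w ω₂ * T ω₁ ω₂ ω))))
        ≡⟨ trans (𝔼-∑ ωs _) (∑-cong ωs (λ ω₁ → 𝔼-∑ ωs _)) ⟩
      ∑ ωs (λ ω₁ → ∑ ωs (λ ω₂ → 𝔼 (λ ω → w ω₁ * (w ω₂ * T ω₁ ω₂ ω))))
        ≤⟨ ∑-mono ωs (λ ω₁ → ∑-mono ωs (λ ω₂ → inner ω₁ ω₂)) ⟩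
      ∑ ωs (λ ω₁ → ∑ ωs (λ ω₂ → w ω₂ * 𝟙 (at γ ω₂ ≟γ at γ ω₁) * (w ω₁ * (inv (cl γ ω₁) * F))))
        ≡⟨ ∑-cong ωs (λ ω₁ → ∑-*ʳ ωs _) ⟩
      ∑ ωs (λ ω₁ → cl γ ω₁ * (w ω₁ * (inv (cl γ ω₁) * F)))
        ≤⟨ ∑-mono ωs (λ ω₁ → ≤-trans (≤-reflexive (shuffle (cl γ ω₁) (w ω₁) (inv (cl γ ω₁)) F))
             (*-monoʳ-≤ (w ω₁) (*-monoʳ-≤ F (*-inv-≤ (cl γ ω₁))))) ⟩
      𝔼 (λ _ → F * F)  ≡⟨ trans (𝔼-const (F * F)) (shuffle′ D F) ⟩
      F * (F * D)      ∎
      where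
      open ≤-Reasoning
      open RV γ using () renaming (_≟_ to _≟γ_)
      open RV (α ⊗ γ) using () renaming (_≟_ to _≟αγ_)
      open RV (β ⊗ γ) using () renaming (_≟_ to _≟βγ_)
      open RV (α ⊗ β ⊗ γ) using () renaming (_≟_ to _≟αβγ_)
      shuffle : ∀ a b c d → a * (b * (c * d)) ≡ b * (d * (a * c))
      shuffle = solve-∀
      shuffle′ : ∀ d f → d * (f * f) ≡ f * (f * d)
      shuffle′ = solve-∀
      -- `ω₁` supplies the label of `α`, `ω₂` that of `β`, and both that of `γ`. For fixed `ω₁` and
      -- `ω₂` the point `ω` runs through a single class of `α ⊗ β ⊗ γ`, to which `fibre` applies.
      T : Ω → Ω → Ω → ℕ
      T ω₁ ω₂ ω = 𝟙 (at (α ⊗ γ) ω₁ ≟αγ at (α ⊗ γ) ω) * 𝟙 (at (β ⊗ γ) ω₂ ≟βγ at (β ⊗ γ) ω)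
        * (inv (cl (α ⊗ β ⊗ γ) ω) * inv (cl γ ω))
      expand : ∀ ω → cl (α ⊗ γ) ω * cl (β ⊗ γ) ω * (inv (cl (α ⊗ β ⊗ γ) ω) * inv (cl γ ω))
               ≡ ∑ ωs (λ ω₁ → ∑ ωs (λ ω₂ → w ω₁ * (w ω₂ * T ω₁ ω₂ ω)))
      expand ω = 𝔼-product _ _ _
      pointwise : ∀ ω₁ ω₂ ω → T ω₁ ω₂ ω ≤ 𝟙 (at γ ω₂ ≟γ at γ ω₁) * inv (cl γ ω₁) *
        (𝟙 (at (α ⊗ β ⊗ γ) ω ≟αβγ (at α ω₁ , at β ω₂ , at γ ω₁)) * inv (cl (α ⊗ β ⊗ γ) ω))
      pointwise ω₁ ω₂ ω with at (α ⊗ γ) ω₁ ≟αγ at (α ⊗ γ) ω | at (β ⊗ γ) ω₂ ≟βγ at (β ⊗ γ) ω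
      ... | no _  | _    = z≤n
      ... | yes _ | no _ = z≤n
      ... | yes p | yes q
        rewrite 𝟙-yes (at γ ω₂ ≟γ at γ ω₁) (trans (cong proj₂ q) (sym (cong proj₂ p)))
              | 𝟙-yes (at (α ⊗ β ⊗ γ) ω ≟αβγ (at α ω₁ , at β ω₂ , at γ ω₁))
                  (cong₂ _,_ (sym (cong proj₁ p)) (cong₂ _,_ (sym (cong proj₁ q)) (sym (cong proj₂ p))))
              | cong (λ c → inv (𝔼 (λ ω′ → 𝟙 (at γ ω′ ≟γ c)))) (cong proj₂ p)
        = ≤-reflexive (comm (inv (cl (α ⊗ β ⊗ γ) ω)) _)
        where
        comm : ∀ a b → (1 * 1) * (a * b) ≡ 1 * b * (1 * a)
        comm = solve-∀
      inner : ∀ ω₁ ω₂ → 𝔼 (λ ω → w ω₁ * (w ω₂ * T ω₁ ω₂ ω))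
                        ≤ w ω₂ * 𝟙 (at γ ω₂ ≟γ at γ ω₁) * (w ω₁ * (inv (cl γ ω₁) * F))
      inner ω₁ ω₂ = begin
        𝔼 (λ ω → w ω₁ * (w ω₂ * T ω₁ ω₂ ω))
          ≤⟨ 𝔼-≤ (λ ω → *-monoʳ-≤ (w ω₁) (*-monoʳ-≤ (w ω₂) (pointwise ω₁ ω₂ ω))) ⟩
        𝔼 (λ ω → w ω₁ * (w ω₂ * (e * i * f ω)))
          ≡⟨ trans (𝔼-*ˡ (w ω₁)) (cong (w ω₁ *_) (trans (𝔼-*ˡ (w ω₂)) (cong (w ω₂ *_) (𝔼-*ˡ (e * i))))) ⟩
        w ω₁ * (w ω₂ * (e * i * 𝔼 f))
          ≤⟨ *-monoʳ-≤ (w ω₁) (*-monoʳ-≤ (w ω₂) (*-monoʳ-≤ (e * i) (fibre (α ⊗ β ⊗ γ) _))) ⟩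
        w ω₁ * (w ω₂ * (e * i * F)) ≡⟨ regroup (w ω₁) (w ω₂) e i F ⟩
        w ω₂ * e * (w ω₁ * (i * F)) ∎
        where
        e = 𝟙 (at γ ω₂ ≟γ at γ ω₁)
        i = inv (cl γ ω₁)
        f = λ ω → 𝟙 (at (α ⊗ β ⊗ γ) ω ≟αβγ (at α ω₁ , at β ω₂ , at γ ω₁)) * inv (cl (α ⊗ β ⊗ γ) ω)
        regroup : ∀ a b e i f → a * (b * (e * i * f)) ≡ b * e * (a * (i * f))
        regroup = solve-∀

    -- Conditional mutual information is nonnegative: I(α; β | γ) ≥ 0. As `J` decreases when the
    -- entropy grows, the joint term is on the larger side.
    submodular : ∀ α β γ → J (α ⊗ γ) * J (β ⊗ γ) ≤ J (α ⊗ β ⊗ γ) * J γ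
    submodular α β γ = *-cancelʳ-≤ _ _ (D ^ D) {{n^n≢0 D}} (≤-trans
      (≤-reflexive (cong (_* D ^ D) (sym (𝔾-* (cl (α ⊗ γ)) (cl (β ⊗ γ))))))
      (jensen-quotient₂ _ (α ⊗ β ⊗ γ) γ D (shannon α β γ)))

    -- In terms of entropy: H(α, β) exceeds H(α) by at most the logarithm of the number of labels of
    -- `β`.
    J-few-labels : ∀ α β (bs : List (Label β)) → (∀ ω → at β ω ∈ bs) →
                   J α ≤ J (α ⊗ β) * length bs ^ D
    J-few-labels α β bs ∈bs = *-cancelʳ-≤ _ _ (D ^ D) {{n^n≢0 D}} (≤-trans
      (jensen-quotient (cl α) (α ⊗ β) (D * length bs) (begin
        𝔼 (λ ω → cl α ω * inv (cl (α ⊗ β) ω))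
          ≡⟨ trans (𝔼-cong (λ ω → sym (∑-*ʳ ωs _))) (𝔼-∑ ωs _) ⟩
        ∑ ωs (λ ω₁ → 𝔼 (λ ω → w ω₁ * 𝟙 (at α ω₁ ≟α at α ω) * inv (cl (α ⊗ β) ω)))
          ≤⟨ ∑-mono ωs (λ ω₁ → 𝔼-≤ (λ ω → pointwise ω₁ ω)) ⟩
        ∑ ωs (λ ω₁ → 𝔼 (λ ω → w ω₁ * ∑ bs (f ω₁ ω)))
          ≡⟨ ∑-cong ωs (λ ω₁ → trans (𝔼-*ˡ (w ω₁)) (cong (w ω₁ *_) (𝔼-∑ bs _))) ⟩
        ∑ ωs (λ ω₁ → w ω₁ * ∑ bs (λ b → 𝔼 (λ ω → f ω₁ ω b)))
          ≤⟨ 𝔼-≤ (λ ω₁ → ∑-mono bs (λ b → fibre (α ⊗ β) (at α ω₁ , b))) ⟩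
        𝔼 (λ _ → ∑ bs (λ _ → F))
          ≡⟨ trans (𝔼-const _) (trans (cong (D *_) (∑-const bs F)) (regroup D (length bs) F)) ⟩
        F * (D * length bs) ∎))
      (≤-reflexive (trans (cong (J (α ⊗ β) *_) (^-distribʳ-* D (length bs) D))
        (swap (J (α ⊗ β)) (D ^ D) (length bs ^ D)))))
      where
      open ≤-Reasoning
      open RV α using () renaming (_≟_ to _≟α_)
      open RV (α ⊗ β) using () renaming (_≟_ to _≟αβ_)
      regroup : ∀ d b f → d * (b * f) ≡ f * (d * b)
      regroup = solve-∀
      swap : ∀ a b c → a * (b * c) ≡ a * c * b
      swap = solve-∀
      f : Ω → Ω → Label β → ℕ
      f ω₁ ω b = 𝟙 (at (α ⊗ β) ω ≟αβ (at α ω₁ , b)) * inv (cl (α ⊗ β) ω)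
      pointwise : ∀ ω₁ ω → w ω₁ * 𝟙 (at α ω₁ ≟α at α ω) * inv (cl (α ⊗ β) ω) ≤ w ω₁ * ∑ bs (f ω₁ ω)
      pointwise ω₁ ω = ≤-trans (≤-reflexive (*-assoc (w ω₁) _ _)) (*-monoʳ-≤ (w ω₁)
        (≤-trans (*-monoˡ-≤ (inv (cl (α ⊗ β) ω)) (𝟙-mono (at α ω₁ ≟α at α ω)
            (at (α ⊗ β) ω ≟αβ (at α ω₁ , at β ω)) (λ e → cong (_, at β ω) (sym e))))
          (∑-∈ (f ω₁ ω) (∈bs ω))))

    -- The entropy of the law of α relative to g / ∑ g is nonnegative.
    gibbs : ∀ α (g : Label α → ℕ) (as : List (Label α)) → (∀ ω → at α ω ∈ as) →
            𝔾 (λ ω → g (at α ω)) * D ^ D ≤ J α * ∑ as g ^ D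
    gibbs α g as ∈as = jensen-quotient _ α (∑ as g) (begin
      𝔼 (λ ω → g (at α ω) * inv (cl α ω))
        ≤⟨ 𝔼-≤ (λ ω → pointwise ω) ⟩
      𝔼 (λ ω → ∑ as (λ a → g a * (𝟙 (at α ω ≟α a) * inv (cl α ω))))
        ≡⟨ trans (𝔼-∑ as _) (∑-cong as (λ a → 𝔼-*ˡ (g a))) ⟩
      ∑ as (λ a → g a * 𝔼 (λ ω → 𝟙 (at α ω ≟α a) * inv (cl α ω)))
        ≤⟨ ∑-mono as (λ a → *-monoʳ-≤ (g a) (fibre α a)) ⟩
      ∑ as (λ a → g a * F)  ≡⟨ trans (∑-*ʳ as F) (*-comm (∑ as g) F) ⟩
      F * ∑ as g            ∎)
      where
      open ≤-Reasoning
      open RV α using () renaming (_≟_ to _≟α_)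
      pointwise : ∀ ω → g (at α ω) * inv (cl α ω)
                        ≤ ∑ as (λ a → g a * (𝟙 (at α ω ≟α a) * inv (cl α ω)))
      pointwise ω = ≤-trans (≤-reflexive (cong (g (at α ω) *_) (sym (trans
          (cong (_* inv (cl α ω)) (𝟙-yes (at α ω ≟α at α ω) refl)) (*-identityˡ _)))))
        (∑-∈ _ (∈as ω))

-- Messages whose conditional probabilities differ between the players.

module Likelihood where

  open import Data.List.Base using (List)
  open import Data.List.Membership.Propositional using (_∈_)
  open import Data.Nat.Base
  open import Data.Nat.Properties hiding (_≟_)
  open import Data.Nat.Tactic.RingSolver using (solve-∀)
  open import Data.Product.Base using (_×_; _,_; proj₁; proj₂)
  open import Relation.Binary.PropositionalEquality hiding (J)
  open import Relation.Nullary.Decidable.Core using (yes; no)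
  open Sums
  open AMGM
  open Entropy

  module LikelihoodRatios {Ω : Set} (ωs : List Ω) (complete : ∀ ω → ω ∈ ωs) (w : Ω → ℕ) where

    open Weighted ωs complete w

    -- With B the weight of an event, (1 + B / 2D) ^ D ≤ 2 ^ B.
    event-power : ∀ (b : Ω → ℕ) → (∀ ω → b ω ≤ 1) → (2 * D + 𝔼 b) ^ D ≤ 2 ^ D * (2 ^ 𝔼 b * D ^ D)
    event-power b b≤1 = *-cancelʳ-≤ _ _ (2 ^ D * D ^ D) {{m*n≢0 _ _ {{m^n≢0 2 D}} {{n^n≢0 D}}}} (begin
      (2 * D + B) ^ D * (2 ^ D * D ^ D)
        ≡⟨ cong (λ x → (2 * D + B) ^ D * (x * D ^ D)) 𝔾g ⟩
      (2 * D + B) ^ D * (𝔾 g * 2 ^ B * D ^ D)   ≡⟨ shuffle₁ ((2 * D + B) ^ D) (𝔾 g) (2 ^ B) (D ^ D) ⟩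
      2 ^ B * ((2 * D + B) ^ D * (𝔾 g * D ^ D)) ≤⟨ *-monoʳ-≤ (2 ^ B) (*-monoʳ-≤ ((2 * D + B) ^ D) (jensen g)) ⟩
      2 ^ B * ((2 * D + B) ^ D * 𝔼 g ^ D)
        ≡⟨ cong (2 ^ B *_) (sym (^-distribʳ-* (2 * D + B) (𝔼 g) D)) ⟩
      2 ^ B * ((2 * D + B) * 𝔼 g) ^ D           ≤⟨ *-monoʳ-≤ (2 ^ B) (^-monoˡ-≤ D square) ⟩
      2 ^ B * (2 * D * (2 * D)) ^ D
        ≡⟨ cong (2 ^ B *_) (trans (^-distribʳ-* (2 * D) (2 * D) D)
             (cong₂ _*_ (^-distribʳ-* 2 D D) (^-distribʳ-* 2 D D))) ⟩
      2 ^ B * (2 ^ D * D ^ D * (2 ^ D * D ^ D)) ≡⟨ shuffle₂ (2 ^ B) (2 ^ D) (D ^ D) ⟩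
      2 ^ D * (2 ^ B * D ^ D) * (2 ^ D * D ^ D) ∎)
      where
      open ≤-Reasoning
      B = 𝔼 b
      -- AM-GM bounds a product from above only, so it is applied to 2 - b: 2^(D - B) D^D ≤ (2D -
      -- B)^D. Then (2D - B)(2D + B) ≤ (2D)^2 turns this into a bound on 2D + B.
      g = λ ω → 2 ∸ b ω
      g+b : ∀ ω → g ω + b ω ≡ 2
      g+b ω = m∸n+n≡m (≤-trans (b≤1 ω) (s≤s z≤n))
      𝔼g : 𝔼 g + B ≡ 2 * D
      𝔼g = trans (sym 𝔼-+) (trans (𝔼-cong g+b) (trans (𝔼-const 2) (*-comm D 2)))
      𝔾g : 2 ^ D ≡ 𝔾 g * 2 ^ B
      𝔾g = trans (sym (𝔾-const 2)) (trans (𝔾-cong (λ ω _ → two (b ω) (b≤1 ω)))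
        (trans (𝔾-* g (λ ω → 2 ^ b ω)) (cong (𝔾 g *_) (𝔾-^ 2 b))))
        where
        two : ∀ c → c ≤ 1 → 2 ≡ (2 ∸ c) * 2 ^ c
        two zero          _ = refl
        two (suc zero)    _ = refl
        two (suc (suc _)) (s≤s ())
      square : (2 * D + B) * 𝔼 g ≤ 2 * D * (2 * D)
      square = subst (λ d → (d + B) * 𝔼 g ≤ d * d) 𝔼g
        (≤-trans (m≤m+n _ (B * B)) (≤-reflexive (expand (𝔼 g) B)))
        where
        expand : ∀ g b → (g + b + b) * g + b * b ≡ (g + b) * (g + b)
        expand = solve-∀
      shuffle₁ : ∀ a b c d → a * (b * c * d) ≡ c * (a * (b * d))
      shuffle₁ = solve-∀
      shuffle₂ : ∀ a b d → a * (b * d * (b * d)) ≡ b * (a * d) * (b * d)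
      shuffle₂ = solve-∀

    -- The next label δ of the transcript extends the label γ; α is the input of
    -- the sender and β that of the receiver.
    module Step (α β γ δ : RV Ω) (extends : δ ⟶ γ) where

      -- The event p(δ | α, γ) > 2^e p(δ | α, β, γ), cross-multiplied; since `δ` determines `γ`, p(δ
      -- | α, γ) is the quotient of the weights of `α ⊗ δ` and `α ⊗ γ`.
      unlikely : ℕ → Ω → ℕ
      unlikely e ω = 𝟙 (2 ^ e * (cl (α ⊗ γ) ω * cl (α ⊗ β ⊗ δ) ω) <?
                        cl (α ⊗ δ) ω * cl (α ⊗ β ⊗ γ) ω)

      -- The event p(δ | α, β, γ) > 2^k p(δ | β, γ): the message surprises the receiver by more than
      -- `k` bits beyond what the pair of inputs explains.
      informative : ℕ → Ω → ℕ
      informative k ω = 𝟙 (2 ^ k * (cl (α ⊗ β ⊗ γ) ω * cl (β ⊗ δ) ω) <?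
                           cl (α ⊗ β ⊗ δ) ω * cl (β ⊗ γ) ω)

      -- The expectation of p(δ | α, γ) / p(δ | α, β, γ) is at most 1; this is `shannon` for `δ` and
      -- `β` given `α ⊗ γ`, with equivalent labels exchanged.
      shannon′ : 𝔼 (λ ω → cl (α ⊗ δ) ω * cl (α ⊗ β ⊗ γ) ω *
                   (inv (cl (α ⊗ β ⊗ δ) ω) * inv (cl (α ⊗ γ) ω))) ≤ F * (F * D)
      shannon′ = ≤-trans (≤-reflexive (𝔼-cong λ ω →
          cong₂ _*_ (cong₂ _*_
              (cl-cong (α ⊗ δ) (δ ⊗ α ⊗ γ) (λ ω ω′ e → cong₂ _,_ (cong proj₂ e) (cong₂ _,_ (cong proj₁ e)
                (extends ω ω′ (cong proj₂ e)))) (λ ω ω′ e → cong₂ _,_ (cong (λ x → proj₁ (proj₂ x)) e)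
                (cong proj₁ e)) ω)
              (cl-cong (α ⊗ β ⊗ γ) (β ⊗ α ⊗ γ) (rotate α β γ) (rotate β α γ) ω))
            (cong (λ x → inv x * inv (cl (α ⊗ γ) ω))
              (cl-cong (α ⊗ β ⊗ δ) (δ ⊗ β ⊗ α ⊗ γ)
                (λ ω ω′ e → let (a , b , d) = split₃ e in
                  cong₂ _,_ d (cong₂ _,_ b (cong₂ _,_ a (extends ω ω′ d))))
                (λ ω ω′ e → cong₂ _,_ (cong (λ x → proj₁ (proj₂ (proj₂ x))) e)
                  (cong₂ _,_ (cong (λ x → proj₁ (proj₂ x)) e) (cong proj₁ e))) ω))))
        (shannon δ β (α ⊗ γ))
        where
        split₃ : ∀ {A B C : Set} {a a′ : A} {b b′ : B} {c c′ : C} →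
                 (a , b , c) ≡ (a′ , b′ , c′) → a ≡ a′ × b ≡ b′ × c ≡ c′
        split₃ refl = refl , refl , refl
        rotate : ∀ (κ κ′ κ″ : RV Ω) → (κ ⊗ κ′ ⊗ κ″) ⟶ (κ′ ⊗ κ ⊗ κ″)
        rotate κ κ′ κ″ ω ω′ e = let (a , b , c) = split₃ e in cong₂ _,_ b (cong₂ _,_ a c)

      -- Markov's inequality for the quotient in `shannon′`, which exceeds 2^e on the event.
      unlikely-weight : ∀ e → 2 ^ e * 𝔼 (unlikely e) ≤ D
      unlikely-weight e = *-cancelˡ-≤ (F * F) {{m*n≢0 F F}} (begin
        F * F * (2 ^ e * 𝔼 (unlikely e))
          ≡⟨ trans (cong (F * F *_) (sym (𝔼-*ˡ (2 ^ e)))) (sym (𝔼-*ˡ (F * F))) ⟩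
        𝔼 (λ ω → F * F * (2 ^ e * unlikely e ω))
          ≤⟨ 𝔼-mono pointwise ⟩
        𝔼 (λ ω → cl (α ⊗ δ) ω * cl (α ⊗ β ⊗ γ) ω *
                   (inv (cl (α ⊗ β ⊗ δ) ω) * inv (cl (α ⊗ γ) ω))) ≤⟨ shannon′ ⟩
        F * (F * D) ≡⟨ sym (*-assoc F F D) ⟩
        F * F * D   ∎)
        where
        open ≤-Reasoning
        pointwise : ∀ ω → 1 ≤ w ω → F * F * (2 ^ e * unlikely e ω)
          ≤ cl (α ⊗ δ) ω * cl (α ⊗ β ⊗ γ) ω * (inv (cl (α ⊗ β ⊗ δ) ω) * inv (cl (α ⊗ γ) ω))
        pointwise ω 1≤w with 2 ^ e * (cl (α ⊗ γ) ω * cl (α ⊗ β ⊗ δ) ω) <?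
                             cl (α ⊗ δ) ω * cl (α ⊗ β ⊗ γ) ω
        ... | no _ = ≤-trans (≤-reflexive (trans (cong (F * F *_) (*-zeroʳ (2 ^ e))) (*-zeroʳ (F * F)))) z≤n
        ... | yes h = begin
          F * F * (2 ^ e * 1)
            ≡⟨ trans (cong₂ (λ a b → a * b * (2 ^ e * 1)) (sym (cl-inv (α ⊗ γ) ω 1≤w))
                 (sym (cl-inv (α ⊗ β ⊗ δ) ω 1≤w)))
                 (regroup (cl (α ⊗ γ) ω) _ (cl (α ⊗ β ⊗ δ) ω) _ (2 ^ e)) ⟩
          2 ^ e * (cl (α ⊗ γ) ω * cl (α ⊗ β ⊗ δ) ω) * (inv (cl (α ⊗ β ⊗ δ) ω) * inv (cl (α ⊗ γ) ω))
            ≤⟨ *-monoˡ-≤ _ (<⇒≤ h) ⟩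
          cl (α ⊗ δ) ω * cl (α ⊗ β ⊗ γ) ω * (inv (cl (α ⊗ β ⊗ δ) ω) * inv (cl (α ⊗ γ) ω)) ∎
          where
          regroup : ∀ a i b j p → a * i * (b * j) * (p * 1) ≡ p * (a * b) * (j * i)
          regroup = solve-∀

      -- The expectation of p(δ | β, γ) / p(δ | α, β, γ) is at most 1.
      shannon″ : 𝔼 (λ ω → cl (α ⊗ β ⊗ γ) ω * cl (β ⊗ δ) ω *
                   (inv (cl (α ⊗ β ⊗ δ) ω) * inv (cl (β ⊗ γ) ω))) ≤ F * (F * D)
      shannon″ = ≤-trans (≤-reflexive (𝔼-cong λ ω →
          cong₂ _*_ (cong (cl (α ⊗ β ⊗ γ) ω *_)
              (cl-cong (β ⊗ δ) (δ ⊗ β ⊗ γ) (λ ω ω′ e → cong₂ _,_ (cong proj₂ e) (cong₂ _,_ (cong proj₁ e)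
                (extends ω ω′ (cong proj₂ e)))) (λ ω ω′ e → cong₂ _,_ (cong (λ x → proj₁ (proj₂ x)) e)
                (cong proj₁ e)) ω))
            (cong (λ x → inv x * inv (cl (β ⊗ γ) ω))
              (cl-cong (α ⊗ β ⊗ δ) (α ⊗ δ ⊗ β ⊗ γ)
                (λ ω ω′ e → cong₂ _,_ (cong proj₁ e) (cong₂ _,_ (cong (λ x → proj₂ (proj₂ x)) e)
                  (cong₂ _,_ (cong (λ x → proj₁ (proj₂ x)) e) (extends ω ω′ (cong (λ x → proj₂ (proj₂ x)) e)))))
                (λ ω ω′ e → cong₂ _,_ (cong proj₁ e) (cong₂ _,_ (cong (λ x → proj₁ (proj₂ (proj₂ x))) e)
                  (cong (λ x → proj₁ (proj₂ x)) e))) ω))))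
        (shannon α δ (β ⊗ γ))

      -- In logarithms, k times the weight of the informative event is at most D times I(α; δ | β,
      -- γ). Jensen's inequality is applied to the quotient of `shannon″`, inflated where it is
      -- tiny.
      informative-cost : ∀ k →
        J (α ⊗ β ⊗ γ) * J (β ⊗ δ) * 2 ^ (k * 𝔼 (informative (2 + k))) ≤ J (α ⊗ β ⊗ δ) * J (β ⊗ γ)
      informative-cost k = *-cancelʳ-≤ _ _ (2 ^ D * 2 ^ B * D ^ D)
        {{m*n≢0 _ _ {{m*n≢0 _ _ {{m^n≢0 2 D}} {{m^n≢0 2 B}}}} {{n^n≢0 D}}}} (begin
        J (α ⊗ β ⊗ γ) * J (β ⊗ δ) * 2 ^ (k * B) * (2 ^ D * 2 ^ B * D ^ D)
          ≡⟨ cong (_* (2 ^ D * 2 ^ B * D ^ D)) (cong (_* 2 ^ (k * B)) (sym (𝔾-* (cl (α ⊗ β ⊗ γ)) (cl (β ⊗ δ))))) ⟩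
        𝔾 v * 2 ^ (k * B) * (2 ^ D * 2 ^ B * D ^ D)
          ≡⟨ shuffle₁ (𝔾 v) (2 ^ (k * B)) (2 ^ D) (2 ^ B) (D ^ D) ⟩
        𝔾 v * (2 ^ D * (2 ^ B * 2 ^ (k * B))) * D ^ D
          ≡⟨ cong (λ x → 𝔾 v * (2 ^ D * x) * D ^ D) (sym (^-distribˡ-+-* 2 B (k * B))) ⟩
        𝔾 v * (2 ^ D * 2 ^ (suc k * B)) * D ^ D
          ≡⟨ cong (λ x → 𝔾 v * x * D ^ D) (sym 𝔾c) ⟩
        𝔾 v * 𝔾 c * D ^ D
          ≡⟨ cong (_* D ^ D) (sym (𝔾-* v c)) ⟩
        𝔾 (λ ω → v ω * c ω) * D ^ D
          ≤⟨ jensen-quotient₂ _ (α ⊗ β ⊗ δ) (β ⊗ γ) (2 * D + B) expectation ⟩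
        J (α ⊗ β ⊗ δ) * J (β ⊗ γ) * (2 * D + B) ^ D
          ≤⟨ *-monoʳ-≤ (J (α ⊗ β ⊗ δ) * J (β ⊗ γ)) (event-power (informative (2 + k)) (λ ω → 𝟙≤1 (_ <? _))) ⟩
        J (α ⊗ β ⊗ δ) * J (β ⊗ γ) * (2 ^ D * (2 ^ B * D ^ D))
          ≡⟨ cong (J (α ⊗ β ⊗ δ) * J (β ⊗ γ) *_) (sym (*-assoc (2 ^ D) (2 ^ B) (D ^ D))) ⟩
        J (α ⊗ β ⊗ δ) * J (β ⊗ γ) * (2 ^ D * 2 ^ B * D ^ D) ∎)
        where
        open ≤-Reasoning
        B = 𝔼 (informative (2 + k))
        v = λ ω → cl (α ⊗ β ⊗ γ) ω * cl (β ⊗ δ) ω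
        -- On the informative event the quotient is below 2^-(k + 2) and `c` is 2^(k + 2), so their
        -- product is at most 1; elsewhere `c` is 2. Of the two extra factors 2, one cancels the 2^D
        -- in `event-power`, the other its 2^B.
        c = λ ω → 2 * 2 ^ (suc k * informative (2 + k) ω)
        shuffle₁ : ∀ g x d b e → g * x * (d * b * e) ≡ g * (d * (b * x)) * e
        shuffle₁ = solve-∀
        𝔾c : 𝔾 c ≡ 2 ^ D * 2 ^ (suc k * B)
        𝔾c = trans (𝔾-* (λ _ → 2) (λ ω → 2 ^ (suc k * informative (2 + k) ω)))
          (cong₂ _*_ (𝔾-const 2) (trans (𝔾-^ 2 _) (cong (2 ^_) (𝔼-*ˡ (suc k)))))
        i = λ ω → inv (cl (α ⊗ β ⊗ δ) ω) * inv (cl (β ⊗ γ) ω)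
        pointwise : ∀ ω → 1 ≤ w ω → v ω * c ω * i ω ≤ 2 * (v ω * i ω) + F * F * informative (2 + k) ω
        pointwise ω 1≤w with 2 ^ (2 + k) * (cl (α ⊗ β ⊗ γ) ω * cl (β ⊗ δ) ω) <? cl (α ⊗ β ⊗ δ) ω * cl (β ⊗ γ) ω
        ... | no _ = ≤-trans (≤-reflexive (trans (cong (λ j → v ω * (2 * 2 ^ j) * i ω) (*-zeroʳ (suc k)))
                (regroup (v ω) (i ω)))) (m≤m+n _ _)
          where
          regroup : ∀ v i → v * (2 * 1) * i ≡ 2 * (v * i)
          regroup = solve-∀
        ... | yes h = ≤-trans (begin
          v ω * (2 * 2 ^ (suc k * 1)) * i ω
            ≡⟨ trans (cong (λ j → v ω * (2 * 2 ^ j) * i ω) (*-identityʳ (suc k))) (cong (_* i ω) (*-comm (v ω) _)) ⟩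
          2 ^ (2 + k) * v ω * i ω ≤⟨ *-monoˡ-≤ (i ω) (<⇒≤ h) ⟩
          cl (α ⊗ β ⊗ δ) ω * cl (β ⊗ γ) ω * i ω
            ≡⟨ trans (regroup (cl (α ⊗ β ⊗ δ) ω) (cl (β ⊗ γ) ω) _ _)
                 (cong₂ _*_ (cl-inv (α ⊗ β ⊗ δ) ω 1≤w) (cl-inv (β ⊗ γ) ω 1≤w)) ⟩
          F * F ≡⟨ sym (*-identityʳ (F * F)) ⟩
          F * F * 1 ∎) (m≤n+m (F * F * 1) (2 * (v ω * i ω)))
          where
          regroup : ∀ a b i j → a * b * (i * j) ≡ a * i * (b * j)
          regroup = solve-∀
        expectation : 𝔼 (λ ω → v ω * c ω * i ω) ≤ F * (F * (2 * D + B))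
        expectation = begin
          𝔼 (λ ω → v ω * c ω * i ω) ≤⟨ 𝔼-mono pointwise ⟩
          𝔼 (λ ω → 2 * (v ω * i ω) + F * F * informative (2 + k) ω)
            ≡⟨ trans 𝔼-+ (cong₂ _+_ (𝔼-*ˡ 2) (𝔼-*ˡ (F * F))) ⟩
          2 * 𝔼 (λ ω → v ω * i ω) + F * F * B ≤⟨ +-monoˡ-≤ _ (*-monoʳ-≤ 2 shannon″) ⟩
          2 * (F * (F * D)) + F * F * B ≡⟨ collect F D B ⟩
          F * (F * (2 * D + B)) ∎
          where
          collect : ∀ f d b → 2 * (f * (f * d)) + f * f * b ≡ f * (f * (2 * d + b))
          collect = solve-∀

      -- If neither exception occurs at ω, then the conditional probability of
      -- the label is at most 2 ^ (k + e) times larger for the sender.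
      typical : ∀ k e ω → 1 ≤ w ω → unlikely e ω ≡ 0 → informative k ω ≡ 0 →
        cl (α ⊗ δ) ω * inv (cl (α ⊗ γ) ω) ≤ 2 ^ (k + e) * (cl (β ⊗ δ) ω * inv (cl (β ⊗ γ) ω))
      typical k e ω 1≤w u i with 2 ^ e * (cl (α ⊗ γ) ω * cl (α ⊗ β ⊗ δ) ω) <? cl (α ⊗ δ) ω * cl (α ⊗ β ⊗ γ) ω
                               | 2 ^ k * (cl (α ⊗ β ⊗ γ) ω * cl (β ⊗ δ) ω) <? cl (α ⊗ β ⊗ δ) ω * cl (β ⊗ γ) ω
      ... | no ≮₁ | no ≮₂ = *-cancelʳ-≤ _ _ (ag * bg * (abg * abd))
          {{m*n≢0 _ _ {{m*n≢0 _ _ {{pos (α ⊗ γ)}} {{pos (β ⊗ γ)}}}}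
                      {{m*n≢0 _ _ {{pos (α ⊗ β ⊗ γ)}} {{pos (α ⊗ β ⊗ δ)}}}}}} (begin
          ad * inv ag * (ag * bg * (abg * abd))
            ≡⟨ shuffle₁ ad (inv ag) ag bg abg abd ⟩
          ag * inv ag * (ad * abg * (abd * bg))
            ≤⟨ *-mono-≤ (≤-reflexive (trans (cl-inv (α ⊗ γ) ω 1≤w) (sym (cl-inv (β ⊗ γ) ω 1≤w))))
                 (*-mono-≤ (≮⇒≥ ≮₁) (≮⇒≥ ≮₂)) ⟩
          bg * inv bg * (2 ^ e * (ag * abd) * (2 ^ k * (abg * bd)))
            ≡⟨ shuffle₂ bg (inv bg) (2 ^ e) ag abd (2 ^ k) abg bd ⟩
          2 ^ k * 2 ^ e * (bd * inv bg) * (ag * bg * (abg * abd))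
            ≡⟨ cong (λ x → x * (bd * inv bg) * (ag * bg * (abg * abd))) (sym (^-distribˡ-+-* 2 k e)) ⟩
          2 ^ (k + e) * (bd * inv bg) * (ag * bg * (abg * abd)) ∎)
        where
        open ≤-Reasoning
        ad = cl (α ⊗ δ) ω
        ag = cl (α ⊗ γ) ω
        bd = cl (β ⊗ δ) ω
        bg = cl (β ⊗ γ) ω
        abd = cl (α ⊗ β ⊗ δ) ω
        abg = cl (α ⊗ β ⊗ γ) ω
        pos : ∀ κ → NonZero (cl κ ω)
        pos κ = >-nonZero (1≤cl κ ω 1≤w)
        shuffle₁ : ∀ ad i ag bg abg abd → ad * i * (ag * bg * (abg * abd)) ≡ ag * i * (ad * abg * (abd * bg))
        shuffle₁ = solve-∀
        shuffle₂ : ∀ bg j e ag abd k abg bd → bg * j * (e * (ag * abd) * (k * (abg * bd)))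
                   ≡ k * e * (bd * j) * (ag * bg * (abg * abd))
        shuffle₂ = solve-∀

-- Hashed rejection sampling of one message.

module Sampling where

  open import Data.Bool.Base using (Bool; true; false)
  open import Data.List.Base using (List; []; _∷_; length; downFrom; cartesianProductWith)
  open import Data.List.Membership.Propositional using (_∈_)
  open import Data.List.Membership.Propositional.Properties using (∈-cartesianProductWith⁺)
  open import Data.List.Relation.Unary.All using ([]; _∷_)
  open import Data.List.Relation.Unary.AllPairs using ([]; _∷_)
  open import Data.List.Relation.Unary.Any using (here; there)
  open import Data.List.Relation.Unary.Unique.Propositional using (Unique)
  import Data.List.Relation.Unary.Unique.Propositional.Properties as Unique
  open import Data.Nat.Base
  open import Data.Nat.Properties
  open import Data.Nat.Tactic.RingSolver using (solve-∀)
  open import Data.Product.Base using (∃-syntax; Σ-syntax; _×_; _,_; proj₁; proj₂)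
  open import Data.Sum.Base using (_⊎_; inj₁; inj₂)
  open import Data.Vec.Base using (Vec; []; _∷_)
  import Data.Vec.Properties as Vec
  open import Relation.Binary.Definitions using (DecidableEquality)
  open import Relation.Binary.PropositionalEquality
  open import Relation.Nullary.Decidable.Core using (Dec; yes; no)
  open import Relation.Nullary.Negation.Core using (¬_)
  open Sums

  bools : List Bool
  bools = true ∷ false ∷ []

  ∈-bools : ∀ b → b ∈ bools
  ∈-bools true  = here refl
  ∈-bools false = there (here refl)

  words : ∀ n → List (Vec Bool n)
  words zero    = [] ∷ []
  words (suc n) = cartesianProductWith _∷_ bools (words n)

  ∈-words : ∀ {n} (b : Vec Bool n) → b ∈ words n
  ∈-words []      = here refl
  ∈-words (b ∷ v) = ∈-cartesianProductWith⁺ _∷_ (∈-bools b) (∈-words v)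

  words-unique : ∀ n → Unique (words n)
  words-unique zero    = [] ∷ []
  words-unique (suc n) = Unique.cartesianProductWith⁺ _∷_ Vec.∷-injective
    (((λ ()) ∷ []) ∷ [] ∷ []) (words-unique n)

  length-words : ∀ n → length (words n) ≡ 2 ^ n
  length-words n = trans (sym (trans (∑-const (words n) 1) (*-identityʳ _))) (go n)
    where
    go : ∀ n → ∑ (words n) (λ _ → 1) ≡ 2 ^ n
    go zero    = refl
    go (suc n) = trans (∑-cartesianProductWith _∷_ bools (words n))
      (cong (λ k → k + (k + 0)) (go n))

  ∑-threshold : ∀ n a → ∑ (downFrom n) (λ u → 𝟙 (u <? a)) ≡ n ⊓ a
  ∑-threshold zero    a = refl
  ∑-threshold (suc n) a with n <? a | ∑-threshold n a
  ... | yes n<a | ih = trans (cong suc (trans ih (m≤n⇒m⊓n≡m (<⇒≤ n<a)))) (sym (m≤n⇒m⊓n≡m n<a))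
  ... | no  n≮a | ih = trans ih (trans (m≥n⇒m⊓n≡n (≮⇒≥ n≮a)) (sym (m≥n⇒m⊓n≡n (m≤n⇒m≤1+n (≮⇒≥ n≮a)))))

  -- A step from a point outside `P` raises `f` by at least 1, so `n` steps end in `P` or at height
  -- `n`.
  climb : ∀ {A : Set} {P : A → Set} (f : A → ℕ) → A → (∀ a → Dec (P a)) →
    (∀ a → ¬ P a → ∃[ b ] f a < f b) → ∀ n → ∃[ b ] (P b ⊎ n ≤ f b)
  climb f a P? up zero    = a , inj₂ z≤n
  climb f a P? up (suc n) with climb f a P? up n
  ... | b , inj₁ p     = b , inj₁ p
  ... | b , inj₂ large with P? b
  ...   | yes p = b , inj₁ p
  ...   | no ¬p with up b ¬p
  ...     | c , more = c , inj₂ (≤-<-trans large more)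

  -- One round: the sender, whose input is s, wants to hand over a message drawn
  -- with probability p s m / F, and the receiver only knows r m / F. Samples
  -- (m , u , h) are taken from a public sequence; the sender stops at the first
  -- one with u < p s m and sends its tag h, and the receiver looks for the first
  -- one with this tag and u < K * r m. A greedy choice of the sequence beats the
  -- average, and each success adds an integer.
  module Round
    {S R M H : Set} (ss : List S) (rs : List R) (ms : List M) (hs : List H)
    (_≟M_ : DecidableEquality M) (_≟H_ : DecidableEquality H)
    (hs-unique : Unique hs)
    (F K Q : ℕ) (1≤F : 1 ≤ F) (size : length hs ≡ K * Q) (1≤KQ : 1 ≤ K * Q) (m₀ : M) (h₀ : H)
    (p : S → M → ℕ) (p≤F : ∀ s m → p s m ≤ F) (∑p≤F : ∀ s → ∑ ms (p s) ≤ F)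
    (r : R → M → ℕ) (∑r≤F : ∀ t → ∑ ms (r t) ≤ F)
    (wt : S → R → ℕ) (value : S → R → M → ℕ)
    where

    Sample : Set
    Sample = M × ℕ × H

    enc : List Sample → S → M × H
    enc []                  s = m₀ , h₀
    enc ((m , u , h) ∷ seq) s with u <? p s m
    ... | yes _ = m , h
    ... | no  _ = enc seq s

    dec : List Sample → R → H → M
    dec []                  t k = m₀
    dec ((m , u , h) ∷ seq) t k with u <? K * r t m | k ≟H h
    ... | yes _ | yes _ = m
    ... | yes _ | no  _ = dec seq t k
    ... | no  _ | _     = dec seq t k

    score : List Sample → S → R → ℕ
    score seq s t =
      𝟙 (proj₁ (enc seq s) ≟M dec seq t (proj₂ (enc seq s))) * value s t (proj₁ (enc seq s))

    total : List Sample → ℕ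
    total seq = ∑ ss λ s → ∑ rs λ t → wt s t * score seq s t

    goal : ℕ
    goal = ∑ ss λ s → ∑ rs λ t → wt s t * ∑ ms (λ m → p s m * 𝟙 (p s m ≤? K * r t m) * value s t m)

    samples : List Sample
    samples = cartesianProductWith _,_ ms (cartesianProductWith _,_ (downFrom F) hs)

    ∑-samples : ∀ f → ∑ samples f ≡ ∑ ms λ m → ∑ (downFrom F) λ u → ∑ hs λ h → f (m , u , h)
    ∑-samples f = trans (∑-cartesianProductWith _,_ ms _)
      (∑-cong ms (λ m → ∑-cartesianProductWith _,_ (downFrom F) hs))

    good : S → R → M → ℕ
    good s t m = 𝟙 (p s m ≤? K * r t m)

    -- The new sample stands in front, so the old sequence is what both players fall back on. If the
    -- sender stops here at a good message, so does the receiver, as u < p ≤ K r and the tags agree.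
    -- Otherwise the old score survives, unless the sender stops here or the receiver accepts here
    -- by mistake.
    extend : ∀ seq s t m u h →
      𝟙 (u <? p s m) * (good s t m * value s t m) + score seq s t
        ≤ (𝟙 (u <? p s m) + 𝟙 (u <? K * r t m) * 𝟙 (proj₂ (enc seq s) ≟H h)) * score seq s t
          + score ((m , u , h) ∷ seq) s t
    extend seq s t m u h with u <? p s m | p s m ≤? K * r t m
    ... | yes u<p | no _ = ≤-trans (m≤m+n (score seq s t) _) (m≤m+n _ _)
    ... | yes u<p | yes good with u <? K * r t m | h ≟H h
    ...   | no u≮  | _ with () ← u≮ (<-≤-trans u<p good)
    ...   | yes _  | no h≢h with () ← h≢h refl
    ...   | yes _  | yes _ rewrite 𝟙-yes (m ≟M m) refl = ≤-trans
            (≤-reflexive (trans (cong (_+ score seq s t) (+-identityʳ _)) (+-comm _ (score seq s t))))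
            (+-monoˡ-≤ _ (m≤m+n (score seq s t) _))
    extend seq s t m u h | no _ | _ with u <? K * r t m | proj₂ (enc seq s) ≟H h
    ...   | yes _ | yes _ = ≤-trans (m≤m+n (score seq s t) 0) (m≤m+n _ _)
    ...   | yes _ | no  _ = ≤-refl
    ...   | no _  | _     = ≤-refl

    N : ℕ
    N = length samples

    gain : S → R → ℕ
    gain s t = ∑ ms (λ m → p s m * good s t m * value s t m)

    ∑-hit : ∀ s t → K * Q * gain s t ≡
      ∑ samples (λ (m , u , h) → 𝟙 (u <? p s m) * (good s t m * value s t m))
    ∑-hit s t = sym (trans (∑-samples _) (trans (∑-cong ms λ m → begin
      ∑ (downFrom F) (λ u → ∑ hs (λ h → 𝟙 (u <? p s m) * (good s t m * value s t m)))
        ≡⟨ ∑-cong (downFrom F) (λ u → trans (∑-const hs _)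
             (swap (length hs) (𝟙 (u <? p s m)) (good s t m * value s t m))) ⟩
      ∑ (downFrom F) (λ u → 𝟙 (u <? p s m) * (length hs * (good s t m * value s t m)))
        ≡⟨ trans (∑-*ʳ (downFrom F) _)
             (cong₂ (λ a b → a * (b * (good s t m * value s t m)))
               (trans (∑-threshold F (p s m)) (m≥n⇒m⊓n≡n (p≤F s m))) size) ⟩
      p s m * (K * Q * (good s t m * value s t m)) ≡⟨ regroup (p s m) (K * Q) (good s t m) (value s t m) ⟩
      K * Q * (p s m * good s t m * value s t m) ∎) (∑-*ˡ ms (K * Q))))
      where
      open ≡-Reasoning
      swap : ∀ a b c → a * (b * c) ≡ b * (a * c)
      swap = solve-∀
      regroup : ∀ p h g v → p * (h * (g * v)) ≡ h * (p * g * v)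
      regroup = solve-∀

    -- For a message `m`, the sender stops for at most `p s m * (K * Q)` pairs of threshold and tag,
    -- and the receiver accepts the tag `k` for at most `K * r t m` of them. With `K * Q` tags the
    -- second kind adds only a fraction 1/Q.
    ∑-loss : ∀ s t k →
      ∑ samples (λ (m , u , h) → 𝟙 (u <? p s m) + 𝟙 (u <? K * r t m) * 𝟙 (k ≟H h)) ≤ K * (1 + Q) * F
    ∑-loss s t k = begin
      ∑ samples (λ (m , u , h) → 𝟙 (u <? p s m) + 𝟙 (u <? K * r t m) * 𝟙 (k ≟H h))
        ≡⟨ ∑-samples _ ⟩
      ∑ ms (λ m → ∑ (downFrom F) (λ u → ∑ hs (λ h → 𝟙 (u <? p s m) + 𝟙 (u <? K * r t m) * 𝟙 (k ≟H h))))
        ≤⟨ ∑-mono ms (λ m → begin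
          ∑ (downFrom F) (λ u → ∑ hs (λ h → 𝟙 (u <? p s m) + 𝟙 (u <? K * r t m) * 𝟙 (k ≟H h)))
            ≤⟨ ∑-mono (downFrom F) (λ u → begin
              ∑ hs (λ h → 𝟙 (u <? p s m) + 𝟙 (u <? K * r t m) * 𝟙 (k ≟H h))
                ≡⟨ trans (∑-+ hs) (cong₂ _+_
                     (trans (∑-const hs _) (*-comm (length hs) _)) (∑-*ˡ hs (𝟙 (u <? K * r t m)))) ⟩
              𝟙 (u <? p s m) * length hs + 𝟙 (u <? K * r t m) * ∑ hs (λ h → 𝟙 (k ≟H h))
                ≤⟨ +-mono-≤ (≤-reflexive (cong (𝟙 (u <? p s m) *_) size))
                     (*-monoʳ-≤ (𝟙 (u <? K * r t m)) (≤-trans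
                       (≤-reflexive (∑-cong hs (λ h → sym (*-identityʳ (𝟙 (k ≟H h))))))
                       (∑-unique-≤ _≟H_ (λ _ → 1) k hs-unique))) ⟩
              𝟙 (u <? p s m) * (K * Q) + 𝟙 (u <? K * r t m) * 1 ∎) ⟩
          ∑ (downFrom F) (λ u → 𝟙 (u <? p s m) * (K * Q) + 𝟙 (u <? K * r t m) * 1)
            ≡⟨ trans (∑-+ (downFrom F)) (cong₂ _+_ (∑-*ʳ (downFrom F) (K * Q)) (∑-*ʳ (downFrom F) 1)) ⟩
          ∑ (downFrom F) (λ u → 𝟙 (u <? p s m)) * (K * Q) + ∑ (downFrom F) (λ u → 𝟙 (u <? K * r t m)) * 1
            ≤⟨ +-mono-≤ (*-monoˡ-≤ (K * Q) (threshold-≤ (p s m))) (*-monoˡ-≤ 1 (threshold-≤ (K * r t m))) ⟩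
          p s m * (K * Q) + K * r t m * 1 ≡⟨ regroup (p s m) (K * Q) K (r t m) ⟩
          K * Q * p s m + K * r t m ∎) ⟩
      ∑ ms (λ m → K * Q * p s m + K * r t m)
        ≡⟨ trans (∑-+ ms) (cong₂ _+_ (∑-*ˡ ms (K * Q)) (∑-*ˡ ms K)) ⟩
      K * Q * ∑ ms (p s) + K * ∑ ms (r t)
        ≤⟨ +-mono-≤ (*-monoʳ-≤ (K * Q) (∑p≤F s)) (*-monoʳ-≤ K (∑r≤F t)) ⟩
      K * Q * F + K * F ≡⟨ collect K Q F ⟩
      K * (1 + Q) * F ∎
      where
      open ≤-Reasoning
      threshold-≤ : ∀ a → ∑ (downFrom F) (λ u → 𝟙 (u <? a)) ≤ a
      threshold-≤ a = ≤-trans (≤-reflexive (∑-threshold F a)) (m⊓n≤n F a)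
      regroup : ∀ p h k r → p * h + k * r * 1 ≡ h * p + k * r
      regroup = solve-∀
      collect : ∀ k q f → k * q * f + k * f ≡ k * (1 + q) * f
      collect = solve-∀

    ∑-extend : ∀ seq s t → K * Q * gain s t + N * score seq s t
      ≤ K * (1 + Q) * F * score seq s t + ∑ samples (λ x → score (x ∷ seq) s t)
    ∑-extend seq s t = begin
      K * Q * gain s t + N * score seq s t
        ≡⟨ trans (cong₂ _+_ (∑-hit s t) (sym (∑-const samples _))) (sym (∑-+ samples)) ⟩
      ∑ samples (λ (m , u , h) → 𝟙 (u <? p s m) * (good s t m * value s t m) + score seq s t)
        ≤⟨ ∑-mono samples (λ (m , u , h) → extend seq s t m u h) ⟩
      ∑ samples (λ (m , u , h) →
          (𝟙 (u <? p s m) + 𝟙 (u <? K * r t m) * 𝟙 (proj₂ (enc seq s) ≟H h)) * score seq s t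
          + score ((m , u , h) ∷ seq) s t)
        ≡⟨ trans (∑-+ samples) (cong (_+ ∑ samples (λ x → score (x ∷ seq) s t)) (∑-*ʳ samples (score seq s t))) ⟩
      ∑ samples (λ (m , u , h) → 𝟙 (u <? p s m) + 𝟙 (u <? K * r t m) * 𝟙 (proj₂ (enc seq s) ≟H h))
          * score seq s t
        + ∑ samples (λ x → score (x ∷ seq) s t)
        ≤⟨ +-monoˡ-≤ (∑ samples (λ x → score (x ∷ seq) s t))
             (*-monoˡ-≤ (score seq s t) (∑-loss s t (proj₂ (enc seq s)))) ⟩
      K * (1 + Q) * F * score seq s t + ∑ samples (λ x → score (x ∷ seq) s t) ∎
      where open ≤-Reasoning

    ∑∑ : (S → R → ℕ) → ℕ
    ∑∑ f = ∑ ss λ s → ∑ rs λ t → wt s t * f s t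

    ∑∑-+ : ∀ f g → ∑∑ (λ s t → f s t + g s t) ≡ ∑∑ f + ∑∑ g
    ∑∑-+ f g = trans (∑-cong ss λ s → trans (∑-cong rs λ t → *-distribˡ-+ (wt s t) (f s t) (g s t))
      (∑-+ rs)) (∑-+ ss)

    ∑∑-* : ∀ c f → ∑∑ (λ s t → c * f s t) ≡ c * ∑∑ f
    ∑∑-* c f = trans (∑-cong ss λ s → trans (∑-cong rs λ t → swap (wt s t) c (f s t)) (∑-*ˡ rs c)) (∑-*ˡ ss c)
      where
      swap : ∀ a b c → a * (b * c) ≡ b * (a * c)
      swap = solve-∀

    ∑-total : ∀ seq → K * Q * goal + N * total seq
      ≤ K * (1 + Q) * F * total seq + ∑ samples (λ x → total (x ∷ seq))
    ∑-total seq = begin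
      K * Q * goal + N * total seq
        ≡⟨ cong₂ _+_ (sym (∑∑-* (K * Q) gain)) (sym (∑∑-* N (score seq))) ⟩
      ∑∑ (λ s t → K * Q * gain s t) + ∑∑ (λ s t → N * score seq s t)
        ≡⟨ sym (∑∑-+ _ _) ⟩
      ∑∑ (λ s t → K * Q * gain s t + N * score seq s t)
        ≤⟨ ∑-mono ss (λ s → ∑-mono rs (λ t → *-monoʳ-≤ (wt s t) (∑-extend seq s t))) ⟩
      ∑∑ (λ s t → K * (1 + Q) * F * score seq s t + ∑ samples (λ x → score (x ∷ seq) s t))
        ≡⟨ trans (∑∑-+ _ _) (cong₂ _+_ (∑∑-* (K * (1 + Q) * F) (score seq)) exchange) ⟩
      K * (1 + Q) * F * total seq + ∑ samples (λ x → total (x ∷ seq)) ∎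
      where
      open ≤-Reasoning
      exchange : ∑∑ (λ s t → ∑ samples (λ x → score (x ∷ seq) s t)) ≡ ∑ samples (λ x → total (x ∷ seq))
      exchange = trans (∑-cong ss λ s → trans (∑-cong rs λ t → sym (∑-*ˡ samples (wt s t)))
        (∑-swap rs samples _)) (∑-swap ss samples _)

    -- As long as the total is below the fraction Q / ((1 + Q) F) of the goal, `∑-total` makes the
    -- average over all one-sample extensions exceed it.
    improve : ∀ seq → (1 + Q) * F * total seq < Q * goal → ∃[ seq′ ] total seq < total seq′
    improve seq short =
      let (x , h) = ∑-above-average samples (total seq) (+-cancelˡ-< (K * (1 + Q) * F * total seq) _ _
            (<-≤-trans (+-monoˡ-< (N * total seq) scaled)
              (∑-total seq)))
      in x ∷ seq , h
      where
      1≤K : NonZero K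
      1≤K = m*n≢0⇒m≢0 K {{>-nonZero 1≤KQ}}
      scaled : K * (1 + Q) * F * total seq < K * Q * goal
      scaled = subst₂ _<_ (assoc₃ K (1 + Q) F (total seq)) (sym (*-assoc K Q goal))
        (*-monoʳ-< K {{1≤K}} short)
        where
        assoc₃ : ∀ k q f t → k * (q * f * t) ≡ k * q * f * t
        assoc₃ = solve-∀

    -- A total of `Q * goal` is high enough as well, because (1 + Q) F ≥ 1; hence the height at
    -- which `climb` stops.
    near-goal : ∃[ seq ] Q * goal ≤ (1 + Q) * F * total seq
    near-goal = conclude (climb total [] (λ seq → Q * goal ≤? (1 + Q) * F * total seq)
      (λ seq short → improve seq (≰⇒> short)) (Q * goal))
      where
      conclude : ∃[ seq ] (Q * goal ≤ (1 + Q) * F * total seq ⊎ Q * goal ≤ total seq) →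
               ∃[ seq ] Q * goal ≤ (1 + Q) * F * total seq
      conclude (seq , inj₁ done)  = seq , done
      conclude (seq , inj₂ large) = seq , ≤-trans large (≤-trans (≤-reflexive (sym (*-identityˡ (total seq))))
        (*-monoˡ-≤ (total seq) (*-mono-≤ {1} {1 + Q} (s≤s z≤n) 1≤F)))

    tagged : List Sample → H → S → R → ℕ
    tagged seq h s t = wt s t * 𝟙 (proj₂ (enc seq s) ≟H h)

    -- If for each tag the rest of the protocol loses a factor B, then the whole
    -- protocol loses (1 + Q) F B.
    combine : (∀ h → h ∈ hs) → ∀ seq → Q * goal ≤ (1 + Q) * F * total seq →
      (win : H → S → R → ℕ) (A B : ℕ) →
      (∀ h → A * ∑ ss (λ s → ∑ rs λ t → tagged seq h s t
                 * 𝟙 (proj₁ (enc seq s) ≟M dec seq t h) * value s t (proj₁ (enc seq s)))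
             ≤ B * ∑ ss (λ s → ∑ rs λ t → tagged seq h s t * win h s t)) →
      Q * A * goal ≤ (1 + Q) * F * B * ∑ ss (λ s → ∑ rs λ t → wt s t * win (proj₂ (enc seq s)) s t)
    combine ∈hs seq near win A B ih = begin
      Q * A * goal                    ≡⟨ swap₁ Q A goal ⟩
      A * (Q * goal)                  ≤⟨ *-monoʳ-≤ A near ⟩
      A * ((1 + Q) * F * total seq)   ≡⟨ swap₂ A ((1 + Q) * F) (total seq) ⟩
      (1 + Q) * F * (A * total seq)   ≤⟨ *-monoʳ-≤ ((1 + Q) * F) split ⟩
      (1 + Q) * F * (B * W)           ≡⟨ sym (*-assoc ((1 + Q) * F) B W) ⟩
      (1 + Q) * F * B * W             ∎
      where
      open ≤-Reasoning
      W = ∑ ss (λ s → ∑ rs λ t → wt s t * win (proj₂ (enc seq s)) s t)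
      swap₁ : ∀ q a g → q * a * g ≡ a * (q * g)
      swap₁ = solve-∀
      swap₂ : ∀ a b c → a * (b * c) ≡ b * (a * c)
      swap₂ = solve-∀
      m = λ s → proj₁ (enc seq s)
      c = λ s → proj₂ (enc seq s)
      old = λ h s t → tagged seq h s t * 𝟙 (m s ≟M dec seq t h) * value s t (m s)
      new = λ h s t → tagged seq h s t * win h s t
      sum-tags : ∀ (g : H → S → R → ℕ) →
        ∑ ss (λ s → ∑ rs λ t → ∑ hs λ h → g h s t) ≡ ∑ hs (λ h → ∑ ss λ s → ∑ rs λ t → g h s t)
      sum-tags g = trans (∑-cong ss λ s → ∑-swap rs hs _) (∑-swap ss hs _)
      old-≥ : ∀ s t → wt s t * score seq s t ≤ ∑ hs (λ h → old h s t)
      old-≥ s t = ≤-trans (≤-reflexive (trans (regroup (wt s t) _ (value s t (m s)))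
          (cong (λ x → wt s t * x * 𝟙 (m s ≟M dec seq t (c s)) * value s t (m s))
            (sym (𝟙-yes (c s ≟H c s) refl)))))
        (∑-∈ (λ h → old h s t) (∈hs (c s)))
        where
        regroup : ∀ w a v → w * (a * v) ≡ w * 1 * a * v
        regroup = solve-∀
      new-≤ : ∀ s t → ∑ hs (λ h → new h s t) ≤ wt s t * win (c s) s t
      new-≤ s t = ≤-trans (≤-reflexive (trans (∑-cong hs λ h → *-assoc (wt s t) _ _) (∑-*ˡ hs (wt s t))))
        (*-monoʳ-≤ (wt s t) (∑-unique-≤ _≟H_ (λ h → win h s t) (c s) hs-unique))
      split : A * total seq ≤ B * W
      split = begin
        A * total seq
          ≤⟨ *-monoʳ-≤ A (∑-mono ss λ s → ∑-mono rs λ t → old-≥ s t) ⟩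
        A * ∑ ss (λ s → ∑ rs λ t → ∑ hs λ h → old h s t)
          ≡⟨ trans (cong (A *_) (sum-tags old)) (sym (∑-*ˡ hs A)) ⟩
        ∑ hs (λ h → A * ∑ ss λ s → ∑ rs λ t → old h s t)
          ≤⟨ ∑-mono hs ih ⟩
        ∑ hs (λ h → B * ∑ ss λ s → ∑ rs λ t → new h s t)
          ≡⟨ trans (∑-*ˡ hs B) (cong (B *_) (sym (sum-tags new))) ⟩
        B * ∑ ss (λ s → ∑ rs λ t → ∑ hs λ h → new h s t)
          ≤⟨ *-monoʳ-≤ B (∑-mono ss λ s → ∑-mono rs λ t → new-≤ s t) ⟩
        B * W ∎

    abstract
      -- Abstract, so that the search for the sequence is never unfolded. The sequence depends only
      -- on the ideal values; the continuation `win` is chosen afterwards and may depend on the tag.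
      handOver : (∀ h → h ∈ hs) → Σ[ enc ∈ (S → M × H) ] Σ[ dec ∈ (R → H → M) ]
        (∀ (win : H → S → R → ℕ) A B →
          (∀ h → A * ∑ ss (λ s → ∑ rs λ t → wt s t * 𝟙 (proj₂ (enc s) ≟H h)
                     * 𝟙 (proj₁ (enc s) ≟M dec t h) * value s t (proj₁ (enc s)))
                 ≤ B * ∑ ss (λ s → ∑ rs λ t → wt s t * 𝟙 (proj₂ (enc s) ≟H h) * win h s t)) →
          Q * A * goal ≤ (1 + Q) * F * B * ∑ ss (λ s → ∑ rs λ t → wt s t * win (proj₂ (enc s)) s t))
      handOver ∈hs = let (seq , near) = near-goal in enc seq , dec seq , combine ∈hs seq near

-- Simulation of a whole transcript by a short protocol.

module Simulation where

  open import Data.Bool.Base using (Bool; true; false)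
  import Data.Bool.Properties as Bool
  open import Data.List.Base using (List; []; _∷_; length)
  open import Data.Nat.Base
  open import Data.Nat.Properties
  open import Data.Nat.Tactic.RingSolver using (solve-∀)
  open import Data.Product.Base using (Σ-syntax; _×_; _,_; proj₁; proj₂)
  open import Data.Vec.Base using (Vec; []; _∷_; head; tail; replicate)
  import Data.Vec.Properties as Vec
  open import Relation.Binary.Definitions using (DecidableEquality)
  open import Relation.Binary.PropositionalEquality
  open import Relation.Nullary.Decidable.Core using (Dec; yes; no)
  open Sums
  open Sampling
  open import Defs using (Player; alice; bob; Tree; output; send; finish; outcome; bits)

  Inputs : Set → Set → Player → Set
  Inputs X Y alice = X
  Inputs X Y bob   = Y

  ⟨_,_⟩ : ∀ {X Y} → X → Y → ∀ p → Inputs X Y p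
  ⟨ x , y ⟩ alice = x
  ⟨ x , y ⟩ bob   = y

  head∷tail : ∀ {A : Set} {n} (v : Vec A (suc n)) → head v ∷ tail v ≡ v
  head∷tail (_ ∷ _) = refl

  module _ {V : Player → Set} {O : Set} {p : Player} {r : ℕ} where

    sendBits : ∀ l → (V p → Vec Bool l) → (Vec Bool l → Tree V O p (suc r)) → Tree V O p (suc r)
    sendBits zero    b next = next []
    sendBits (suc l) b next = send (λ v → head (b v)) λ c →
      sendBits l (λ v → tail (b v)) (λ k → next (c ∷ k))

    outcome-sendBits : ∀ l b next v → outcome (sendBits l b next) v ≡ outcome (next (b (v p))) v
    outcome-sendBits zero    b next v with b (v p)
    ... | [] = refl
    outcome-sendBits (suc l) b next v = trans (outcome-sendBits l _ (λ k → next (_ ∷ k)) v)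
      (cong (λ k → outcome (next k) v) (head∷tail (b (v p))))

    bits-sendBits : ∀ l b next v → bits (sendBits l b next) v ≡ l + bits (next (b (v p))) v
    bits-sendBits zero    b next v with b (v p)
    ... | [] = refl
    bits-sendBits (suc l) b next v = cong suc (trans (bits-sendBits l _ (λ k → next (_ ∷ k)) v)
      (cong (λ k → l + bits (next k) v) (head∷tail (b (v p)))))

  -- The last round: since only the output matters, one bit suffices.
  module LastRound
    {S R M : Set} (ss : List S) (rs : List R) (ms : List M) (F : ℕ)
    (p : S → M → ℕ) (∑p≤F : ∀ s → ∑ ms (p s) ≤ F)
    (φ : S → R → M → ℕ) (φ≤1 : ∀ s t m → φ s t m ≤ 1)
    (wt : S → R → ℕ) (z : M → Bool) (f : S → R → Bool)
    where

    right : Bool → S → ℕ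
    right c s = ∑ rs λ t → wt s t * 𝟙 (c Bool.≟ f s t)

    best : S → Bool
    best s with right false s ≤? right true s
    ... | yes _ = true
    ... | no  _ = false

    ≤-best : ∀ c s → right c s ≤ right (best s) s
    ≤-best c s with right false s ≤? right true s
    ≤-best true  s | yes _ = ≤-refl
    ≤-best false s | yes h = h
    ≤-best true  s | no ¬h = <⇒≤ (≰⇒> ¬h)
    ≤-best false s | no _  = ≤-refl

    last-round : ∑ ss (λ s → ∑ rs λ t → wt s t * ∑ ms (λ m → p s m * φ s t m * 𝟙 (z m Bool.≟ f s t)))
      ≤ F * ∑ ss (λ s → ∑ rs λ t → wt s t * 𝟙 (best s Bool.≟ f s t))
    last-round = ≤-trans (∑-mono ss per-input) (≤-reflexive (∑-*ˡ ss F))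
      where
      open ≤-Reasoning
      regroup : ∀ v p e → v * (p * e) ≡ p * (v * e)
      regroup = solve-∀
      per-input : ∀ s → ∑ rs (λ t → wt s t * ∑ ms (λ m → p s m * φ s t m * 𝟙 (z m Bool.≟ f s t)))
                        ≤ F * right (best s) s
      per-input s = begin
        ∑ rs (λ t → wt s t * ∑ ms (λ m → p s m * φ s t m * 𝟙 (z m Bool.≟ f s t)))
          ≤⟨ ∑-mono rs (λ t → *-monoʳ-≤ (wt s t) (∑-mono ms (λ m → *-monoˡ-≤ (𝟙 (z m Bool.≟ f s t))
               (≤-trans (*-monoʳ-≤ (p s m) (φ≤1 s t m)) (≤-reflexive (*-identityʳ (p s m))))))) ⟩
        ∑ rs (λ t → wt s t * ∑ ms (λ m → p s m * 𝟙 (z m Bool.≟ f s t)))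
          ≡⟨ trans (∑-cong rs λ t → sym (∑-*ˡ ms (wt s t))) (∑-swap rs ms _) ⟩
        ∑ ms (λ m → ∑ rs (λ t → wt s t * (p s m * 𝟙 (z m Bool.≟ f s t))))
          ≡⟨ ∑-cong ms (λ m → trans (∑-cong rs λ t → regroup (wt s t) (p s m) (𝟙 (z m Bool.≟ f s t)))
               (∑-*ˡ rs (p s m))) ⟩
        ∑ ms (λ m → p s m * right (z m) s)
          ≤⟨ ∑-mono ms (λ m → *-monoʳ-≤ (p s m) (≤-best (z m) s)) ⟩
        ∑ ms (λ m → p s m * right (best s) s) ≡⟨ ∑-*ʳ ms _ ⟩
        ∑ ms (p s) * right (best s) s         ≤⟨ *-monoˡ-≤ _ (∑p≤F s) ⟩
        F * right (best s) s                  ∎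

  module Protocols
    {X Y M : Set} (xs : List X) (ys : List Y) (ms : List M) (_≟M_ : DecidableEquality M) (m₀ : M)
    (f : X → Y → Bool) (z : M → Bool) (F : ℕ) (1≤F : 1 ≤ F) (k e : ℕ)
    (pA : ℕ → X → M → M → ℕ) (pB : ℕ → Y → M → M → ℕ)
    (pA≤F : ∀ i x τ m → pA i x τ m ≤ F) (∑pA≤F : ∀ i x τ → ∑ ms (pA i x τ) ≤ F)
    (pB≤F : ∀ i y τ m → pB i y τ m ≤ F) (∑pB≤F : ∀ i y τ → ∑ ms (pB i y τ) ≤ F)
    where

    K Q l : ℕ
    K = 2 ^ k
    Q = 2 ^ e
    l = k + e

    PTree : Player → ℕ → Set
    PTree = Tree (Inputs X Y) Bool

    correct : ∀ {p r} → (X → Y → ℕ) → PTree p r → ℕ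
    correct wt t = ∑ xs λ x → ∑ ys λ y → wt x y * 𝟙 (outcome t ⟨ x , y ⟩ Bool.≟ f x y)

    -- The probability, up to the factor F ^ s, that in the rounds from i on
    -- only messages are sent that the receiver finds at most K times less
    -- likely than the sender, and that the output is correct.
    win : ℕ → ℕ → Player → X → Y → M → ℕ
    win zero    i p     x y τ = 𝟙 (z τ Bool.≟ f x y)
    win (suc s) i alice x y τ = ∑ ms λ m →
      pA i x τ m * 𝟙 (pA i x τ m ≤? K * pB i y τ m) * win s (suc i) bob x y m
    win (suc s) i bob   x y τ = ∑ ms λ m →
      pB i y τ m * 𝟙 (pB i y τ m ≤? K * pA i x τ m) * win s (suc i) alice x y m

    -- `a` and `b` give what Alice and Bob take the transcript to be. After a failed hand-over these
    -- may differ, and such inputs are counted as lost.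
    ideal : ℕ → ℕ → Player → (X → M) → (Y → M) → (X → Y → ℕ) → ℕ
    ideal s i p a b wt = ∑ xs λ x → ∑ ys λ y → wt x y * 𝟙 (a x ≟M b y) * win s i p x y (a x)

    swap-sums : ∀ (g : X → Y → ℕ) → ∑ xs (λ x → ∑ ys (g x)) ≡ ∑ ys (λ y → ∑ xs λ x → g x y)
    swap-sums = ∑-swap xs ys

    1≤2^ : ∀ n → 1 ≤ 2 ^ n
    1≤2^ n = ≤-trans (≤-reflexive (sym (^-zeroˡ n))) (^-monoˡ-≤ n (s≤s z≤n))

    size : length (words l) ≡ K * Q
    size = trans (length-words l) (^-distribˡ-+-* 2 k e)

    guard : ∀ {A : Set} (d : Dec A) w {u v} → (A → u ≡ v) → w * 𝟙 d * u ≡ w * 𝟙 d * v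
    guard d w h = trans (*-assoc w (𝟙 d) _) (trans (cong (w *_) (𝟙-guard d h)) (sym (*-assoc w (𝟙 d) _)))

    flip-≟ : ∀ m m′ → 𝟙 (m ≟M m′) ≡ 𝟙 (m′ ≟M m)
    flip-≟ m m′ = 𝟙-cong (m ≟M m′) (m′ ≟M m) sym sym

    -- Of the `suc s` rounds, `s` are hand-overs, each costing `l` bits and a factor (1 + Q)/Q; the
    -- last is replaced by one bit. The power of `F` normalises the conditional probabilities.
    Simulation : ℕ → ℕ → (p : Player) → (X → M) → (Y → M) → (X → Y → ℕ) → Set
    Simulation s i p a b wt = Σ[ t ∈ PTree p (suc s) ] (∀ v → bits t v ≡ s * l + 1) ×
      Q ^ s * ideal (suc s) i p a b wt ≤ (1 + Q) ^ s * F ^ suc s * correct wt t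

    weaken : ∀ (wt : X → Y → ℕ) {A : X → Y → Set} (d : ∀ x y → Dec (A x y)) (g : X → Y → ℕ) →
      ∑ xs (λ x → ∑ ys λ y → wt x y * 𝟙 (d x y) * g x y) ≤ ∑ xs (λ x → ∑ ys λ y → wt x y * g x y)
    weaken wt d g = ∑-mono xs λ x → ∑-mono ys λ y → *-monoˡ-≤ (g x y)
      (≤-trans (*-monoʳ-≤ (wt x y) (𝟙≤1 (d x y))) (≤-reflexive (*-identityʳ (wt x y))))

    base : ∀ {I C} → I ≤ F * C → 1 * I ≤ 1 * (F * 1) * C
    base {I} {C} h = ≤-trans (≤-reflexive (*-identityˡ I)) (≤-trans h
      (≤-reflexive (cong (_* C) (sym (trans (*-identityˡ (F * 1)) (*-identityʳ F))))))

    factor : ∀ a b C → (1 + Q) * F * (a * b) * C ≡ (1 + Q) * a * (F * b) * C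
    factor a b C = shuffle (1 + Q) F a b C
      where
      shuffle : ∀ q f a b c → q * f * (a * b) * c ≡ q * a * (f * b) * c
      shuffle = solve-∀

    -- After a hand-over the recursion is entered once for each tag, with the weights restricted to
    -- the inputs that produce this tag and with `enc` and `dec` as the players' new transcripts.
    simulate : ∀ s i p a b wt → Simulation s i p a b wt
    simulate zero i alice a b wt = send best (λ c → finish (output c)) , (λ _ → refl) , base
      (≤-trans last-round (*-monoʳ-≤ F (weaken wt (λ x y → a x ≟M b y) (λ x y → 𝟙 (best x Bool.≟ f x y)))))
      where open LastRound xs ys ms F (λ x → pA i x (a x)) (λ x → ∑pA≤F i x (a x))
              (λ x y m → 𝟙 (pA i x (a x) m ≤? K * pB i y (a x) m)) (λ x y m → 𝟙≤1 (_ ≤? _))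
              (λ x y → wt x y * 𝟙 (a x ≟M b y)) z f
    simulate zero i bob a b wt = send best (λ c → finish (output c)) , (λ _ → refl) , base (begin
      ideal 1 i bob a b wt
        ≡⟨ trans (∑-cong xs λ x → ∑-cong ys λ y → guard (a x ≟M b y) (wt x y) λ eq →
             cong (win 1 i bob x y) eq) (swap-sums _) ⟩
      _ ≤⟨ last-round ⟩
      F * ∑ ys (λ y → ∑ xs λ x → wt x y * 𝟙 (a x ≟M b y) * 𝟙 (best y Bool.≟ f x y))
        ≡⟨ cong (F *_) (sym (swap-sums _)) ⟩
      _ ≤⟨ *-monoʳ-≤ F (weaken wt (λ x y → a x ≟M b y) (λ x y → 𝟙 (best y Bool.≟ f x y))) ⟩
      _ ∎)
      where
      open ≤-Reasoning
      open LastRound ys xs ms F (λ y → pB i y (b y)) (λ y → ∑pB≤F i y (b y))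
              (λ y x m → 𝟙 (pB i y (b y) m ≤? K * pA i x (b y) m)) (λ y x m → 𝟙≤1 (_ ≤? _))
              (λ y x → wt x y * 𝟙 (a x ≟M b y)) z (λ y x → f x y)
    simulate (suc s) i alice a b wt with Round.handOver xs ys ms (words l) _≟M_ (Vec.≡-dec Bool._≟_)
        (words-unique l) F K Q 1≤F size (*-mono-≤ (1≤2^ k) (1≤2^ e)) m₀ (replicate l false)
        (λ x → pA i x (a x)) (λ x → pA≤F i x (a x)) (λ x → ∑pA≤F i x (a x))
        (λ y → pB i y (b y)) (λ y → ∑pB≤F i y (b y))
        (λ x y → wt x y * 𝟙 (a x ≟M b y)) (win (suc s) (suc i) bob) ∈-words
    ... | enc , dec , won = tree , cost , (begin
      Q * Q ^ s * ideal (suc (suc s)) i alice a b wt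
        ≡⟨ cong (Q * Q ^ s *_) (∑-cong xs λ x → ∑-cong ys λ y → guard (a x ≟M b y) (wt x y) λ eq →
             ∑-cong ms λ m → cong (λ τ → pA i x (a x) m * 𝟙 (pA i x (a x) m ≤? K * pB i y τ m)
               * win (suc s) (suc i) bob x y m) eq) ⟩
      _
        ≤⟨ won (λ h x y → 𝟙 (outcome (sub h) ⟨ x , y ⟩ Bool.≟ f x y))
             (Q ^ s) ((1 + Q) ^ s * F ^ suc s) (λ h → proj₂ (proj₂ (rest h))) ⟩
      _ ≤⟨ *-monoʳ-≤ ((1 + Q) * F * ((1 + Q) ^ s * F ^ suc s)) (weaken wt (λ x y → a x ≟M b y) _) ⟩
      (1 + Q) * F * ((1 + Q) ^ s * F ^ suc s)
        * ∑ xs (λ x → ∑ ys λ y → wt x y * 𝟙 (outcome (sub (proj₂ (enc x))) ⟨ x , y ⟩ Bool.≟ f x y))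
        ≡⟨ trans (factor ((1 + Q) ^ s) (F ^ suc s) _)
             (cong ((1 + Q) ^ suc s * F ^ suc (suc s) *_) (∑-cong xs λ x → ∑-cong ys λ y →
               cong (λ o → wt x y * 𝟙 (o Bool.≟ f x y)) (sym (outcome-sendBits l _ _ ⟨ x , y ⟩)))) ⟩
      (1 + Q) ^ suc s * F ^ suc (suc s) * correct wt tree ∎)
      where
      open ≤-Reasoning
      tagged : Vec Bool l → X → Y → ℕ
      tagged h x y = wt x y * 𝟙 (a x ≟M b y) * 𝟙 (Vec.≡-dec Bool._≟_ (proj₂ (enc x)) h)
      rest : ∀ h → Simulation s (suc i) bob (λ x → proj₁ (enc x)) (λ y → dec y h) (tagged h)
      rest h = simulate s (suc i) bob (λ x → proj₁ (enc x)) (λ y → dec y h) (tagged h)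
      sub : ∀ h → PTree bob (suc s)
      sub h = proj₁ (rest h)
      tree : PTree alice (suc (suc s))
      tree = sendBits l (λ x → proj₂ (enc x)) (λ h → finish (sub h))
      cost : ∀ v → bits tree v ≡ suc s * l + 1
      cost v = trans (bits-sendBits l _ _ v) (trans (cong (l +_) (proj₁ (proj₂ (rest (proj₂ (enc (v alice))))) v)) (sym (+-assoc l _ 1)))
    simulate (suc s) i bob a b wt with Round.handOver ys xs ms (words l) _≟M_ (Vec.≡-dec Bool._≟_)
        (words-unique l) F K Q 1≤F size (*-mono-≤ (1≤2^ k) (1≤2^ e)) m₀ (replicate l false)
        (λ y → pB i y (b y)) (λ y → pB≤F i y (b y)) (λ y → ∑pB≤F i y (b y))
        (λ x → pA i x (a x)) (λ x → ∑pA≤F i x (a x))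
        (λ y x → wt x y * 𝟙 (a x ≟M b y)) (λ y x → win (suc s) (suc i) alice x y) ∈-words
    ... | enc , dec , won = tree , cost , (begin
      Q * Q ^ s * ideal (suc (suc s)) i bob a b wt
        ≡⟨ cong (Q * Q ^ s *_) (trans (∑-cong xs λ x → ∑-cong ys λ y → guard (a x ≟M b y) (wt x y) λ eq →
             ∑-cong ms λ m → cong₂ (λ τ τ′ → pB i y τ m * 𝟙 (pB i y τ m ≤? K * pA i x τ′ m)
               * win (suc s) (suc i) alice x y m) eq refl) (swap-sums _)) ⟩
      _
        ≤⟨ won (λ h y x → 𝟙 (outcome (sub h) ⟨ x , y ⟩ Bool.≟ f x y))
             (Q ^ s) ((1 + Q) ^ s * F ^ suc s) ih ⟩
      _ ≡⟨ cong ((1 + Q) * F * ((1 + Q) ^ s * F ^ suc s) *_) (sym (swap-sums _)) ⟩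
      _ ≤⟨ *-monoʳ-≤ ((1 + Q) * F * ((1 + Q) ^ s * F ^ suc s)) (weaken wt (λ x y → a x ≟M b y) _) ⟩
      (1 + Q) * F * ((1 + Q) ^ s * F ^ suc s)
        * ∑ xs (λ x → ∑ ys λ y → wt x y * 𝟙 (outcome (sub (proj₂ (enc y))) ⟨ x , y ⟩ Bool.≟ f x y))
        ≡⟨ trans (factor ((1 + Q) ^ s) (F ^ suc s) _)
             (cong ((1 + Q) ^ suc s * F ^ suc (suc s) *_) (∑-cong xs λ x → ∑-cong ys λ y →
               cong (λ o → wt x y * 𝟙 (o Bool.≟ f x y)) (sym (outcome-sendBits l _ _ ⟨ x , y ⟩)))) ⟩
      (1 + Q) ^ suc s * F ^ suc (suc s) * correct wt tree ∎)
      where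
      open ≤-Reasoning
      tagged : Vec Bool l → Y → X → ℕ
      tagged h y x = wt x y * 𝟙 (a x ≟M b y) * 𝟙 (Vec.≡-dec Bool._≟_ (proj₂ (enc y)) h)
      rest : ∀ h → Simulation s (suc i) alice (λ x → dec x h) (λ y → proj₁ (enc y))
                     (λ x y → tagged h y x)
      rest h = simulate s (suc i) alice (λ x → dec x h) (λ y → proj₁ (enc y))
        (λ x y → tagged h y x)
      sub : ∀ h → PTree alice (suc s)
      sub h = proj₁ (rest h)
      tree : PTree bob (suc (suc s))
      tree = sendBits l (λ y → proj₂ (enc y)) (λ h → finish (sub h))
      cost : ∀ v → bits tree v ≡ suc s * l + 1
      cost v = trans (bits-sendBits l _ _ v) (trans (cong (l +_) (proj₁ (proj₂ (rest (proj₂ (enc (v bob))))) v)) (sym (+-assoc l _ 1)))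
      -- The recursion sums over `x` outside and compares Alice's transcript with Bob's, whereas
      -- `Round` has the sender, here Bob, first in both places.
      ih : ∀ h → _
      ih h = subst₂ _≤_
        (cong (Q ^ s *_) (trans (∑-cong xs λ x → ∑-cong ys λ y →
          trans (guard (dec x h ≟M proj₁ (enc y)) (tagged h y x) λ eq →
                   cong (win (suc s) (suc i) alice x y) eq)
            (cong (λ g → tagged h y x * g * win (suc s) (suc i) alice x y (proj₁ (enc y)))
              (flip-≟ (dec x h) (proj₁ (enc y))))) (swap-sums _)))
        (cong ((1 + Q) ^ s * F ^ suc s *_) (swap-sums _))
        (proj₂ (proj₂ (rest h)))

-- A hard function forces divergence or informative messages in each copy.

module SingleCopy where

  open import Data.Bool.Base using (Bool)
  import Data.Bool.Properties as Bool
  open import Data.List.Base using (List)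
  open import Data.List.Membership.Propositional using (_∈_)
  open import Data.List.Relation.Unary.Unique.Propositional using (Unique)
  open import Data.Nat.Base
  open import Data.Nat.Properties hiding (_≟_)
  open import Data.Nat.Tactic.RingSolver using (solve-∀)
  open import Data.Product.Base using (∃-syntax; _,_; proj₁; proj₂)
  open import Data.Empty using (⊥; ⊥-elim)
  open import Relation.Binary.Definitions using (DecidableEquality)
  open import Relation.Binary.PropositionalEquality hiding (J)
  open import Relation.Nullary.Decidable.Core using (Dec; yes; no)
  open import Relation.Nullary.Negation.Core using (¬_)
  open Sums
  open AMGM
  open Entropy
  open Likelihood
  open Sampling
  open Simulation
  open import Defs using (Player; alice; bob; other; Tree; bits)

  -- Bernoulli's inequality (q/(1 + q))^s ≥ 1 - s/(1 + q), cleared of denominators. It measures the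
  -- loss in `s` hand-overs.
  bernoulli : ∀ q s → (1 + q) ^ s * (1 + q) ≤ q ^ s * (1 + q) + s * (1 + q) ^ s
  bernoulli q zero    = ≤-reflexive (sym (+-identityʳ _))
  bernoulli q (suc s) = begin
    (1 + q) * b * (1 + q)                     ≡⟨ split q b ⟩
    b * (1 + q) + q * (b * (1 + q))           ≤⟨ +-monoʳ-≤ (b * (1 + q)) (*-monoʳ-≤ q (bernoulli q s)) ⟩
    b * (1 + q) + q * (a * (1 + q) + s * b)   ≤⟨ m≤m+n _ (s * b) ⟩
    b * (1 + q) + q * (a * (1 + q) + s * b) + s * b ≡⟨ collect q a b s ⟩
    q * a * (1 + q) + suc s * ((1 + q) * b)   ∎
    where
    open ≤-Reasoning
    a = q ^ s
    b = (1 + q) ^ s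
    split : ∀ q b → (1 + q) * b * (1 + q) ≡ b * (1 + q) + q * (b * (1 + q))
    split = solve-∀
    collect : ∀ q a b s → b * (1 + q) + q * (a * (1 + q) + s * b) + s * b
              ≡ q * a * (1 + q) + suc s * ((1 + q) * b)
    collect = solve-∀

  -- (16 / 15) ^ 64 ≥ 32.
  power-slack : ∀ d u → 64 * u ≤ d → 15 ^ d * 32 ^ u ≤ 16 ^ d
  power-slack d u 64u≤d with m≤n⇒∃[o]m+o≡n 64u≤d
  ... | o , refl = begin
    15 ^ (64 * u + o) * 32 ^ u
      ≡⟨ cong (_* 32 ^ u) (^-distribˡ-+-* 15 (64 * u) o) ⟩
    15 ^ (64 * u) * 15 ^ o * 32 ^ u
      ≡⟨ cong (λ x → x * 15 ^ o * 32 ^ u) (sym (^-*-assoc 15 64 u)) ⟩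
    (15 ^ 64) ^ u * 15 ^ o * 32 ^ u
      ≡⟨ swap ((15 ^ 64) ^ u) (15 ^ o) (32 ^ u) ⟩
    (15 ^ 64) ^ u * 32 ^ u * 15 ^ o
      ≡⟨ cong (_* 15 ^ o) (sym (^-distribʳ-* (15 ^ 64) 32 u)) ⟩
    (15 ^ 64 * 32) ^ u * 15 ^ o
      ≤⟨ *-mono-≤ (^-monoˡ-≤ u (≤ᵇ⇒≤ (15 ^ 64 * 32) (16 ^ 64) _)) (^-monoˡ-≤ o (n≤1+n 15)) ⟩
    (16 ^ 64) ^ u * 16 ^ o
      ≡⟨ cong (_* 16 ^ o) (^-*-assoc 16 64 u) ⟩
    16 ^ (64 * u) * 16 ^ o
      ≡⟨ sym (^-distribˡ-+-* 16 (64 * u) o) ⟩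
    16 ^ (64 * u + o) ∎
    where
    open ≤-Reasoning
    swap : ∀ a b c → a * b * c ≡ a * c * b
    swap = solve-∀

  -- G/p ≤ (b/q) C ≤ (t/v)(h/u) S ≤ (n/t) S. Only the last inequality concerns the constants; it is
  -- decided by evaluation where the lemma is applied.
  combine-ratios : ∀ t u v h n {q b p G C S} .{{_ : NonZero (u * v)}} .{{_ : NonZero q}} →
    q * G ≤ b * p * C → v * b ≤ t * q → u * C ≤ h * S → t * t * h ≤ u * v * n → t * G ≤ n * S * p
  combine-ratios t u v h n {q} {b} {p} {G} {C} {S} qG vb uC num = *-cancelˡ-≤ (u * v * q) {{m*n≢0 (u * v) q}} (begin
    u * v * q * (t * G)             ≡⟨ shuffle₁ t u v q G ⟩
    t * v * u * (q * G)             ≤⟨ *-monoʳ-≤ (t * v * u) qG ⟩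
    t * v * u * (b * p * C)         ≡⟨ shuffle₂ t u v b p C ⟩
    t * (v * b * (p * (u * C)))     ≤⟨ *-monoʳ-≤ t (*-mono-≤ vb (*-monoʳ-≤ p uC)) ⟩
    t * (t * q * (p * (h * S)))     ≡⟨ shuffle₃ t h q p S ⟩
    t * t * h * (q * (S * p))       ≤⟨ *-monoˡ-≤ (q * (S * p)) num ⟩
    u * v * n * (q * (S * p))       ≡⟨ shuffle₄ u v n q S p ⟩
    u * v * q * (n * S * p)         ∎)
    where
    open ≤-Reasoning
    shuffle₁ : ∀ t u v q g → u * v * q * (t * g) ≡ t * v * u * (q * g)
    shuffle₁ = solve-∀
    shuffle₂ : ∀ t u v b p c → t * v * u * (b * p * c) ≡ t * (v * b * (p * (u * c)))
    shuffle₂ = solve-∀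
    shuffle₃ : ∀ t h q p c → t * (t * q * (p * (h * c))) ≡ t * t * h * (q * (c * p))
    shuffle₃ = solve-∀
    shuffle₄ : ∀ u v n q c p → u * v * n * (q * (c * p)) ≡ u * v * q * (n * c * p)
    shuffle₄ = solve-∀

  power-ratio : ∀ q s → 64 * s ≤ q → 63 * (1 + q) ^ s ≤ 64 * q ^ s
  power-ratio q s 64s≤q = *-cancelʳ-≤ _ _ (1 + q) (+-cancelʳ-≤ ((1 + q) * b) _ _ (begin
    63 * b * (1 + q) + (1 + q) * b    ≡⟨ merge b q ⟩
    64 * (b * (1 + q))                ≤⟨ *-monoʳ-≤ 64 (bernoulli q s) ⟩
    64 * (a * (1 + q) + s * b)        ≡⟨ expand a b q s ⟩
    64 * a * (1 + q) + 64 * s * b     ≤⟨ +-monoʳ-≤ _ (*-monoˡ-≤ b (m≤n⇒m≤1+n 64s≤q)) ⟩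
    64 * a * (1 + q) + (1 + q) * b    ∎))
    where
    open ≤-Reasoning
    a = q ^ s
    b = (1 + q) ^ s
    merge : ∀ b q → 63 * b * (1 + q) + (1 + q) * b ≡ 64 * (b * (1 + q))
    merge = solve-∀
    expand : ∀ a b q s → 64 * (a * (1 + q) + s * b) ≡ 64 * a * (1 + q) + 64 * s * b
    expand = solve-∀

  -- The induction step of `exception`. If the test `d` fails, one of `u` and `i` is positive and
  -- supplies a factor 32, and 3 times 32 is at least 64.
  exceptional : ∀ {P : Set} (d : Dec P) x u v i j → (¬ P → u ≡ 0 → i ≡ 0 → ⊥) →
    64 ≤ (64 * x + 3) * 32 ^ (v + j) → 64 ≤ (64 * (𝟙 d * x) + 3) * 32 ^ (u + v + (i + j))
  exceptional (yes _) x u v i j _ h = ≤-trans h (*-mono-≤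
    (≤-reflexive (cong (λ y → 64 * y + 3) (sym (*-identityˡ x))))
    (^-monoʳ-≤ 32 (+-mono-≤ (m≤n+m v u) (m≤n+m j i))))
  exceptional (no ¬p) x u v i j h _ = large (u + v + (i + j))
    (≤-trans (positive u i (h ¬p)) (+-mono-≤ (m≤m+n u v) (m≤m+n i j)))
    where
    large : ∀ n → 1 ≤ n → 64 ≤ 3 * 32 ^ n
    large n 1≤n = ≤-trans (m≤m+n 64 32) (*-monoʳ-≤ 3 (^-monoʳ-≤ 32 {1} {n} 1≤n))
    positive : ∀ u i → (u ≡ 0 → i ≡ 0 → ⊥) → 1 ≤ u + i
    positive zero    zero    h = ⊥-elim (h refl refl)
    positive zero    (suc i) h = s≤s z≤n
    positive (suc u) i       h = s≤s z≤n

  -- A random input (A , B) together with a transcript that becomes longer from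
  -- T i to T (suc i), distributed according to w. The round sent by p at time i
  -- extends T i to T (suc i).
  module System
    {Ω X Y M : Set} (ωs : List Ω) (complete : ∀ ω → ω ∈ ωs) (w : Ω → ℕ)
    (_≟X_ : DecidableEquality X) (_≟Y_ : DecidableEquality Y) (_≟M_ : DecidableEquality M)
    (xs : List X) (ys : List Y) (A : Ω → X) (B : Ω → Y) (A∈ : ∀ ω → A ω ∈ xs) (B∈ : ∀ ω → B ω ∈ ys)
    (t : ℕ → Ω → M) (m₀ : M) (t₀ : ∀ ω → t 0 ω ≡ m₀)
    (extends : ∀ i ω ω′ → t (suc i) ω ≡ t (suc i) ω′ → t i ω ≡ t i ω′)
    (s : ℕ) (ms : List M) (ms-unique : Unique ms) (t∈ : ∀ i ω → i ≤ suc s → t i ω ∈ ms)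
    where

    open Weighted ωs complete w

    α : Player → RV Ω
    α alice = record { at = A ; _≟_ = _≟X_ }
    α bob   = record { at = B ; _≟_ = _≟Y_ }

    T : ℕ → RV Ω
    T i = record { at = t i ; _≟_ = _≟M_ }

    AB : ℕ → RV Ω
    AB i = α alice ⊗ α bob ⊗ T i

    -- F times the conditional probability of the message m after τ, given a.
    cond : (κ : RV Ω) → ℕ → Label κ → M → M → ℕ
    cond κ i a τ m = 𝔼 (λ ω → 𝟙 (RV._≟_ (κ ⊗ T i ⊗ T (suc i)) (at κ ω , t i ω , t (suc i) ω) (a , τ , m)))
      * inv (𝔼 (λ ω → 𝟙 (RV._≟_ (κ ⊗ T i) (at κ ω , t i ω) (a , τ))))

    ∑-cond : ∀ κ i a τ → ∑ ms (cond κ i a τ) ≤ F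
    ∑-cond κ i a τ = begin
      ∑ ms (cond κ i a τ)    ≡⟨ trans (∑-*ʳ ms (inv c)) (cong (_* inv c) (sym (𝔼-∑ ms _))) ⟩
      𝔼 (λ ω → ∑ ms λ m → 𝟙 (RV._≟_ (κ ⊗ T i ⊗ T (suc i)) (at κ ω , t i ω , t (suc i) ω) (a , τ , m))) * inv c
                             ≤⟨ *-monoˡ-≤ (inv c) (𝔼-≤ pointwise) ⟩
      c * inv c              ≤⟨ *-inv-≤ c ⟩
      F                      ∎
      where
      open ≤-Reasoning
      c = 𝔼 (λ ω → 𝟙 (RV._≟_ (κ ⊗ T i) (at κ ω , t i ω) (a , τ)))
      split : ∀ ω m → 𝟙 (RV._≟_ (κ ⊗ T i ⊗ T (suc i)) (at κ ω , t i ω , t (suc i) ω) (a , τ , m))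
        ≤ 𝟙 (t (suc i) ω ≟M m) * 𝟙 (RV._≟_ (κ ⊗ T i) (at κ ω , t i ω) (a , τ))
      split ω m with RV._≟_ (κ ⊗ T i ⊗ T (suc i)) (at κ ω , t i ω , t (suc i) ω) (a , τ , m)
      ... | no _  = z≤n
      ... | yes e = ≤-reflexive (sym (cong₂ _*_ (𝟙-yes (t (suc i) ω ≟M m) (cong (λ x → proj₂ (proj₂ x)) e))
        (𝟙-yes (RV._≟_ (κ ⊗ T i) (at κ ω , t i ω) (a , τ)) (cong₂ _,_ (cong proj₁ e) (cong (λ x → proj₁ (proj₂ x)) e)))))
      pointwise : ∀ ω → ∑ ms (λ m → 𝟙 (RV._≟_ (κ ⊗ T i ⊗ T (suc i)) (at κ ω , t i ω , t (suc i) ω) (a , τ , m)))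
        ≤ 𝟙 (RV._≟_ (κ ⊗ T i) (at κ ω , t i ω) (a , τ))
      pointwise ω = ≤-trans (∑-mono ms (split ω)) (∑-unique-≤ _≟M_ _ (t (suc i) ω) ms-unique)

    cond≤F : ∀ κ i a τ m → cond κ i a τ m ≤ F
    cond≤F κ i a τ m = ≤-trans (*-monoˡ-≤ (inv c) (𝔼-≤ λ ω →
        𝟙-mono (RV._≟_ (κ ⊗ T i ⊗ T (suc i)) _ _) (RV._≟_ (κ ⊗ T i) _ _)
          (λ e → cong₂ _,_ (cong proj₁ e) (cong (λ x → proj₁ (proj₂ x)) e)))) (*-inv-≤ c)
      where
      c = 𝔼 (λ ω → 𝟙 (RV._≟_ (κ ⊗ T i) (at κ ω , t i ω) (a , τ)))

    step : RV Ω → ℕ → Ω → ℕ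
    step κ i ω = cond κ i (at κ ω) (t i ω) (t (suc i) ω)

    step-≡ : ∀ κ i ω → step κ i ω ≡ cl (κ ⊗ T (suc i)) ω * inv (cl (κ ⊗ T i) ω)
    step-≡ κ i ω = cong (_* inv (cl (κ ⊗ T i) ω)) (cl-cong (κ ⊗ T i ⊗ T (suc i)) (κ ⊗ T (suc i))
      (λ ω ω′ e → cong₂ _,_ (cong proj₁ e) (cong (λ x → proj₂ (proj₂ x)) e))
      (λ ω ω′ e → cong₂ _,_ (cong proj₁ e) (cong₂ _,_ (extends i ω ω′ (cong proj₂ e)) (cong proj₂ e))) ω)

    -- The chain rule: the average logarithm of the conditional probability of the next transcript
    -- is a difference of two entropies.
    𝔾-step : ∀ κ i → 𝔾 (step κ i) * J (κ ⊗ T i) ≡ J (κ ⊗ T (suc i)) * F ^ D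
    𝔾-step κ i = trans (sym (𝔾-* (step κ i) (cl (κ ⊗ T i)))) (trans (𝔾-cong (λ ω 1≤w →
        trans (cong (_* cl (κ ⊗ T i) ω) (step-≡ κ i ω))
          (trans (assoc (cl (κ ⊗ T (suc i)) ω) _ (cl (κ ⊗ T i) ω))
            (cong (cl (κ ⊗ T (suc i)) ω *_) (cl-inv (κ ⊗ T i) ω 1≤w)))))
      (trans (𝔾-* (cl (κ ⊗ T (suc i))) (λ _ → F)) (cong (J (κ ⊗ T (suc i)) *_) (𝔾-const F))))
      where
      assoc : ∀ a b c → a * b * c ≡ a * (c * b)
      assoc = solve-∀

    -- For a kernel `q`, `walk` is the mass of all continuations of a transcript, weighted by `g` at
    -- the end; `along` is the factor that the actual continuation at `ω` contributes.
    module Walk (q : ℕ → Player → X → Y → M → M → ℕ) (g : X → Y → M → ℕ) where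

      walk : ℕ → ℕ → Player → X → Y → M → ℕ
      walk zero    i p x y τ = g x y τ
      walk (suc k) i p x y τ = ∑ ms λ m → q i p x y τ m * walk k (suc i) (other p) x y m

      along : ℕ → ℕ → Player → Ω → ℕ
      along zero    i p ω = 1
      along (suc k) i p ω = q i p (A ω) (B ω) (t i ω) (t (suc i) ω) * along k (suc i) (other p) ω

      private
        _≟_ : ∀ {i} → DecidableEquality (Label (AB i))
        _≟_ {i} = RV._≟_ (AB i)

      -- A change of measure: dividing by the actual weight of inputs and final transcript turns the
      -- expectation into a sum over transcripts. Only those that occur are counted, so the sum is
      -- at most the full `walk`.
      along-≤ : ∀ k i p → k + i ≡ suc s → ∀ x y τ →
        𝔼 (λ ω → 𝟙 (_≟_ {i} (A ω , B ω , t i ω) (x , y , τ)) *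
            (along k i p ω * g (A ω) (B ω) (t (suc s) ω) * inv (cl (AB (suc s)) ω)))
          ≤ walk k i p x y τ * F
      along-≤ zero i p refl x y τ = begin
        𝔼 (λ ω → 𝟙 (_≟_ {i} (A ω , B ω , t i ω) (x , y , τ)) * (1 * g (A ω) (B ω) (t i ω) * inv (cl (AB i) ω)))
          ≡⟨ 𝔼-cong (λ ω → trans (𝟙-guard (_≟_ {i} (A ω , B ω , t i ω) (x , y , τ)) λ e →
               cong (λ (x , y , τ) → 1 * g x y τ * inv (cl (AB i) ω)) e)
               (regroup (𝟙 (_≟_ {i} (A ω , B ω , t i ω) (x , y , τ))) (g x y τ) (inv (cl (AB i) ω)))) ⟩
        𝔼 (λ ω → g x y τ * (𝟙 (_≟_ {i} (A ω , B ω , t i ω) (x , y , τ)) * inv (cl (AB i) ω)))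
          ≡⟨ 𝔼-*ˡ (g x y τ) ⟩
        g x y τ * 𝔼 (λ ω → 𝟙 (_≟_ {i} (A ω , B ω , t i ω) (x , y , τ)) * inv (cl (AB i) ω))
          ≤⟨ *-monoʳ-≤ (g x y τ) (fibre (AB i) (x , y , τ)) ⟩
        g x y τ * F ∎
        where
        open ≤-Reasoning
        regroup : ∀ e g i → e * (1 * g * i) ≡ g * (e * i)
        regroup = solve-∀
      along-≤ (suc k) i p k+i x y τ = begin
        𝔼 (λ ω → 𝟙 (_≟_ {i} (A ω , B ω , t i ω) (x , y , τ)) * (along (suc k) i p ω * e ω * v ω))
          ≤⟨ 𝔼-≤ pointwise ⟩
        𝔼 (λ ω → ∑ ms λ m → q i p x y τ m * f m ω)
          ≡⟨ trans (𝔼-∑ ms _) (∑-cong ms λ m → 𝔼-*ˡ (q i p x y τ m)) ⟩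
        ∑ ms (λ m → q i p x y τ m * 𝔼 (f m))
          ≤⟨ ∑-mono ms (λ m → ≤-trans (*-monoʳ-≤ (q i p x y τ m)
               (along-≤ k (suc i) (other p) (trans (+-suc k i) k+i) x y m))
               (≤-reflexive (sym (*-assoc (q i p x y τ m) _ F)))) ⟩
        ∑ ms (λ m → q i p x y τ m * walk k (suc i) (other p) x y m * F)
          ≡⟨ ∑-*ʳ ms F ⟩
        walk (suc k) i p x y τ * F ∎
        where
        open ≤-Reasoning
        e = λ ω → g (A ω) (B ω) (t (suc s) ω)
        v = λ ω → inv (cl (AB (suc s)) ω)
        f : M → Ω → ℕ
        f m ω = 𝟙 (_≟_ {suc i} (A ω , B ω , t (suc i) ω) (x , y , m)) * (along k (suc i) (other p) ω * e ω * v ω)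
        i<s : suc i ≤ suc s
        i<s = ≤-trans (m≤n+m (suc i) k) (≤-reflexive (trans (+-suc k i) k+i))
        pointwise : ∀ ω → 𝟙 (_≟_ {i} (A ω , B ω , t i ω) (x , y , τ)) * (along (suc k) i p ω * e ω * v ω)
          ≤ ∑ ms (λ m → q i p x y τ m * f m ω)
        pointwise ω with _≟_ {i} (A ω , B ω , t i ω) (x , y , τ)
        ... | no _ = z≤n
        ... | yes refl = ≤-trans (≤-reflexive (trans (regroup (q i p x y τ (t (suc i) ω)) _ (e ω) (v ω))
                (cong (λ b → q i p x y τ (t (suc i) ω) * (b * (along k (suc i) (other p) ω * e ω * v ω)))
                  (sym (𝟙-yes (_≟_ {suc i} (x , y , t (suc i) ω) (x , y , t (suc i) ω)) refl)))))
              (∑-∈ (λ m → q i p x y τ m * f m ω) (t∈ (suc i) ω i<s))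
          where
          regroup : ∀ q r e v → 1 * (q * r * e * v) ≡ q * (1 * (r * e * v))
          regroup = solve-∀

      module _ (μ : X → Y → ℕ) where

        -- The same change of measure from the start, where the inputs have mass `μ` in the ideal
        -- process instead of their actual law.
        expectation-≤ : 𝔼 (λ ω → μ (A ω) (B ω) *
            (along (suc s) 0 alice ω * g (A ω) (B ω) (t (suc s) ω) * inv (cl (AB (suc s)) ω)))
          ≤ ∑ xs (λ x → ∑ ys λ y → μ x y * walk (suc s) 0 alice x y m₀) * F
        expectation-≤ = begin
          𝔼 (λ ω → μ (A ω) (B ω) * h ω)
            ≤⟨ 𝔼-≤ pointwise ⟩
          𝔼 (λ ω → ∑ xs λ x → ∑ ys λ y → μ x y * (𝟙 (_≟_ {0} (A ω , B ω , t 0 ω) (x , y , m₀)) * h ω))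
            ≡⟨ trans (𝔼-∑ xs _) (∑-cong xs λ x → trans (𝔼-∑ ys _) (∑-cong ys λ y → 𝔼-*ˡ (μ x y))) ⟩
          ∑ xs (λ x → ∑ ys λ y → μ x y * 𝔼 (λ ω → 𝟙 (_≟_ {0} (A ω , B ω , t 0 ω) (x , y , m₀)) * h ω))
            ≤⟨ ∑-mono xs (λ x → ∑-mono ys λ y → ≤-trans
                 (*-monoʳ-≤ (μ x y) (along-≤ (suc s) 0 alice (+-identityʳ (suc s)) x y m₀))
                 (≤-reflexive (sym (*-assoc (μ x y) _ F)))) ⟩
          ∑ xs (λ x → ∑ ys λ y → μ x y * walk (suc s) 0 alice x y m₀ * F)
            ≡⟨ trans (∑-cong xs λ x → ∑-*ʳ ys F) (∑-*ʳ xs F) ⟩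
          ∑ xs (λ x → ∑ ys λ y → μ x y * walk (suc s) 0 alice x y m₀) * F ∎
          where
          open ≤-Reasoning
          h = λ ω → along (suc s) 0 alice ω * g (A ω) (B ω) (t (suc s) ω) * inv (cl (AB (suc s)) ω)
          pointwise : ∀ ω → μ (A ω) (B ω) * h ω ≤
            ∑ xs (λ x → ∑ ys λ y → μ x y * (𝟙 (_≟_ {0} (A ω , B ω , t 0 ω) (x , y , m₀)) * h ω))
          pointwise ω = ≤-trans (≤-trans (≤-reflexive (cong (μ (A ω) (B ω) *_) (sym (trans
              (cong (_* h ω) (𝟙-yes (_≟_ {0} (A ω , B ω , t 0 ω) (A ω , B ω , m₀))
                (cong (λ τ → A ω , B ω , τ) (t₀ ω)))) (*-identityˡ (h ω))))))
            (∑-∈ (λ y → μ (A ω) y * (𝟙 (_≟_ {0} (A ω , B ω , t 0 ω) (A ω , y , m₀)) * h ω)) (B∈ ω)))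
            (∑-∈ (λ x → ∑ ys λ y → μ x y * (𝟙 (_≟_ {0} (A ω , B ω , t 0 ω) (x , y , m₀)) * h ω)) (A∈ ω))

    -- The products over the rounds from i on of J(α ⊗ T), where α is the input
    -- of the sender (σ) or of the receiver (ρ), before and after the round.
    module Rounds where

      σ⁻ σ⁺ ρ⁻ ρ⁺ : ℕ → ℕ → Player → ℕ
      σ⁻ zero    i p = 1
      σ⁻ (suc k) i p = J (α p ⊗ T i) * σ⁻ k (suc i) (other p)
      σ⁺ zero    i p = 1
      σ⁺ (suc k) i p = J (α p ⊗ T (suc i)) * σ⁺ k (suc i) (other p)
      ρ⁻ zero    i p = 1
      ρ⁻ (suc k) i p = J (α (other p) ⊗ T i) * ρ⁻ k (suc i) (other p)
      ρ⁺ zero    i p = 1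
      ρ⁺ (suc k) i p = J (α (other p) ⊗ T (suc i)) * ρ⁺ k (suc i) (other p)

      likelihood : ℕ → ℕ → Player → Ω → ℕ
      likelihood zero    i p ω = 1
      likelihood (suc k) i p ω = step (α p) i ω * likelihood k (suc i) (other p) ω

      𝔾-likelihood : ∀ k i p → 𝔾 (likelihood k i p) * σ⁻ k i p ≡ σ⁺ k i p * (F ^ k) ^ D
      𝔾-likelihood zero    i p = trans (*-identityʳ _) (trans (𝔾-const 1) (sym (*-identityˡ (1 ^ D))))
      𝔾-likelihood (suc k) i p = begin
        𝔾 (likelihood (suc k) i p) * (J (α p ⊗ T i) * σ⁻ k (suc i) (other p))
          ≡⟨ cong (_* (J (α p ⊗ T i) * σ⁻ k (suc i) (other p))) (𝔾-* (step (α p) i) _) ⟩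
        𝔾 (step (α p) i) * 𝔾 (likelihood k (suc i) (other p)) * (J (α p ⊗ T i) * σ⁻ k (suc i) (other p))
          ≡⟨ shuffle (𝔾 (step (α p) i)) _ (J (α p ⊗ T i)) _ ⟩
        𝔾 (step (α p) i) * J (α p ⊗ T i) * (𝔾 (likelihood k (suc i) (other p)) * σ⁻ k (suc i) (other p))
          ≡⟨ cong₂ _*_ (𝔾-step (α p) i) (𝔾-likelihood k (suc i) (other p)) ⟩
        J (α p ⊗ T (suc i)) * F ^ D * (σ⁺ k (suc i) (other p) * (F ^ k) ^ D)
          ≡⟨ trans (shuffle (J (α p ⊗ T (suc i))) (F ^ D) _ _)
               (cong (σ⁺ (suc k) i p *_) (sym (^-distribʳ-* F (F ^ k) D))) ⟩
        σ⁺ (suc k) i p * (F ^ suc k) ^ D ∎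
        where
        open ≡-Reasoning
        shuffle : ∀ a b c d → a * b * (c * d) ≡ a * c * (b * d)
        shuffle = solve-∀

      module Exceptions (k₀ e : ℕ) where

        module _ (p : Player) (i : ℕ) where
          unlikely = LikelihoodRatios.Step.unlikely ωs complete w (α p) (α (other p)) (T i) (T (suc i)) (extends i)
          informative = LikelihoodRatios.Step.informative ωs complete w (α p) (α (other p)) (T i) (T (suc i)) (extends i)
          unlikely-weight = LikelihoodRatios.Step.unlikely-weight ωs complete w (α p) (α (other p)) (T i) (T (suc i)) (extends i)
          informative-cost = LikelihoodRatios.Step.informative-cost ωs complete w (α p) (α (other p)) (T i) (T (suc i)) (extends i)
          typical = LikelihoodRatios.Step.typical ωs complete w (α p) (α (other p)) (T i) (T (suc i)) (extends i)

        unlikelies informatives : ℕ → ℕ → Player → Ω → ℕ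
        unlikelies zero    i p ω = 0
        unlikelies (suc k) i p ω = unlikely p i e ω + unlikelies k (suc i) (other p) ω
        informatives zero    i p ω = 0
        informatives (suc k) i p ω = informative p i (2 + k₀) ω + informatives k (suc i) (other p) ω

        K : ℕ
        K = 2 ^ (2 + k₀ + e)

        unexceptional : ℕ → ℕ → Player → Ω → ℕ
        unexceptional zero    i p ω = 1
        unexceptional (suc k) i p ω =
          𝟙 (step (α p) i ω ≤? K * step (α (other p)) i ω) * unexceptional k (suc i) (other p) ω

        unlikelies-weight : ∀ k i p → 2 ^ e * 𝔼 (unlikelies k i p) ≤ k * D
        unlikelies-weight zero    i p = ≤-reflexive (trans (cong (2 ^ e *_) (trans (𝔼-const 0) (*-zeroʳ D))) (*-zeroʳ (2 ^ e)))
        unlikelies-weight (suc k) i p = ≤-trans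
          (≤-reflexive (trans (cong (2 ^ e *_) 𝔼-+) (*-distribˡ-+ (2 ^ e) _ _)))
          (+-mono-≤ (unlikely-weight p i e) (unlikelies-weight k (suc i) (other p)))

        -- Stated pointwise so that it survives the geometric mean, which a vanishing indicator
        -- would not. A transcript without exceptions gives 67, one with an exception at least 3
        -- times 32.
        exception : ∀ k i p ω → 1 ≤ w ω →
          64 ≤ (64 * unexceptional k i p ω + 3) * 32 ^ (unlikelies k i p ω + informatives k i p ω)
        exception zero    i p ω 1≤w = m≤m+n 64 3
        exception (suc k) i p ω 1≤w = exceptional (step (α p) i ω ≤? K * step (α (other p)) i ω)
          (unexceptional k (suc i) (other p) ω) (unlikely p i e ω) (unlikelies k (suc i) (other p) ω)
          (informative p i (2 + k₀) ω) (informatives k (suc i) (other p) ω)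
          (λ ≰ u≡0 i≡0 → ≰ (subst₂ (λ a b → a ≤ K * b) (sym (step-≡ (α p) i ω)) (sym (step-≡ (α (other p)) i ω))
            (typical p i (2 + k₀) e ω 1≤w u≡0 i≡0)))
          (exception k (suc i) (other p) ω 1≤w)

        joint-flip : ∀ p i → J (α p ⊗ α (other p) ⊗ T i) ≡ J (AB i)
        joint-flip alice i = refl
        joint-flip bob   i = J-cong (α bob ⊗ α alice ⊗ T i) (AB i) (flip (α bob) (α alice)) (flip (α alice) (α bob))
          where
          flip : ∀ κ κ′ → (κ ⊗ κ′ ⊗ T i) ⟶ (κ′ ⊗ κ ⊗ T i)
          flip κ κ′ ω ω′ e = cong₂ _,_ (cong (λ x → proj₁ (proj₂ x)) e) (cong₂ _,_ (cong proj₁ e) (cong (λ x → proj₂ (proj₂ x)) e))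

        -- `informative-cost` summed over the rounds. The joint terms `J (AB i)` telescope, while
        -- those with the receiver's input alone are collected in `ρ⁻` and `ρ⁺`.
        informatives-cost : ∀ k i p →
          J (AB i) * ρ⁺ k i p * 2 ^ (k₀ * 𝔼 (informatives k i p)) ≤ J (AB (k + i)) * ρ⁻ k i p
        informatives-cost zero i p = ≤-reflexive (trans (cong (λ x → J (AB i) * 1 * 2 ^ x)
          (trans (cong (k₀ *_) (trans (𝔼-const 0) (*-zeroʳ D))) (*-zeroʳ k₀))) (*-identityʳ (J (AB i) * 1)))
        informatives-cost (suc k) i p = *-cancelʳ-≤ _ _ (J (AB (suc i))) {{J≢0 (AB (suc i))}} (begin
          J (AB i) * (r⁺ * ρ⁺ k (suc i) q) * 2 ^ (k₀ * 𝔼 (informatives (suc k) i p)) * J (AB (suc i))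
            ≡⟨ cong (λ x → J (AB i) * (r⁺ * ρ⁺ k (suc i) q) * x * J (AB (suc i))) (trans
                 (cong (2 ^_) (trans (cong (k₀ *_) 𝔼-+) (*-distribˡ-+ k₀ _ _)))
                 (^-distribˡ-+-* 2 (k₀ * 𝔼 (informative p i (2 + k₀))) _)) ⟩
          J (AB i) * (r⁺ * ρ⁺ k (suc i) q) * (x * y) * J (AB (suc i))
            ≡⟨ shuffle₁ (J (AB i)) r⁺ (ρ⁺ k (suc i) q) x y (J (AB (suc i))) ⟩
          J (AB i) * r⁺ * x * (J (AB (suc i)) * ρ⁺ k (suc i) q * y)
            ≤⟨ *-mono-≤ (subst₂ (λ a b → a * r⁺ * x ≤ b * r⁻) (joint-flip p i) (joint-flip p (suc i))
                 (informative-cost p i k₀)) (informatives-cost k (suc i) q) ⟩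
          J (AB (suc i)) * r⁻ * (J (AB (k + suc i)) * ρ⁻ k (suc i) q)
            ≡⟨ trans (cong (λ l → J (AB (suc i)) * r⁻ * (J (AB l) * ρ⁻ k (suc i) q)) (+-suc k i))
                 (shuffle₂ (J (AB (suc i))) r⁻ (J (AB (suc k + i))) (ρ⁻ k (suc i) q)) ⟩
          J (AB (suc k + i)) * (r⁻ * ρ⁻ k (suc i) q) * J (AB (suc i)) ∎)
          where
          open ≤-Reasoning
          q = other p
          r⁺ = J (α q ⊗ T (suc i))
          r⁻ = J (α q ⊗ T i)
          x = 2 ^ (k₀ * 𝔼 (informative p i (2 + k₀)))
          y = 2 ^ (k₀ * 𝔼 (informatives k (suc i) q))
          shuffle₁ : ∀ a r p x y b → a * (r * p) * (x * y) * b ≡ a * r * x * (b * p * y)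
          shuffle₁ = solve-∀
          shuffle₂ : ∀ b r a p → b * r * (a * p) ≡ a * (r * p) * b
          shuffle₂ = solve-∀

    module Hard
      (μ : X → Y → ℕ) (f : X → Y → Bool) (z : M → Bool) (k₀ e : ℕ) (e-large : 64 * suc s ≤ 2 ^ e)
      (sound : ∀ ω → 1 ≤ w ω → z (t (suc s) ω) ≡ f (A ω) (B ω))
      where

      open Rounds
      open Exceptions k₀ e public

      open Protocols xs ys ms _≟M_ m₀ f z F (>-nonZero⁻¹ F) (2 + k₀ + e) e
        (cond (α alice)) (cond (α bob)) (cond≤F (α alice)) (∑-cond (α alice)) (cond≤F (α bob)) (∑-cond (α bob))
        public using (correct; Q; simulate; win; ideal)

      S : ℕ
      S = ∑ xs λ x → ∑ ys λ y → μ x y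

      private
        *-interchange : ∀ a b c d → a * b * (c * d) ≡ a * c * (b * d)
        *-interchange = solve-∀

        -- Sampling from the sender's conditional law, with and without the requirement that the
        -- receiver finds the message at most `K` times less likely.
        filtered unfiltered : ℕ → Player → X → Y → M → M → ℕ
        filtered i alice x y τ m = cond (α alice) i x τ m * 𝟙 (cond (α alice) i x τ m ≤? K * cond (α bob) i y τ m)
        filtered i bob   x y τ m = cond (α bob) i y τ m * 𝟙 (cond (α bob) i y τ m ≤? K * cond (α alice) i x τ m)
        unfiltered i alice x y τ m = cond (α alice) i x τ m
        unfiltered i bob   x y τ m = cond (α bob) i y τ m

        module Filtered = Walk filtered (λ x y τ → 𝟙 (z τ Bool.≟ f x y))
        module Unfiltered = Walk unfiltered (λ x y τ → 1)

        filtered-walk : ∀ k i p x y τ → Filtered.walk k i p x y τ ≡ win k i p x y τ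
        filtered-walk zero    i p     x y τ = refl
        filtered-walk (suc k) i alice x y τ = ∑-cong ms λ m →
          cong (cond (α alice) i x τ m * 𝟙 (cond (α alice) i x τ m ≤? K * cond (α bob) i y τ m) *_)
            (filtered-walk k (suc i) bob x y m)
        filtered-walk (suc k) i bob   x y τ = ∑-cong ms λ m →
          cong (cond (α bob) i y τ m * 𝟙 (cond (α bob) i y τ m ≤? K * cond (α alice) i x τ m) *_)
            (filtered-walk k (suc i) alice x y m)

        filtered-along : ∀ k i p ω → Filtered.along k i p ω ≡ likelihood k i p ω * unexceptional k i p ω
        filtered-along zero    i p     ω = refl
        filtered-along (suc k) i alice ω = trans
          (cong (step (α alice) i ω * φ *_) (filtered-along k (suc i) bob ω))
          (*-interchange (step (α alice) i ω) φ (likelihood k (suc i) bob ω) (unexceptional k (suc i) bob ω))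
          where φ = 𝟙 (step (α alice) i ω ≤? K * step (α bob) i ω)
        filtered-along (suc k) i bob   ω = trans
          (cong (step (α bob) i ω * φ *_) (filtered-along k (suc i) alice ω))
          (*-interchange (step (α bob) i ω) φ (likelihood k (suc i) alice ω) (unexceptional k (suc i) alice ω))
          where φ = 𝟙 (step (α bob) i ω ≤? K * step (α alice) i ω)

        unfiltered-walk : ∀ k i p x y τ → Unfiltered.walk k i p x y τ ≤ F ^ k
        unfiltered-walk zero    i p     x y τ = ≤-refl
        unfiltered-walk (suc k) i alice x y τ = ≤-trans (∑-mono ms λ m →
            *-monoʳ-≤ (cond (α alice) i x τ m) (unfiltered-walk k (suc i) bob x y m))
          (≤-trans (≤-reflexive (∑-*ʳ ms (F ^ k))) (*-monoˡ-≤ (F ^ k) (∑-cond (α alice) i x τ)))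
        unfiltered-walk (suc k) i bob   x y τ = ≤-trans (∑-mono ms λ m →
            *-monoʳ-≤ (cond (α bob) i y τ m) (unfiltered-walk k (suc i) alice x y m))
          (≤-trans (≤-reflexive (∑-*ʳ ms (F ^ k))) (*-monoˡ-≤ (F ^ k) (∑-cond (α bob) i y τ)))

        unfiltered-along : ∀ k i p ω → Unfiltered.along k i p ω ≡ likelihood k i p ω
        unfiltered-along zero    i p     ω = refl
        unfiltered-along (suc k) i alice ω = cong (step (α alice) i ω *_) (unfiltered-along k (suc i) bob ω)
        unfiltered-along (suc k) i bob   ω = cong (step (α bob) i ω *_) (unfiltered-along k (suc i) alice ω)

        -- Up to normalisation, the product of `P`, `L` and `V` is the quotient of the ideal and the
        -- actual probability of the inputs and the transcript.
        L U V P : Ω → ℕ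
        L = likelihood (suc s) 0 alice
        U = unexceptional (suc s) 0 alice
        V ω = inv (cl (AB (suc s)) ω)
        P ω = μ (A ω) (B ω)

        G : ℕ
        G = ∑ xs λ x → ∑ ys λ y → μ x y * win (suc s) 0 alice x y m₀

        typical-part : 𝔼 (λ ω → P ω * (L ω * U ω * V ω)) ≤ G * F
        typical-part = ≤-trans (≤-trans (𝔼-mono λ ω 1≤w → ≤-reflexive (cong (P ω *_) (cong (_* V ω)
              (trans (sym (filtered-along (suc s) 0 alice ω)) (trans (sym (*-identityʳ _))
                (cong (Filtered.along (suc s) 0 alice ω *_)
                  (sym (𝟙-yes (z (t (suc s) ω) Bool.≟ f (A ω) (B ω)) (sound ω 1≤w)))))))))
            (Filtered.expectation-≤ μ))
          (≤-reflexive (cong (_* F) (∑-cong xs λ x → ∑-cong ys λ y →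
            cong (μ x y *_) (filtered-walk (suc s) 0 alice x y m₀))))

        whole : 𝔼 (λ ω → P ω * (L ω * V ω)) ≤ S * F ^ suc s * F
        whole = ≤-trans (≤-trans (𝔼-mono λ ω 1≤w → ≤-reflexive (cong (λ x → P ω * (x * V ω))
              (trans (sym (unfiltered-along (suc s) 0 alice ω)) (sym (*-identityʳ _)))))
            (Unfiltered.expectation-≤ μ))
          (*-monoˡ-≤ F (≤-trans (∑-mono xs λ x → ∑-mono ys λ y →
              *-monoʳ-≤ (μ x y) (unfiltered-walk (suc s) 0 alice x y m₀))
            (≤-reflexive (trans (∑-cong xs λ x → ∑-*ʳ ys (F ^ suc s)) (∑-*ʳ xs (F ^ suc s))))))

      module _ (hard : ∀ (τ : Tree (Inputs X Y) Bool alice (suc s)) →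
                  (∀ v → bits τ v ≡ s * (2 + k₀ + e + e) + 1) → 20 * correct μ τ ≤ 11 * S)
        where

        private
          -- The simulated protocol is right with probability at most 11/20, the hand-overs lose at
          -- most a factor 64/63, and 11/20 times 64/63 is below 37/64.
          G-bound : 64 * G ≤ 37 * S * F ^ suc s
          G-bound = combine-ratios 64 20 63 11 37
              {Q ^ s} {(1 + Q) ^ s} {F ^ suc s} {G} {correct μ τ} {S} {{_}} {{m^n≢0 Q s {{m^n≢0 2 e}}}} sim
              (power-ratio Q s (≤-trans (*-monoʳ-≤ 64 (n≤1+n s)) e-large))
              (hard τ (proj₁ (proj₂ simulation))) (≤ᵇ⇒≤ (64 * 64 * 11) (20 * 63 * 37) _)
            where
            simulation = simulate s 0 alice (λ _ → m₀) (λ _ → m₀) μ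
            τ = proj₁ simulation
            sim : Q ^ s * G ≤ (1 + Q) ^ s * F ^ suc s * correct μ τ
            sim = ≤-trans (*-monoʳ-≤ (Q ^ s) (≤-reflexive (∑-cong xs λ x → ∑-cong ys λ y →
                cong (_* win (suc s) 0 alice x y m₀) (sym (trans (cong (μ x y *_) (𝟙-yes (m₀ ≟M m₀) refl))
                  (*-identityʳ (μ x y)))))))
              (proj₂ (proj₂ simulation))

          -- In units of `S * F ^ suc s`, the unexceptional part counted 64 times contributes at
          -- most 37, and the whole counted 3 times at most 3.
          expectation : 𝔼 (λ ω → P ω * (L ω * (64 * U ω + 3)) * V ω) ≤ F * (40 * S * F ^ suc s)
          expectation = begin
            𝔼 (λ ω → P ω * (L ω * (64 * U ω + 3)) * V ω)
              ≡⟨ trans (𝔼-cong λ ω → split 64 3 (P ω) (L ω) (U ω) (V ω))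
                   (trans 𝔼-+ (cong₂ _+_ (𝔼-*ˡ 64) (𝔼-*ˡ 3))) ⟩
            64 * 𝔼 (λ ω → P ω * (L ω * U ω * V ω)) + 3 * 𝔼 (λ ω → P ω * (L ω * V ω))
              ≤⟨ +-mono-≤ (*-monoʳ-≤ 64 typical-part) (*-monoʳ-≤ 3 whole) ⟩
            64 * (G * F) + 3 * (S * F ^ suc s * F)
              ≡⟨ cong (_+ 3 * (S * F ^ suc s * F)) (sym (*-assoc 64 G F)) ⟩
            64 * G * F + 3 * (S * F ^ suc s * F)
              ≤⟨ +-monoˡ-≤ (3 * (S * F ^ suc s * F)) (*-monoˡ-≤ F G-bound) ⟩
            37 * S * F ^ suc s * F + 3 * (S * F ^ suc s * F) ≡⟨ merge 37 3 S (F ^ suc s) F ⟩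
            F * (40 * S * F ^ suc s) ∎
            where
            open ≤-Reasoning
            split : ∀ a b p l u v → p * (l * (a * u + b)) * v ≡ a * (p * (l * u * v)) + b * (p * (l * v))
            split = solve-∀
            merge : ∀ a b c p f → a * c * p * f + b * (c * p * f) ≡ f * ((a + b) * c * p)
            merge = solve-∀

          -- By the choice of `e`, the expected number of unlikely messages in all rounds together
          -- is at most 1/64.
          unlikely-power : 15 ^ D * 32 ^ 𝔼 (unlikelies (suc s) 0 alice) ≤ 16 ^ D
          unlikely-power = power-slack D (𝔼 (unlikelies (suc s) 0 alice)) (*-cancelˡ-≤ (suc s) (begin
            suc s * (64 * u)     ≡⟨ shuffle (suc s) 64 u ⟩
            64 * suc s * u       ≤⟨ *-monoˡ-≤ u e-large ⟩
            2 ^ e * u            ≤⟨ unlikelies-weight (suc s) 0 alice ⟩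
            suc s * D            ∎))
            where
            open ≤-Reasoning
            u = 𝔼 (unlikelies (suc s) 0 alice)
            shuffle : ∀ a b c → a * (b * c) ≡ b * a * c
            shuffle = solve-∀

        I : ℕ
        I = 𝔼 (informatives (suc s) 0 alice)

        -- In logarithms, D times the divergence of the actual law of inputs and transcript from the
        -- ideal one is at least D log(3/2) - 5 `I`. The 3/2 is (64 · 15)/(40 · 16), from
        -- `exception`, `unlikely-power` and `expectation`.
        divergence : 𝔾 P * σ⁺ (suc s) 0 alice * (3 * D) ^ D
          ≤ J (AB (suc s)) * σ⁻ (suc s) 0 alice * (2 * S) ^ D * 32 ^ I
        divergence = *-cancelʳ-≤ _ _ ((F ^ suc s) ^ D * 320 ^ D)
          {{m*n≢0 _ _ {{m^n≢0 (F ^ suc s) D {{F^≢0 (suc s)}}}} {{m^n≢0 320 D}}}} (begin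
          𝔾 P * σ⁺′ * (3 * D) ^ D * ((F ^ suc s) ^ D * 320 ^ D)
            ≡⟨ cong (λ x → 𝔾 P * σ⁺′ * x * ((F ^ suc s) ^ D * 320 ^ D)) (^-distribʳ-* 3 D D) ⟩
          𝔾 P * σ⁺′ * (3 ^ D * D ^ D) * ((F ^ suc s) ^ D * 320 ^ D)
            ≡⟨ shuffle₁ (𝔾 P) σ⁺′ (3 ^ D) (D ^ D) ((F ^ suc s) ^ D) (320 ^ D) ⟩
          𝔾 P * (σ⁺′ * (F ^ suc s) ^ D) * (3 ^ D * 320 ^ D) * D ^ D
            ≡⟨ cong₂ (λ x y → 𝔾 P * x * y * D ^ D) (sym (𝔾-likelihood (suc s) 0 alice))
                 (trans (sym (^-distribʳ-* 3 320 D)) (^-distribʳ-* 64 15 D)) ⟩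
          𝔾 P * (𝔾 L * σ⁻′) * (64 ^ D * 15 ^ D) * D ^ D
            ≤⟨ *-monoˡ-≤ (D ^ D) (*-monoʳ-≤ (𝔾 P * (𝔾 L * σ⁻′)) (*-monoˡ-≤ (15 ^ D) exceptions)) ⟩
          𝔾 P * (𝔾 L * σ⁻′) * (𝔾 C * (32 ^ u * 32 ^ I) * 15 ^ D) * D ^ D
            ≡⟨ shuffle₂ (𝔾 P) (𝔾 L) σ⁻′ (𝔾 C) (32 ^ u) (32 ^ I) (15 ^ D) (D ^ D) ⟩
          𝔾 P * (𝔾 L * 𝔾 C) * D ^ D * (σ⁻′ * (15 ^ D * 32 ^ u) * 32 ^ I)
            ≡⟨ cong (λ x → x * D ^ D * (σ⁻′ * (15 ^ D * 32 ^ u) * 32 ^ I))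
                 (sym (trans (𝔾-* P (λ ω → L ω * C ω)) (cong (𝔾 P *_) (𝔾-* L C)))) ⟩
          𝔾 (λ ω → P ω * (L ω * C ω)) * D ^ D * (σ⁻′ * (15 ^ D * 32 ^ u) * 32 ^ I)
            ≤⟨ *-mono-≤ (jensen-quotient _ (AB (suc s)) (40 * S * F ^ suc s) expectation)
                 (*-monoˡ-≤ (32 ^ I) (*-monoʳ-≤ σ⁻′ unlikely-power)) ⟩
          J (AB (suc s)) * (40 * S * F ^ suc s) ^ D * (σ⁻′ * 16 ^ D * 32 ^ I)
            ≡⟨ cong (λ x → J (AB (suc s)) * x * (σ⁻′ * 16 ^ D * 32 ^ I))
                 (trans (^-distribʳ-* (40 * S) (F ^ suc s) D) (cong (_* (F ^ suc s) ^ D) (^-distribʳ-* 40 S D))) ⟩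
          J (AB (suc s)) * (40 ^ D * S ^ D * (F ^ suc s) ^ D) * (σ⁻′ * 16 ^ D * 32 ^ I)
            ≡⟨ shuffle₃ (J (AB (suc s))) (40 ^ D) (S ^ D) ((F ^ suc s) ^ D) σ⁻′ (16 ^ D) (32 ^ I) ⟩
          J (AB (suc s)) * σ⁻′ * (40 ^ D * 16 ^ D * S ^ D) * 32 ^ I * (F ^ suc s) ^ D
            ≡⟨ cong (λ x → J (AB (suc s)) * σ⁻′ * (x * S ^ D) * 32 ^ I * (F ^ suc s) ^ D)
                 (trans (sym (^-distribʳ-* 40 16 D)) (^-distribʳ-* 2 320 D)) ⟩
          J (AB (suc s)) * σ⁻′ * (2 ^ D * 320 ^ D * S ^ D) * 32 ^ I * (F ^ suc s) ^ D
            ≡⟨ shuffle₄ (J (AB (suc s))) σ⁻′ (2 ^ D) (320 ^ D) (S ^ D) (32 ^ I) ((F ^ suc s) ^ D) ⟩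
          J (AB (suc s)) * σ⁻′ * (2 ^ D * S ^ D) * 32 ^ I * ((F ^ suc s) ^ D * 320 ^ D)
            ≡⟨ cong (λ x → J (AB (suc s)) * σ⁻′ * x * 32 ^ I * ((F ^ suc s) ^ D * 320 ^ D))
                 (sym (^-distribʳ-* 2 S D)) ⟩
          J (AB (suc s)) * σ⁻′ * (2 * S) ^ D * 32 ^ I * ((F ^ suc s) ^ D * 320 ^ D) ∎)
          where
          open ≤-Reasoning
          σ⁺′ = σ⁺ (suc s) 0 alice
          σ⁻′ = σ⁻ (suc s) 0 alice
          u = 𝔼 (unlikelies (suc s) 0 alice)
          C : Ω → ℕ
          C ω = 64 * U ω + 3
          exceptions : 64 ^ D ≤ 𝔾 C * (32 ^ u * 32 ^ I)
          exceptions = begin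
            64 ^ D                                  ≡⟨ sym (𝔾-const 64) ⟩
            𝔾 (λ _ → 64)                            ≤⟨ 𝔾-mono (exception (suc s) 0 alice) ⟩
            𝔾 (λ ω → C ω * 32 ^ (v ω))              ≡⟨ trans (𝔾-* C (λ ω → 32 ^ v ω)) (cong (𝔾 C *_) (𝔾-^ 32 v)) ⟩
            𝔾 C * 32 ^ 𝔼 v
              ≡⟨ cong (𝔾 C *_) (trans (cong (32 ^_) 𝔼-+) (^-distribˡ-+-* 32 u I)) ⟩
            𝔾 C * (32 ^ u * 32 ^ I)                 ∎
            where
            v = λ ω → unlikelies (suc s) 0 alice ω + informatives (suc s) 0 alice ω
          shuffle₁ : ∀ p s a d f b → p * s * (a * d) * (f * b) ≡ p * (s * f) * (a * b) * d
          shuffle₁ = solve-∀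
          shuffle₂ : ∀ p l s c u i a d → p * (l * s) * (c * (u * i) * a) * d
                     ≡ p * (l * c) * d * (s * (a * u) * i)
          shuffle₂ = solve-∀
          shuffle₃ : ∀ j a c f s b i → j * (a * c * f) * (s * b * i) ≡ j * s * (a * b * c) * i * f
          shuffle₃ = solve-∀
          shuffle₄ : ∀ j s a b c i f → j * s * (a * b * c) * i * f ≡ j * s * (a * c) * i * (f * b)
          shuffle₄ = solve-∀

        -- In logarithms, `k₀ * I` is at most D times the information that the messages reveal to
        -- their receivers.
        information : J (AB 0) * ρ⁺ (suc s) 0 alice * 2 ^ (k₀ * I) ≤ J (AB (suc s)) * ρ⁻ (suc s) 0 alice
        information = subst (λ j → J (AB 0) * ρ⁺ (suc s) 0 alice * 2 ^ (k₀ * I) ≤ J (AB j) * ρ⁻ (suc s) 0 alice)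
          (+-identityʳ (suc s)) (informatives-cost (suc s) 0 alice)

-- Transcripts as bit strings.

module Transcript where

  open import Data.Bool.Base using (Bool; true; false)
  open import Data.List.Base using (List; []; _∷_; length; map; _++_)
  open import Data.List.Properties using (∷-injectiveˡ; ∷-injectiveʳ; length-map; length-++)
  open import Data.List.Membership.Propositional using (_∈_)
  open import Data.List.Membership.Propositional.Properties using (∈-map⁺; ∈-++⁺ˡ; ∈-++⁺ʳ)
  open import Data.List.Relation.Unary.Any using (here; there)
  open import Data.Maybe.Base using (Maybe; just; nothing)
  open import Data.Nat.Base
  open import Data.Nat.Properties
  open import Data.Nat.Tactic.RingSolver using (solve-∀)
  open import Relation.Binary.PropositionalEquality
  open import Defs using (Player; other; Tree; output; send; finish; outcome; bits)

  turn : Player → ℕ → Player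
  turn p zero    = p
  turn p (suc k) = turn (other p) k

  turn-suc : ∀ p k → turn p (suc k) ≡ other (turn p k)
  turn-suc p zero    = refl
  turn-suc p (suc k) = turn-suc (other p) k

  module _ {V : Player → Set} {O : Set} where

    -- The bits sent in the first k rounds. Messages are self-delimiting, so
    -- they need not be separated.
    sent : ∀ {p r} → ℕ → Tree V O p r → (∀ q → V q) → List Bool
    sent {p} zero    t             v = []
    sent {p} (suc k) (output o)    v = []
    sent {p} (suc k) (send b next) v = b (v p) ∷ sent (suc k) (next (b (v p))) v
    sent {p} (suc k) (finish t)    v = sent k t v

    -- The next message is a function of the bits sent before and of what its sender sees.
    sent-suc : ∀ {p r} k (t : Tree V O p r) v v′ → v (turn p k) ≡ v′ (turn p k) →
               sent k t v ≡ sent k t v′ → sent (suc k) t v ≡ sent (suc k) t v′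
    sent-suc {p} k       (output o)    v v′ eq h = refl
    sent-suc {p} zero    (send b next) v v′ eq h rewrite eq =
      cong (b (v′ p) ∷_) (sent-suc zero (next (b (v′ p))) v v′ eq refl)
    sent-suc {p} zero    (finish t)    v v′ eq h = refl
    sent-suc {p} (suc k) (send b next) v v′ eq h = cong₂ _∷_ (∷-injectiveˡ h)
      (trans (sent-suc (suc k) (next (b (v p))) v v′ eq
          (trans (∷-injectiveʳ h) (cong (λ c → sent (suc k) (next c) v′) (sym (∷-injectiveˡ h)))))
        (cong (λ c → sent (suc (suc k)) (next c) v′) (∷-injectiveˡ h)))
    sent-suc {p} (suc k) (finish t)    v v′ eq h = sent-suc k t v v′ eq h

    -- The tree itself parses the bits, so the end of an earlier round can be located in a longer
    -- string.
    sent-pred : ∀ {p r} k (t : Tree V O p r) v v′ →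
                sent (suc k) t v ≡ sent (suc k) t v′ → sent k t v ≡ sent k t v′
    sent-pred     zero    t             v v′ h = refl
    sent-pred     (suc k) (output o)    v v′ h = refl
    sent-pred {p} (suc k) (send b next) v v′ h = cong₂ _∷_ (∷-injectiveˡ h)
      (trans (sent-pred (suc k) (next (b (v p))) v v′
          (trans (∷-injectiveʳ h) (cong (λ c → sent (suc (suc k)) (next c) v′) (sym (∷-injectiveˡ h)))))
        (cong (λ c → sent (suc k) (next c) v′) (∷-injectiveˡ h)))
    sent-pred     (suc k) (finish t)    v v′ h = sent-pred k t v v′ h

    decode : ∀ {p r} → Tree V O p r → List Bool → Maybe O
    decode (output o)    bs       = just o
    decode (send b next) []       = nothing
    decode (send b next) (c ∷ bs) = decode (next c) bs
    decode (finish t)    bs       = decode t bs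

    decode-sent : ∀ {p r} (t : Tree V O p r) v → decode t (sent r t v) ≡ just (outcome t v)
    decode-sent     (output o)    v = refl
    decode-sent {p} (send b next) v = decode-sent (next (b (v p))) v
    decode-sent     (finish t)    v = decode-sent t v

    length-sent : ∀ {p r} k (t : Tree V O p r) v → length (sent k t v) ≤ bits t v
    length-sent     zero    t             v = z≤n
    length-sent     (suc k) (output o)    v = z≤n
    length-sent {p} (suc k) (send b next) v = s≤s (length-sent (suc k) (next (b (v p))) v)
    length-sent     (suc k) (finish t)    v = length-sent k t v

  -- All words of length at most `l`: transcripts on different inputs may have different lengths.
  shortWords : ℕ → List (List Bool)
  shortWords zero    = [] ∷ []
  shortWords (suc l) = [] ∷ map (true ∷_) (shortWords l) ++ map (false ∷_) (shortWords l)

  ∈-shortWords : ∀ l bs → length bs ≤ l → bs ∈ shortWords l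
  ∈-shortWords zero    []           _       = here refl
  ∈-shortWords (suc l) []           _       = here refl
  ∈-shortWords (suc l) (true ∷ bs)  (s≤s h) = there (∈-++⁺ˡ (∈-map⁺ (true ∷_) (∈-shortWords l bs h)))
  ∈-shortWords (suc l) (false ∷ bs) (s≤s h) =
    there (∈-++⁺ʳ (map (true ∷_) (shortWords l)) (∈-map⁺ (false ∷_) (∈-shortWords l bs h)))

  length-shortWords : ∀ l → suc (length (shortWords l)) ≡ 2 ^ suc l
  length-shortWords zero    = refl
  length-shortWords (suc l) = trans (cong (λ k → suc (suc k)) (trans (length-++ (map (true ∷_) (shortWords l)))
      (cong₂ _+_ (length-map (true ∷_) (shortWords l)) (length-map (false ∷_) (shortWords l)))))
    (trans (double (length (shortWords l))) (cong (2 *_) (length-shortWords l)))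
    where
    double : ∀ k → suc (suc (k + k)) ≡ 2 * suc k
    double = solve-∀

-- From the two summed inequalities to the bound (9/10)^n.

module Numeric where

  open import Data.Empty using (⊥-elim)
  open import Data.Nat.Base
  open import Data.Nat.Properties
  open import Data.Nat.Tactic.RingSolver using (solve-∀)
  open import Relation.Binary.PropositionalEquality
  open import Relation.Nullary.Decidable.Core using (yes; no)
  open Sums
  open AMGM

  ^-comm : ∀ a m n → (a ^ m) ^ n ≡ (a ^ n) ^ m
  ^-comm a m n = trans (^-*-assoc a m n) (trans (cong (a ^_) (*-comm m n)) (sym (^-*-assoc a n m)))

  -- The `N`-th power of the first inequality turns `32 ^ β` into the power of 2 that the second one
  -- bounds; since 32 is 2^5, this is where the charge of `5 * N` bits comes from. All terms are
  -- then `D`-th powers.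
  root-bound : ∀ D S B n N β .{{_ : NonZero D}} →
    D ^ D * ((3 * D) ^ D) ^ n ≤ (D ^ D) ^ n * ((2 * S) ^ D) ^ n * 32 ^ β →
    2 ^ (5 * N * β) * D ^ D ≤ (S ^ D) ^ n * (B ^ D * B ^ D) →
    (D * 3 ^ n) ^ N * D ≤ (2 ^ n * S ^ n) ^ N * S ^ n * (B * B)
  root-bound D S B n N β h₁ h₂ = ^-cancelˡ-≤ D (begin
    ((D * p) ^ N * D) ^ D                       ≡⟨ ^-distribʳ-* ((D * p) ^ N) D D ⟩
    ((D * p) ^ N) ^ D * D ^ D                   ≡⟨ cong (_* D ^ D) (^-comm (D * p) N D) ⟩
    ((D * p) ^ D) ^ N * D ^ D                   ≤⟨ *-monoˡ-≤ (D ^ D) (^-monoˡ-≤ N first) ⟩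
    ((q * Z) ^ D * 32 ^ β) ^ N * D ^ D
      ≡⟨ cong (_* D ^ D) (trans (^-distribʳ-* ((q * Z) ^ D) (32 ^ β) N)
           (cong₂ _*_ (^-comm (q * Z) D N) bits)) ⟩
    ((q * Z) ^ N) ^ D * 2 ^ (5 * N * β) * D ^ D ≡⟨ *-assoc (((q * Z) ^ N) ^ D) _ _ ⟩
    ((q * Z) ^ N) ^ D * (2 ^ (5 * N * β) * D ^ D)
      ≤⟨ *-monoʳ-≤ (((q * Z) ^ N) ^ D) h₂ ⟩
    ((q * Z) ^ N) ^ D * ((S ^ D) ^ n * (B ^ D * B ^ D))
      ≡⟨ trans (cong₂ (λ a b → ((q * Z) ^ N) ^ D * (a * b)) (^-comm S D n) (sym (^-distribʳ-* B B D)))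
           (sym (*-assoc (((q * Z) ^ N) ^ D) (Z ^ D) _)) ⟩
    ((q * Z) ^ N) ^ D * Z ^ D * (B * B) ^ D
      ≡⟨ trans (cong (_* (B * B) ^ D) (sym (^-distribʳ-* ((q * Z) ^ N) Z D)))
           (sym (^-distribʳ-* ((q * Z) ^ N * Z) (B * B) D)) ⟩
    ((q * Z) ^ N * Z * (B * B)) ^ D             ∎)
    where
    open ≤-Reasoning
    p = 3 ^ n
    q = 2 ^ n
    Z = S ^ n
    bits : (32 ^ β) ^ N ≡ 2 ^ (5 * N * β)
    bits = trans (^-*-assoc 32 β N) (trans (^-*-assoc 2 5 (β * N)) (cong (2 ^_) (order β N)))
      where
      order : ∀ b n → 5 * (b * n) ≡ 5 * n * b
      order = solve-∀
    split : ∀ a b → ((a * b) ^ D) ^ n ≡ (a ^ n) ^ D * (b ^ D) ^ n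
    split a b = trans (cong (_^ n) (^-distribʳ-* a b D)) (trans (^-distribʳ-* (a ^ D) (b ^ D) n)
      (cong (_* (b ^ D) ^ n) (^-comm a D n)))
    first : (D * p) ^ D ≤ (q * Z) ^ D * 32 ^ β
    first = *-cancelˡ-≤ ((D ^ D) ^ n) {{m^n≢0 (D ^ D) n {{n^n≢0 D}}}} (begin
      (D ^ D) ^ n * (D * p) ^ D               ≡⟨ cong ((D ^ D) ^ n *_) (^-distribʳ-* D p D) ⟩
      (D ^ D) ^ n * (D ^ D * p ^ D)           ≡⟨ shuffle ((D ^ D) ^ n) (D ^ D) (p ^ D) ⟩
      D ^ D * (p ^ D * (D ^ D) ^ n)           ≡⟨ cong (D ^ D *_) (sym (split 3 D)) ⟩
      D ^ D * ((3 * D) ^ D) ^ n               ≤⟨ h₁ ⟩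
      (D ^ D) ^ n * ((2 * S) ^ D) ^ n * 32 ^ β
        ≡⟨ cong (λ x → (D ^ D) ^ n * x * 32 ^ β) (trans (split 2 S)
             (trans (cong (q ^ D *_) (^-comm S D n)) (sym (^-distribʳ-* q Z D)))) ⟩
      (D ^ D) ^ n * (q * Z) ^ D * 32 ^ β      ≡⟨ *-assoc ((D ^ D) ^ n) _ _ ⟩
      (D ^ D) ^ n * ((q * Z) ^ D * 32 ^ β)    ∎)
      where
      shuffle : ∀ a b c → a * (b * c) ≡ b * (c * a)
      shuffle = solve-∀

  -- Fourth powers clear the quarter in 2 log B ≤ N n / 4, which is all that remains of the number
  -- of bits.
  fourth : ℕ → ℕ
  fourth a = a * a * (a * a)

  fourth-mono : ∀ {a b} → a ≤ b → fourth a ≤ fourth b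
  fourth-mono h = *-mono-≤ (*-mono-≤ h h) (*-mono-≤ h h)

  fourth-* : ∀ a b → fourth (a * b) ≡ fourth a * fourth b
  fourth-* = lemma
    where
    lemma : ∀ a b → a * b * (a * b) * (a * b * (a * b)) ≡ a * a * (a * a) * (b * b * (b * b))
    lemma = solve-∀

  fourth-^ : ∀ a n → fourth (a ^ n) ≡ fourth a ^ n
  fourth-^ a n = sym (trans (^-distribʳ-* (a * a) (a * a) n)
    (cong₂ _*_ (^-distribʳ-* a a n) (^-distribʳ-* a a n)))

  -- 81 * 9 ^ 8 ≥ 32 * 10 ^ 8.
  rates : ∀ n → 2 ^ n * fourth (2 ^ n) * (fourth (10 ^ n) * fourth (10 ^ n))
              ≤ fourth (3 ^ n) * (fourth (9 ^ n) * fourth (9 ^ n))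
  rates n = subst₂ _≤_
    (trans (^-distribʳ-* (2 * fourth 2) (fourth 10 * fourth 10) n)
      (cong₂ _*_ (trans (^-distribʳ-* 2 (fourth 2) n) (cong (2 ^ n *_) (sym (fourth-^ 2 n))))
        (trans (^-distribʳ-* (fourth 10) (fourth 10) n) (cong₂ _*_ (sym (fourth-^ 10 n)) (sym (fourth-^ 10 n))))))
    (trans (^-distribʳ-* (fourth 3) (fourth 9 * fourth 9) n)
      (cong₂ _*_ (sym (fourth-^ 3 n))
        (trans (^-distribʳ-* (fourth 9) (fourth 9) n) (cong₂ _*_ (sym (fourth-^ 9 n)) (sym (fourth-^ 9 n))))))
    (^-monoˡ-≤ n (≤ᵇ⇒≤ (2 * fourth 2 * (fourth 10 * fourth 10)) (fourth 3 * (fourth 9 * fourth 9)) _))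

  -- With p = D/S^n, `root-bound` says (3/2)^(nN) ≤ p^-(N + 1) B^2. Its fourth power and B^8 ≤
  -- 2^(nN) give (81/32)^(nN) ≤ p^-(4(N + 1)). If p > (9/10)^n, the right side is below
  -- (10/9)^(8nN), contrary to `rates`.
  success-bound : ∀ D S B n N β c .{{_ : NonZero N}} →
    D ^ D * ((3 * D) ^ D) ^ n ≤ (D ^ D) ^ n * ((2 * S) ^ D) ^ n * 32 ^ β →
    2 ^ (5 * N * β) * D ^ D ≤ (S ^ D) ^ n * (B ^ D * B ^ D) →
    B ≤ 2 ^ suc c → 8 * suc c ≤ N * n → 10 ^ n * D ≤ 9 ^ n * S ^ n
  success-bound zero S B n N β c _ _ _ _ = ≤-trans (≤-reflexive (*-zeroʳ (10 ^ n))) z≤n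
  success-bound D@(suc _) S B n N@(suc N′) β c h₁ h₂ B≤ c≤ with 10 ^ n * D ≤? 9 ^ n * S ^ n
  ... | yes h = h
  ... | no ¬h = ⊥-elim (<-irrefl refl (<-≤-trans below above))
    where
    open ≤-Reasoning
    p = 3 ^ n
    q = 2 ^ n
    u = 9 ^ n
    v = 10 ^ n
    Z = S ^ n
    Q = q ^ N
    d = D ^ N * D
    -- Pads the exponent 4 (N + 1) of 9 and 10 to 8 N, which `N` ≥ 1 permits.
    rest = fourth (u ^ N′)
    few : fourth (B * B) ≤ Q
    few = begin
      fourth (B * B)               ≤⟨ fourth-mono (*-mono-≤ B≤ B≤) ⟩
      fourth (2 ^ suc c * 2 ^ suc c)
        ≡⟨ trans (cong fourth (sym (^-distribʳ-* 2 2 (suc c)))) (trans (fourth-^ 4 (suc c)) (^-*-assoc 2 8 (suc c))) ⟩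
      2 ^ (8 * suc c)              ≤⟨ ^-monoʳ-≤ 2 c≤ ⟩
      2 ^ (N * n)                  ≡⟨ trans (cong (2 ^_) (*-comm N n)) (sym (^-*-assoc 2 n N)) ⟩
      Q                            ∎
    root : d * p ^ N ≤ Q * (Z ^ N * Z) * (B * B)
    root = ≤-trans (≤-reflexive (trans (swap (D ^ N) D (p ^ N)) (cong (_* D) (sym (^-distribʳ-* D p N)))))
      (≤-trans (root-bound D S B n N β h₁ h₂) (≤-reflexive (cong (_* (B * B))
        (trans (cong (_* Z) (^-distribʳ-* q Z N)) (*-assoc Q (Z ^ N) Z)))))
      where
      swap : ∀ a b c → a * b * c ≡ a * c * b
      swap = solve-∀
    uZ<vD : u * Z < v * D
    uZ<vD = ≰⇒> ¬h
    below : fourth (d * p ^ N) * (fourth (u ^ N * u) * rest)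
           < Q * fourth Q * (fourth (v ^ N * v) * fourth (v ^ N′)) * fourth d
    below = begin-strict
      fourth (d * p ^ N) * (fourth (u ^ N * u) * rest)
        ≤⟨ *-monoˡ-≤ (fourth (u ^ N * u) * rest) (≤-trans (fourth-mono root)
             (≤-trans (≤-reflexive (fourth-* (Q * (Z ^ N * Z)) (B * B))) (*-monoʳ-≤ (fourth (Q * (Z ^ N * Z))) few))) ⟩
      fourth (Q * (Z ^ N * Z)) * Q * (fourth (u ^ N * u) * rest)
        ≡⟨ cong (λ x → x * Q * (fourth (u ^ N * u) * rest)) (fourth-* Q (Z ^ N * Z)) ⟩
      fourth Q * fourth (Z ^ N * Z) * Q * (fourth (u ^ N * u) * rest)
        ≡⟨ shuffle₁ (fourth Q) (fourth (Z ^ N * Z)) Q (fourth (u ^ N * u)) rest ⟩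
      Q * fourth Q * rest * (fourth (u ^ N * u) * fourth (Z ^ N * Z))
        ≡⟨ cong (Q * fourth Q * rest *_) (sym (trans (cong fourth (trans (cong (_* (u * Z)) (^-distribʳ-* u Z N))
             (interchange (u ^ N) (Z ^ N) u Z))) (fourth-* (u ^ N * u) (Z ^ N * Z)))) ⟩
      Q * fourth Q * rest * fourth ((u * Z) ^ N * (u * Z))
        ≤⟨ *-monoˡ-≤ _ (*-monoʳ-≤ (Q * fourth Q) (fourth-mono (^-monoˡ-≤ N′ (^-monoˡ-≤ n (n≤1+n 9))))) ⟩
      Q * fourth Q * fourth (v ^ N′) * fourth ((u * Z) ^ N * (u * Z))
        <⟨ *-monoʳ-< (Q * fourth Q * fourth (v ^ N′)) {{positive}} fourth-strict ⟩
      Q * fourth Q * fourth (v ^ N′) * fourth ((v * D) ^ N * (v * D))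
        ≡⟨ cong (Q * fourth Q * fourth (v ^ N′) *_) (trans (cong fourth (trans (cong (_* (v * D)) (^-distribʳ-* v D N))
             (interchange (v ^ N) (D ^ N) v D))) (fourth-* (v ^ N * v) d)) ⟩
      Q * fourth Q * fourth (v ^ N′) * (fourth (v ^ N * v) * fourth d)
        ≡⟨ shuffle₂ (Q * fourth Q) (fourth (v ^ N′)) (fourth (v ^ N * v)) (fourth d) ⟩
      Q * fourth Q * (fourth (v ^ N * v) * fourth (v ^ N′)) * fourth d ∎
      where
      shuffle₁ : ∀ a z q u r → a * z * q * (u * r) ≡ q * a * r * (u * z)
      shuffle₁ = solve-∀
      shuffle₂ : ∀ a b c d → a * b * (c * d) ≡ a * (c * b) * d
      shuffle₂ = solve-∀
      interchange : ∀ a b c d → a * b * (c * d) ≡ a * c * (b * d)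
      interchange = solve-∀
      fourth≢0 : ∀ a → .{{_ : NonZero a}} → NonZero (fourth a)
      fourth≢0 a = m*n≢0 (a * a) (a * a) {{m*n≢0 a a}} {{m*n≢0 a a}}
      positive : NonZero (Q * fourth Q * fourth (v ^ N′))
      positive = m*n≢0 _ _ {{m*n≢0 _ _ {{Q≢0}} {{fourth≢0 Q {{Q≢0}}}}}}
        {{fourth≢0 (v ^ N′) {{m^n≢0 v N′ {{m^n≢0 10 n}}}}}}
        where
        Q≢0 : NonZero Q
        Q≢0 = m^n≢0 q N {{m^n≢0 2 n}}
      power-strict : (u * Z) ^ N * (u * Z) < (v * D) ^ N * (v * D)
      power-strict = *-mono-< (^-monoˡ-< N uZ<vD) uZ<vD
      fourth-strict : fourth ((u * Z) ^ N * (u * Z)) < fourth ((v * D) ^ N * (v * D))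
      fourth-strict = *-mono-< (*-mono-< power-strict power-strict) (*-mono-< power-strict power-strict)
    eighth : ∀ a → fourth (a ^ N * a) * fourth (a ^ N′) ≡ (fourth a * fourth a) ^ N
    eighth a = trans (sym (fourth-* (a ^ N * a) (a ^ N′))) (trans (cong fourth (*-assoc (a ^ N) a (a ^ N′)))
      (trans (fourth-* (a ^ N) (a ^ N)) (trans (cong₂ _*_ (fourth-^ a N) (fourth-^ a N))
        (sym (^-distribʳ-* (fourth a) (fourth a) N)))))
    above : Q * fourth Q * (fourth (v ^ N * v) * fourth (v ^ N′)) * fourth d
         ≤ fourth (d * p ^ N) * (fourth (u ^ N * u) * rest)
    above = begin
      Q * fourth Q * (fourth (v ^ N * v) * fourth (v ^ N′)) * fourth d
        ≡⟨ cong (_* fourth d) (trans (cong₂ _*_ (trans (cong (Q *_) (fourth-^ q N)) (sym (^-distribʳ-* q (fourth q) N)))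
             (eighth v)) (sym (^-distribʳ-* (q * fourth q) (fourth v * fourth v) N))) ⟩
      (q * fourth q * (fourth v * fourth v)) ^ N * fourth d
        ≤⟨ *-monoˡ-≤ (fourth d) (^-monoˡ-≤ N (rates n)) ⟩
      (fourth p * (fourth u * fourth u)) ^ N * fourth d
        ≡⟨ cong (_* fourth d) (trans (^-distribʳ-* (fourth p) (fourth u * fourth u) N)
             (cong₂ _*_ (sym (fourth-^ p N)) (sym (eighth u)))) ⟩
      fourth (p ^ N) * (fourth (u ^ N * u) * rest) * fourth d
        ≡⟨ shuffle (fourth (p ^ N)) (fourth (u ^ N * u) * rest) (fourth d) ⟩
      fourth d * fourth (p ^ N) * (fourth (u ^ N * u) * rest)
        ≡⟨ cong (_* (fourth (u ^ N * u) * rest)) (sym (fourth-* d (p ^ N))) ⟩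
      fourth (d * p ^ N) * (fourth (u ^ N * u) * rest) ∎
      where
      shuffle : ∀ a b c → a * b * c ≡ c * a * b
      shuffle = solve-∀

-- Telescoping over the copies.

module MultiCopy where

  open import Data.Bool.Base using (Bool; false)
  import Data.Bool.Properties as Bool
  open import Data.Fin.Base using (Fin; zero; suc; toℕ)
  open import Data.List.Base using (List; []; _∷_; length; map; cartesianProductWith; take; drop; concatMap; upTo; deduplicate)
  import Data.List.Properties as List
  open import Data.List.Membership.Propositional using (_∈_)
  open import Data.List.Membership.Propositional.Properties
    using (∈-cartesianProductWith⁺; ∈-deduplicate⁺; ∈-concatMap⁺; ∈-map⁺; ∈-upTo⁺)
  open import Data.List.Relation.Unary.Unique.Propositional using (Unique)
  import Data.List.Relation.Unary.Unique.DecPropositional.Properties as DecUnique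
  import Data.List.Relation.Unary.Any as Any
  open import Data.Maybe.Base using (maybe′)
  open import Data.Nat.Base
  open import Data.Nat.Properties hiding (_≟_)
  open import Data.Nat.Tactic.RingSolver using (solve-∀)
  open import Data.Product.Base using (_×_; _,_; proj₁; proj₂)
  import Data.Product.Properties as Product
  open import Data.Vec.Base using (Vec; []; _∷_; lookup; toList)
  import Data.Vec.Properties as Vec
  open import Relation.Binary.Definitions using (DecidableEquality)
  open import Relation.Binary.PropositionalEquality hiding (J)
  open import Relation.Nullary.Decidable.Core using (Dec; yes; no)
  open Sums
  open AMGM
  open Entropy
  open Simulation
  open SingleCopy
  open Transcript
  open Numeric
  open import Defs using (Player; alice; bob; other; Tree; outcome; bits)

  fins : ∀ n → List (Fin n)
  fins zero    = []
  fins (suc n) = zero ∷ map suc (fins n)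

  ∏-map : ∀ {A B : Set} (h : A → B) xs {f : B → ℕ} → ∏ (map h xs) f ≡ ∏ xs (λ x → f (h x))
  ∏-map h []       = refl
  ∏-map h (x ∷ xs) {f} = cong (f (h x) *_) (∏-map h xs)

  ∏-≢0 : ∀ {A : Set} (xs : List A) {f} → (∀ x → NonZero (f x)) → NonZero (∏ xs f)
  ∏-≢0 []       h = _
  ∏-≢0 (x ∷ xs) h = m*n≢0 _ _ {{h x}} {{∏-≢0 xs h}}

  ∏-telescope : ∀ n (g : ℕ → ℕ) →
    ∏ (fins n) (λ i → g (suc (toℕ i))) * g 0 ≡ ∏ (fins n) (λ i → g (toℕ i)) * g n
  ∏-telescope zero    g = refl
  ∏-telescope (suc n) g = begin
    g 1 * ∏ (map suc (fins n)) (λ i → g (suc (toℕ i))) * g 0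
      ≡⟨ cong (λ x → g 1 * x * g 0) (∏-map suc (fins n)) ⟩
    g 1 * ∏ (fins n) (λ i → g (suc (suc (toℕ i)))) * g 0   ≡⟨ shuffle (g 1) _ (g 0) ⟩
    ∏ (fins n) (λ i → g (suc (suc (toℕ i)))) * g 1 * g 0
      ≡⟨ cong (_* g 0) (∏-telescope n (λ k → g (suc k))) ⟩
    ∏ (fins n) (λ i → g (suc (toℕ i))) * g (suc n) * g 0   ≡⟨ shuffle′ _ (g (suc n)) (g 0) ⟩
    g 0 * ∏ (fins n) (λ i → g (suc (toℕ i))) * g (suc n)
      ≡⟨ cong (λ x → g 0 * x * g (suc n)) (sym (∏-map suc (fins n))) ⟩
    g 0 * ∏ (map suc (fins n)) (λ i → g (toℕ i)) * g (suc n) ∎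
    where
    open ≡-Reasoning
    shuffle : ∀ a b c → a * b * c ≡ b * a * c
    shuffle = solve-∀
    shuffle′ : ∀ a b c → a * b * c ≡ c * a * b
    shuffle′ = solve-∀

  -- The inequalities are multiplied over all copies; the products of `a` and `b` then cancel except
  -- for the end terms `p` and `q`.
  telescope-≤ : ∀ {n} (z a b d : Fin n → ℕ) p q → (∀ i → NonZero (a i)) →
    (∀ i → z i * a i ≤ b i * d i) → ∏ (fins n) b * p ≡ ∏ (fins n) a * q →
    ∏ (fins n) z * p ≤ q * ∏ (fins n) d
  telescope-≤ {n} z a b d p q a≢0 h e = *-cancelˡ-≤ (∏ (fins n) a) {{∏-≢0 (fins n) a≢0}} (begin
    ∏ (fins n) a * (∏ (fins n) z * p)         ≡⟨ shuffle (∏ (fins n) a) (∏ (fins n) z) p ⟩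
    ∏ (fins n) z * ∏ (fins n) a * p           ≡⟨ cong (_* p) (sym (∏-* {f = z} {a} (fins n))) ⟩
    ∏ (fins n) (λ i → z i * a i) * p          ≤⟨ *-monoˡ-≤ p (∏-mono (fins n) h) ⟩
    ∏ (fins n) (λ i → b i * d i) * p          ≡⟨ cong (_* p) (∏-* {f = b} {d} (fins n)) ⟩
    ∏ (fins n) b * ∏ (fins n) d * p           ≡⟨ swap (∏ (fins n) b) (∏ (fins n) d) p ⟩
    ∏ (fins n) b * p * ∏ (fins n) d           ≡⟨ cong (_* ∏ (fins n) d) e ⟩
    ∏ (fins n) a * q * ∏ (fins n) d           ≡⟨ *-assoc (∏ (fins n) a) q (∏ (fins n) d) ⟩
    ∏ (fins n) a * (q * ∏ (fins n) d)         ∎)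
    where
    open ≤-Reasoning
    shuffle : ∀ a b c → a * (b * c) ≡ b * a * c
    shuffle = solve-∀
    swap : ∀ a b c → a * b * c ≡ a * c * b
    swap = solve-∀

  length-fins : ∀ n → length (fins n) ≡ n
  length-fins zero    = refl
  length-fins (suc n) = cong suc (trans (List.length-map suc (fins n)) (length-fins n))

  module _ {A : Set} where

    take-suc⁺ : ∀ {n} (i : Fin n) (x x′ : Vec A n) →
      take (toℕ i) (toList x) ≡ take (toℕ i) (toList x′) → lookup x i ≡ lookup x′ i →
      take (suc (toℕ i)) (toList x) ≡ take (suc (toℕ i)) (toList x′)
    take-suc⁺ zero    (a ∷ x) (a′ ∷ x′) h e = cong (_∷ []) e
    take-suc⁺ (suc i) (a ∷ x) (a′ ∷ x′) h e =
      cong₂ _∷_ (List.∷-injectiveˡ h) (take-suc⁺ i x x′ (List.∷-injectiveʳ h) e)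

    take-suc⁻ : ∀ {n} (i : Fin n) (x x′ : Vec A n) →
      take (suc (toℕ i)) (toList x) ≡ take (suc (toℕ i)) (toList x′) →
      take (toℕ i) (toList x) ≡ take (toℕ i) (toList x′) × lookup x i ≡ lookup x′ i
    take-suc⁻ zero    (a ∷ x) (a′ ∷ x′) h = refl , List.∷-injectiveˡ h
    take-suc⁻ (suc i) (a ∷ x) (a′ ∷ x′) h =
      let (p , e) = take-suc⁻ i x x′ (List.∷-injectiveʳ h)
      in cong₂ _∷_ (List.∷-injectiveˡ h) p , e

    drop-suc⁺ : ∀ {n} (i : Fin n) (y y′ : Vec A n) →
      drop (suc (toℕ i)) (toList y) ≡ drop (suc (toℕ i)) (toList y′) → lookup y i ≡ lookup y′ i →
      drop (toℕ i) (toList y) ≡ drop (toℕ i) (toList y′)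
    drop-suc⁺ zero    (a ∷ y) (a′ ∷ y′) h e = cong₂ _∷_ e h
    drop-suc⁺ (suc i) (a ∷ y) (a′ ∷ y′) h e = drop-suc⁺ i y y′ h e

    drop-suc⁻ : ∀ {n} (i : Fin n) (y y′ : Vec A n) →
      drop (toℕ i) (toList y) ≡ drop (toℕ i) (toList y′) →
      drop (suc (toℕ i)) (toList y) ≡ drop (suc (toℕ i)) (toList y′) × lookup y i ≡ lookup y′ i
    drop-suc⁻ zero    (a ∷ y) (a′ ∷ y′) h = List.∷-injectiveʳ h , List.∷-injectiveˡ h
    drop-suc⁻ (suc i) (a ∷ y) (a′ ∷ y′) h = drop-suc⁻ i y y′ h

    toList-injective : ∀ {n} (x x′ : Vec A n) → toList x ≡ toList x′ → x ≡ x′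
    toList-injective []      []        h = refl
    toList-injective (a ∷ x) (a′ ∷ x′) h =
      cong₂ _∷_ (List.∷-injectiveˡ h) (toList-injective x x′ (List.∷-injectiveʳ h))

    take-all : ∀ {n} (x : Vec A n) → take n (toList x) ≡ toList x
    take-all []      = refl
    take-all (a ∷ x) = cong (a ∷_) (take-all x)

    drop-all : ∀ {n} (y : Vec A n) → drop n (toList y) ≡ []
    drop-all []      = refl
    drop-all (a ∷ y) = drop-all y

  module Copies
    {X Y : Set} (_≟X_ : DecidableEquality X) (_≟Y_ : DecidableEquality Y)
    (xs : List X) (ys : List Y) (∈xs : ∀ x → x ∈ xs) (∈ys : ∀ y → y ∈ ys)
    (μ : X → Y → ℕ) (f : X → Y → Bool) (n₁ s : ℕ)
    (ωs : List (Vec X (suc n₁) × Vec Y (suc n₁))) (complete : ∀ ω → ω ∈ ωs) (unique : Unique ωs)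
    (t : Tree (Inputs (Vec X (suc n₁)) (Vec Y (suc n₁))) (Vec Bool (suc n₁)) alice (suc s)) (c : ℕ)
    (short : ∀ v → bits t v ≤ c)
    (answer : Vec X (suc n₁) × Vec Y (suc n₁) → Vec Bool (suc n₁)) (answer-lookup : ∀ ω i → lookup (answer ω) i ≡ f (lookup (proj₁ ω) i) (lookup (proj₂ ω) i))
    where

    private
      n : ℕ
      n = suc n₁

      Ω : Set
      Ω = Vec X n × Vec Y n

    inputs : Ω → ∀ q → Inputs (Vec X n) (Vec Y n) q
    inputs (x , y) = ⟨ x , y ⟩

    correct? : ∀ ω → Dec (outcome t (inputs ω) ≡ answer ω)
    correct? ω = Vec.≡-dec Bool._≟_ (outcome t (inputs ω)) (answer ω)

    P : Fin n → Ω → ℕ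
    P i (x , y) = μ (lookup x i) (lookup y i)

    -- The product mass restricted to the inputs on which `t` is right. Its total `D`, divided by
    -- `S ^ n`, is the success probability.
    w : Ω → ℕ
    w ω = ∏ (fins n) (λ i → P i ω) * 𝟙 (correct? ω)

    open Weighted ωs complete w

    H : ℕ → RV Ω
    H k = record { at = λ ω → sent k t (inputs ω) ; _≟_ = List.≡-dec Bool._≟_ }

    -- `u j` consists of x before `j` and y from `j` on. The public part of copy `i` together with
    -- x_i is `u (i + 1)`, and together with y_i it is `u i`; hence the sums over the copies
    -- telescope.
    prefix suffix u : ℕ → RV Ω
    prefix j = record { at = λ (x , y) → take j (toList x) ; _≟_ = List.≡-dec _≟X_ }
    suffix j = record { at = λ (x , y) → drop j (toList y) ; _≟_ = List.≡-dec _≟Y_ }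
    u j = prefix j ⊗ suffix j

    U : ℕ → ℕ → ℕ
    U j k = J (u j ⊗ H k)

    Message : Set
    Message = (List X × List Y) × List Bool

    _≟M_ : DecidableEquality Message
    _≟M_ = Product.≡-dec (Product.≡-dec (List.≡-dec _≟X_) (List.≡-dec _≟Y_)) (List.≡-dec Bool._≟_)

    -- Alice's first message of the i-th copy also contains the coordinates
    -- before i of x and those after i of y, which makes the other coordinates
    -- of x and y independent.
    label : Fin n → ℕ → Ω → Message
    label i zero    ω       = ([] , []) , []
    label i (suc k) (x , y) =
      (take (toℕ i) (toList x) , drop (suc (toℕ i)) (toList y)) , sent (suc k) t ⟨ x , y ⟩

    label-extends : ∀ i k ω ω′ → label i (suc k) ω ≡ label i (suc k) ω′ → label i k ω ≡ label i k ω′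
    label-extends i zero    ω ω′ e = refl
    label-extends i (suc k) ω ω′ e =
      cong₂ _,_ (cong proj₁ e) (sent-pred (suc k) t (inputs ω) (inputs ω′) (cong proj₂ e))

    messages : Fin n → List Message
    messages i = deduplicate _≟M_ (concatMap (λ k → map (label i k) ωs) (upTo (2 + s)))

    label-∈ : ∀ i k ω → k ≤ suc s → label i k ω ∈ messages i
    label-∈ i k ω k≤ = ∈-deduplicate⁺ _≟M_ (∈-concatMap⁺ (λ k → map (label i k) ωs)
      (Any.map (λ { refl → ∈-map⁺ (label i k) (complete ω) }) (∈-upTo⁺ (s≤s k≤))))

    module Copy (i : Fin n) = System ωs complete w _≟X_ _≟Y_ _≟M_ xs ys
      (λ ω → lookup (proj₁ ω) i) (λ ω → lookup (proj₂ ω) i) (λ ω → ∈xs _) (λ ω → ∈ys _)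
      (label i) (([] , []) , []) (λ ω → refl) (label-extends i) s
      (messages i) (DecUnique.deduplicate-! _≟M_ _) (label-∈ i)

    sound-weight : ∀ ω → 1 ≤ w ω → outcome t (inputs ω) ≡ answer ω
    sound-weight ω 1≤w with correct? ω
    ... | yes e = e
    ... | no _  with () ← subst (1 ≤_) (*-zeroʳ (∏ (fins n) (λ i → P i ω))) 1≤w

    bit : Fin n → Message → Bool
    bit i (_ , h) = maybe′ (λ o → lookup o i) false (decode t h)

    bit-sound : ∀ i ω → 1 ≤ w ω → bit i (label i (suc s) ω) ≡ f (lookup (proj₁ ω) i) (lookup (proj₂ ω) i)
    bit-sound i ω 1≤w = trans (cong (maybe′ (λ o → lookup o i) false) (decode-sent t (inputs ω)))
      (trans (cong (λ o → lookup o i) (sound-weight ω 1≤w)) (answer-lookup ω i))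

    ∏ᵢ : (Fin n → ℕ) → ℕ
    ∏ᵢ = ∏ (fins n)

    Xᵢ Yᵢ : Fin n → RV Ω
    Xᵢ i = Copy.α i alice
    Yᵢ i = Copy.α i bob

    X-label : ∀ i k → J (Xᵢ i ⊗ Copy.T i (suc k)) ≡ U (suc (toℕ i)) (suc k)
    X-label i k = J-cong (Xᵢ i ⊗ Copy.T i (suc k)) (u (suc (toℕ i)) ⊗ H (suc k))
      (λ (x , y) (x′ , y′) e → cong₂ _,_
        (cong₂ _,_ (take-suc⁺ i x x′ (cong (λ (_ , (p , _) , _) → p) e) (cong proj₁ e))
          (cong (λ (_ , (_ , q) , _) → q) e))
        (cong (λ (_ , _ , h) → h) e))
      (λ (x , y) (x′ , y′) e → let (p , l) = take-suc⁻ i x x′ (cong (λ ((p , _) , _) → p) e) in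
        cong₂ _,_ l (cong₂ _,_ (cong₂ _,_ p (cong (λ ((_ , q) , _) → q) e)) (cong proj₂ e)))

    Y-label : ∀ i k → J (Yᵢ i ⊗ Copy.T i (suc k)) ≡ U (toℕ i) (suc k)
    Y-label i k = J-cong (Yᵢ i ⊗ Copy.T i (suc k)) (u (toℕ i) ⊗ H (suc k))
      (λ (x , y) (x′ , y′) e → cong₂ _,_
        (cong₂ _,_ (cong (λ (_ , (p , _) , _) → p) e)
          (drop-suc⁺ i y y′ (cong (λ (_ , (_ , q) , _) → q) e) (cong proj₁ e)))
        (cong (λ (_ , _ , h) → h) e))
      (λ (x , y) (x′ , y′) e → let (q , l) = drop-suc⁻ i y y′ (cong (λ ((_ , q) , _) → q) e) in
        cong₂ _,_ l (cong₂ _,_ (cong₂ _,_ (cong (λ ((p , _) , _) → p) e) q) (cong proj₂ e)))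

    forget : ∀ i (κ : RV Ω) → J (κ ⊗ Copy.T i 0) ≡ J κ
    forget i κ = J-cong (κ ⊗ Copy.T i 0) κ (λ ω ω′ e → cong proj₁ e) (λ ω ω′ e → cong (_, _) e)

    x-determined : ∀ (ω ω′ : Ω) → take n (toList (proj₁ ω)) ≡ take n (toList (proj₁ ω′)) → proj₁ ω ≡ proj₁ ω′
    x-determined (x , _) (x′ , _) e = toList-injective x x′ (trans (sym (take-all x)) (trans e (take-all x′)))

    y-determined : ∀ (ω ω′ : Ω) → toList (proj₂ ω) ≡ toList (proj₂ ω′) → proj₂ ω ≡ proj₂ ω′
    y-determined (_ , y) (_ , y′) = toList-injective y y′

    -- `u n` contains all of x, which together with the past determines a message of Alice.
    alice-determined : ∀ k → turn alice k ≡ alice → U n (suc k) ≡ U n k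
    alice-determined k e = J-cong (u n ⊗ H (suc k)) (u n ⊗ H k)
      (λ ω ω′ h → cong₂ _,_ (cong proj₁ h) (sent-pred k t (inputs ω) (inputs ω′) (cong proj₂ h)))
      (λ ω ω′ h → cong₂ _,_ (cong proj₁ h) (sent-suc k t (inputs ω) (inputs ω′)
        (subst (λ q → inputs ω q ≡ inputs ω′ q) (sym e) (x-determined ω ω′ (cong (λ ((p , _) , _) → p) h)))
        (cong proj₂ h)))

    bob-determined : ∀ k → turn alice k ≡ bob → U 0 (suc k) ≡ U 0 k
    bob-determined k e = J-cong (u 0 ⊗ H (suc k)) (u 0 ⊗ H k)
      (λ ω ω′ h → cong₂ _,_ (cong proj₁ h) (sent-pred k t (inputs ω) (inputs ω′) (cong proj₂ h)))
      (λ ω ω′ h → cong₂ _,_ (cong proj₁ h) (sent-suc k t (inputs ω) (inputs ω′)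
        (subst (λ q → inputs ω q ≡ inputs ω′ q) (sym e) (y-determined ω ω′ (cong (λ ((_ , q) , _) → q) h)))
        (cong proj₂ h)))

    -- The factors common to both players: the products over the copies of `U (i + 1) k` for Alice
    -- and of `U i k` for Bob differ only in the ends `U n k` and `U 0 k`.
    I : ℕ → ℕ
    I k = ∏ (fins n₁) (λ i → U (suc (toℕ i)) k)

    ∏-lower : ∀ k → ∏ᵢ (λ i → U (toℕ i) k) ≡ U 0 k * I k
    ∏-lower k = cong (U 0 k *_) (∏-map suc (fins n₁))

    ∏-upper : ∀ k → ∏ᵢ (λ i → U (suc (toℕ i)) k) ≡ U n k * I k
    ∏-upper k = *-cancelʳ-≡ _ _ (U 0 k) {{J≢0 (u 0 ⊗ H k)}} (trans (∏-telescope n (λ j → U j k))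
      (trans (cong (_* U n k) (∏-lower k)) (shuffle (U 0 k) (I k) (U n k))))
      where
      shuffle : ∀ a b c → a * b * c ≡ c * b * a
      shuffle = solve-∀

    ∏σ⁺ ∏σ⁻ ∏ρ⁺ ∏ρ⁻ : ℕ → ℕ → Player → ℕ
    ∏σ⁺ k j p = ∏ᵢ (λ i → Copy.Rounds.σ⁺ i k j p)
    ∏σ⁻ k j p = ∏ᵢ (λ i → Copy.Rounds.σ⁻ i k j p)
    ∏ρ⁺ k j p = ∏ᵢ (λ i → Copy.Rounds.ρ⁺ i k j p)
    ∏ρ⁻ k j p = ∏ᵢ (λ i → Copy.Rounds.ρ⁻ i k j p)

    ends : Player → ℕ → ℕ
    ends alice = U n
    ends bob   = U 0

    side : Player → ℕ → ℕ
    side p k = ∏ᵢ (λ i → J (Copy.α i p ⊗ Copy.T i k))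

    ∏σ⁺-suc : ∀ k j p → ∏σ⁺ (suc k) j p ≡ side p (suc j) * ∏σ⁺ k (suc j) (other p)
    ∏σ⁺-suc k j p = ∏-* {f = λ i → J (Copy.α i p ⊗ Copy.T i (suc j))} {λ i → Copy.Rounds.σ⁺ i k (suc j) (other p)} (fins n)

    ∏σ⁻-suc : ∀ k j p → ∏σ⁻ (suc k) j p ≡ side p j * ∏σ⁻ k (suc j) (other p)
    ∏σ⁻-suc k j p = ∏-* {f = λ i → J (Copy.α i p ⊗ Copy.T i j)} {λ i → Copy.Rounds.σ⁻ i k (suc j) (other p)} (fins n)

    ∏ρ⁺-suc : ∀ k j p → ∏ρ⁺ (suc k) j p ≡ side (other p) (suc j) * ∏ρ⁺ k (suc j) (other p)
    ∏ρ⁺-suc k j p = ∏-* {f = λ i → J (Copy.α i (other p) ⊗ Copy.T i (suc j))} {λ i → Copy.Rounds.ρ⁺ i k (suc j) (other p)} (fins n)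

    ∏ρ⁻-suc : ∀ k j p → ∏ρ⁻ (suc k) j p ≡ side (other p) j * ∏ρ⁻ k (suc j) (other p)
    ∏ρ⁻-suc k j p = ∏-* {f = λ i → J (Copy.α i (other p) ⊗ Copy.T i j)} {λ i → Copy.Rounds.ρ⁻ i k (suc j) (other p)} (fins n)

    ∏-side : ∀ p k → side p (suc k) ≡ ends p (suc k) * I (suc k)
    ∏-side alice k = trans (∏-cong (fins n) (λ i → X-label i k)) (∏-upper (suc k))
    ∏-side bob   k = trans (∏-cong (fins n) (λ i → Y-label i k)) (∏-lower (suc k))

    ends-sender : ∀ p k → turn alice k ≡ p → ends p (suc k) ≡ ends p k
    ends-sender alice k e = alice-determined k e
    ends-sender bob   k e = bob-determined k e

    I≢0 : ∀ k → NonZero (I k)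
    I≢0 k = ∏-≢0 (fins n₁) (λ i → J≢0 (u (suc (toℕ i)) ⊗ H k))

    -- A sender's end term does not change in the sender's own round, so only quotients of
    -- consecutive `I` remain. The first round is left out, since no public part precedes it.
    σ-telescope : ∀ k j p → turn alice (suc j) ≡ p →
      ∏σ⁺ k (suc j) p * I (suc j) ≡ ∏σ⁻ k (suc j) p * I (k + suc j)
    σ-telescope zero    j p e = refl
    σ-telescope (suc k) j p e = begin
      ∏σ⁺ (suc k) (suc j) p * I (suc j)
        ≡⟨ cong (_* I (suc j)) (trans (∏σ⁺-suc k (suc j) p) (cong (_* ∏σ⁺ k (2 + j) (other p)) (∏-side p (suc j)))) ⟩
      ends p (2 + j) * I (2 + j) * ∏σ⁺ k (2 + j) (other p) * I (suc j)
        ≡⟨ shuffle (ends p (2 + j)) (I (2 + j)) (∏σ⁺ k (2 + j) (other p)) (I (suc j)) ⟩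
      ends p (2 + j) * I (suc j) * (∏σ⁺ k (2 + j) (other p) * I (2 + j))
        ≡⟨ cong₂ (λ a b → a * I (suc j) * b) (ends-sender p (suc j) e)
             (σ-telescope k (suc j) (other p) (trans (turn-suc alice (suc j)) (cong other e))) ⟩
      ends p (suc j) * I (suc j) * (∏σ⁻ k (2 + j) (other p) * I (k + suc (suc j)))
        ≡⟨ cong₂ (λ a b → a * (∏σ⁻ k (2 + j) (other p) * I b)) (sym (∏-side p j)) (+-suc k (suc j)) ⟩
      side p (suc j) * (∏σ⁻ k (2 + j) (other p) * I (suc k + suc j))
        ≡⟨ trans (sym (*-assoc (side p (suc j)) (∏σ⁻ k (2 + j) (other p)) (I (suc k + suc j))))
             (cong (_* I (suc k + suc j)) (sym (∏σ⁻-suc k (suc j) p))) ⟩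
      ∏σ⁻ (suc k) (suc j) p * I (suc k + suc j) ∎
      where
      open ≡-Reasoning
      shuffle : ∀ a b c d → a * b * c * d ≡ a * d * (c * b)
      shuffle = solve-∀

    -- Only the receiver's end term changes, so it may be exchanged for the product of both ends,
    -- which telescopes regardless of whose turn it is.
    both-ends : ∀ p k → turn alice k ≡ p →
      ends (other p) (suc k) * (U 0 k * U n k) ≡ ends (other p) k * (U 0 (suc k) * U n (suc k))
    both-ends alice k e rewrite alice-determined k e = shuffle (U 0 (suc k)) (U 0 k) (U n k)
      where
      shuffle : ∀ a b c → a * (b * c) ≡ b * (a * c)
      shuffle = solve-∀
    both-ends bob   k e rewrite bob-determined k e = shuffle (U n (suc k)) (U 0 k) (U n k)
      where
      shuffle : ∀ a b c → a * (b * c) ≡ c * (b * a)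
      shuffle = solve-∀

    ρ-telescope : ∀ k j p → turn alice (suc j) ≡ p →
      ∏ρ⁺ k (suc j) p * (I (suc j) * (U 0 (suc j) * U n (suc j)))
        ≡ ∏ρ⁻ k (suc j) p * (I (k + suc j) * (U 0 (k + suc j) * U n (k + suc j)))
    ρ-telescope zero    j p e = refl
    ρ-telescope (suc k) j p e = begin
      ∏ρ⁺ (suc k) (suc j) p * (I (suc j) * b)
        ≡⟨ cong (_* (I (suc j) * b)) (trans (∏ρ⁺-suc k (suc j) p) (cong (_* ∏ρ⁺ k (2 + j) q) (∏-side q (suc j)))) ⟩
      ends q (2 + j) * I (2 + j) * ∏ρ⁺ k (2 + j) q * (I (suc j) * b)
        ≡⟨ shuffle₁ (ends q (2 + j)) (I (2 + j)) (∏ρ⁺ k (2 + j) q) (I (suc j)) b ⟩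
      ends q (2 + j) * b * (I (suc j) * (∏ρ⁺ k (2 + j) q * I (2 + j)))
        ≡⟨ cong (_* (I (suc j) * (∏ρ⁺ k (2 + j) q * I (2 + j)))) (both-ends p (suc j) e) ⟩
      ends q (suc j) * b′ * (I (suc j) * (∏ρ⁺ k (2 + j) q * I (2 + j)))
        ≡⟨ shuffle₂ (ends q (suc j)) b′ (I (suc j)) (∏ρ⁺ k (2 + j) q) (I (2 + j)) ⟩
      ends q (suc j) * I (suc j) * (∏ρ⁺ k (2 + j) q * (I (2 + j) * b′))
        ≡⟨ cong₂ _*_ (sym (∏-side q j))
             (ρ-telescope k (suc j) q (trans (turn-suc alice (suc j)) (cong other e))) ⟩
      side q (suc j) * (∏ρ⁻ k (2 + j) q * E (k + suc (suc j)))
        ≡⟨ trans (sym (*-assoc (side q (suc j)) (∏ρ⁻ k (2 + j) q) (E (k + suc (suc j)))))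
             (cong₂ _*_ (sym (∏ρ⁻-suc k (suc j) p)) (cong E (+-suc k (suc j)))) ⟩
      ∏ρ⁻ (suc k) (suc j) p * (I (suc k + suc j) * (U 0 (suc k + suc j) * U n (suc k + suc j))) ∎
      where
      open ≡-Reasoning
      q = other p
      E = λ l → I l * (U 0 l * U n l)
      b = U 0 (suc j) * U n (suc j)
      b′ = U 0 (2 + j) * U n (2 + j)
      shuffle₁ : ∀ e i r k b → e * i * r * (k * b) ≡ e * b * (k * (r * i))
      shuffle₁ = solve-∀
      shuffle₂ : ∀ e b k r i → e * b * (k * (r * i)) ≡ e * k * (r * (i * b))
      shuffle₂ = solve-∀

    r : ℕ
    r = suc s

    W : ℕ
    W = 𝔾 w

    AB : Fin n → ℕ → RV Ω
    AB i k = Copy.AB i k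

    _≟Ω_ : DecidableEquality Ω
    _≟Ω_ = Product.≡-dec (Vec.≡-dec _≟X_) (Vec.≡-dec _≟Y_)

    W≢0 : NonZero W
    W≢0 = >-nonZero (≤-trans (≤-reflexive (sym (trans (𝔾-const 1) (^-zeroˡ D)))) (𝔾-mono (λ ω h → h)))

    -- x is revealed coordinate by coordinate when all of y and the transcript are known.
    chain : ℕ → RV Ω
    chain j = prefix j ⊗ suffix 0 ⊗ H r

    J-chain-≤ : J (chain n) ≤ W
    J-chain-≤ = 𝔾-mono λ ω _ → ≤-trans (∑-mono ωs λ ω′ → ≤-trans
        (*-monoʳ-≤ (w ω′) (𝟙-mono (RV._≟_ (chain n) (at (chain n) ω′) (at (chain n) ω)) (ω ≟Ω ω′) λ e →
          sym (cong₂ _,_ (x-determined ω′ ω (cong proj₁ e)) (y-determined ω′ ω (cong (λ (_ , q , _) → q) e)))))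
        (≤-reflexive (*-comm (w ω′) (𝟙 (ω ≟Ω ω′)))))
      (∑-unique-≤ _≟Ω_ w ω unique)

    -- Given the transcript and x before `i`, knowing all of y instead of y from `i` on cannot raise
    -- the entropy of x_i.
    chain-step : ∀ i → J (AB i r) * J (chain (toℕ i)) ≤ J (chain (suc (toℕ i))) * U (toℕ i) r
    chain-step i = subst₂ _≤_
      (cong₂ _*_
        (J-cong (Xᵢ i ⊗ γ) (AB i r)
          (λ ω ω′ e → let (q , l) = drop-suc⁻ i (proj₂ ω) (proj₂ ω′) (cong (λ (_ , (_ , q) , _) → q) e) in
            cong₂ _,_ (cong proj₁ e) (cong₂ _,_ l
              (cong₂ _,_ (cong₂ _,_ (cong (λ (_ , (p , _) , _) → p) e) q) (cong (λ (_ , _ , h) → h) e))))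
          (λ ω ω′ e → cong₂ _,_ (cong proj₁ e) (cong₂ _,_
            (cong₂ _,_ (cong (λ (_ , _ , (p , _) , _) → p) e)
              (drop-suc⁺ i (proj₂ ω) (proj₂ ω′) (cong (λ (_ , _ , (_ , q) , _) → q) e) (cong (λ (_ , l , _) → l) e)))
            (cong (λ (_ , _ , _ , h) → h) e))))
        (J-cong (suffix 0 ⊗ γ) (chain (toℕ i))
          (λ ω ω′ e → cong₂ _,_ (cong (λ (_ , (p , _) , _) → p) e)
            (cong₂ _,_ (cong proj₁ e) (cong (λ (_ , _ , h) → h) e)))
          (λ ω ω′ e → cong₂ _,_ (cong (λ (_ , q , _) → q) e) (cong₂ _,_
            (cong₂ _,_ (cong proj₁ e) (cong (drop (toℕ i)) (cong (λ (_ , q , _) → q) e)))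
            (cong (λ (_ , _ , h) → h) e)))))
      (cong (_* J γ)
        (J-cong (Xᵢ i ⊗ suffix 0 ⊗ γ) (chain (suc (toℕ i)))
          (λ ω ω′ e → cong₂ _,_
            (take-suc⁺ i (proj₁ ω) (proj₁ ω′) (cong (λ (_ , _ , (p , _) , _) → p) e) (cong proj₁ e))
            (cong₂ _,_ (cong (λ (_ , q , _) → q) e) (cong (λ (_ , _ , _ , h) → h) e)))
          (λ ω ω′ e → let (p , l) = take-suc⁻ i (proj₁ ω) (proj₁ ω′) (cong proj₁ e) in
            cong₂ _,_ l (cong₂ _,_ (cong (λ (_ , q , _) → q) e) (cong₂ _,_
              (cong₂ _,_ p (cong (drop (toℕ i)) (cong (λ (_ , q , _) → q) e)))
              (cong (λ (_ , _ , h) → h) e))))))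
      (submodular (Xᵢ i) (suffix 0) γ)
      where γ = u (toℕ i) ⊗ H r

    ∏ᵢ-const : ∀ a → ∏ᵢ (λ _ → a) ≡ a ^ n
    ∏ᵢ-const a = trans (∏-const (fins n) a) (cong (a ^_) (length-fins n))

    -- The chain rule along `chain`, whose last member determines the whole input and so has `J` at
    -- most `W`.
    ∏-joint : ∏ᵢ (λ i → J (AB i r)) ≤ W * I r
    ∏-joint = *-cancelʳ-≤ _ _ (U 0 r) {{J≢0 (u 0 ⊗ H r)}} (begin
      ∏ᵢ (λ i → J (AB i r)) * U 0 r        ≡⟨ cong (∏ᵢ (λ i → J (AB i r)) *_) chain-0 ⟩
      ∏ᵢ (λ i → J (AB i r)) * J (chain 0)
        ≤⟨ telescope-≤ (λ i → J (AB i r)) (λ i → J (chain (toℕ i))) (λ i → J (chain (suc (toℕ i)))) (λ i → U (toℕ i) r)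
             (J (chain 0)) (J (chain n)) (λ i → J≢0 (chain (toℕ i))) chain-step (∏-telescope n (λ j → J (chain j))) ⟩
      J (chain n) * ∏ᵢ (λ i → U (toℕ i) r) ≤⟨ *-mono-≤ J-chain-≤ (≤-reflexive (∏-lower r)) ⟩
      W * (U 0 r * I r)                    ≡⟨ shuffle W (U 0 r) (I r) ⟩
      W * I r * U 0 r                      ∎)
      where
      open ≤-Reasoning
      chain-0 : U 0 r ≡ J (chain 0)
      chain-0 = J-cong (u 0 ⊗ H r) (chain 0)
        (λ ω ω′ e → cong (λ ((p , q) , h) → p , q , h) e) (λ ω ω′ e → cong (λ (p , q , h) → (p , q) , h) e)
      shuffle : ∀ w u i → w * (u * i) ≡ w * i * u
      shuffle = solve-∀

    constant-J : ∀ (κ : RV Ω) → (∀ ω ω′ → at κ ω ≡ at κ ω′) → J κ ≡ D ^ D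
    constant-J κ h = trans (J-cong κ trivial (λ _ _ _ → refl) (λ ω ω′ _ → h ω ω′)) J-trivial

    two-step : ∀ κ κ′ κ″ → (κ ⊗ κ′) ⟶ κ″ → κ″ ⟶ (κ ⊗ κ′) → J κ * J κ′ ≤ J κ″ * D ^ D
    two-step κ κ′ κ″ to from = subst₂ _≤_
      (cong₂ _*_ (J-cong (κ ⊗ trivial) κ (λ _ _ e → cong proj₁ e) (λ _ _ e → cong (_, _) e))
        (J-cong (κ′ ⊗ trivial) κ′ (λ _ _ e → cong proj₁ e) (λ _ _ e → cong (_, _) e)))
      (cong₂ _*_ (J-cong (κ ⊗ κ′ ⊗ trivial) κ″
        (λ ω ω′ e → to ω ω′ (cong (λ (a , b , _) → a , b) e))
        (λ ω ω′ e → cong (λ (a , b) → a , b , _) (from ω ω′ e))) J-trivial)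
      (submodular κ κ′ trivial)

    subadditive-x : ∏ᵢ (λ i → J (Xᵢ i)) * D ^ D ≤ J (prefix n) * (D ^ D) ^ n
    subadditive-x = subst₂ _≤_ (cong (∏ᵢ (λ i → J (Xᵢ i)) *_) (constant-J (prefix 0) (λ _ _ → refl)))
      (cong (J (prefix n) *_) (∏ᵢ-const (D ^ D)))
      (telescope-≤ (λ i → J (Xᵢ i)) (λ i → J (prefix (toℕ i))) (λ i → J (prefix (suc (toℕ i)))) (λ _ → D ^ D)
        (J (prefix 0)) (J (prefix n)) (λ i → J≢0 (prefix (toℕ i)))
        (λ i → two-step (Xᵢ i) (prefix (toℕ i)) (prefix (suc (toℕ i)))
          (λ ω ω′ e → take-suc⁺ i (proj₁ ω) (proj₁ ω′) (cong proj₂ e) (cong proj₁ e))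
          (λ ω ω′ e → let (p , l) = take-suc⁻ i (proj₁ ω) (proj₁ ω′) e in cong₂ _,_ l p))
        (∏-telescope n (λ j → J (prefix j))))

    subadditive-y : ∏ᵢ (λ i → J (Yᵢ i)) * D ^ D ≤ J (suffix 0) * (D ^ D) ^ n
    subadditive-y = subst₂ _≤_
      (cong (∏ᵢ (λ i → J (Yᵢ i)) *_)
        (constant-J (suffix n) (λ ω ω′ → trans (drop-all (proj₂ ω)) (sym (drop-all (proj₂ ω′))))))
      (cong (J (suffix 0) *_) (∏ᵢ-const (D ^ D)))
      (telescope-≤ (λ i → J (Yᵢ i)) (λ i → J (suffix (suc (toℕ i)))) (λ i → J (suffix (toℕ i))) (λ _ → D ^ D)
        (J (suffix n)) (J (suffix 0)) (λ i → J≢0 (suffix (suc (toℕ i))))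
        (λ i → two-step (Yᵢ i) (suffix (suc (toℕ i))) (suffix (toℕ i))
          (λ ω ω′ e → drop-suc⁺ i (proj₂ ω) (proj₂ ω′) (cong proj₂ e) (cong proj₁ e))
          (λ ω ω′ e → let (q , l) = drop-suc⁻ i (proj₂ ω) (proj₂ ω′) e in cong₂ _,_ l q))
        (sym (∏-telescope n (λ j → J (suffix j)))))

    S : ℕ
    S = ∑ xs λ x → ∑ ys λ y → μ x y

    W-product : W ≡ ∏ᵢ (λ i → 𝔾 (P i))
    W-product = trans (𝔾-cong λ ω 1≤w → trans (cong (∏ (fins n) (λ i → P i ω) *_)
        (𝟙-yes (correct? ω) (sound-weight ω 1≤w))) (*-identityʳ _))
      (𝔾-∏ (fins n) P)

    -- For each copy the conditioned law of (x_i, y_i) has nonnegative divergence from `μ`; on the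
    -- support of `w` its logarithm is the sum over the copies.
    gibbs-copies : W * (D ^ D) ^ n ≤ ∏ᵢ (λ i → J (AB i 0)) * (S ^ D) ^ n
    gibbs-copies = subst₂ _≤_
      (trans (∏-* {f = λ i → 𝔾 (P i)} {λ _ → D ^ D} (fins n)) (cong₂ _*_ (sym W-product) (∏ᵢ-const (D ^ D))))
      (trans (∏-* {f = λ i → J (AB i 0)} {λ _ → S ^ D} (fins n))
        (cong (∏ᵢ (λ i → J (AB i 0)) *_) (∏ᵢ-const (S ^ D))))
      (∏-mono (fins n) λ i → subst₂ (λ a b → 𝔾 (P i) * D ^ D ≤ a * b ^ D)
        (J-cong (Xᵢ i ⊗ Yᵢ i) (AB i 0) (λ ω ω′ e → cong (λ (a , b) → a , b , _) e)
          (λ ω ω′ e → cong (λ (a , b , _) → a , b) e))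
        (∑-cartesianProductWith _,_ xs ys)
        (gibbs (Xᵢ i ⊗ Yᵢ i) (λ (x , y) → μ x y) (cartesianProductWith _,_ xs ys)
          (λ ω → ∈-cartesianProductWith⁺ _,_ (∈xs _) (∈ys _))))

    B : ℕ
    B = length (shortWords c)

    -- The transcript takes at most `B` values, so adjoining it raises the entropy of x by at most
    -- log B.
    few-x : J (prefix n) ≤ U n r * B ^ D
    few-x = ≤-trans (J-few-labels (prefix n) (H r) (shortWords c)
        (λ ω → ∈-shortWords c _ (≤-trans (length-sent r t (inputs ω)) (short (inputs ω)))))
      (≤-reflexive (cong (_* B ^ D) (J-cong (prefix n ⊗ H r) (u n ⊗ H r)
        (λ ω ω′ e → cong₂ _,_ (cong₂ _,_ (cong proj₁ e)
          (trans (drop-all (proj₂ ω)) (sym (drop-all (proj₂ ω′))))) (cong proj₂ e))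
        (λ ω ω′ e → cong (λ ((p , _) , h) → p , h) e))))

    few-y : J (suffix 0) ≤ U 0 r * B ^ D
    few-y = ≤-trans (J-few-labels (suffix 0) (H r) (shortWords c)
        (λ ω → ∈-shortWords c _ (≤-trans (length-sent r t (inputs ω)) (short (inputs ω)))))
      (≤-reflexive (cong (_* B ^ D) (J-cong (suffix 0 ⊗ H r) (u 0 ⊗ H r)
        (λ ω ω′ e → cong (λ (q , h) → (_ , q) , h) e)
        (λ ω ω′ e → cong (λ ((_ , q) , h) → q , h) e))))

    -- The first message does not change what x determines.
    x-first : U n 1 ≡ J (prefix n)
    x-first = J-cong (u n ⊗ H 1) (prefix n) (λ ω ω′ e → cong (λ ((p , _) , _) → p) e)
      (λ ω ω′ e → cong₂ _,_ (cong₂ _,_ e (trans (drop-all (proj₂ ω)) (sym (drop-all (proj₂ ω′)))))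
        (sent-suc 0 t (inputs ω) (inputs ω′) (x-determined ω ω′ e) refl))

    -- The first round is separated because the public parts enter there; the other rounds are
    -- `σ-telescope`.
    ∏σ : ∏σ⁺ r 0 alice * ∏ᵢ (λ i → J (Xᵢ i)) ≡ ∏σ⁻ r 0 alice * (J (prefix n) * I r)
    ∏σ = begin
      ∏σ⁺ r 0 alice * x
        ≡⟨ cong (_* x) (trans (∏σ⁺-suc s 0 alice) (cong (_* ∏σ⁺ s 1 bob) (∏-side alice 0))) ⟩
      U n 1 * I 1 * ∏σ⁺ s 1 bob * x       ≡⟨ shuffle₁ (U n 1) (I 1) (∏σ⁺ s 1 bob) x ⟩
      x * (U n 1 * (∏σ⁺ s 1 bob * I 1))
        ≡⟨ cong₂ (λ a b → x * (a * b)) x-first (σ-telescope s 0 bob refl) ⟩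
      x * (J (prefix n) * (∏σ⁻ s 1 bob * I (s + 1)))
        ≡⟨ cong (λ l → x * (J (prefix n) * (∏σ⁻ s 1 bob * I l))) (+-comm s 1) ⟩
      x * (J (prefix n) * (∏σ⁻ s 1 bob * I r)) ≡⟨ shuffle₂ x (J (prefix n)) (∏σ⁻ s 1 bob) (I r) ⟩
      x * ∏σ⁻ s 1 bob * (J (prefix n) * I r)
        ≡⟨ cong (_* (J (prefix n) * I r)) (trans
             (cong (_* ∏σ⁻ s 1 bob) (sym (∏-cong (fins n) (λ i → forget i (Xᵢ i)))))
             (sym (∏σ⁻-suc s 0 alice))) ⟩
      ∏σ⁻ r 0 alice * (J (prefix n) * I r) ∎
      where
      open ≡-Reasoning
      x = ∏ᵢ (λ i → J (Xᵢ i))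
      shuffle₁ : ∀ a b c d → a * b * c * d ≡ d * (a * (c * b))
      shuffle₁ = solve-∀
      shuffle₂ : ∀ a b c d → a * (b * (c * d)) ≡ a * c * (b * d)
      shuffle₂ = solve-∀

    ∏ρ : ∏ρ⁺ r 0 alice * (∏ᵢ (λ i → J (Yᵢ i)) * J (prefix n)) ≡ ∏ρ⁻ r 0 alice * (I r * (U 0 r * U n r))
    ∏ρ = begin
      ∏ρ⁺ r 0 alice * (y * J (prefix n))
        ≡⟨ cong₂ (λ a b → a * (y * b))
             (trans (∏ρ⁺-suc s 0 alice) (cong (_* ∏ρ⁺ s 1 bob) (∏-side bob 0))) (sym x-first) ⟩
      U 0 1 * I 1 * ∏ρ⁺ s 1 bob * (y * U n 1)   ≡⟨ shuffle (U 0 1) (I 1) (∏ρ⁺ s 1 bob) y (U n 1) ⟩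
      y * (∏ρ⁺ s 1 bob * (I 1 * (U 0 1 * U n 1)))
        ≡⟨ cong (y *_) (ρ-telescope s 0 bob refl) ⟩
      y * (∏ρ⁻ s 1 bob * (I (s + 1) * (U 0 (s + 1) * U n (s + 1))))
        ≡⟨ cong (λ l → y * (∏ρ⁻ s 1 bob * (I l * (U 0 l * U n l)))) (+-comm s 1) ⟩
      y * (∏ρ⁻ s 1 bob * (I r * (U 0 r * U n r)))
        ≡⟨ sym (*-assoc y (∏ρ⁻ s 1 bob) _) ⟩
      y * ∏ρ⁻ s 1 bob * (I r * (U 0 r * U n r))
        ≡⟨ cong (_* (I r * (U 0 r * U n r))) (trans
             (cong (_* ∏ρ⁻ s 1 bob) (sym (∏-cong (fins n) (λ i → forget i (Yᵢ i)))))
             (sym (∏ρ⁻-suc s 0 alice))) ⟩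
      ∏ρ⁻ r 0 alice * (I r * (U 0 r * U n r)) ∎
      where
      open ≡-Reasoning
      y = ∏ᵢ (λ i → J (Yᵢ i))
      shuffle : ∀ a b c y d → a * b * c * (y * d) ≡ y * (c * (b * (a * d)))
      shuffle = solve-∀

    module Bound
      (N e : ℕ) (e-large : 64 * suc s ≤ 2 ^ e)
      (hard : ∀ (τ : Tree (Inputs X Y) Bool alice (suc s)) → (∀ v → bits τ v ≡ s * (2 + 5 * N + e + e) + 1) →
        20 * ∑ xs (λ x → ∑ ys λ y → μ x y * 𝟙 (outcome τ ⟨ x , y ⟩ Bool.≟ f x y)) ≤ 11 * S)
      where

      exceptions : Fin n → ℕ
      exceptions i = Copy.Hard.I i μ f (bit i) (5 * N) e e-large (bit-sound i) hard

      β : ℕ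
      β = ∑ (fins n) exceptions

      ∏₄ : ∀ (a b c d : Fin n → ℕ) → ∏ᵢ (λ i → a i * b i * c i * d i) ≡ ∏ᵢ a * ∏ᵢ b * ∏ᵢ c * ∏ᵢ d
      ∏₄ a b c d = trans (∏-* {f = λ i → a i * b i * c i} {d} (fins n)) (cong (_* ∏ᵢ d) (∏₃ a b c))
        where
        ∏₃ : ∀ (a b c : Fin n → ℕ) → ∏ᵢ (λ i → a i * b i * c i) ≡ ∏ᵢ a * ∏ᵢ b * ∏ᵢ c
        ∏₃ a b c = trans (∏-* {f = λ i → a i * b i} {c} (fins n)) (cong (_* ∏ᵢ c) (∏-* {f = a} {b} (fins n)))

      divergences : W * ∏σ⁺ r 0 alice * ((3 * D) ^ D) ^ n
        ≤ ∏ᵢ (λ i → J (AB i r)) * ∏σ⁻ r 0 alice * ((2 * S) ^ D) ^ n * 32 ^ β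
      divergences = subst₂ _≤_
        (trans (∏-* {f = λ i → 𝔾 (P i) * Copy.Rounds.σ⁺ i r 0 alice} {λ _ → (3 * D) ^ D} (fins n))
          (cong₂ _*_ (trans (∏-* {f = λ i → 𝔾 (P i)} {λ i → Copy.Rounds.σ⁺ i r 0 alice} (fins n))
              (cong (_* ∏σ⁺ r 0 alice) (sym W-product)))
            (∏ᵢ-const ((3 * D) ^ D))))
        (trans (∏₄ (λ i → J (AB i r)) (λ i → Copy.Rounds.σ⁻ i r 0 alice) (λ _ → (2 * S) ^ D) (λ i → 32 ^ exceptions i))
          (cong₂ (λ a b → ∏ᵢ (λ i → J (AB i r)) * ∏σ⁻ r 0 alice * a * b)
            (∏ᵢ-const ((2 * S) ^ D)) (∏-^-∑ (fins n) {exceptions} 32)))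
        (∏-mono (fins n) (λ i → Copy.Hard.divergence i μ f (bit i) (5 * N) e e-large (bit-sound i) hard))

      informations : ∏ᵢ (λ i → J (AB i 0)) * ∏ρ⁺ r 0 alice * 2 ^ (5 * N * β)
        ≤ ∏ᵢ (λ i → J (AB i r)) * ∏ρ⁻ r 0 alice
      informations = subst₂ _≤_
        (trans (∏-* {f = λ i → J (AB i 0) * Copy.Rounds.ρ⁺ i r 0 alice} {λ i → 2 ^ (5 * N * exceptions i)} (fins n))
          (cong₂ _*_ (∏-* {f = λ i → J (AB i 0)} {λ i → Copy.Rounds.ρ⁺ i r 0 alice} (fins n))
            (trans (∏-^-∑ (fins n) {λ i → 5 * N * exceptions i} 2)
              (cong (2 ^_) (∑-*ˡ (fins n) {exceptions} (5 * N))))))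
        (∏-* {f = λ i → J (AB i r)} {λ i → Copy.Rounds.ρ⁻ i r 0 alice} (fins n))
        (∏-mono (fins n) (λ i → Copy.Hard.information i μ f (bit i) (5 * N) e e-large (bit-sound i) hard))

      -- In logarithms, n log(3/2) ≤ log(1/p) + 5 β/D for the success probability p = D/S^n. The
      -- summed divergences are at most the entropy deficiency log(1/p), as `I r` cancels between
      -- `∏σ` and `∏-joint` and the entropy of x is subadditive.
      few-exceptions : D ^ D * ((3 * D) ^ D) ^ n ≤ (D ^ D) ^ n * ((2 * S) ^ D) ^ n * 32 ^ β
      few-exceptions = *-cancelˡ-≤ (J (prefix n) * (W * I r * ∏σ⁻′))
        {{m*n≢0 _ _ {{J≢0 (prefix n)}} {{m*n≢0 _ _ {{m*n≢0 _ _ {{W≢0}} {{I≢0 r}}}} {{σ⁻≢0}}}}}} (begin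
        J (prefix n) * (W * I r * ∏σ⁻′) * (D ^ D * ((3 * D) ^ D) ^ n)
          ≡⟨ shuffle₁ (J (prefix n)) W (I r) ∏σ⁻′ (D ^ D) (((3 * D) ^ D) ^ n) ⟩
        ∏σ⁻′ * (J (prefix n) * I r) * (W * ((3 * D) ^ D) ^ n * D ^ D)
          ≡⟨ cong (_* (W * ((3 * D) ^ D) ^ n * D ^ D)) (sym ∏σ) ⟩
        ∏σ⁺′ * x * (W * ((3 * D) ^ D) ^ n * D ^ D)
          ≡⟨ shuffle₂ ∏σ⁺′ x W (((3 * D) ^ D) ^ n) (D ^ D) ⟩
        W * ∏σ⁺′ * ((3 * D) ^ D) ^ n * (x * D ^ D)
          ≤⟨ *-mono-≤ (≤-trans divergences (*-monoˡ-≤ (32 ^ β) (*-monoˡ-≤ (((2 * S) ^ D) ^ n)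
               (*-monoˡ-≤ ∏σ⁻′ ∏-joint)))) subadditive-x ⟩
        W * I r * ∏σ⁻′ * ((2 * S) ^ D) ^ n * 32 ^ β * (J (prefix n) * (D ^ D) ^ n)
          ≡⟨ shuffle₃ (W * I r * ∏σ⁻′) (((2 * S) ^ D) ^ n) (32 ^ β) (J (prefix n)) ((D ^ D) ^ n) ⟩
        J (prefix n) * (W * I r * ∏σ⁻′) * ((D ^ D) ^ n * ((2 * S) ^ D) ^ n * 32 ^ β) ∎)
        where
        open ≤-Reasoning
        x = ∏ᵢ (λ i → J (Xᵢ i))
        ∏σ⁺′ = ∏σ⁺ r 0 alice
        ∏σ⁻′ = ∏σ⁻ r 0 alice
        σ⁻≢0 : NonZero ∏σ⁻′
        σ⁻≢0 = ∏-≢0 (fins n) (λ i → positive i r 0 alice)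
          where
          positive : ∀ i k j p → NonZero (Copy.Rounds.σ⁻ i k j p)
          positive i zero    j p = _
          positive i (suc k) j p = m*n≢0 _ _ {{J≢0 (Copy.α i p ⊗ Copy.T i j)}} {{positive i k (suc j) (other p)}}
        shuffle₁ : ∀ a w i s d t → a * (w * i * s) * (d * t) ≡ s * (a * i) * (w * t * d)
        shuffle₁ = solve-∀
        shuffle₂ : ∀ s x w t d → s * x * (w * t * d) ≡ w * s * t * (x * d)
        shuffle₂ = solve-∀
        shuffle₃ : ∀ v t b a d → v * t * b * (a * d) ≡ a * v * (d * t * b)
        shuffle₃ = solve-∀

      -- In logarithms, 5 N β/D ≤ log(1/p) + 2 log B. The transcript accounts for log B once with x
      -- and once with y, and the conditioning on success for log(1/p).
      many-bits : 2 ^ (5 * N * β) * D ^ D ≤ (S ^ D) ^ n * (B ^ D * B ^ D)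
      many-bits = *-cancelˡ-≤ (W * (D ^ D) ^ n * (U 0 r * U n r) * (∏ρ⁻′ * I r * k))
        {{m*n≢0 _ _ {{m*n≢0 _ _ {{m*n≢0 _ _ {{W≢0}} {{m^n≢0 (D ^ D) n {{n^n≢0 D}}}}}}
          {{m*n≢0 _ _ {{J≢0 (u 0 ⊗ H r)}} {{J≢0 (u n ⊗ H r)}}}}}}
          {{m*n≢0 _ _ {{m*n≢0 _ _ {{ρ⁻≢0}} {{I≢0 r}}}} {{k≢0}}}}}} (begin
        W * Dⁿ * (U 0 r * U n r) * (∏ρ⁻′ * I r * k) * (z * D ^ D)
          ≡⟨ shuffle₁ W Dⁿ (U 0 r * U n r) ∏ρ⁻′ (I r) k z (D ^ D) ⟩
        W * Dⁿ * (∏ρ⁻′ * (I r * (U 0 r * U n r)) * z * D ^ D * k)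
          ≤⟨ *-monoˡ-≤ (∏ρ⁻′ * (I r * (U 0 r * U n r)) * z * D ^ D * k) gibbs-copies ⟩
        k * (S ^ D) ^ n * (∏ρ⁻′ * (I r * (U 0 r * U n r)) * z * D ^ D * k)
          ≡⟨ cong (λ a → k * (S ^ D) ^ n * (a * z * D ^ D * k)) (sym ∏ρ) ⟩
        k * (S ^ D) ^ n * (∏ρ⁺′ * (y * J (prefix n)) * z * D ^ D * k)
          ≡⟨ shuffle₂ k ((S ^ D) ^ n) ∏ρ⁺′ y (J (prefix n)) z (D ^ D) ⟩
        k * ∏ρ⁺′ * z * (J (prefix n) * (y * D ^ D) * ((S ^ D) ^ n * k))
          ≤⟨ *-mono-≤ (≤-trans informations (*-monoˡ-≤ ∏ρ⁻′ ∏-joint))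
               (*-monoˡ-≤ ((S ^ D) ^ n * k) (*-mono-≤ few-x
                 (≤-trans subadditive-y (*-monoˡ-≤ Dⁿ few-y)))) ⟩
        W * I r * ∏ρ⁻′ * (U n r * B ^ D * (U 0 r * B ^ D * Dⁿ) * ((S ^ D) ^ n * k))
          ≡⟨ shuffle₃ W (I r) ∏ρ⁻′ (U n r) (B ^ D) (U 0 r) Dⁿ ((S ^ D) ^ n) k ⟩
        W * Dⁿ * (U 0 r * U n r) * (∏ρ⁻′ * I r * k) * ((S ^ D) ^ n * (B ^ D * B ^ D)) ∎)
        where
        open ≤-Reasoning
        Dⁿ = (D ^ D) ^ n
        z = 2 ^ (5 * N * β)
        k = ∏ᵢ (λ i → J (AB i 0))
        y = ∏ᵢ (λ i → J (Yᵢ i))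
        ∏ρ⁺′ = ∏ρ⁺ r 0 alice
        ∏ρ⁻′ = ∏ρ⁻ r 0 alice
        k≢0 : NonZero k
        k≢0 = ∏-≢0 (fins n) (λ i → J≢0 (AB i 0))
        ρ⁻≢0 : NonZero ∏ρ⁻′
        ρ⁻≢0 = ∏-≢0 (fins n) (λ i → positive i r 0 alice)
          where
          positive : ∀ i k j p → NonZero (Copy.Rounds.ρ⁻ i k j p)
          positive i zero    j p = _
          positive i (suc k) j p = m*n≢0 _ _ {{J≢0 (Copy.α i (other p) ⊗ Copy.T i j)}} {{positive i k (suc j) (other p)}}
        shuffle₁ : ∀ w d u s i k z e → w * d * u * (s * i * k) * (z * e) ≡ w * d * (s * (i * u) * z * e * k)
        shuffle₁ = solve-∀
        shuffle₂ : ∀ k s p y a z d → k * s * (p * (y * a) * z * d * k) ≡ k * p * z * (a * (y * d) * (s * k))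
        shuffle₂ = solve-∀
        shuffle₃ : ∀ w i s u b v d t k → w * i * s * (u * b * (v * b * d) * (t * k))
                   ≡ w * d * (v * u) * (s * i * k) * (t * (b * b))
        shuffle₃ = solve-∀

      weight-bound : .{{_ : NonZero N}} → 8 * suc c ≤ N * n → 10 ^ n * D ≤ 9 ^ n * S ^ n
      weight-bound = success-bound D S B n N β c few-exceptions many-bits
        (≤-trans (n≤1+n B) (≤-reflexive (length-shortWords c)))

-- Protocols with few leaves against the best constant answer.

module Counting where

  open import Data.Bool.Base using (Bool; true; false)
  import Data.Bool.Properties as Bool
  open import Data.List.Base using (List; []; _∷_; cartesianProductWith)
  open import Data.List.Membership.Propositional using (_∈_)
  open import Data.List.Relation.Unary.Unique.Propositional using (Unique)
  open import Data.Nat.Base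
  open import Data.Nat.Properties hiding (_≟_)
  open import Data.Nat.Tactic.RingSolver using (solve-∀)
  open import Data.Product.Base using (_×_; _,_)
  open import Data.Vec.Base as Vec using (Vec; []; _∷_)
  import Data.Vec.Properties as Vec
  open import Relation.Binary.Definitions using (DecidableEquality)
  open import Relation.Binary.PropositionalEquality
  open import Relation.Nullary.Decidable.Core using (yes; no)
  open Sums
  open import Defs using (Player; Tree; output; send; finish; outcome; bits; mapⁿ)

  -- Serves to replace the enumeration of a power of a finite set by `vectors`, on which induction
  -- over the length is direct.
  ∑-unique-complete : ∀ {A : Set} (_≟_ : DecidableEquality A) {xs ys : List A} →
    Unique xs → (∀ x → x ∈ ys) → ∀ f → ∑ xs f ≤ ∑ ys f
  ∑-unique-complete _≟_ {xs} {ys} unique ∈ys f = begin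
    ∑ xs f                                           ≤⟨ ∑-mono xs once ⟩
    ∑ xs (λ x → ∑ ys λ y → 𝟙 (y ≟ x) * f y)          ≡⟨ ∑-swap xs ys _ ⟩
    ∑ ys (λ y → ∑ xs λ x → 𝟙 (y ≟ x) * f y)          ≤⟨ ∑-mono ys (λ y → ∑-unique-≤ _≟_ (λ _ → f y) y unique) ⟩
    ∑ ys f                                           ∎
    where
    open ≤-Reasoning
    once : ∀ x → f x ≤ ∑ ys (λ y → 𝟙 (y ≟ x) * f y)
    once x = ≤-trans (≤-reflexive (sym (trans (cong (_* f x) (𝟙-yes (x ≟ x) refl)) (*-identityˡ (f x)))))
      (∑-∈ (λ y → 𝟙 (y ≟ x) * f y) (∈ys x))

  module _ {V : Player → Set} {O Ω : Set} (_≟_ : DecidableEquality O)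
    (ωs : List Ω) (inputs : Ω → ∀ p → V p) (answer : Ω → O) where

    success : ∀ {p r} → (Ω → ℕ) → Tree V O p r → ℕ
    success w t = ∑ ωs λ ω → w ω * 𝟙 (outcome t (inputs ω) ≟ answer ω)

    -- There are at most 2 ^ T leaves.
    success-≤ : ∀ {p r} (t : Tree V O p r) w T M → (∀ ω → 1 ≤ w ω → bits t (inputs ω) ≤ T) →
      (∀ o → ∑ ωs (λ ω → w ω * 𝟙 (o ≟ answer ω)) ≤ M) → success w t ≤ 2 ^ T * M
    success-≤ (output o) w T M short fixed = ≤-trans (fixed o)
      (≤-trans (≤-reflexive (sym (*-identityˡ M))) (*-monoˡ-≤ M (≤-trans (≤-reflexive (sym (^-zeroˡ T)))
        (^-monoˡ-≤ T (s≤s z≤n)))))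
    success-≤ (finish t) w T M short fixed = success-≤ t w T M short fixed
    -- No bit is left, so every input that reaches this node has weight 0.
    success-≤ (send b next) w zero M short fixed = ≤-trans (∑-mono ωs (λ ω → none ω)) (≤-trans
        (≤-reflexive (∑-0 ωs)) z≤n)
      where
      none : ∀ ω → w ω * 𝟙 (outcome (send b next) (inputs ω) ≟ answer ω) ≤ 0
      none ω with w ω | short ω
      ... | zero  | _ = z≤n
      ... | suc _ | h with () ← h (s≤s z≤n)
    success-≤ {p} (send b next) w (suc T) M short fixed = begin
      success w (send b next)
        ≡⟨ trans (∑-cong ωs (λ ω → split ω (b (inputs ω p)) refl)) (∑-+ ωs) ⟩
      success (w↾ true) (next true) + success (w↾ false) (next false)
        ≤⟨ +-mono-≤ (part true) (part false) ⟩
      2 ^ T * M + 2 ^ T * M   ≡⟨ double (2 ^ T) M ⟩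
      2 ^ suc T * M           ∎
      where
      open ≤-Reasoning
      w↾ : Bool → Ω → ℕ
      w↾ c ω = w ω * 𝟙 (b (inputs ω p) Bool.≟ c)
      double : ∀ a m → a * m + a * m ≡ 2 * a * m
      double = solve-∀
      hit : Ω → Bool → ℕ
      hit ω c = 𝟙 (outcome (next c) (inputs ω) ≟ answer ω)
      split : ∀ ω c → b (inputs ω p) ≡ c → w ω * hit ω (b (inputs ω p)) ≡
        w ω * 𝟙 (b (inputs ω p) Bool.≟ true) * hit ω true + w ω * 𝟙 (b (inputs ω p) Bool.≟ false) * hit ω false
      split ω true  e rewrite e = lemma (w ω) (hit ω true) (hit ω false)
        where
        lemma : ∀ w h h′ → w * h ≡ w * 1 * h + w * 0 * h′
        lemma = solve-∀
      split ω false e rewrite e = lemma (w ω) (hit ω true) (hit ω false)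
        where
        lemma : ∀ w h h′ → w * h′ ≡ w * 0 * h + w * 1 * h′
        lemma = solve-∀
      part : ∀ c → success (w↾ c) (next c) ≤ 2 ^ T * M
      part c = success-≤ (next c) (w↾ c) T M shorter
        (λ o → ≤-trans (∑-mono ωs (λ ω → *-monoˡ-≤ (𝟙 (o ≟ answer ω)) (≤-trans
          (*-monoʳ-≤ (w ω) (𝟙≤1 (b (inputs ω p) Bool.≟ c))) (≤-reflexive (*-identityʳ (w ω)))))) (fixed o))
        where
        shorter : ∀ ω → 1 ≤ w↾ c ω → bits (next c) (inputs ω) ≤ T
        shorter ω h with b (inputs ω p) Bool.≟ c | short ω
        ... | yes refl | s = s≤s⁻¹ (s (subst (1 ≤_) (*-identityʳ (w ω)) h))
        ... | no _     | _ with () ← subst (1 ≤_) (*-zeroʳ (w ω)) h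

  vectors : ∀ {A : Set} → List A → ∀ n → List (Vec A n)
  vectors xs zero    = [] ∷ []
  vectors xs (suc n) = cartesianProductWith _∷_ xs (vectors xs n)

  weights : ∀ {X Y : Set} → (X × Y → ℕ) → ∀ {n} → Vec X n → Vec Y n → ℕ
  weights μ []      []      = 1
  weights μ (x ∷ v) (y ∷ v′) = μ (x , y) * weights μ v v′

  module _ {X Y : Set} (xs : List X) (ys : List Y) (μ : X × Y → ℕ) (f : X × Y → Bool) (a b : ℕ)
    (constant : ∀ c → a * ∑ xs (λ x → ∑ ys λ y → μ (x , y) * 𝟙 (c Bool.≟ f (x , y))) ≤ b)
    where

    private
      _≟_ : ∀ {n} → DecidableEquality (Vec Bool n)
      _≟_ = Vec.≡-dec Bool._≟_

    -- For a fixed answer the weight of success is a product over the coordinates.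
    constant-power : ∀ n (z : Vec Bool n) →
      a ^ n * ∑ (vectors xs n) (λ v → ∑ (vectors ys n) λ v′ → weights μ v v′ * 𝟙 (z ≟ mapⁿ f n (v , v′))) ≤ b ^ n
    constant-power zero    []      = ≤-refl
    constant-power (suc n) (c ∷ z) = begin
      a * a ^ n * ∑ (vectors xs (suc n)) (λ v → ∑ (vectors ys (suc n)) λ v′ →
          weights μ v v′ * 𝟙 ((c ∷ z) ≟ mapⁿ f (suc n) (v , v′)))
        ≡⟨ cong (a * a ^ n *_) (trans (∑-cartesianProductWith _∷_ xs (vectors xs n)) (∑-cong xs λ x →
             ∑-cong (vectors xs n) λ v → ∑-cartesianProductWith _∷_ ys (vectors ys n))) ⟩
      a * a ^ n * ∑ xs (λ x → ∑ (vectors xs n) λ v → ∑ ys λ y → ∑ (vectors ys n) λ v′ →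
          μ (x , y) * weights μ v v′ * 𝟙 ((c ∷ z) ≟ (f (x , y) ∷ mapⁿ f n (v , v′))))
        ≤⟨ *-monoʳ-≤ (a * a ^ n) (∑-mono xs λ x → ∑-mono (vectors xs n) λ v → ∑-mono ys λ y →
             ∑-mono (vectors ys n) λ v′ → split x v y v′) ⟩
      a * a ^ n * ∑ xs (λ x → ∑ (vectors xs n) λ v → ∑ ys λ y → ∑ (vectors ys n) λ v′ → h x y * H v v′)
        ≡⟨ cong (a * a ^ n *_) (∑-cong xs λ x → trans (∑-cong (vectors xs n) λ v →
             trans (∑-cong ys λ y → ∑-*ˡ (vectors ys n) (h x y)) (∑-*ʳ ys (∑ (vectors ys n) (H v))))
             (∑-*ˡ (vectors xs n) (∑ ys (h x)))) ⟩
      a * a ^ n * ∑ xs (λ x → ∑ ys (h x) * ∑ (vectors xs n) (λ v → ∑ (vectors ys n) (H v)))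
        ≡⟨ cong (a * a ^ n *_) (∑-*ʳ xs _) ⟩
      a * a ^ n * (∑ xs (λ x → ∑ ys (h x)) * ∑ (vectors xs n) (λ v → ∑ (vectors ys n) (H v)))
        ≡⟨ interchange a (a ^ n) _ _ ⟩
      a * ∑ xs (λ x → ∑ ys (h x)) * (a ^ n * ∑ (vectors xs n) (λ v → ∑ (vectors ys n) (H v)))
        ≤⟨ *-mono-≤ (constant c) (constant-power n z) ⟩
      b * b ^ n ∎
      where
      open ≤-Reasoning
      h : X → Y → ℕ
      h x y = μ (x , y) * 𝟙 (c Bool.≟ f (x , y))
      H : Vec X n → Vec Y n → ℕ
      H v v′ = weights μ v v′ * 𝟙 (z ≟ mapⁿ f n (v , v′))
      interchange : ∀ a b c d → a * b * (c * d) ≡ a * c * (b * d)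
      interchange = solve-∀
      split : ∀ x v y v′ → μ (x , y) * weights μ v v′ * 𝟙 ((c ∷ z) ≟ (f (x , y) ∷ mapⁿ f n (v , v′))) ≤ h x y * H v v′
      split x v y v′ with (c ∷ z) ≟ (f (x , y) ∷ mapⁿ f n (v , v′))
      ... | no _  = ≤-trans (≤-reflexive (*-zeroʳ (μ (x , y) * weights μ v v′))) z≤n
      ... | yes e = ≤-reflexive (trans (regroup (μ (x , y)) (weights μ v v′)) (cong₂ (λ i j → μ (x , y) * i * (weights μ v v′ * j))
          (sym (𝟙-yes (c Bool.≟ f (x , y)) (Vec.∷-injectiveˡ e)))
          (sym (𝟙-yes (z ≟ mapⁿ f n (v , v′)) (Vec.∷-injectiveʳ e)))))
        where
        regroup : ∀ m w → m * w * 1 ≡ m * 1 * (w * 1)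
        regroup = solve-∀

-- The theorem for integer masses and deterministic protocols.

module DirectProduct where

  open import Data.Bool.Base using (Bool)
  import Data.Bool.Properties as Bool
  open import Data.Fin.Base using (Fin; zero; suc)
  import Data.Fin.Properties as Fin
  open import Data.List.Base as List using (List; []; _∷_; cartesianProductWith)
  open import Data.List.Membership.Propositional using (_∈_)
  open import Data.List.Membership.Propositional.Properties using (∈-cartesianProductWith⁺)
  import Data.List.Relation.Unary.Any as Any
  import Data.List.Relation.Unary.Any.Properties as Any
  open import Data.Nat.Base
  open import Data.Nat.Properties hiding (_≟_)
  open import Data.Nat.Tactic.RingSolver using (solve-∀)
  open import Data.Product.Base using (∃-syntax; _×_; _,_; proj₁; proj₂)
  open import Data.Sum.Base using (_⊎_; inj₁; inj₂)
  open import Data.Vec.Base using (Vec; []; _∷_; lookup)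
  open import Relation.Binary.Definitions using (DecidableEquality)
  open import Relation.Binary.PropositionalEquality
  open import Relation.Nullary.Decidable.Core using (yes; no)
  open Sums
  open Simulation
  open MultiCopy
  open Counting
  open import Defs using (alice; Tree; output; finish; outcome; bits; mapⁿ; FinSet; Carrier; elements; complete; unique; _×ᶠ_; _^ᶠ_; _≟ⁿ_)

  -- Equality is decided by positions in the enumeration, from which the elements can be looked up
  -- again.
  finSet-≟ : (A : FinSet) → DecidableEquality (Carrier A)
  finSet-≟ A x y with Any.index (complete A x) Fin.≟ Any.index (complete A y)
  ... | no  i≢j = no λ { refl → i≢j refl }
  ... | yes i≡j = yes (trans (Any.lookup-index (complete A x))
          (trans (cong (List.lookup (elements A)) i≡j) (sym (Any.lookup-index (complete A y)))))

  weights-∏ : ∀ {X Y : Set} (μ : X × Y → ℕ) {n} (v : Vec X n) (v′ : Vec Y n) →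
    weights μ v v′ ≡ ∏ (fins n) (λ i → μ (lookup v i , lookup v′ i))
  weights-∏ μ []      []       = refl
  weights-∏ μ {suc n} (x ∷ v) (y ∷ v′) = cong (μ (x , y) *_)
    (trans (weights-∏ μ v v′) (sym (∏-map suc (fins n))))

  lookup-mapⁿ : ∀ {X Y : Set} (f : X × Y → Bool) {n} (v : Vec X n) (v′ : Vec Y n) i →
    lookup (mapⁿ f n (v , v′)) i ≡ f (lookup v i , lookup v′ i)
  lookup-mapⁿ f (x ∷ v) (y ∷ v′) zero    = refl
  lookup-mapⁿ f (x ∷ v) (y ∷ v′) (suc i) = lookup-mapⁿ f v v′ i

  ∈-vectors : ∀ {A : Set} {xs : List A} → (∀ x → x ∈ xs) → ∀ {n} (v : Vec A n) → v ∈ vectors xs n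
  ∈-vectors ∈xs []      = Any.here refl
  ∈-vectors ∈xs (x ∷ v) = ∈-cartesianProductWith⁺ _∷_ (∈xs x) (∈-vectors ∈xs v)

  -- Two copies pay for one bit: 2 · 11^2 = 242 is at most 18^2 = 324. Thus `2 ^ T` leaves raise the
  -- rate 11/20 to at most 9/10.
  2^T*11^n≤18^n : ∀ T n → T + T ≤ n → 2 ^ T * 11 ^ n ≤ 18 ^ n
  2^T*11^n≤18^n T n h with m≤n⇒∃[o]m+o≡n h
  ... | o , refl = begin
    2 ^ T * 11 ^ (T + T + o)            ≡⟨ cong (2 ^ T *_) (expand 11) ⟩
    2 ^ T * (11 ^ T * 11 ^ T * 11 ^ o)  ≡⟨ shuffle (2 ^ T) (11 ^ T) (11 ^ o) ⟩
    2 ^ T * 11 ^ T * 11 ^ T * 11 ^ o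
      ≡⟨ cong (_* 11 ^ o) (trans (cong (_* 11 ^ T) (sym (^-distribʳ-* 2 11 T))) (sym (^-distribʳ-* 22 11 T))) ⟩
    242 ^ T * 11 ^ o                    ≤⟨ *-mono-≤ (^-monoˡ-≤ T (m≤m+n 242 82)) (^-monoˡ-≤ o (m≤m+n 11 7)) ⟩
    324 ^ T * 18 ^ o                    ≡⟨ cong (_* 18 ^ o) (^-distribʳ-* 18 18 T) ⟩
    18 ^ T * 18 ^ T * 18 ^ o            ≡⟨ sym (expand 18) ⟩
    18 ^ (T + T + o)                    ∎
    where
    open ≤-Reasoning
    expand : ∀ a → a ^ (T + T + o) ≡ a ^ T * a ^ T * a ^ o
    expand a = trans (^-distribˡ-+-* a (T + T) o) (cong (_* a ^ o) (^-distribˡ-+-* a T T))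
    shuffle : ∀ a b c → a * (b * b * c) ≡ a * b * b * c
    shuffle = solve-∀

  -- Either the simulation fits into `cost` for suitable parameters, or there is one round with so
  -- few bits that leaves can be counted. The second case covers a cost of 0.
  Affordable : ℕ → ℕ → ℕ → ℕ → Set
  Affordable n s T cost =
    (∃[ N ] ∃[ e ] 1 ≤ N × 8 * suc T ≤ N * n × 64 * suc s ≤ 2 ^ e × s * (2 + 5 * N + e + e) + 1 ≤ cost)
    ⊎ (s ≡ 0 × T + T ≤ n)

  module _ (X Y : FinSet) (f : Carrier X × Carrier Y → Bool) (μ : Carrier X × Carrier Y → ℕ) where

    mass : ℕ
    mass = ∑ (elements (X ×ᶠ Y)) μ

    correct₁ : ∀ {r} → Tree (Inputs (Carrier X) (Carrier Y)) Bool alice r → ℕ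
    correct₁ τ = ∑ (elements (X ×ᶠ Y)) (λ xy → μ xy * 𝟙 (outcome τ ⟨ proj₁ xy , proj₂ xy ⟩ Bool.≟ f xy))

    correctⁿ : ∀ {n r} → Tree (Inputs (Vec (Carrier X) n) (Vec (Carrier Y) n)) (Vec Bool n) alice r → ℕ
    correctⁿ {n} t = ∑ (elements (X ^ᶠ n ×ᶠ Y ^ᶠ n)) λ ω →
      weights μ (proj₁ ω) (proj₂ ω) * 𝟙 (outcome t ⟨ proj₁ ω , proj₂ ω ⟩ ≟ⁿ mapⁿ f n ω)

    directProduct : ∀ n s T cost .{{_ : NonZero n}}
      (t : Tree (Inputs (Vec (Carrier X) n) (Vec (Carrier Y) n)) (Vec Bool n) alice (suc s)) →
      (∀ v → bits t v ≤ T) →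
      (∀ (τ : Tree (Inputs (Carrier X) (Carrier Y)) Bool alice (suc s)) →
        (∀ v → bits τ v ≤ cost) → 20 * correct₁ τ ≤ 11 * mass) →
      Affordable n s T cost → 10 ^ n * correctⁿ t ≤ 9 ^ n * mass ^ n
    directProduct n@(suc n₁) s T cost t short hard (inj₁ (N , e , 1≤N , bits≤ , rounds≤ , cost≤)) =
      subst₂ (λ a b → 10 ^ n * a ≤ 9 ^ n * b ^ n)
        (∑-cong (elements (X ^ᶠ n ×ᶠ Y ^ᶠ n)) λ (v , v′) → cong (_* _) (sym (weights-∏ μ v v′)))
        (sym mass-≡)
        (Copies.Bound.weight-bound (finSet-≟ X) (finSet-≟ Y) (elements X) (elements Y) (complete X) (complete Y)
          (λ x y → μ (x , y)) (λ x y → f (x , y)) n₁ s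
          (elements (X ^ᶠ n ×ᶠ Y ^ᶠ n)) (complete (X ^ᶠ n ×ᶠ Y ^ᶠ n)) (unique (X ^ᶠ n ×ᶠ Y ^ᶠ n))
          t T short (mapⁿ f n) (λ (v , v′) i → lookup-mapⁿ f v v′ i)
          N e rounds≤ (λ τ cost≡ → subst₂ (λ a b → 20 * a ≤ 11 * b)
            (∑-cartesianProductWith _,_ (elements X) (elements Y)) mass-≡
            (hard τ (λ v → ≤-trans (≤-reflexive (cost≡ v)) cost≤)))
          {{>-nonZero 1≤N}} bits≤)
      where
      mass-≡ : mass ≡ ∑ (elements X) λ x → ∑ (elements Y) λ y → μ (x , y)
      mass-≡ = ∑-cartesianProductWith _,_ (elements X) (elements Y)
    directProduct n zero T cost t short hard (inj₂ (refl , T+T≤n)) = *-cancelˡ-≤ (20 ^ n) {{m^n≢0 20 n}} (begin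
      20 ^ n * (10 ^ n * correctⁿ t)         ≡⟨ swap (20 ^ n) (10 ^ n) (correctⁿ t) ⟩
      10 ^ n * (20 ^ n * correctⁿ t)         ≤⟨ *-monoʳ-≤ (10 ^ n) count ⟩
      10 ^ n * (2 ^ T * (11 * mass) ^ n)
        ≡⟨ cong (10 ^ n *_) (trans (cong (2 ^ T *_) (^-distribʳ-* 11 mass n)) (sym (*-assoc (2 ^ T) (11 ^ n) (mass ^ n)))) ⟩
      10 ^ n * (2 ^ T * 11 ^ n * mass ^ n)
        ≤⟨ *-monoʳ-≤ (10 ^ n) (*-monoˡ-≤ (mass ^ n) (2^T*11^n≤18^n T n T+T≤n)) ⟩
      10 ^ n * (18 ^ n * mass ^ n)
        ≡⟨ trans (sym (*-assoc (10 ^ n) (18 ^ n) (mass ^ n))) (cong (_* mass ^ n)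
             (trans (sym (^-distribʳ-* 10 18 n)) (^-distribʳ-* 20 9 n))) ⟩
      20 ^ n * 9 ^ n * mass ^ n              ≡⟨ *-assoc (20 ^ n) (9 ^ n) (mass ^ n) ⟩
      20 ^ n * (9 ^ n * mass ^ n)            ∎)
      where
      open ≤-Reasoning
      swap : ∀ a b c → a * (b * c) ≡ b * (a * c)
      swap = solve-∀
      ωs = elements (X ^ᶠ n ×ᶠ Y ^ᶠ n)
      all = cartesianProductWith _,_ (vectors (elements X) n) (vectors (elements Y) n)
      M : ℕ
      M = (11 * mass) ^ n
      -- The factor `20 ^ n` keeps the bound (11/20)^n on a constant answer an integer.
      U : Vec (Carrier X) n × Vec (Carrier Y) n → ℕ
      U ω = weights μ (proj₁ ω) (proj₂ ω) * 20 ^ n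
      fixed : ∀ z → ∑ ωs (λ ω → U ω * 𝟙 (z ≟ⁿ mapⁿ f n ω)) ≤ M
      fixed z = begin
        ∑ ωs (λ ω → U ω * 𝟙 (z ≟ⁿ mapⁿ f n ω))
          ≤⟨ ∑-unique-complete (finSet-≟ (X ^ᶠ n ×ᶠ Y ^ᶠ n)) (unique (X ^ᶠ n ×ᶠ Y ^ᶠ n))
               (λ (v , v′) → ∈-cartesianProductWith⁺ _,_ (∈-vectors (complete X) v) (∈-vectors (complete Y) v′))
               (λ ω → U ω * 𝟙 (z ≟ⁿ mapⁿ f n ω)) ⟩
        ∑ all (λ ω → U ω * 𝟙 (z ≟ⁿ mapⁿ f n ω))
          ≡⟨ trans (∑-cong all λ ω → shuffle (weights μ (proj₁ ω) (proj₂ ω)) (20 ^ n) (𝟙 (z ≟ⁿ mapⁿ f n ω)))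
               (trans (∑-*ˡ all (20 ^ n)) (cong (20 ^ n *_)
                 (∑-cartesianProductWith _,_ (vectors (elements X) n) (vectors (elements Y) n)))) ⟩
        20 ^ n * ∑ (vectors (elements X) n) (λ v → ∑ (vectors (elements Y) n) λ v′ →
            weights μ v v′ * 𝟙 (z ≟ⁿ mapⁿ f n (v , v′)))
          ≤⟨ constant-power (elements X) (elements Y) μ f 20 (11 * mass) (λ c → subst (λ a → 20 * a ≤ 11 * mass)
               (∑-cartesianProductWith _,_ (elements X) (elements Y))
               -- A constant answer is a protocol with one empty message, so hardness applies to it
               -- at any cost.
               (hard (finish (output c)) (λ _ → z≤n))) n z ⟩
        M ∎
        where
        shuffle : ∀ a b c → a * b * c ≡ b * (a * c)
        shuffle = solve-∀
      count : 20 ^ n * correctⁿ t ≤ 2 ^ T * M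
      count = ≤-trans (≤-reflexive (trans (sym (∑-*ˡ ωs (20 ^ n))) (∑-cong ωs λ ω →
          shuffle (20 ^ n) (weights μ (proj₁ ω) (proj₂ ω)) _)))
        (success-≤ _≟ⁿ_ ωs (λ ω → ⟨ proj₁ ω , proj₂ ω ⟩) (mapⁿ f n) t U T M (λ ω _ → short _) fixed)
        where
        shuffle : ∀ a b c → a * (b * c) ≡ b * a * c
        shuffle = solve-∀

-- Rational sums and powers, and common denominators.

module Rationals where

  import Data.Integer.Base as ℤ
  open import Data.List.Base using (List; []; _∷_)
  open import Data.List.Membership.Propositional using (_∈_)
  open import Data.Nat.Base as ℕ using (ℕ; zero; suc)
  import Data.Nat.Properties as ℕ
  open import Data.Rational.Base
  import Data.Rational.Properties as ℚ
  open import Data.Rational.Solver using (module +-*-Solver)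
  open import Relation.Binary.PropositionalEquality
  open Sums using (∑)
  open import Defs using (module CauchyProofs)
  open CauchyProofs public using (nat; nat-+; nat-*; nat-≤; nat-nonneg; nat-pos; 0≤*; 0≤+; 0<*; 0<+; *-mono; +-mono; *-monoˡ; *-monoʳ; inv; inv-pos; *-inv; *-cancel; 0<1; 0≤1)

  module S = +-*-Solver

  private variable
    A B : Set

  -- Turns an inequality into an identity for the ring solver and a visibly nonnegative difference.
  by-diff : ∀ p q d → q - p ≡ d → 0ℚ ≤ d → p ≤ q
  by-diff p q d eq 0≤d = subst₂ _≤_ (ℚ.+-identityʳ p) (trans (cong (p +_) (sym eq)) (restore p q))
    (ℚ.+-monoʳ-≤ p {0ℚ} {d} 0≤d)
    where
    restore : ∀ p q → p + (q - p) ≡ q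
    restore = S.solve 2 (λ p q → p S.:+ (q S.:- p) S.:= q) refl

  diff-≥0 : ∀ p q → p ≤ q → 0ℚ ≤ q - p
  diff-≥0 p q p≤q = subst (_≤ q - p) (ℚ.+-inverseʳ p) (ℚ.+-monoˡ-≤ (- p) {p} {q} p≤q)

  Σ : List A → (A → ℚ) → ℚ
  Σ []       f = 0ℚ
  Σ (x ∷ xs) f = f x + Σ xs f

  Σ-cong : ∀ (xs : List A) {f g : A → ℚ} → (∀ x → f x ≡ g x) → Σ xs f ≡ Σ xs g
  Σ-cong []       h = refl
  Σ-cong (x ∷ xs) h = cong₂ _+_ (h x) (Σ-cong xs h)

  Σ-mono : ∀ (xs : List A) {f g : A → ℚ} → (∀ x → f x ≤ g x) → Σ xs f ≤ Σ xs g
  Σ-mono []               h = ℚ.≤-refl {0ℚ}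
  Σ-mono (x ∷ xs) {f} {g} h = +-mono (f x) (g x) (Σ xs f) (Σ xs g) (h x) (Σ-mono xs h)

  Σ-+ : ∀ (xs : List A) (f g : A → ℚ) → Σ xs (λ x → f x + g x) ≡ Σ xs f + Σ xs g
  Σ-+ []       f g = refl
  Σ-+ (x ∷ xs) f g = trans (cong (f x + g x +_) (Σ-+ xs f g)) (shuffle (f x) (g x) (Σ xs f) (Σ xs g))
    where
    shuffle : ∀ a b c d → a + b + (c + d) ≡ a + c + (b + d)
    shuffle = S.solve 4 (λ a b c d → a S.:+ b S.:+ (c S.:+ d) S.:= a S.:+ c S.:+ (b S.:+ d)) refl

  Σ-*ˡ : ∀ (xs : List A) (f : A → ℚ) c → Σ xs (λ x → c * f x) ≡ c * Σ xs f
  Σ-*ˡ []       f c = sym (ℚ.*-zeroʳ c)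
  Σ-*ˡ (x ∷ xs) f c = trans (cong (c * f x +_) (Σ-*ˡ xs f c)) (sym (ℚ.*-distribˡ-+ c (f x) (Σ xs f)))

  Σ-0 : ∀ (xs : List A) → Σ xs (λ _ → 0ℚ) ≡ 0ℚ
  Σ-0 []       = refl
  Σ-0 (x ∷ xs) = trans (cong (0ℚ +_) (Σ-0 xs)) (ℚ.+-identityˡ 0ℚ)

  Σ-swap : ∀ (xs : List A) (ys : List B) (f : A → B → ℚ) →
           Σ xs (λ x → Σ ys (f x)) ≡ Σ ys (λ y → Σ xs (λ x → f x y))
  Σ-swap []       ys f = sym (Σ-0 ys)
  Σ-swap (x ∷ xs) ys f = trans (cong (Σ ys (f x) +_) (Σ-swap xs ys f)) (sym (Σ-+ ys (f x) _))

  Σ-exchange : ∀ (xs : List A) (ys : List B) (f : A → ℚ) (g : B → ℚ) (h : A → B → ℚ) →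
    Σ xs (λ x → f x * Σ ys (λ y → g y * h x y)) ≡ Σ ys (λ y → g y * Σ xs (λ x → f x * h x y))
  Σ-exchange xs ys f g h = trans (Σ-cong xs λ x → sym (Σ-*ˡ ys _ (f x)))
    (trans (Σ-swap xs ys _) (Σ-cong ys λ y → trans (Σ-cong xs λ x → shuffle (f x) (g y) (h x y)) (Σ-*ˡ xs _ (g y))))
    where
    shuffle : ∀ a b c → a * (b * c) ≡ b * (a * c)
    shuffle = S.solve 3 (λ a b c → a S.:* (b S.:* c) S.:= b S.:* (a S.:* c)) refl

  ∣Σ∣≤ : ∀ (xs : List A) (f : A → ℚ) → ∣ Σ xs f ∣ ≤ Σ xs (λ x → ∣ f x ∣)
  ∣Σ∣≤ []       f = ℚ.≤-refl {0ℚ}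
  ∣Σ∣≤ (x ∷ xs) f = ℚ.≤-trans {∣ f x + Σ xs f ∣} {∣ f x ∣ + ∣ Σ xs f ∣} {∣ f x ∣ + Σ xs (λ x → ∣ f x ∣)}
    (ℚ.∣p+q∣≤∣p∣+∣q∣ (f x) (Σ xs f))
    (ℚ.+-monoʳ-≤ (∣ f x ∣) {∣ Σ xs f ∣} {Σ xs (λ x → ∣ f x ∣)} (∣Σ∣≤ xs f))

  ∣Σ*∣≤ : ∀ (xs : List A) (f g : A → ℚ) b → (∀ x → ∣ g x ∣ ≤ b) →
    ∣ Σ xs (λ x → f x * g x) ∣ ≤ b * Σ xs (λ x → ∣ f x ∣)
  ∣Σ*∣≤ xs f g b h = ℚ.≤-trans {∣ Σ xs (λ x → f x * g x) ∣} {Σ xs (λ x → ∣ f x * g x ∣)} {b * Σ xs (λ x → ∣ f x ∣)}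
    (∣Σ∣≤ xs (λ x → f x * g x))
    (subst (Σ xs (λ x → ∣ f x * g x ∣) ≤_) (Σ-*ˡ xs (λ x → ∣ f x ∣) b)
      (Σ-mono xs λ x → subst₂ _≤_ (sym (ℚ.∣p*q∣≡∣p∣*∣q∣ (f x) (g x))) (ℚ.*-comm (∣ f x ∣) b)
        (*-monoˡ (∣ g x ∣) b (∣ f x ∣) (ℚ.0≤∣p∣ (f x)) (h x))))

  Σ-nat : ∀ (xs : List A) (f : A → ℕ) → Σ xs (λ x → nat (f x)) ≡ nat (∑ xs f)
  Σ-nat []       f = refl
  Σ-nat (x ∷ xs) f = trans (cong (nat (f x) +_) (Σ-nat xs f)) (nat-+ (f x) (∑ xs f))

  infixr 8 _^_

  _^_ : ℚ → ℕ → ℚ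
  p ^ zero  = 1ℚ
  p ^ suc n = p * p ^ n

  ^-nonneg : ∀ p n → 0ℚ ≤ p → 0ℚ ≤ p ^ n
  ^-nonneg p zero    h = 0≤1
  ^-nonneg p (suc n) h = 0≤* p (p ^ n) h (^-nonneg p n h)

  ^-pos : ∀ p n → 0ℚ < p → 0ℚ < p ^ n
  ^-pos p zero    h = 0<1
  ^-pos p (suc n) h = 0<* p (p ^ n) h (^-pos p n h)

  ^-mono : ∀ p q n → 0ℚ ≤ p → p ≤ q → p ^ n ≤ q ^ n
  ^-mono p q zero    0≤p p≤q = ℚ.≤-refl {1ℚ}
  ^-mono p q (suc n) 0≤p p≤q = *-mono p q (p ^ n) (q ^ n) (ℚ.≤-trans {0ℚ} {p} {q} 0≤p p≤q)
    (^-nonneg p n 0≤p) p≤q (^-mono p q n 0≤p p≤q)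

  ^-distrib : ∀ p q n → (p * q) ^ n ≡ p ^ n * q ^ n
  ^-distrib p q zero    = sym (ℚ.*-identityˡ 1ℚ)
  ^-distrib p q (suc n) = trans (cong (p * q *_) (^-distrib p q n)) (shuffle p q (p ^ n) (q ^ n))
    where
    shuffle : ∀ a b c d → a * b * (c * d) ≡ a * c * (b * d)
    shuffle = S.solve 4 (λ a b c d → a S.:* b S.:* (c S.:* d) S.:= a S.:* c S.:* (b S.:* d)) refl

  nat-^ : ∀ a n → nat (a ℕ.^ n) ≡ nat a ^ n
  nat-^ a zero    = refl
  nat-^ a (suc n) = trans (sym (nat-* a (a ℕ.^ n))) (cong (nat a *_) (nat-^ a n))

  module _ {A : Set} (xs : List A) (f : A → ℚ) where

    open import Data.Nat.Divisibility using (_∣_; ∣-trans; m∣m*n; n∣m*n)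
    open import Data.Nat.DivMod using (m/n*n≡m)
    open import Data.List.Relation.Unary.Any using (here; there)
    open Sums using (∏)

    denominator : ℕ
    denominator = ∏ xs (λ x → ↧ₙ (f x))

    denominator≢0 : ℕ.NonZero denominator
    denominator≢0 = go xs
      where
      go : ∀ ys → ℕ.NonZero (∏ ys (λ x → ↧ₙ (f x)))
      go []       = _
      go (y ∷ ys) = ℕ.m*n≢0 (↧ₙ (f y)) (∏ ys (λ x → ↧ₙ (f x))) {{_}} {{go ys}}

    ↧ₙ∣denominator : ∀ {x} → x ∈ xs → ↧ₙ (f x) ∣ denominator
    ↧ₙ∣denominator = go
      where
      go : ∀ {x ys} → x ∈ ys → ↧ₙ (f x) ∣ ∏ ys (λ x → ↧ₙ (f x))
      go {ys = y ∷ ys} (here refl) = m∣m*n (∏ ys (λ x → ↧ₙ (f x)))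
      go {ys = y ∷ ys} (there x∈)  = ∣-trans (go x∈) (n∣m*n (↧ₙ (f y)))

    -- Absolute values are taken because the rational approximations of a nonnegative real may be
    -- negative.
    cleared : A → ℕ
    cleared x = ℤ.∣ ↥ (f x) ∣ ℕ.* (denominator ℕ./ ↧ₙ (f x))

    cleared-≡ : ∀ x → x ∈ xs → nat (cleared x) ≡ nat denominator * ∣ f x ∣
    cleared-≡ x x∈ = begin
      nat (a ℕ.* k)                    ≡⟨ cong nat (ℕ.*-comm a k) ⟩
      nat (k ℕ.* a)                    ≡⟨ sym (nat-* k a) ⟩
      nat k * nat a                    ≡⟨ cong (nat k *_) (sym fraction) ⟩
      nat k * (nat d * ∣ f x ∣)        ≡⟨ sym (ℚ.*-assoc (nat k) (nat d) (∣ f x ∣)) ⟩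
      nat k * nat d * ∣ f x ∣
        ≡⟨ cong (_* ∣ f x ∣) (trans (nat-* k d) (cong nat (m/n*n≡m (↧ₙ∣denominator x∈)))) ⟩
      nat denominator * ∣ f x ∣        ∎
      where
      open ≡-Reasoning
      a = ℤ.∣ ↥ (f x) ∣
      d = ↧ₙ (f x)
      k = denominator ℕ./ d
      fraction : nat d * ∣ f x ∣ ≡ nat a
      fraction = go (f x)
        where
        import Data.Rational.Unnormalised.Base as ℚᵘ
        import Data.Integer.Properties as ℤ
        open CauchyProofs using (ratio-*; natᵘ)
        go : ∀ q → nat (↧ₙ q) * ∣ q ∣ ≡ nat ℤ.∣ ↥ q ∣
        go q@record{} = trans (cong (nat (↧ₙ q) *_) (sym (ℚ.fromℚᵘ-toℚᵘ ∣ q ∣)))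
          (trans (ratio-* (natᵘ (↧ₙ q)) (toℚᵘ ∣ q ∣))
            (ℚ.fromℚᵘ-cong {natᵘ (↧ₙ q) ℚᵘ.* toℚᵘ ∣ q ∣} {natᵘ ℤ.∣ ↥ q ∣} (ℚᵘ.*≡*
              (trans (ℤ.*-identityʳ (ℤ.+ ↧ₙ q ℤ.* ℤ.+ ℤ.∣ ↥ q ∣))
                (trans (ℤ.*-comm (ℤ.+ ↧ₙ q) (ℤ.+ ℤ.∣ ↥ q ∣))
                  (cong (λ e → ℤ.+ ℤ.∣ ↥ q ∣ ℤ.* ℤ.+ e) (sym (ℕ.*-identityˡ (↧ₙ q)))))))))

-- Inequalities between reals as inequalities at all late indices.

module Limits where

  open import Data.List.Base as List using (List; []; _∷_)
  open import Data.Nat.Base as ℕ using (ℕ; zero; suc)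
  import Data.Nat.Properties as ℕ
  open import Data.Product.Base using (∃-syntax; _×_; _,_; proj₁; proj₂)
  open import Data.Rational.Base
  import Data.Rational.Properties as ℚ
  open import Data.Sum.Base using (inj₁; inj₂)
  open import Data.Empty using (⊥-elim)
  open import Relation.Binary.PropositionalEquality
  open import Relation.Nullary.Decidable.Core using (yes; no)
  open Rationals
  open import Defs using (ℝ; seq; cauchy; 0ℝ; 1ℝ; FinSet; Carrier; elements; IsDistribution)
  import Defs as ℝ

  0<½* : ∀ ε → 0ℚ < ε → 0ℚ < ½ * ε
  0<½* ε 0<ε = 0<* ½ ε (ℚ.positive⁻¹ ½) 0<ε

  ½-sum : ∀ ε → ½ * ε + ½ * ε ≡ ε
  ½-sum ε = trans (sym (ℚ.*-distribʳ-+ ε ½ ½)) (ℚ.*-identityˡ ε)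

  Eventually : (ℕ → Set) → Set
  Eventually P = ∃[ N ] ∀ m → N ℕ.≤ m → P m

  both : ∀ {P Q : ℕ → Set} → Eventually P → Eventually Q → Eventually (λ m → P m × Q m)
  both (M , p) (N , q) = M ℕ.⊔ N , λ m h → p m (ℕ.m⊔n≤o⇒m≤o M N h) , q m (ℕ.m⊔n≤o⇒n≤o M N h)

  map-eventually : ∀ {P Q : ℕ → Set} → (∀ m → P m → Q m) → Eventually P → Eventually Q
  map-eventually f (N , p) = N , λ m h → f m (p m h)

  p≤∣p∣ : ∀ p → p ≤ ∣ p ∣
  p≤∣p∣ p with ℚ.≤-total 0ℚ p
  ... | inj₁ 0≤p = ℚ.≤-reflexive (sym (ℚ.0≤p⇒∣p∣≡p 0≤p))
  ... | inj₂ p≤0 = ℚ.≤-trans {p} {0ℚ} {∣ p ∣} p≤0 (ℚ.0≤∣p∣ p)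

  -- `x ≤ y` is a negation. If the inequality failed by ε at one late index, the Cauchy property
  -- would leave a gap of ε/2 at all later ones, that is, `y < x`.
  ≤-eventually : ∀ x y → x ℝ.≤ y → ∀ ε → 0ℚ < ε → Eventually (λ m → seq x m ≤ seq y m + ε)
  ≤-eventually x y x≤y ε 0<ε with cauchy (x ℝ.- y) (½ * ε) (0<½* ε 0<ε)
  ... | N , close = N , go
    where
    go : ∀ m → N ℕ.≤ m → seq x m ≤ seq y m + ε
    go m N≤m with seq x m ℚ.≤? seq y m + ε
    ... | yes h = h
    ... | no ¬h = ⊥-elim (x≤y (½ * ε , 0<½* ε 0<ε , N , λ k N≤k → by-diff (½ * ε) (seq x k - seq y k)
        ((½ * ε - (seq x m - seq y m - (seq x k - seq y k))) + (seq x m - (seq y m + (½ * ε + ½ * ε))))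
        (identity (½ * ε) (seq x m) (seq y m) (seq x k) (seq y k))
        (0≤+ (½ * ε - (seq x m - seq y m - (seq x k - seq y k))) (seq x m - (seq y m + (½ * ε + ½ * ε)))
          (diff-≥0 (seq x m - seq y m - (seq x k - seq y k)) (½ * ε)
            (ℚ.≤-trans {seq x m - seq y m - (seq x k - seq y k)} {∣ seq x m - seq y m - (seq x k - seq y k) ∣} {½ * ε}
              (p≤∣p∣ (seq x m - seq y m - (seq x k - seq y k))) (close m k N≤m N≤k)))
          (diff-≥0 (seq y m + (½ * ε + ½ * ε)) (seq x m)
            (subst (λ e → seq y m + e ≤ seq x m) (sym (½-sum ε)) (ℚ.<⇒≤ {seq y m + ε} {seq x m} (ℚ.≰⇒> {seq x m} {seq y m + ε} ¬h)))))))
      where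
      identity : ∀ e a b c d → (c - d) - e ≡ (e - (a - b - (c - d))) + (a - (b + (e + e)))
      identity = S.solve 5 (λ e a b c d → (c S.:- d) S.:- e S.:=
        (e S.:- (a S.:- b S.:- (c S.:- d))) S.:+ (a S.:- (b S.:+ (e S.:+ e)))) refl

  <-eventually : ∀ x y → x ℝ.< y → Eventually (λ m → seq x m < seq y m)
  <-eventually x y (ε , 0<ε , N , h) = N , λ m N≤m → subst₂ _<_ (ℚ.+-identityʳ (seq x m)) (restore (seq x m) (seq y m))
    (ℚ.+-monoʳ-< (seq x m) {0ℚ} {seq y m - seq x m} (ℚ.<-≤-trans {0ℚ} {ε} {seq y m - seq x m} 0<ε (h m N≤m)))
    where
    restore : ∀ p q → p + (q - p) ≡ q
    restore = S.solve 2 (λ p q → p S.:+ (q S.:- p) S.:= q) refl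

  seq-∑ : ∀ (A : FinSet) f m → seq (ℝ.∑ A f) m ≡ Σ (elements A) (λ a → seq (f a) m)
  seq-∑ A f m = go (elements A)
    where
    go : ∀ xs → seq (List.foldr ℝ._+_ 0ℝ (List.map f xs)) m ≡ Σ xs (λ a → seq (f a) m)
    go []       = refl
    go (x ∷ xs) = cong (seq (f x) m +_) (go xs)

  abs-of-almost-nonneg : ∀ p ε → 0ℚ ≤ ε → 0ℚ ≤ p + ε → ∣ p ∣ ≤ p + (ε + ε)
  abs-of-almost-nonneg p ε 0≤ε h with ℚ.∣p∣≡p∨∣p∣≡-p p
  ... | inj₁ eq = subst (_≤ p + (ε + ε)) (sym eq) (subst (_≤ p + (ε + ε)) (ℚ.+-identityʳ p)
          (ℚ.+-monoʳ-≤ p {0ℚ} {ε + ε} (0≤+ ε ε 0≤ε 0≤ε)))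
  ... | inj₂ eq = subst (_≤ p + (ε + ε)) (sym eq) (by-diff (- p) (p + (ε + ε)) ((p + ε) + (p + ε))
          (identity p ε) (0≤+ (p + ε) (p + ε) h h))
    where
    identity : ∀ p e → (p + (e + e)) - - p ≡ (p + e) + (p + e)
    identity = S.solve 2 (λ p e → (p S.:+ (e S.:+ e)) S.:- (S.:- p) S.:= (p S.:+ e) S.:+ (p S.:+ e)) refl

  module _ {A : Set} (μ : A → ℝ) where

    abs-sum-eventually : (∀ a → 0ℝ ℝ.≤ μ a) → ∀ xs ε → 0ℚ < ε →
      Eventually (λ m → Σ xs (λ a → ∣ seq (μ a) m ∣) ≤ Σ xs (λ a → seq (μ a) m) + ε)
    abs-sum-eventually 0≤μ []       ε 0<ε = 0 , λ m _ → subst (0ℚ ≤_) (sym (ℚ.+-identityˡ ε)) (ℚ.<⇒≤ 0<ε)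
    abs-sum-eventually 0≤μ (x ∷ xs) ε 0<ε = map-eventually combine
        (both (≤-eventually 0ℝ (μ x) (0≤μ x) ε₄ 0<ε₄) (abs-sum-eventually 0≤μ xs (½ * ε) (0<½* ε 0<ε)))
      where
      ε₄ = ½ * (½ * ε)
      0<ε₄ = 0<½* (½ * ε) (0<½* ε 0<ε)
      combine : ∀ m → 0ℚ ≤ seq (μ x) m + ε₄ × Σ xs (λ a → ∣ seq (μ a) m ∣) ≤ Σ xs (λ a → seq (μ a) m) + ½ * ε →
                Σ (x ∷ xs) (λ a → ∣ seq (μ a) m ∣) ≤ Σ (x ∷ xs) (λ a → seq (μ a) m) + ε
      combine m (h , ih) = subst (Σ (x ∷ xs) (λ a → ∣ seq (μ a) m ∣) ≤_)
        (trans (shuffle (seq (μ x) m) ε₄ (Σ xs (λ a → seq (μ a) m)) (½ * ε))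
          (cong (seq (μ x) m + Σ xs (λ a → seq (μ a) m) +_) (trans (cong (_+ ½ * ε) (½-sum (½ * ε))) (½-sum ε))))
        (+-mono (∣ seq (μ x) m ∣) (seq (μ x) m + (ε₄ + ε₄)) (Σ xs (λ a → ∣ seq (μ a) m ∣)) (Σ xs (λ a → seq (μ a) m) + ½ * ε)
          (abs-of-almost-nonneg (seq (μ x) m) ε₄ (ℚ.<⇒≤ 0<ε₄) h) ih)
        where
        shuffle : ∀ a e b f → a + (e + e) + (b + f) ≡ a + b + (e + e + f)
        shuffle = S.solve 4 (λ a e b f → a S.:+ (e S.:+ e) S.:+ (b S.:+ f) S.:= a S.:+ b S.:+ (e S.:+ e S.:+ f)) refl

    uniformly-cauchy : ∀ xs ε → 0ℚ < ε →
      ∃[ N ] ∀ m k → N ℕ.≤ m → N ℕ.≤ k → Σ xs (λ a → ∣ seq (μ a) m - seq (μ a) k ∣) ≤ ε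
    uniformly-cauchy []       ε 0<ε = 0 , λ m k _ _ → ℚ.<⇒≤ 0<ε
    uniformly-cauchy (x ∷ xs) ε 0<ε with cauchy (μ x) (½ * ε) (0<½* ε 0<ε) | uniformly-cauchy xs (½ * ε) (0<½* ε 0<ε)
    ... | M , p | N , q = M ℕ.⊔ N , λ m k hm hk →
      subst (Σ (x ∷ xs) (λ a → ∣ seq (μ a) m - seq (μ a) k ∣) ≤_) (½-sum ε)
        (+-mono (∣ seq (μ x) m - seq (μ x) k ∣) (½ * ε) (Σ xs (λ a → ∣ seq (μ a) m - seq (μ a) k ∣)) (½ * ε)
          (p m k (ℕ.m⊔n≤o⇒m≤o M N hm) (ℕ.m⊔n≤o⇒m≤o M N hk)) (q m k (ℕ.m⊔n≤o⇒n≤o M N hm) (ℕ.m⊔n≤o⇒n≤o M N hk)))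

  module _ (A : FinSet) (μ : Carrier A → ℝ) (isD : IsDistribution A μ) (ε : ℚ) (0<ε : 0ℚ < ε) where

    private
      mass norm : ℕ → ℚ
      mass m = Σ (elements A) (λ a → seq (μ a) m)
      norm m = Σ (elements A) (λ a → ∣ seq (μ a) m ∣)

    mass-≥ : Eventually (λ m → 1ℚ ≤ mass m + ε)
    mass-≥ = map-eventually (λ m h → subst (λ s → 1ℚ ≤ s + ε) (seq-∑ A μ m) h)
      (≤-eventually 1ℝ (ℝ.∑ A μ) (proj₂ (proj₂ isD)) ε 0<ε)

    norm-≤-mass : Eventually (λ m → norm m ≤ mass m + ε)
    norm-≤-mass = abs-sum-eventually μ (proj₁ isD) (elements A) ε 0<ε

    norm-≤ : Eventually (λ m → norm m ≤ 1ℚ + (ε + ε))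
    norm-≤ = map-eventually (λ m (a , b) → subst (norm m ≤_) (ℚ.+-assoc 1ℚ ε ε)
        (ℚ.≤-trans {norm m} {mass m + ε} {1ℚ + ε + ε} a
          (ℚ.+-monoˡ-≤ ε {mass m} {1ℚ + ε} (subst (_≤ 1ℚ + ε) (seq-∑ A μ m) b))))
      (both norm-≤-mass (≤-eventually (ℝ.∑ A μ) 1ℝ (proj₁ (proj₂ isD)) ε 0<ε))

-- Partial sums of the exponential series and a lower bound on exp(-n/1000).

module Exponential where

  open import Data.Nat.Base as ℕ using (ℕ; zero; suc)
  import Data.Nat.Properties as ℕ
  open import Data.Product.Base using (_,_; proj₁; proj₂)
  open import Data.Rational.Base
  import Data.Rational.Properties as ℚ
  import Data.Integer.Base as ℤ
  open import Data.Sum.Base using (inj₁; inj₂)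
  open import Data.Empty using (⊥-elim)
  open import Relation.Binary.PropositionalEquality
  open import Relation.Nullary.Decidable using (from-yes)
  open Rationals
  open Limits
  open import Defs using (fromℚ; fromℕ; cauchy; module CauchyProofs)
  import Defs as ℝ
  open CauchyProofs using (T; E; T-nonneg; E-nonneg; T-abs; T-shift; E-tail; ∣+∣≤; ∣*∣≤; u; u-nonneg; nat-u)

  ≤-+ : ∀ a b → 0ℚ ≤ b → a ≤ a + b
  ≤-+ a b 0≤b = subst (_≤ a + b) (ℚ.+-identityʳ a) (ℚ.+-monoʳ-≤ a {0ℚ} {b} 0≤b)

  -- The sum of T x i * T y j over i < k and i + j + 1 = k + l, that of
  -- T x i * E y (k + l - i) over i < k.
  module _ (x y : ℚ) where

    diagonal triangle : ℕ → ℕ → ℚ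
    diagonal zero    l = 0ℚ
    diagonal (suc k) l = diagonal k (suc l) + T x k * T y l
    triangle zero    l = 0ℚ
    triangle (suc k) l = triangle k (suc l) + T x k * E y (suc l)

    -- The factor equals i + j on every term, and i `T x i` is x times the preceding term by
    -- `T-shift`. Thus part of a row of the binomial expansion is traced to the row before.
    diagonal-step : ∀ k l → nat (suc (k ℕ.+ l)) * diagonal (suc k) (suc l)
                            ≡ x * diagonal k (suc l) + y * diagonal (suc k) l
    diagonal-step zero l = begin
      nat (suc l) * (0ℚ + 1ℚ * T y (suc l))       ≡⟨ lhs (nat (suc l)) (T y (suc l)) 1ℚ ⟩
      1ℚ * (T y (suc l) * nat (suc l))            ≡⟨ cong (1ℚ *_) (T-shift y l) ⟩
      1ℚ * (T y l * y)                            ≡⟨ rhs x y (T y l) 1ℚ ⟩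
      x * 0ℚ + y * (0ℚ + 1ℚ * T y l)              ∎
      where
      open ≡-Reasoning
      lhs : ∀ n t o → n * (0ℚ + o * t) ≡ o * (t * n)
      lhs = S.solve 3 (λ n t o → n S.:* (S.con 0ℚ S.:+ o S.:* t) S.:= o S.:* (t S.:* n)) refl
      rhs : ∀ x y t o → o * (t * y) ≡ x * 0ℚ + y * (0ℚ + o * t)
      rhs = S.solve 4 (λ x y t o → o S.:* (t S.:* y) S.:= x S.:* S.con 0ℚ S.:+ y S.:* (S.con 0ℚ S.:+ o S.:* t)) refl
    diagonal-step (suc k) l = begin
      nat (suc (suc k ℕ.+ l)) * (diagonal (suc k) (suc (suc l)) + tk * sl)
        ≡⟨ ℚ.*-distribˡ-+ (nat (suc (suc k ℕ.+ l))) (diagonal (suc k) (suc (suc l))) (tk * sl) ⟩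
      nat (suc (suc k ℕ.+ l)) * diagonal (suc k) (suc (suc l)) + nat (suc (suc k ℕ.+ l)) * (tk * sl)
        ≡⟨ cong₂ (λ a b → nat a * diagonal (suc k) (suc (suc l)) + b * (tk * sl))
             (cong suc (sym (ℕ.+-suc k l)))
             (trans (cong nat (cong suc (sym (ℕ.+-suc k l)))) (sym (nat-+ (suc k) (suc l)))) ⟩
      nat (suc (k ℕ.+ suc l)) * diagonal (suc k) (suc (suc l)) + (nat (suc k) + nat (suc l)) * (tk * sl)
        ≡⟨ cong₂ _+_ (diagonal-step k (suc l)) (split (nat (suc k)) (nat (suc l)) tk sl) ⟩
      x * diagonal k (suc (suc l)) + y * diagonal (suc k) (suc l) + (tk * nat (suc k) * sl + tk * (sl * nat (suc l)))
        ≡⟨ cong₂ (λ a b → x * diagonal k (suc (suc l)) + y * diagonal (suc k) (suc l) + (a * sl + tk * b))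
             (T-shift x k) (T-shift y l) ⟩
      x * diagonal k (suc (suc l)) + y * diagonal (suc k) (suc l) + (T x k * x * sl + tk * (T y l * y))
        ≡⟨ collect x y (diagonal k (suc (suc l))) (diagonal (suc k) (suc l)) (T x k) sl tk (T y l) ⟩
      x * (diagonal k (suc (suc l)) + T x k * sl) + y * (diagonal (suc k) (suc l) + tk * T y l) ∎
      where
      open ≡-Reasoning
      tk = T x (suc k)
      sl = T y (suc l)
      split : ∀ a b t s → (a + b) * (t * s) ≡ t * a * s + t * (s * b)
      split = S.solve 4 (λ a b t s → (a S.:+ b) S.:* (t S.:* s) S.:= t S.:* a S.:* s S.:+ t S.:* (s S.:* b)) refl
      collect : ∀ x y a b t s t′ s′ → x * a + y * b + (t * x * s + t′ * (s′ * y)) ≡ x * (a + t * s) + y * (b + t′ * s′)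
      collect = S.solve 8 (λ x y a b t s t′ s′ → x S.:* a S.:+ y S.:* b S.:+ (t S.:* x S.:* s S.:+ t′ S.:* (s′ S.:* y))
        S.:= x S.:* (a S.:+ t S.:* s) S.:+ y S.:* (b S.:+ t′ S.:* s′)) refl

    diagonal-end : ∀ k → nat (suc k) * diagonal (suc (suc k)) 0 ≡ (x + y) * diagonal (suc k) 0
    diagonal-end k = begin
      nat (suc k) * (diagonal (suc k) 1 + T x (suc k) * 1ℚ)
        ≡⟨ split (nat (suc k)) (diagonal (suc k) 1) (T x (suc k)) 1ℚ ⟩
      nat (suc k) * diagonal (suc k) 1 + T x (suc k) * nat (suc k) * 1ℚ
        ≡⟨ cong₂ (λ a b → a + b * 1ℚ)
             (trans (cong (λ j → nat (suc j) * diagonal (suc k) 1) (sym (ℕ.+-identityʳ k))) (diagonal-step k 0))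
             (T-shift x k) ⟩
      x * diagonal k 1 + y * diagonal (suc k) 0 + T x k * x * 1ℚ
        ≡⟨ collect x y (diagonal k 1) (T x k) 1ℚ ⟩
      (x + y) * (diagonal k 1 + T x k * 1ℚ) ∎
      where
      open ≡-Reasoning
      split : ∀ n d t o → n * (d + t * o) ≡ n * d + t * n * o
      split = S.solve 4 (λ n d t o → n S.:* (d S.:+ t S.:* o) S.:= n S.:* d S.:+ t S.:* n S.:* o) refl
      collect : ∀ x y d t o → x * d + y * (d + t * o) + t * x * o ≡ (x + y) * (d + t * o)
      collect = S.solve 5 (λ x y d t o → x S.:* d S.:+ y S.:* (d S.:+ t S.:* o) S.:+ t S.:* x S.:* o
        S.:= (x S.:+ y) S.:* (d S.:+ t S.:* o)) refl

    binomial : ∀ k → diagonal (suc k) 0 ≡ T (x + y) k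
    binomial zero    = refl
    binomial (suc k) = ℚ.≤-antisym (cancel (ℚ.≤-reflexive eq)) (cancel (ℚ.≤-reflexive (sym eq)))
      where
      eq : nat (suc k) * diagonal (suc (suc k)) 0 ≡ nat (suc k) * T (x + y) (suc k)
      eq = trans (diagonal-end k) (trans (cong ((x + y) *_) (binomial k))
        (trans (ℚ.*-comm (x + y) (T (x + y) k)) (trans (sym (T-shift (x + y) k)) (ℚ.*-comm (T (x + y) (suc k)) (nat (suc k))))))
      cancel : ∀ {a b} → nat (suc k) * a ≤ nat (suc k) * b → a ≤ b
      cancel {a} {b} = *-cancel a b (nat (suc k)) (nat-pos k)

    triangle-step : ∀ k l → triangle k (suc l) ≡ triangle k l + diagonal k (suc l)
    triangle-step zero    l = refl
    triangle-step (suc k) l = trans (cong (_+ T x k * (E y (suc l) + T y (suc l))) (triangle-step k (suc l)))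
      (shuffle (triangle k (suc l)) (diagonal k (suc (suc l))) (T x k) (E y (suc l)) (T y (suc l)))
      where
      shuffle : ∀ a b t e s → a + b + t * (e + s) ≡ a + t * e + (b + t * s)
      shuffle = S.solve 5 (λ a b t e s → a S.:+ b S.:+ t S.:* (e S.:+ s) S.:= a S.:+ t S.:* e S.:+ (b S.:+ t S.:* s)) refl

    triangle-sum : ∀ k → triangle k 0 ≡ E (x + y) k
    triangle-sum zero    = refl
    triangle-sum (suc k) = trans (cong₂ (λ a b → a + T x k * b) (triangle-step k 0) (ℚ.+-identityˡ 1ℚ))
      (trans (ℚ.+-assoc (triangle k 0) (diagonal k 1) (T x k * 1ℚ)) (cong₂ _+_ (triangle-sum k) (binomial k)))

  module _ (x y a b : ℚ) (0≤a : 0ℚ ≤ a) (0≤b : 0ℚ ≤ b) (xa : ∣ x ∣ ≤ a) (yb : ∣ y ∣ ≤ b) where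

    -- The difference consists of the terms `T x i * T y j` outside the triangle, and each is
    -- bounded in absolute value by the corresponding term for `a` and `b`.
    product-gap : ∀ k l → ∣ E x k * E y (k ℕ.+ l) - triangle x y k l ∣ ≤ E a k * E b (k ℕ.+ l) - triangle a b k l
    product-gap zero    l = ℚ.≤-reflexive (trans (cong ∣_∣ (vanish (E y l))) (sym (vanish (E b l))))
      where
      vanish : ∀ e → 0ℚ * e - 0ℚ ≡ 0ℚ
      vanish = S.solve 1 (λ e → S.con 0ℚ S.:* e S.:- S.con 0ℚ S.:= S.con 0ℚ) refl
    product-gap (suc k) l = subst (λ L → ∣ (E x k + T x k) * E y L - triangle x y (suc k) l ∣
          ≤ (E a k + T a k) * E b L - triangle a b (suc k) l) (ℕ.+-suc k l)
      (subst₂ (λ p q → ∣ p ∣ ≤ q)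
        (sym (split (E x k) (T x k) (E y L) (triangle x y k (suc l)) (E y (suc l))))
        (sym (split (E a k) (T a k) (E b L) (triangle a b k (suc l)) (E b (suc l))))
        (∣+∣≤ (E x k * E y L - triangle x y k (suc l)) (T x k * (E y L - E y (suc l)))
          (product-gap k (suc l))
          (∣*∣≤ (T x k) (E y L - E y (suc l)) (T-nonneg a 0≤a k) (T-abs x a 0≤a xa k)
            (subst (_≤ E b L - E b (suc l)) (swap (E y (suc l)) (E y L)) (E-tail y b 0≤b yb (suc l) k)))))
      where
      L = k ℕ.+ suc l
      split : ∀ e t p r q → (e + t) * p - (r + t * q) ≡ (e * p - r) + t * (p - q)
      split = S.solve 5 (λ e t p r q → (e S.:+ t) S.:* p S.:- (r S.:+ t S.:* q) S.:= (e S.:* p S.:- r) S.:+ t S.:* (p S.:- q)) refl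
      swap : ∀ p q → ∣ p - q ∣ ≡ ∣ q - p ∣
      swap = CauchyProofs.∣-∣-swap

    E-product : ∀ k → ∣ E x k * E y k - E (x + y) k ∣ ≤ E a k * E b k - E (a + b) k
    E-product k = subst₂ (λ p q → ∣ E x k * E y k - p ∣ ≤ E a k * E b k - q) (triangle-sum x y k) (triangle-sum a b k)
      (subst (λ l → ∣ E x k * E y l - triangle x y k 0 ∣ ≤ E a k * E b l - triangle a b k 0) (ℕ.+-identityʳ k) (product-gap k 0))

  module _ (a b : ℚ) (0≤a : 0ℚ ≤ a) (0≤b : 0ℚ ≤ b) where

    private
      ∣a∣ = CauchyProofs.nonneg-∣∣ a 0≤a
      ∣b∣ = CauchyProofs.nonneg-∣∣ b 0≤b
      0≤TE : ∀ k l → 0ℚ ≤ T a k * E b l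
      0≤TE k l = 0≤* (T a k) (E b l) (T-nonneg a 0≤a k) (E-nonneg b 0≤b l)

    E-+-≤ : ∀ k → E (a + b) k ≤ E a k * E b k
    E-+-≤ k = by-diff (E (a + b) k) (E a k * E b k) (E a k * E b k - E (a + b) k) refl
      (ℚ.≤-trans {0ℚ} {∣ E a k * E b k - E (a + b) k ∣} {E a k * E b k - E (a + b) k}
        (ℚ.0≤∣p∣ (E a k * E b k - E (a + b) k)) (E-product a b a b 0≤a 0≤b ∣a∣ ∣b∣ k))

    triangle-shift : ∀ m k l → triangle a b k (m ℕ.+ l) ≤ triangle a b (m ℕ.+ k) l
    triangle-shift zero    k l = ℚ.≤-refl {triangle a b k l}
    triangle-shift (suc m) k l = ℚ.≤-trans {triangle a b k (suc m ℕ.+ l)} {triangle a b (m ℕ.+ k) (suc l)} {triangle a b (suc m ℕ.+ k) l}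
      (subst (λ j → triangle a b k j ≤ triangle a b (m ℕ.+ k) (suc l)) (ℕ.+-suc m l) (triangle-shift m k (suc l)))
      (≤-+ (triangle a b (m ℕ.+ k) (suc l)) _ (0≤TE (m ℕ.+ k) (suc l)))

    triangle-≥ : ∀ k l → E a k * E b l ≤ triangle a b k l
    triangle-≥ zero    l = ℚ.≤-reflexive (ℚ.*-zeroˡ (E b l))
    triangle-≥ (suc k) l = ℚ.≤-trans {(E a k + T a k) * E b l} {(E a k + T a k) * E b (suc l)} {triangle a b (suc k) l}
      (*-monoˡ (E b l) (E b (suc l)) (E a k + T a k) (E-nonneg a 0≤a (suc k)) (≤-+ (E b l) (T b l) (T-nonneg b 0≤b l)))
      (subst (_≤ triangle a b (suc k) l) (sym (ℚ.*-distribʳ-+ (E b (suc l)) (E a k) (T a k)))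
        (ℚ.+-monoˡ-≤ (T a k * E b (suc l)) {E a k * E b (suc l)} {triangle a b k (suc l)} (triangle-≥ k (suc l))))

    -- For nonnegative terms: the square of index pairs below `k` lies in the triangle of degrees
    -- below 2k.
    E-*-≤ : ∀ k → E a k * E b k ≤ E (a + b) (k ℕ.+ k)
    E-*-≤ k = ℚ.≤-trans {E a k * E b k} {triangle a b k k} {E (a + b) (k ℕ.+ k)} (triangle-≥ k k)
      (subst (triangle a b k k ≤_) (triangle-sum a b (k ℕ.+ k))
        (subst (λ j → triangle a b k j ≤ triangle a b (k ℕ.+ k) 0) (ℕ.+-identityʳ k) (triangle-shift k k 0)))

  factor-nonneg : ∀ p e → 0ℚ ≤ e → 0ℚ < p * e → 0ℚ ≤ p
  factor-nonneg p e 0≤e 0<pe with ℚ.≤-total 0ℚ p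
  ... | inj₁ h = h
  ... | inj₂ h = ⊥-elim (ℚ.<-irrefl {0ℚ} refl (ℚ.<-≤-trans {0ℚ} {p * e} {0ℚ} 0<pe
      (subst (p * e ≤_) (ℚ.*-zeroˡ e) (*-monoʳ p 0ℚ e 0≤e h))))

  E-0 : ∀ k → E 0ℚ (suc k) ≡ 1ℚ
  E-0 zero    = refl
  E-0 (suc k) = trans (cong₂ _+_ (E-0 k) (trans (cong (_* u k) (ℚ.*-zeroʳ (T 0ℚ k))) (ℚ.*-zeroˡ (u k)))) (ℚ.+-identityʳ 1ℚ)

  -- With variables for the constants, rational arithmetic stays symbolic in the proof. `γ` bounds
  -- exp κ from above, and 2a is a lower bound for 1 - β γ.
  module ExpBound (κ β γ a : ℚ) (0≤κ : 0ℚ ≤ κ) (2κ≤1 : κ + κ ≤ 1ℚ) (0<γ : 0ℚ < γ)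
    (E-base : E κ 1 + (T κ 1 + T κ 1) ≤ γ) (0<a : 0ℚ < a) (0<h : 0ℚ < 1ℚ - a)
    (0≤l : 0ℚ ≤ 1ℚ - (a + a)) (l≤1 : 1ℚ - (a + a) ≤ 1ℚ) (0≤βγ : 0ℚ ≤ β * γ) (βγ≤l : β * γ ≤ 1ℚ - (a + a))
    where

    private
      l = 1ℚ - (a + a)

    T-halves : ∀ k → T κ (suc k) + T κ (suc k) ≤ T κ k
    T-halves k = subst₂ _≤_ (collect (T κ k) κ (u k)) (ℚ.*-identityʳ (T κ k))
      (*-monoˡ ((κ + κ) * u k) 1ℚ (T κ k) (T-nonneg κ 0≤κ k)
        (ℚ.≤-trans {(κ + κ) * u k} {(κ + κ) * 1ℚ} {1ℚ}
          (*-monoˡ (u k) 1ℚ (κ + κ) (0≤+ κ κ 0≤κ 0≤κ) u≤1) (subst (_≤ 1ℚ) (sym (ℚ.*-identityʳ (κ + κ))) 2κ≤1)))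
      where
      u≤1 : u k ≤ 1ℚ
      u≤1 = subst₂ _≤_ (ℚ.*-identityˡ (u k)) (nat-u k)
        (*-monoʳ 1ℚ (nat (suc k)) (u k) (u-nonneg k) (nat-≤ {1} {suc k} (ℕ.s≤s ℕ.z≤n)))
      collect : ∀ t a v → t * ((a + a) * v) ≡ t * a * v + t * a * v
      collect = S.solve 3 (λ t a v → t S.:* ((a S.:+ a) S.:* v) S.:= t S.:* a S.:* v S.:+ t S.:* a S.:* v) refl

    -- The terms at least halve, so partial sum plus twice the next term never increases; `E-base`
    -- bounds its first value.
    E-κ-≤ : ∀ k → E κ (suc k) ≤ γ
    E-κ-≤ k = ℚ.≤-trans {E κ (suc k)} {E κ (suc k) + (T κ (suc k) + T κ (suc k))} {γ}
      (≤-+ (E κ (suc k)) (T κ (suc k) + T κ (suc k))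
        (0≤+ (T κ (suc k)) (T κ (suc k)) (T-nonneg κ 0≤κ (suc k)) (T-nonneg κ 0≤κ (suc k))))
      (bounded k)
      where
      bounded : ∀ k → E κ (suc k) + (T κ (suc k) + T κ (suc k)) ≤ γ
      bounded zero    = E-base
      bounded (suc k) = ℚ.≤-trans {E κ (suc (suc k)) + (T κ (suc (suc k)) + T κ (suc (suc k)))}
        {E κ (suc k) + (T κ (suc k) + T κ (suc k))} {γ}
        (subst (E κ (suc (suc k)) + (T κ (suc (suc k)) + T κ (suc (suc k))) ≤_) (ℚ.+-assoc (E κ (suc k)) (T κ (suc k)) (T κ (suc k)))
          (ℚ.+-monoʳ-≤ (E κ (suc k) + T κ (suc k)) {T κ (suc (suc k)) + T κ (suc (suc k))} {T κ (suc k)} (T-halves (suc k))))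
        (bounded k)

    0≤κ* : ∀ n → 0ℚ ≤ κ * nat n
    0≤κ* n = 0≤* κ (nat n) 0≤κ (nat-nonneg n)

    E-κn-≤ : ∀ n k → E (κ * nat n) (suc k) ≤ γ ^ n
    E-κn-≤ zero    k = ℚ.≤-reflexive (trans (cong (λ q → E q (suc k)) (ℚ.*-zeroʳ κ)) (E-0 k))
    E-κn-≤ (suc n) k = subst (λ q → E q (suc k) ≤ γ * γ ^ n) (sym eq)
      (ℚ.≤-trans {E (κ + κ * nat n) (suc k)} {E κ (suc k) * E (κ * nat n) (suc k)} {γ * γ ^ n}
        (E-+-≤ κ (κ * nat n) 0≤κ (0≤κ* n) (suc k))
        (*-mono (E κ (suc k)) γ (E (κ * nat n) (suc k)) (γ ^ n) (ℚ.<⇒≤ 0<γ)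
          (E-nonneg (κ * nat n) (0≤κ* n) (suc k)) (E-κ-≤ k) (E-κn-≤ n k)))
      where
      eq : κ * nat (suc n) ≡ κ + κ * nat n
      eq = trans (cong (κ *_) (sym (nat-+ 1 n))) (trans (ℚ.*-distribˡ-+ κ 1ℚ (nat n))
        (cong (_+ κ * nat n) (ℚ.*-identityʳ κ)))

    βγ-bound : ∀ n → (β * γ) ^ suc n ≤ l
    βγ-bound n = ℚ.≤-trans {(β * γ) ^ suc n} {l * 1ℚ} {l}
      (*-mono (β * γ) (l) ((β * γ) ^ n) 1ℚ 0≤l
        (^-nonneg (β * γ) n 0≤βγ) βγ≤l (below n))
      (ℚ.≤-reflexive (ℚ.*-identityʳ (l)))
      where
      below : ∀ n → (β * γ) ^ n ≤ 1ℚ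
      below zero    = ℚ.≤-refl {1ℚ}
      below (suc n) = *-mono (β * γ) 1ℚ ((β * γ) ^ n) 1ℚ 0≤1 (^-nonneg (β * γ) n 0≤βγ)
        (ℚ.≤-trans {β * γ} {l} {1ℚ} βγ≤l l≤1) (below n)

    -- For q = κ n the product of exp(-q) and exp q is at least 1 - a, and exp q ≤ γ^n, while (β
    -- γ)^n ≤ 1 - 2a. So exp(-q) exceeds β^n by at least a/γ^n, the witness `gap`.
    exp-lower′ : ∀ n .{{_ : ℕ.NonZero n}} → fromℚ (β ^ n) ℝ.< ℝ.exp (ℝ.- (fromℚ κ ℝ.* fromℕ n))
    exp-lower′ n@(suc n₁) = gap , 0<* a (inv g 0<g) 0<a (inv-pos g 0<g) , suc N , λ where
        (suc k) (ℕ.s≤s N≤k) → *-cancel gap (E (- q) (suc k) - β ^ n) g 0<g (bound k (ℕ.m≤n⇒m≤1+n N≤k))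
      where
      -- The truncated product deviates from 1 by at most the part of the series of exp(2q) between
      -- the indices m and 2m; this modulus makes it at most `a`.
      N = proj₁ (cauchy (ℝ.exp (fromℚ (κ * nat n + κ * nat n))) a 0<a)
      close = proj₂ (cauchy (ℝ.exp (fromℚ (κ * nat n + κ * nat n))) a 0<a)
      q = κ * nat n
      0≤q = 0≤κ* n
      g = γ ^ n
      0<g = ^-pos γ n 0<γ
      gap = a * inv g 0<g
      bound : ∀ k → N ℕ.≤ suc k → g * gap ≤ g * (E (- q) (suc k) - β ^ n)
      bound k N≤ = subst (_≤ g * (p - β ^ n)) (sym (CauchyProofs.cancel-inv g a 0<g))
        (by-diff a (g * (p - β ^ n))
          ((p * g - p * e) + (p * e - (1ℚ - a)) + (l - β ^ n * g))
          (identity p g (β ^ n) e a)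
          (0≤+ ((p * g - p * e) + (p * e - (1ℚ - a))) (l - β ^ n * g)
            (0≤+ (p * g - p * e) (p * e - (1ℚ - a))
              (diff-≥0 (p * e) (p * g) (*-monoˡ e g p 0≤p (E-κn-≤ n k)))
              (diff-≥0 (1ℚ - a) (p * e) pe))
            (diff-≥0 (β ^ n * g) l (subst (_≤ l) (^-distrib β γ n) (βγ-bound n₁)))))
        where
        m = suc k
        p = E (- q) m
        e = E q m
        0≤e = E-nonneg q 0≤q m
        identity : ∀ p g b e a → g * (p - b) - a ≡ (p * g - p * e) + (p * e - (1ℚ - a)) + (1ℚ - (a + a) - b * g)
        identity = S.solve 5 (λ p g b e a → g S.:* (p S.:- b) S.:- a S.:=
          (p S.:* g S.:- p S.:* e) S.:+ (p S.:* e S.:- (S.con 1ℚ S.:- a)) S.:+ (S.con 1ℚ S.:- (a S.:+ a) S.:- b S.:* g)) refl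
        near-one : ∣ p * e - 1ℚ ∣ ≤ a
        near-one = subst (λ o → ∣ p * e - o ∣ ≤ a)
          (trans (cong (λ z → E z m) (ℚ.+-inverseˡ q)) (E-0 k))
          (ℚ.≤-trans {∣ p * e - E (- q + q) m ∣} {e * e - E (q + q) m} {a}
            (E-product (- q) q q q 0≤q 0≤q (subst (_≤ q) (sym (ℚ.∣-p∣≡∣p∣ q)) (CauchyProofs.nonneg-∣∣ q 0≤q))
              (CauchyProofs.nonneg-∣∣ q 0≤q) m)
            (ℚ.≤-trans {e * e - E (q + q) m} {E (q + q) (m ℕ.+ m) - E (q + q) m} {a}
              (ℚ.+-monoˡ-≤ (- E (q + q) m) {e * e} {E (q + q) (m ℕ.+ m)} (E-*-≤ q q 0≤q 0≤q m))
              (ℚ.≤-trans {E (q + q) (m ℕ.+ m) - E (q + q) m} {∣ E (q + q) (m ℕ.+ m) - E (q + q) m ∣} {a}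
                (p≤∣p∣ (E (q + q) (m ℕ.+ m) - E (q + q) m))
                (close (m ℕ.+ m) m (ℕ.≤-trans N≤ (ℕ.m≤m+n m m)) N≤))))
        pe : (1ℚ - a) ≤ p * e
        pe = by-diff (1ℚ - a) (p * e) (a - (1ℚ - p * e)) (regroup (p * e) a)
          (diff-≥0 (1ℚ - p * e) a (ℚ.≤-trans {1ℚ - p * e} {∣ p * e - 1ℚ ∣} {a}
            (subst (1ℚ - p * e ≤_) (CauchyProofs.∣-∣-swap 1ℚ (p * e)) (p≤∣p∣ (1ℚ - p * e))) near-one))
          where
          regroup : ∀ x a → x - (1ℚ - a) ≡ a - (1ℚ - x)
          regroup = S.solve 2 (λ x a → x S.:- (S.con 1ℚ S.:- a) S.:= a S.:- (S.con 1ℚ S.:- x)) refl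
        0≤p : 0ℚ ≤ p
        0≤p = factor-nonneg p e 0≤e (ℚ.<-≤-trans {0ℚ} {1ℚ - a} {p * e} 0<h pe)

  -- The constants satisfy 1 + 2/1000 = 501/500 and 19/20 · 501/500 ≤ 1 - 2/50.
  exp-lower : ∀ n .{{_ : ℕ.NonZero n}} →
    fromℚ ((ℤ.+ 19 / 20) ^ n) ℝ.< ℝ.exp (ℝ.- (fromℚ (ℤ.+ 1 / 1000) ℝ.* fromℕ n))
  exp-lower = ExpBound.exp-lower′ (ℤ.+ 1 / 1000) (ℤ.+ 19 / 20) (ℤ.+ 501 / 500) (ℤ.+ 1 / 50)
    (from-yes (0ℚ ℚ.≤? ℤ.+ 1 / 1000)) (from-yes ((ℤ.+ 1 / 1000) + (ℤ.+ 1 / 1000) ℚ.≤? 1ℚ)) (ℚ.positive⁻¹ (ℤ.+ 501 / 500))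
    (from-yes (E (ℤ.+ 1 / 1000) 1 + (T (ℤ.+ 1 / 1000) 1 + T (ℤ.+ 1 / 1000) 1) ℚ.≤? ℤ.+ 501 / 500))
    (ℚ.positive⁻¹ (ℤ.+ 1 / 50)) (ℚ.positive⁻¹ (1ℚ - (ℤ.+ 1 / 50)))
    (from-yes (0ℚ ℚ.≤? 1ℚ - ((ℤ.+ 1 / 50) + (ℤ.+ 1 / 50)))) (from-yes (1ℚ - ((ℤ.+ 1 / 50) + (ℤ.+ 1 / 50)) ℚ.≤? 1ℚ))
    (from-yes (0ℚ ℚ.≤? (ℤ.+ 19 / 20) * (ℤ.+ 501 / 500)))
    (from-yes ((ℤ.+ 19 / 20) * (ℤ.+ 501 / 500) ℚ.≤? 1ℚ - ((ℤ.+ 1 / 50) + (ℤ.+ 1 / 50))))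

-- Fixing the coins of a protocol.

module Averaging where

  open import Data.Bool.Base using (Bool)
  open import Data.List.Base as List using (List; []; _∷_)
  open import Data.List.Membership.Propositional using (_∈_)
  open import Data.List.Relation.Unary.Any using (here; there)
  open import Data.List.Relation.Unary.All using ([])
  open import Data.List.Relation.Unary.AllPairs using ([]; _∷_)
  open import Data.Nat.Base as ℕ using (ℕ; zero; suc)
  import Data.Nat.Properties as ℕ
  open import Data.Product.Base using (_×_; _,_; proj₁; proj₂)
  open import Data.Rational.Base
  import Data.Rational.Properties as ℚ
  open import Data.Empty using (⊥)
  open import Data.Unit.Base using (⊤; tt)
  open import Data.Vec.Base as Vec using (Vec; []; _∷_)
  open import Relation.Binary.PropositionalEquality
  open Simulation using (Inputs; ⟨_,_⟩)
  open Rationals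
  open Limits
  open import Defs using (ℝ; seq; 0ℝ; 1ℝ; FinSet; Carrier; elements; complete; _×ᶠ_; ProbSpace; Outcome; Player; alice; bob; Tree; output; send; finish; outcome; bits; Protocol; max)
  import Defs as ℝ

  module _ {V V′ : Player → Set} {O : Set} (h : ∀ p → V′ p → V p) where

    comap : ∀ {p r} → Tree V O p r → Tree V′ O p r
    comap     (output o)    = output o
    comap {p} (send b next) = send (λ v → b (h p v)) (λ c → comap (next c))
    comap     (finish t)    = finish (comap t)

    outcome-comap : ∀ {p r} (t : Tree V O p r) v v′ → (∀ q → h q (v′ q) ≡ v q) →
                    outcome (comap t) v′ ≡ outcome t v
    outcome-comap     (output o)    v v′ eq = refl
    outcome-comap {p} (send b next) v v′ eq =
      trans (cong (λ a → outcome (comap (next (b a))) v′) (eq p)) (outcome-comap (next (b (v p))) v v′ eq)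
    outcome-comap     (finish t)    v v′ eq = outcome-comap t v v′ eq

    bits-comap : ∀ {p r} (t : Tree V O p r) v v′ → (∀ q → h q (v′ q) ≡ v q) →
                 bits (comap t) v′ ≡ bits t v
    bits-comap     (output o)    v v′ eq = refl
    bits-comap {p} (send b next) v v′ eq =
      cong suc (trans (cong (λ a → bits (comap (next (b a))) v′) (eq p)) (bits-comap (next (b (v p))) v v′ eq))
    bits-comap     (finish t)    v v′ eq = bits-comap t v v′ eq

  ≤-max : ∀ (A : FinSet) f a → f a ℕ.≤ max A f
  ≤-max A f a = go (elements A) (complete A a)
    where
    go : ∀ xs → a ∈ xs → f a ℕ.≤ List.foldr ℕ._⊔_ 0 (List.map f xs)
    go (x ∷ xs) (here refl) = ℕ.m≤m⊔n (f x) _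
    go (x ∷ xs) (there a∈)  = ℕ.≤-trans (go xs a∈) (ℕ.m≤n⊔m (f x) _)

  max-≤ : ∀ (A : FinSet) f k → (∀ a → f a ℕ.≤ k) → max A f ℕ.≤ k
  max-≤ A f k h = go (elements A)
    where
    go : ∀ xs → List.foldr ℕ._⊔_ 0 (List.map f xs) ℕ.≤ k
    go []       = ℕ.z≤n
    go (x ∷ xs) = ℕ.⊔-lub (h x) (go xs)

  nat-cancel-≤ : ∀ a b → nat a ≤ nat b → a ℕ.≤ b
  nat-cancel-≤ a b h = ℕ.≮⇒≥ λ b<a → ℚ.<-irrefl {nat b} refl (ℚ.<-≤-trans {nat b} {nat (suc b)} {nat b}
    (subst₂ _<_ (ℚ.+-identityˡ (nat b)) (nat-+ 1 b) (ℚ.+-monoˡ-< (nat b) {0ℚ} {1ℚ} 0<1))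
    (ℚ.≤-trans {nat (suc b)} {nat a} {nat b} (nat-≤ b<a) h))

  module _ (A : FinSet) (p : Carrier A → ℝ) (m : ℕ) where

    mean : (Carrier A → ℚ) → ℚ
    mean g = Σ (elements A) (λ a → seq (p a) m * g a)

  module _ {X Y : FinSet} {O : Set} {r : ℕ} (π : Protocol X Y O r) where

    open Protocol π
    open ProbSpace

    private
      Ω = space publicCoin
      A = space (privateCoin alice)
      B = space (privateCoin bob)

    fixed : Outcome publicCoin → Outcome (privateCoin alice) → Outcome (privateCoin bob) →
            Tree (Inputs (Carrier X) (Carrier Y)) O alice r
    fixed ω a b = comap (λ { alice x → x , a ; bob y → y , b }) (tree ω)

    outcome-fixed : ∀ ω a b xy → outcome (tree ω) (view xy a b) ≡ outcome (fixed ω a b) ⟨ proj₁ xy , proj₂ xy ⟩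
    outcome-fixed ω a b xy = sym (outcome-comap _ (tree ω) (view xy a b) ⟨ proj₁ xy , proj₂ xy ⟩
      (λ { alice → refl ; bob → refl }))

    bits-fixed : ∀ ω a b v → bits (fixed ω a b) v ℕ.≤ ‖_‖
    bits-fixed ω a b v = ℕ.≤-trans
      (ℕ.≤-reflexive (bits-comap _ (tree ω) (view (v alice , v bob) a b) v (λ { alice → refl ; bob → refl })))
      (ℕ.≤-trans (ℕ.≤-trans (ℕ.≤-trans
        (≤-max B (λ b → bits (tree ω) (view (v alice , v bob) a b)) b)
        (≤-max A (λ a → max B λ b → bits (tree ω) (view (v alice , v bob) a b)) a))
        (≤-max Ω (λ ω → max A λ a → max B λ b → bits (tree ω) (view (v alice , v bob) a b)) ω))
        (≤-max (X ×ᶠ Y) (λ xy → max Ω λ ω → max A λ a → max B λ b → bits (tree ω) (view xy a b)) (v alice , v bob)))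

    seq-expect : ∀ ν φ m → seq (expect ν φ) m ≡
      mean (X ×ᶠ Y) ν m (λ xy → mean Ω (mass publicCoin) m λ ω → mean A (mass (privateCoin alice)) m λ a →
        mean B (mass (privateCoin bob)) m λ b → seq (φ xy (outcome (tree ω) (view xy a b))) m)
    seq-expect ν φ m = trans (seq-∑ (X ×ᶠ Y) _ m) (Σ-cong (elements (X ×ᶠ Y)) λ xy → cong (seq (ν xy) m *_)
      (trans (seq-∑ Ω _ m) (Σ-cong (elements Ω) λ ω → cong (seq (mass publicCoin ω) m *_)
        (trans (seq-∑ A _ m) (Σ-cong (elements A) λ a → cong (seq (mass (privateCoin alice) a) m *_)
          (seq-∑ B _ m))))))

    -- At a single index the masses of a coin are only nearly a distribution, so each of the three
    -- averages costs a factor `t`. The coins are moved outside first, where the bound for fixed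
    -- coins applies.
    expect-≤ : ∀ ν φ m t b → 0ℚ ≤ b → 0ℚ ≤ t →
      Σ (elements Ω) (λ ω → ∣ seq (mass publicCoin ω) m ∣) ≤ t →
      Σ (elements A) (λ a → ∣ seq (mass (privateCoin alice) a) m ∣) ≤ t →
      Σ (elements B) (λ b → ∣ seq (mass (privateCoin bob) b) m ∣) ≤ t →
      (∀ ω α β → ∣ mean (X ×ᶠ Y) ν m (λ xy → seq (φ xy (outcome (tree ω) (view xy α β))) m) ∣ ≤ b) →
      seq (expect ν φ) m ≤ b * t * t * t
    expect-≤ ν φ m t b 0≤b 0≤t tΩ tA tB h = subst (_≤ b * t * t * t) (sym (trans (seq-expect ν φ m) reorder))
      (ℚ.≤-trans {V} {∣ V ∣} {b * t * t * t} (p≤∣p∣ V)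
        (bound Ω (mass publicCoin) (b * t * t) tΩ (0≤* (b * t) t (0≤* b t 0≤b 0≤t) 0≤t) _ λ ω →
          bound A (mass (privateCoin alice)) (b * t) tA (0≤* b t 0≤b 0≤t) _ λ α →
            bound B (mass (privateCoin bob)) b tB 0≤b _ λ β → h ω α β))
      where
      g : Carrier X × Carrier Y → Carrier Ω → Carrier A → Carrier B → ℚ
      g xy ω α β = seq (φ xy (outcome (tree ω) (view xy α β))) m
      V = mean Ω (mass publicCoin) m λ ω → mean A (mass (privateCoin alice)) m λ α →
          mean B (mass (privateCoin bob)) m λ β → mean (X ×ᶠ Y) ν m λ xy → g xy ω α β
      exchange : ∀ (C D : FinSet) c d (h : Carrier C → Carrier D → ℚ) →
        mean C c m (λ x → mean D d m (h x)) ≡ mean D d m (λ y → mean C c m (λ x → h x y))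
      exchange C D c d h = Σ-exchange (elements C) (elements D) (λ x → seq (c x) m) (λ y → seq (d y) m) h
      mean-cong : ∀ (C : FinSet) c {h k : Carrier C → ℚ} → (∀ x → h x ≡ k x) → mean C c m h ≡ mean C c m k
      mean-cong C c e = Σ-cong (elements C) (λ x → cong (seq (c x) m *_) (e x))
      reorder : (mean (X ×ᶠ Y) ν m λ xy → mean Ω (mass publicCoin) m λ ω → mean A (mass (privateCoin alice)) m λ α →
        mean B (mass (privateCoin bob)) m λ β → g xy ω α β) ≡ V
      reorder = trans (exchange (X ×ᶠ Y) Ω ν (mass publicCoin) _) (mean-cong Ω (mass publicCoin) λ ω →
        trans (exchange (X ×ᶠ Y) A ν (mass (privateCoin alice)) _) (mean-cong A (mass (privateCoin alice)) λ α →
          exchange (X ×ᶠ Y) B ν (mass (privateCoin bob)) _))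
      bound : ∀ (C : FinSet) c k → Σ (elements C) (λ x → ∣ seq (c x) m ∣) ≤ t → 0ℚ ≤ k → ∀ h →
        (∀ x → ∣ h x ∣ ≤ k) → ∣ mean C c m h ∣ ≤ k * t
      bound C c k tC 0≤k h hk = ℚ.≤-trans {∣ mean C c m h ∣} {k * Σ (elements C) (λ x → ∣ seq (c x) m ∣)} {k * t}
        (∣Σ*∣≤ (elements C) (λ x → seq (c x) m) h k hk)
        (*-monoˡ (Σ (elements C) (λ x → ∣ seq (c x) m ∣)) t k 0≤k tC)

  ≤-pointwise : ∀ x y → (∀ m → seq y m ≤ seq x m) → y ℝ.≤ x
  ≤-pointwise x y h x<y = contradict (<-eventually x y x<y)
    where
    contradict : Eventually (λ m → seq x m < seq y m) → ⊥
    contradict (N , l) = ℚ.<-irrefl {seq x N} refl (ℚ.<-≤-trans {seq x N} {seq y N} {seq x N} (l N ℕ.≤-refl) (h N))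

  unit : FinSet
  unit = record { Carrier = ⊤ ; elements = tt ∷ [] ; complete = λ _ → here refl ; unique = [] ∷ [] }

  noCoin : ProbSpace
  noCoin = record
    { space = unit
    ; mass  = λ _ → 1ℝ
    ; isDistribution = (λ _ → ≤-pointwise 1ℝ 0ℝ (λ _ → 0≤1)) ,
        ≤-pointwise 1ℝ (ℝ.∑ unit (λ _ → 1ℝ)) (λ _ → ℚ.≤-reflexive (ℚ.+-identityʳ 1ℚ)) ,
        ≤-pointwise (ℝ.∑ unit (λ _ → 1ℝ)) 1ℝ (λ _ → ℚ.≤-reflexive (sym (ℚ.+-identityʳ 1ℚ)))
    }

  deterministic : ∀ {X Y : FinSet} {O r} → Tree (Inputs (Carrier X) (Carrier Y)) O alice r → Protocol X Y O r
  deterministic τ = record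
    { publicCoin  = noCoin
    ; privateCoin = λ _ → noCoin
    ; tree        = λ _ → comap (λ { alice v → proj₁ v ; bob v → proj₁ v }) τ
    }

  module _ {X Y : FinSet} {O : Set} {r : ℕ} (τ : Tree (Inputs (Carrier X) (Carrier Y)) O alice r) where

    open Protocol (deterministic {X} {Y} τ)

    cost-deterministic : ∀ c → (∀ v → bits τ v ℕ.≤ c) → ‖_‖ ℕ.≤ c
    cost-deterministic c h = max-≤ (X ×ᶠ Y) _ c λ xy → max-≤ unit _ c λ ω → max-≤ unit _ c λ a → max-≤ unit _ c λ b →
      ℕ.≤-trans (ℕ.≤-reflexive (bits-comap _ τ ⟨ proj₁ xy , proj₂ xy ⟩ (view xy a b) (λ { alice → refl ; bob → refl })))
        (h ⟨ proj₁ xy , proj₂ xy ⟩)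

    expect-deterministic : ∀ ν φ m → seq (expect ν φ) m ≡
      mean (X ×ᶠ Y) ν m (λ xy → seq (φ xy (outcome τ ⟨ proj₁ xy , proj₂ xy ⟩)) m)
    expect-deterministic ν φ m = trans (seq-expect (deterministic {X} {Y} τ) ν φ m)
      (Σ-cong (elements (X ×ᶠ Y)) λ xy → cong (seq (ν xy) m *_)
        (trans (single _) (trans (single _) (trans (single _)
          (cong (λ o → seq (φ xy o) m) (outcome-comap _ τ ⟨ proj₁ xy , proj₂ xy ⟩ (view xy tt tt)
            (λ { alice → refl ; bob → refl })))))))
      where
      single : ∀ x → 1ℚ * x + 0ℚ ≡ x
      single x = trans (ℚ.+-identityʳ (1ℚ * x)) (ℚ.*-identityˡ x)

-- The communication budget and the choice of parameters.

module Affordability where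

  open import Data.Empty using (⊥)
  import Data.Integer.Base as ℤ
  open import Data.Nat.Base as ℕ using (ℕ; zero; suc)
  open import Data.Nat.DivMod using (m≡m%n+[m/n]*n; m%n<n; m/n*n≤m)
  open import Data.Nat.Logarithm using (⌊log₂_⌋; ⌊log₂⌋-mono-≤; ⌊log₂[2^n]⌋≡n)
  import Data.Nat.Properties as ℕ
  open import Data.Nat.Tactic.RingSolver using (solve-∀)
  open import Data.Product.Base using (_×_; _,_; proj₁; proj₂)
  open import Data.Rational.Base
  import Data.Rational.Properties as ℚ
  open import Data.Sum.Base using (inj₁; inj₂)
  open import Relation.Binary.PropositionalEquality
  open import Relation.Nullary.Decidable using (from-yes)
  open import Relation.Nullary.Negation.Core using (¬_)
  open DirectProduct using (Affordable)
  open Rationals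
  open Limits
  open Averaging using (nat-cancel-≤)
  open import Defs using (ℝ; seq; 1ℝ; fromℚ; fromℕ; log₂; logApprox; module CauchyProofs)
  import Defs as ℝ
  open CauchyProofs using (u; nat-u; over; u-nonneg)

  2^⌊log₂⌋≤ : ∀ r .{{_ : ℕ.NonZero r}} → 2 ℕ.^ ⌊log₂ r ⌋ ℕ.≤ r
  2^⌊log₂⌋≤ r = CauchyProofs.pow-log-≤ r

  <2^1+⌊log₂⌋ : ∀ r → r ℕ.< 2 ℕ.^ suc ⌊log₂ r ⌋
  <2^1+⌊log₂⌋ r = CauchyProofs.<-pow-log r

  -- Every approximation, and not just the limit, is at least the integer part, which can thus
  -- replace `log₂ r` at any index.
  logApprox-≥ : ∀ r .{{_ : ℕ.NonZero r}} k → nat ⌊log₂ r ⌋ ≤ logApprox r k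
  logApprox-≥ r k = subst₂ _≤_ clear (sym (over ⌊log₂ (r ℕ.^ suc k) ⌋ k))
    (*-monoʳ (nat (⌊log₂ r ⌋ ℕ.* suc k)) (nat ⌊log₂ (r ℕ.^ suc k) ⌋) (u k) (u-nonneg k) (nat-≤ power))
    where
    power : ⌊log₂ r ⌋ ℕ.* suc k ℕ.≤ ⌊log₂ (r ℕ.^ suc k) ⌋
    power = subst (ℕ._≤ ⌊log₂ (r ℕ.^ suc k) ⌋) (⌊log₂[2^n]⌋≡n (⌊log₂ r ⌋ ℕ.* suc k)) (⌊log₂⌋-mono-≤
      (subst (ℕ._≤ r ℕ.^ suc k) (ℕ.^-*-assoc 2 ⌊log₂ r ⌋ (suc k)) (ℕ.^-monoˡ-≤ (suc k) (2^⌊log₂⌋≤ r))))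
    clear : nat (⌊log₂ r ⌋ ℕ.* suc k) * u k ≡ nat ⌊log₂ r ⌋
    clear = trans (cong (_* u k) (sym (nat-* ⌊log₂ r ⌋ (suc k)))) (trans (ℚ.*-assoc (nat ⌊log₂ r ⌋) (nat (suc k)) (u k))
      (trans (cong (nat ⌊log₂ r ⌋ *_) (nat-u k)) (ℚ.*-identityʳ (nat ⌊log₂ r ⌋))))

  e-large : ∀ r → 64 ℕ.* r ℕ.≤ 2 ℕ.^ (7 ℕ.+ ⌊log₂ r ⌋)
  e-large r = ℕ.≤-trans (ℕ.*-monoʳ-≤ 64 (ℕ.<⇒≤ (<2^1+⌊log₂⌋ r)))
    (ℕ.≤-reflexive (sym (ℕ.^-distribˡ-+-* 2 6 (suc ⌊log₂ r ⌋))))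

  module _ (n T : ℕ) .{{_ : ℕ.NonZero n}} where

    -- The parameter N of the simulation: N n is at least 8 (T + 1), yet stays of order n + T.
    copies : ℕ
    copies = suc (8 ℕ.* suc T ℕ./ n)

    copies-≥ : 8 ℕ.* suc T ℕ.≤ copies ℕ.* n
    copies-≥ = ℕ.≤-trans (ℕ.≤-reflexive (m≡m%n+[m/n]*n (8 ℕ.* suc T) n))
      (ℕ.+-monoˡ-≤ (8 ℕ.* suc T ℕ./ n ℕ.* n) (ℕ.<⇒≤ (m%n<n (8 ℕ.* suc T) n)))

    copies-≤ : copies ℕ.* n ℕ.≤ n ℕ.+ 8 ℕ.* suc T
    copies-≤ = ℕ.+-monoʳ-≤ n (m/n*n≤m (8 ℕ.* suc T) n)

    cost : ℕ → ℕ
    cost s = s ℕ.* (2 ℕ.+ 5 ℕ.* copies ℕ.+ (7 ℕ.+ ⌊log₂ suc s ⌋) ℕ.+ (7 ℕ.+ ⌊log₂ suc s ⌋)) ℕ.+ 1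

    affordable : ∀ s → Affordable n s T (cost s)
    affordable s = inj₁ (copies , 7 ℕ.+ ⌊log₂ suc s ⌋ , ℕ.s≤s ℕ.z≤n , copies-≥ , e-large (suc s) , ℕ.≤-refl)

    -- With two or more rounds the integer part of log r is at least 1, so all additive constants
    -- are absorbed into r log r times `n`.
    cost-≤ : ∀ s → 1 ℕ.≤ s → 1 ℕ.≤ ⌊log₂ suc s ⌋ →
      n ℕ.* cost s ℕ.≤ 104 ℕ.* (suc s ℕ.* ⌊log₂ suc s ⌋ ℕ.* n) ℕ.+ 40 ℕ.* (suc s ℕ.* T)
    cost-≤ s 1≤s 1≤λ = begin
      n ℕ.* (s ℕ.* (2 ℕ.+ 5 ℕ.* copies ℕ.+ (7 ℕ.+ λ₂) ℕ.+ (7 ℕ.+ λ₂)) ℕ.+ 1) ≡⟨ lhs n s copies λ₂ ⟩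
      s ℕ.* (16 ℕ.* n ℕ.+ 5 ℕ.* (copies ℕ.* n) ℕ.+ 2 ℕ.* (λ₂ ℕ.* n)) ℕ.+ n
        ≤⟨ ℕ.+-monoˡ-≤ n (ℕ.*-monoʳ-≤ s (ℕ.+-monoˡ-≤ (2 ℕ.* (λ₂ ℕ.* n)) (ℕ.+-monoʳ-≤ (16 ℕ.* n) (ℕ.*-monoʳ-≤ 5
             (ℕ.≤-trans copies-≤ (ℕ.≤-reflexive (mid n T)) ))))) ⟩
      s ℕ.* (16 ℕ.* n ℕ.+ 5 ℕ.* (n ℕ.+ 8 ℕ.+ 8 ℕ.* T) ℕ.+ 2 ℕ.* (λ₂ ℕ.* n)) ℕ.+ n
        ≤⟨ ℕ.+-mono-≤ (ℕ.*-mono-≤ (ℕ.n≤1+n s) (ℕ.+-monoˡ-≤ (2 ℕ.* (λ₂ ℕ.* n)) (ℕ.+-mono-≤ (ℕ.*-monoʳ-≤ 16 n≤λn)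
             (ℕ.*-monoʳ-≤ 5 (ℕ.+-monoˡ-≤ (8 ℕ.* T) (ℕ.+-mono-≤ n≤λn (ℕ.*-monoʳ-≤ 8 1≤λn)))))))
           n≤rλn ⟩
      suc s ℕ.* (16 ℕ.* (λ₂ ℕ.* n) ℕ.+ 5 ℕ.* (λ₂ ℕ.* n ℕ.+ 8 ℕ.* (λ₂ ℕ.* n) ℕ.+ 8 ℕ.* T) ℕ.+ 2 ℕ.* (λ₂ ℕ.* n))
        ℕ.+ suc s ℕ.* (λ₂ ℕ.* n)
        ≤⟨ ℕ.m≤m+n _ (40 ℕ.* (suc s ℕ.* (λ₂ ℕ.* n))) ⟩
      suc s ℕ.* (16 ℕ.* (λ₂ ℕ.* n) ℕ.+ 5 ℕ.* (λ₂ ℕ.* n ℕ.+ 8 ℕ.* (λ₂ ℕ.* n) ℕ.+ 8 ℕ.* T) ℕ.+ 2 ℕ.* (λ₂ ℕ.* n))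
        ℕ.+ suc s ℕ.* (λ₂ ℕ.* n) ℕ.+ 40 ℕ.* (suc s ℕ.* (λ₂ ℕ.* n)) ≡⟨ rhs (suc s) λ₂ n T ⟩
      104 ℕ.* (suc s ℕ.* λ₂ ℕ.* n) ℕ.+ 40 ℕ.* (suc s ℕ.* T) ∎
      where
      open ℕ.≤-Reasoning
      λ₂ = ⌊log₂ suc s ⌋
      n≤λn : n ℕ.≤ λ₂ ℕ.* n
      n≤λn = ℕ.≤-trans (ℕ.≤-reflexive (sym (ℕ.*-identityˡ n))) (ℕ.*-monoˡ-≤ n 1≤λ)
      1≤λn : 1 ℕ.≤ λ₂ ℕ.* n
      1≤λn = ℕ.≤-trans (ℕ.>-nonZero⁻¹ n) n≤λn
      n≤rλn : n ℕ.≤ suc s ℕ.* (λ₂ ℕ.* n)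
      n≤rλn = ℕ.≤-trans n≤λn (ℕ.m≤m+n _ _)
      lhs : ∀ n s N l → n ℕ.* (s ℕ.* (2 ℕ.+ 5 ℕ.* N ℕ.+ (7 ℕ.+ l) ℕ.+ (7 ℕ.+ l)) ℕ.+ 1)
        ≡ s ℕ.* (16 ℕ.* n ℕ.+ 5 ℕ.* (N ℕ.* n) ℕ.+ 2 ℕ.* (l ℕ.* n)) ℕ.+ n
      lhs = solve-∀
      mid : ∀ n T → n ℕ.+ 8 ℕ.* suc T ≡ n ℕ.+ 8 ℕ.+ 8 ℕ.* T
      mid = solve-∀
      rhs : ∀ r l n T →
        r ℕ.* (16 ℕ.* (l ℕ.* n) ℕ.+ 5 ℕ.* (l ℕ.* n ℕ.+ 8 ℕ.* (l ℕ.* n) ℕ.+ 8 ℕ.* T) ℕ.+ 2 ℕ.* (l ℕ.* n))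
        ℕ.+ r ℕ.* (l ℕ.* n) ℕ.+ 40 ℕ.* (r ℕ.* (l ℕ.* n)) ≡ 104 ℕ.* (r ℕ.* l ℕ.* n) ℕ.+ 40 ℕ.* (r ℕ.* T)
      rhs = solve-∀

  1≤⌊log₂⌋ : ∀ s → 1 ℕ.≤ s → 1 ℕ.≤ ⌊log₂ suc s ⌋
  1≤⌊log₂⌋ s 1≤s = subst (ℕ._≤ ⌊log₂ suc s ⌋) (⌊log₂[2^n]⌋≡n 1) (⌊log₂⌋-mono-≤ (ℕ.s≤s 1≤s))

  κ : ℚ
  κ = ℤ.+ 1 / 1000

  0<κ : fromℚ 0ℚ ℝ.< fromℚ κ
  0<κ = κ , ℚ.positive⁻¹ κ , 0 , λ _ _ → from-yes (κ ℚ.≤? κ - 0ℚ)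

  module _ (n s T : ℕ) .{{_ : ℕ.NonZero n}} (C : ℝ)
    (large : fromℕ 7 ℝ.* (fromℕ (suc s) ℝ.* log₂ (suc s)) ℝ.* ℝ.recip (fromℚ κ) 0<κ ℝ.< C)
    (budget : fromℕ T ℝ.≤ (fromℚ κ ℝ.* C ℝ./ⁿ suc s ℝ.- log₂ (suc s)) ℝ.* fromℕ n)
    where

    private
      r = suc s
      R = nat r
      L = nat ⌊log₂ r ⌋

      0≤RL : 0ℚ ≤ R * L
      0≤RL = 0≤* R L (nat-nonneg r) (nat-nonneg ⌊log₂ r ⌋)

    C-large : Eventually (λ m → nat 7000 * (R * L) ≤ seq C m)
    C-large = map-eventually (λ m h → ℚ.≤-trans {nat 7000 * (R * L)} {nat 7 * (R * logApprox r m) * nat 1000} {seq C m}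
        (subst (_≤ nat 7 * (R * logApprox r m) * nat 1000) (shuffle (R * L))
          (*-monoʳ (nat 7 * (R * L)) (nat 7 * (R * logApprox r m)) (nat 1000) (nat-nonneg 1000)
            (*-monoˡ (R * L) (R * logApprox r m) (nat 7) (nat-nonneg 7)
              (*-monoˡ L (logApprox r m) R (nat-nonneg r) (logApprox-≥ r m)))))
        (ℚ.<⇒≤ h))
      (<-eventually (fromℕ 7 ℝ.* (fromℕ (suc s) ℝ.* log₂ (suc s)) ℝ.* ℝ.recip (fromℚ κ) 0<κ) C large)
      where
      shuffle : ∀ w → nat 7 * w * nat 1000 ≡ nat 7000 * w
      shuffle w = trans (trans (cong (_* nat 1000) (ℚ.*-comm (nat 7) w)) (ℚ.*-assoc w (nat 7) (nat 1000)))
        (trans (cong (w *_) (nat-* 7 1000)) (ℚ.*-comm w (nat 7000)))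

    T-small : ∀ ε → 0ℚ < ε → Eventually (λ m → nat T ≤ (κ * seq C m * u s - L) * nat n + ε)
    T-small ε 0<ε = map-eventually (λ m h → ℚ.≤-trans {nat T} {(κ * seq C m * u s - logApprox r m) * nat n + ε}
        {(κ * seq C m * u s - L) * nat n + ε} h
        (ℚ.+-monoˡ-≤ ε {(κ * seq C m * u s - logApprox r m) * nat n} {(κ * seq C m * u s - L) * nat n}
          (*-monoʳ (κ * seq C m * u s - logApprox r m) (κ * seq C m * u s - L) (nat n) (nat-nonneg n)
            (ℚ.+-monoʳ-≤ (κ * seq C m * u s) { - logApprox r m} { - L} (ℚ.neg-antimono-≤ {L} {logApprox r m} (logApprox-≥ r m))))))
      (≤-eventually (fromℕ T) ((fromℚ κ ℝ.* C ℝ./ⁿ suc s ℝ.- log₂ (suc s)) ℝ.* fromℕ n) budget ε 0<ε)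

    -- An integer cost that stands in for the real `C`: protocols of this cost are covered by the
    -- hypothesis on the advantage, and the integer theorem can work with them.
    Suitable : ℕ → Set
    Suitable c = (∀ k → k ℕ.≤ c → fromℕ k ℝ.≤ C) × Affordable n s T c

    scaled : ∀ m → nat T ≤ (κ * seq C m * u s - L) * nat n + 1ℚ → R * nat T ≤ κ * seq C m * nat n + R
    scaled m h = ℚ.≤-trans {R * nat T} {R * ((κ * seq C m * u s - L) * nat n + 1ℚ)} {κ * seq C m * nat n + R}
      (*-monoˡ (nat T) ((κ * seq C m * u s - L) * nat n + 1ℚ) R (nat-nonneg r) h)
      (by-diff (R * ((κ * seq C m * u s - L) * nat n + 1ℚ)) (κ * seq C m * nat n + R) (R * L * nat n)
        (trans (cong (λ o → κ * seq C m * nat n + R - o) (expand R (κ * seq C m) (u s) L (nat n)))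
          (trans (cong (λ o → κ * seq C m * nat n + R - (κ * seq C m * nat n * o - R * L * nat n + R)) (nat-u s))
            (cancel (κ * seq C m * nat n) R (R * L * nat n))))
        (0≤* (R * L) (nat n) 0≤RL (nat-nonneg n)))
      where
      expand : ∀ r c v l n → r * ((c * v - l) * n + 1ℚ) ≡ c * n * (r * v) - r * l * n + r
      expand = S.solve 5 (λ r c v l n → r S.:* ((c S.:* v S.:- l) S.:* n S.:+ S.con 1ℚ) S.:=
        c S.:* n S.:* (r S.:* v) S.:- r S.:* l S.:* n S.:+ r) refl
      cancel : ∀ a r b → a + r - (a * 1ℚ - b + r) ≡ b
      cancel = S.solve 3 (λ a r b → a S.:+ r S.:- (a S.:* S.con 1ℚ S.:- b S.:+ r) S.:= b) refl

    not-below : ∀ k → Eventually (λ m → nat k ≤ seq C m) → fromℕ k ℝ.≤ C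
    not-below k ev C<k = contradict (both ev (<-eventually C (fromℕ k) C<k))
      where
      contradict : Eventually (λ m → nat k ≤ seq C m × seq C m < nat k) → ⊥
      contradict (N , h) = ℚ.<-irrefl {nat k} refl (ℚ.≤-<-trans {nat k} {seq C N} {nat k}
        (proj₁ (h N ℕ.≤-refl)) (proj₂ (h N ℕ.≤-refl)))

    -- By the budget, the term with `T` costs at most 40 κ C, which is C/25, plus 40 r log r. The
    -- rest of C pays for 144 r log r, because C ≥ 7000 r log r.
    cost-bound : 1 ℕ.≤ s → ∀ m → nat T ≤ (κ * seq C m * u s - L) * nat n + 1ℚ → nat 7000 * (R * L) ≤ seq C m →
      nat (cost n T s) ≤ seq C m
    cost-bound 1≤s m small 7000w≤c = ℚ.≤-trans {nat (cost n T s)} {nat 144 * w + nat 40 * (κ * c)} {c}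
      (*-cancel (nat (cost n T s)) (nat 144 * w + nat 40 * (κ * c)) (nat n) 0<n
        (ℚ.≤-trans {nat n * nat (cost n T s)} {nat 104 * (w * nat n) + nat 40 * (κ * c * nat n + w * nat n)}
          {nat n * (nat 144 * w + nat 40 * (κ * c))}
          (ℚ.≤-trans {nat n * nat (cost n T s)} {nat 104 * (w * nat n) + nat 40 * (R * nat T)}
            {nat 104 * (w * nat n) + nat 40 * (κ * c * nat n + w * nat n)}
            (subst₂ _≤_ (sym (nat-* n (cost n T s))) translate (nat-≤ (cost-≤ n T s 1≤s 1≤λ)))
            (ℚ.+-monoʳ-≤ (nat 104 * (w * nat n)) {nat 40 * (R * nat T)} {nat 40 * (κ * c * nat n + w * nat n)}
              (*-monoˡ (R * nat T) (κ * c * nat n + w * nat n) (nat 40) (nat-nonneg 40)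
                (ℚ.≤-trans {R * nat T} {κ * c * nat n + R} {κ * c * nat n + w * nat n} (scaled m small)
                  (ℚ.+-monoʳ-≤ (κ * c * nat n) {R} {w * nat n} R≤wn)))))
          (ℚ.≤-reflexive (trans (collect (nat 104) (nat 40) w (nat n) (κ * c))
            (cong (λ a → nat n * (a * w + nat 40 * (κ * c))) (nat-+ 104 40))))))
      (by-diff (nat 144 * w + nat 40 * (κ * c)) c ((ℤ.+ 24 / 25) * (c - nat 7000 * w) + nat 6576 * w)
        (identity c w)
        (0≤+ ((ℤ.+ 24 / 25) * (c - nat 7000 * w)) (nat 6576 * w)
          (0≤* (ℤ.+ 24 / 25) (c - nat 7000 * w) (ℚ.<⇒≤ (ℚ.positive⁻¹ (ℤ.+ 24 / 25))) (diff-≥0 (nat 7000 * w) c 7000w≤c))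
          (0≤* (nat 6576) w (nat-nonneg 6576) 0≤RL)))
      where
      c = seq C m
      w = R * L
      1≤λ = 1≤⌊log₂⌋ s 1≤s
      0<n : 0ℚ < nat n
      0<n = ℚ.<-≤-trans {0ℚ} {1ℚ} {nat n} 0<1 (nat-≤ (ℕ.>-nonZero⁻¹ n))
      R≤wn : R ≤ w * nat n
      R≤wn = subst (R ≤_) (trans (sym (nat-* (r ℕ.* ⌊log₂ r ⌋) n)) (cong (_* nat n) (sym (nat-* r ⌊log₂ r ⌋))))
        (nat-≤ (ℕ.≤-trans (ℕ.≤-reflexive (sym (trans (ℕ.*-identityʳ (r ℕ.* 1)) (ℕ.*-identityʳ r))))
          (ℕ.*-mono-≤ (ℕ.*-monoʳ-≤ r 1≤λ) (ℕ.>-nonZero⁻¹ n))))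
      translate : nat (104 ℕ.* (r ℕ.* ⌊log₂ r ⌋ ℕ.* n) ℕ.+ 40 ℕ.* (r ℕ.* T)) ≡ nat 104 * (w * nat n) + nat 40 * (R * nat T)
      translate = trans (sym (nat-+ (104 ℕ.* (r ℕ.* ⌊log₂ r ⌋ ℕ.* n)) (40 ℕ.* (r ℕ.* T)))) (cong₂ _+_
        (trans (sym (nat-* 104 (r ℕ.* ⌊log₂ r ⌋ ℕ.* n))) (cong (nat 104 *_)
          (trans (sym (nat-* (r ℕ.* ⌊log₂ r ⌋) n)) (cong (_* nat n) (sym (nat-* r ⌊log₂ r ⌋))))))
        (trans (sym (nat-* 40 (r ℕ.* T))) (cong (nat 40 *_) (sym (nat-* r T)))))
      collect : ∀ a b w n k → a * (w * n) + b * (k * n + w * n) ≡ n * ((a + b) * w + b * k)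
      collect = S.solve 5 (λ a b w n k → a S.:* (w S.:* n) S.:+ b S.:* (k S.:* n S.:+ w S.:* n) S.:=
        n S.:* ((a S.:+ b) S.:* w S.:+ b S.:* k)) refl
      identity : ∀ c w → c - (nat 144 * w + nat 40 * (κ * c)) ≡ (ℤ.+ 24 / 25) * (c - nat 7000 * w) + nat 6576 * w
      identity = S.solve 2 (λ c w → c S.:- (S.con (nat 144) S.:* w S.:+ S.con (nat 40) S.:* (S.con κ S.:* c)) S.:=
        S.con (ℤ.+ 24 / 25) S.:* (c S.:- S.con (nat 7000) S.:* w) S.:+ S.con (nat 6576) S.:* w) refl

    several-rounds : 1 ℕ.≤ s → Suitable (cost n T s)
    several-rounds 1≤s = (λ k k≤ → not-below k (map-eventually (λ m (small , big) →
        ℚ.≤-trans {nat k} {nat (cost n T s)} {seq C m} (nat-≤ k≤) (cost-bound 1≤s m small big))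
        (both (T-small 1ℚ 0<1) C-large))) , affordable n T s

    C-nonneg : Eventually (λ m → 0ℚ ≤ seq C m)
    C-nonneg = map-eventually (λ m h → ℚ.≤-trans {0ℚ} {nat 7000 * (R * L)} {seq C m}
      (0≤* (nat 7000) (R * L) (nat-nonneg 7000) 0≤RL) h) C-large

    one-round-one-bit : s ≡ 0 → ¬ (C ℝ.< 1ℝ) → Suitable 1
    one-round-one-bit refl C≮1 = (λ { zero _ → not-below 0 C-nonneg ; (suc zero) _ → C≮1 ; (suc (suc _)) (ℕ.s≤s ()) }) ,
      affordable n T 0

    -- With one round and C < 1 the budget leaves T ≤ n/1000 + 1/4, the last term being slack for
    -- the approximation, and so 2T ≤ n.
    one-round-no-bit : s ≡ 0 → C ℝ.< 1ℝ → Suitable 0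
    one-round-no-bit refl C<1 = (λ { zero _ → not-below 0 C-nonneg }) , inj₂ (refl , nat-cancel-≤ (T ℕ.+ T) n
        (at-index (both (T-small (ℤ.+ 1 / 4) (ℚ.positive⁻¹ (ℤ.+ 1 / 4))) (<-eventually C 1ℝ C<1))))
      where
      at-index : Eventually (λ m → nat T ≤ (κ * seq C m * u 0 - L) * nat n + (ℤ.+ 1 / 4) × seq C m < 1ℚ) →
        nat (T ℕ.+ T) ≤ nat n
      at-index (N , h) = subst (_≤ nat n) (nat-+ T T) (by-diff (nat T + nat T) (nat n)
          ((a - nat T) + (a - nat T) + ((ℤ.+ 499 / 500) * (nat n - 1ℚ) + (ℤ.+ 249 / 500))) (identity (nat T) (nat n))
          (0≤+ ((a - nat T) + (a - nat T)) ((ℤ.+ 499 / 500) * (nat n - 1ℚ) + (ℤ.+ 249 / 500))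
            (0≤+ (a - nat T) (a - nat T) (diff-≥0 (nat T) a T≤a) (diff-≥0 (nat T) a T≤a))
            (0≤+ ((ℤ.+ 499 / 500) * (nat n - 1ℚ)) (ℤ.+ 249 / 500)
              (0≤* (ℤ.+ 499 / 500) (nat n - 1ℚ) (ℚ.<⇒≤ (ℚ.positive⁻¹ (ℤ.+ 499 / 500)))
                (diff-≥0 1ℚ (nat n) (nat-≤ (ℕ.>-nonZero⁻¹ n))))
              (ℚ.<⇒≤ (ℚ.positive⁻¹ (ℤ.+ 249 / 500))))))
        where
        c = seq C N
        a = κ * nat n + (ℤ.+ 1 / 4)
        identity : ∀ t n → n - (t + t) ≡ (κ * n + (ℤ.+ 1 / 4) - t) + (κ * n + (ℤ.+ 1 / 4) - t)
          + ((ℤ.+ 499 / 500) * (n - 1ℚ) + (ℤ.+ 249 / 500))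
        identity = S.solve 2 (λ t n → n S.:- (t S.:+ t) S.:= (S.con κ S.:* n S.:+ S.con (ℤ.+ 1 / 4) S.:- t)
          S.:+ (S.con κ S.:* n S.:+ S.con (ℤ.+ 1 / 4) S.:- t)
          S.:+ (S.con (ℤ.+ 499 / 500) S.:* (n S.:- S.con 1ℚ) S.:+ S.con (ℤ.+ 249 / 500))) refl
        T≤a : nat T ≤ a
        T≤a = by-diff (nat T) a (((κ * c * 1ℚ - L) * nat n + (ℤ.+ 1 / 4) - nat T) + (κ * nat n * (1ℚ - c) + L * nat n))
          (split κ (nat n) (ℤ.+ 1 / 4) (nat T) c L)
          (0≤+ ((κ * c * 1ℚ - L) * nat n + (ℤ.+ 1 / 4) - nat T) (κ * nat n * (1ℚ - c) + L * nat n)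
            (diff-≥0 (nat T) ((κ * c * 1ℚ - L) * nat n + (ℤ.+ 1 / 4)) (proj₁ (h N ℕ.≤-refl)))
            (0≤+ (κ * nat n * (1ℚ - c)) (L * nat n)
              (0≤* (κ * nat n) (1ℚ - c) (0≤* κ (nat n) (ℚ.<⇒≤ (ℚ.positive⁻¹ κ)) (nat-nonneg n))
                (diff-≥0 c 1ℚ (ℚ.<⇒≤ (proj₂ (h N ℕ.≤-refl)))))
              (0≤* L (nat n) (nat-nonneg ⌊log₂ r ⌋) (nat-nonneg n))))
          where
          split : ∀ k n q t c l → (k * n + q) - t ≡ ((k * c * 1ℚ - l) * n + q - t) + (k * n * (1ℚ - c) + l * n)
          split = S.solve 6 (λ k n q t c l → (k S.:* n S.:+ q) S.:- t S.:= ((k S.:* c S.:* S.con 1ℚ S.:- l) S.:* n S.:+ q S.:- t)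
            S.:+ (k S.:* n S.:* (S.con 1ℚ S.:- c) S.:+ l S.:* n)) refl

    -- Whether C < 1 is undecidable, so a suitable cost exists only up to double negation. This is
    -- enough, since the inequality to be proved is itself a negation.
    suitable : (∀ c → Suitable c → ⊥) → ⊥
    suitable k = go s refl
      where
      go : ∀ s′ → s ≡ s′ → ⊥
      go zero     eq = k 1 (one-round-one-bit eq (λ C<1 → k 0 (one-round-no-bit eq C<1)))
      go (suc s′) eq = k (cost n T s) (several-rounds (subst (1 ℕ.≤_) (sym eq) (ℕ.s≤s ℕ.z≤n)))

-- From small advantage to hardness for integer masses.

module Hardness where

  open import Data.Bool.Base using (Bool; true; false)
  import Data.Bool.Properties as Bool
  open import Data.List.Base using (List)
  open import Data.Nat.Base as ℕ using (ℕ; zero; suc)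
  import Data.Nat.Properties as ℕ
  open import Data.Product.Base using (∃-syntax; _×_; _,_; proj₁; proj₂)
  open import Data.Rational.Base
  import Data.Rational.Properties as ℚ
  open import Relation.Binary.PropositionalEquality
  open import Relation.Nullary.Decidable.Core using (Dec; yes; no)
  open import Relation.Nullary.Decidable using (from-yes)
  open Sums using (𝟙)
  open Simulation using (Inputs; ⟨_,_⟩)
  open DirectProduct
  open Rationals
  open Limits
  open Averaging
  open import Defs using (Protocol; ℝ; seq; 1ℝ; fromℚ; fromℕ; FinSet; Carrier; elements; complete; _×ᶠ_; alice; Tree; outcome; bits)
  import Defs as ℝ

  sign : Bool → Bool → ℚ
  sign o g = nat (𝟙 (o Bool.≟ g)) + nat (𝟙 (o Bool.≟ g)) - 1ℚ

  ∣sign∣≤1 : ∀ o g → ∣ sign o g ∣ ≤ 1ℚ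
  ∣sign∣≤1 true  true  = from-yes (∣ sign true true ∣ ℚ.≤? 1ℚ)
  ∣sign∣≤1 true  false = from-yes (∣ sign true false ∣ ℚ.≤? 1ℚ)
  ∣sign∣≤1 false true  = from-yes (∣ sign false true ∣ ℚ.≤? 1ℚ)
  ∣sign∣≤1 false false = from-yes (∣ sign false false ∣ ℚ.≤? 1ℚ)

  module _ (X Y : FinSet) (f : Carrier X × Carrier Y → Bool) (μ : Carrier X × Carrier Y → ℝ) (r : ℕ) (C : ℝ) where

    private
      L : List (Carrier X × Carrier Y)
      L = elements (X ×ᶠ Y)
      Tree₁ = Tree (Inputs (Carrier X) (Carrier Y)) Bool alice r
      bit = ℝ.bit r X Y μ C

    seq-sign : ∀ o g m → seq ((ℝ.- 1ℝ) ℝ.^ (bit o ℕ.+ bit g)) m ≡ sign o g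
    seq-sign true  true  m = refl
    seq-sign true  false m = refl
    seq-sign false true  m = refl
    seq-sign false false m = refl

    bias : Tree₁ → ℕ → ℚ
    bias τ m = Σ L (λ xy → seq (μ xy) m * sign (outcome τ ⟨ proj₁ xy , proj₂ xy ⟩) (f xy))

    φ : Carrier X × Carrier Y → Bool → ℝ
    φ xy o = (ℝ.- 1ℝ) ℝ.^ (bit o ℕ.+ bit (f xy))

    seq-adv : ∀ τ m → seq (Protocol.expect (deterministic {X} {Y} τ) μ φ) m ≡ bias τ m
    seq-adv τ m = trans (expect-deterministic {X} {Y} τ μ φ m)
      (Σ-cong L λ xy → cong (seq (μ xy) m *_) (seq-sign (outcome τ ⟨ proj₁ xy , proj₂ xy ⟩) (f xy) m))

    -- The signs are bounded by 1, so the right side is independent of `τ`; this makes one index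
    -- serve all protocols.
    bias-diff : ∀ τ m k → bias τ m - bias τ k ≤ Σ L (λ xy → ∣ seq (μ xy) m - seq (μ xy) k ∣)
    bias-diff τ m k = subst₂ _≤_ difference (ℚ.*-identityˡ (Σ L (λ xy → ∣ seq (μ xy) m - seq (μ xy) k ∣)))
      (ℚ.≤-trans {d} {∣ d ∣} {1ℚ * Σ L (λ xy → ∣ seq (μ xy) m - seq (μ xy) k ∣)} (p≤∣p∣ d)
        (∣Σ*∣≤ L (λ xy → seq (μ xy) m - seq (μ xy) k) σ 1ℚ (λ xy → ∣sign∣≤1 (outcome τ ⟨ proj₁ xy , proj₂ xy ⟩) (f xy))))
      where
      σ : Carrier X × Carrier Y → ℚ
      σ xy = sign (outcome τ ⟨ proj₁ xy , proj₂ xy ⟩) (f xy)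
      d = Σ L (λ xy → (seq (μ xy) m - seq (μ xy) k) * σ xy)
      split : ∀ a b s → a * s ≡ (a - b) * s + b * s
      split = S.solve 3 (λ a b s → a S.:* s S.:= (a S.:- b) S.:* s S.:+ b S.:* s) refl
      cancel : ∀ a b → a + b - b ≡ a
      cancel = S.solve 2 (λ a b → a S.:+ b S.:- b S.:= a) refl
      difference : d ≡ bias τ m - bias τ k
      difference = sym (trans (cong (_- bias τ k) (trans (Σ-cong L λ xy → split (seq (μ xy) m) (seq (μ xy) k) (σ xy))
        (Σ-+ L (λ xy → (seq (μ xy) m - seq (μ xy) k) * σ xy) (λ xy → seq (μ xy) k * σ xy)))) (cancel d (bias τ k)))

    -- The bound on the advantage holds at all late indices, simultaneously for
    -- all protocols.
    bias-bounded : ∀ b K δ → 0ℚ < δ → b ℝ.< fromℚ K → (c : ℕ) → (∀ k → k ℕ.≤ c → fromℕ k ℝ.≤ C) →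
      (∀ i → ℝ.Sup.value (ℝ.adv r X Y μ C f) i ℝ.≤ b) →
      Eventually (λ m → ∀ (τ : Tree₁) → (∀ v → bits τ v ℕ.≤ c) → bias τ m ≤ K + (δ + δ))
    bias-bounded b K δ 0<δ b<K c c≤C adv≤b = go (uniformly-cauchy μ L δ 0<δ) (<-eventually b (fromℚ K) b<K)
      where
      go : (∃[ N ] ∀ m k → N ℕ.≤ m → N ℕ.≤ k → Σ L (λ xy → ∣ seq (μ xy) m - seq (μ xy) k ∣) ≤ δ) →
           Eventually (λ m → seq b m < K) →
           Eventually (λ m → ∀ (τ : Tree₁) → (∀ v → bits τ v ℕ.≤ c) → bias τ m ≤ K + (δ + δ))
      go (N , close) (M , below) = N , λ m N≤m τ short → ℚ.≮⇒≥ {K + (δ + δ)} {bias τ m} λ large →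
        adv≤b (deterministic {X} {Y} τ , c≤C _ (cost-deterministic {X} {Y} τ c short))
          (δ , 0<δ , N ℕ.⊔ M , λ k h → subst (λ v → δ ≤ v - seq b k) (sym (seq-adv τ k))
            (by-diff δ (bias τ k - seq b k)
              ((δ - (bias τ m - bias τ k)) + (bias τ m - (K + (δ + δ))) + (K - seq b k))
              (identity δ (bias τ k) (bias τ m) K (seq b k))
              (0≤+ ((δ - (bias τ m - bias τ k)) + (bias τ m - (K + (δ + δ)))) (K - seq b k)
                (0≤+ (δ - (bias τ m - bias τ k)) (bias τ m - (K + (δ + δ)))
                  (diff-≥0 (bias τ m - bias τ k) δ (ℚ.≤-trans {bias τ m - bias τ k}
                    {Σ L (λ xy → ∣ seq (μ xy) m - seq (μ xy) k ∣)} {δ} (bias-diff τ m k)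
                    (close m k N≤m (ℕ.m⊔n≤o⇒m≤o N M h))))
                  (diff-≥0 (K + (δ + δ)) (bias τ m) (ℚ.<⇒≤ large)))
                (diff-≥0 (seq b k) K (ℚ.<⇒≤ (below k (ℕ.m⊔n≤o⇒n≤o N M h)))))))
        where
        identity : ∀ d x y k b → (x - b) - d ≡ (d - (y - x)) + (y - (k + (d + d))) + (k - b)
        identity = S.solve 5 (λ d x y k b → (x S.:- b) S.:- d S.:=
          (d S.:- (y S.:- x)) S.:+ (y S.:- (k S.:+ (d S.:+ d))) S.:+ (k S.:- b)) refl

    module _ (m : ℕ) where

      q : Carrier X × Carrier Y → ℚ
      q xy = seq (μ xy) m

      μ̂ : Carrier X × Carrier Y → ℕ
      μ̂ = cleared L q

      Δ A M : ℚ
      Δ = nat (denominator L q)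
      A = Σ L (λ xy → ∣ q xy ∣)
      M = Σ L q

      0<Δ : 0ℚ < Δ
      0<Δ = ℚ.<-≤-trans {0ℚ} {1ℚ} {Δ} 0<1 (nat-≤ (ℕ.>-nonZero⁻¹ (denominator L q) {{denominator≢0 L q}}))

      μ̂-≡ : ∀ xy → nat (μ̂ xy) ≡ Δ * ∣ q xy ∣
      μ̂-≡ xy = cleared-≡ L q xy (complete (X ×ᶠ Y) xy)

      nat-mass : nat (mass X Y f μ̂) ≡ Δ * A
      nat-mass = trans (sym (Σ-nat L μ̂)) (trans (Σ-cong L μ̂-≡) (Σ-*ˡ L (λ xy → ∣ q xy ∣) Δ))

      0≤A : 0ℚ ≤ A
      0≤A = ℚ.≤-trans {0ℚ} {∣ M ∣} {A} (ℚ.0≤∣p∣ M) (∣Σ∣≤ L q)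

      -- Twice the weight of success is the bias plus the total mass, up to `A - M` for passing from
      -- `q` to absolute values. With `a` ≤ A/10 this is at most 11/10 of the total.
      hard : ∀ a → nat 10 * a ≤ A → ∀ (τ : Tree₁) → bias τ m + (A - M) ≤ a →
        20 ℕ.* correct₁ X Y f μ̂ τ ℕ.≤ 11 ℕ.* mass X Y f μ̂
      hard a 10a≤A τ small = nat-cancel-≤ (20 ℕ.* correct₁ X Y f μ̂ τ) (11 ℕ.* mass X Y f μ̂)
        (subst₂ _≤_ (trans (sym lhs) (nat-* 20 (correct₁ X Y f μ̂ τ))) (trans (sym rhs) (nat-* 11 (mass X Y f μ̂)))
          (*-monoˡ (nat 20 * I) (nat 11 * A) Δ (ℚ.<⇒≤ 0<Δ) main))
        where
        o : Carrier X × Carrier Y → Bool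
        o xy = outcome τ ⟨ proj₁ xy , proj₂ xy ⟩
        ι : Carrier X × Carrier Y → ℚ
        ι xy = nat (𝟙 (o xy Bool.≟ f xy))
        I = Σ L (λ xy → ∣ q xy ∣ * ι xy)
        nat-correct : nat (correct₁ X Y f μ̂ τ) ≡ Δ * I
        nat-correct = trans (sym (Σ-nat L (λ xy → μ̂ xy ℕ.* 𝟙 (o xy Bool.≟ f xy)))) (trans (Σ-cong L λ xy →
            trans (sym (nat-* (μ̂ xy) (𝟙 (o xy Bool.≟ f xy)))) (trans (cong (_* ι xy) (μ̂-≡ xy)) (ℚ.*-assoc Δ (∣ q xy ∣) (ι xy))))
          (Σ-*ˡ L (λ xy → ∣ q xy ∣ * ι xy) Δ))
        shuffle : ∀ a b c → a * (b * c) ≡ b * (a * c)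
        shuffle = S.solve 3 (λ a b c → a S.:* (b S.:* c) S.:= b S.:* (a S.:* c)) refl
        lhs : nat 20 * nat (correct₁ X Y f μ̂ τ) ≡ Δ * (nat 20 * I)
        lhs = trans (cong (nat 20 *_) nat-correct) (shuffle (nat 20) Δ I)
        rhs : nat 11 * nat (mass X Y f μ̂) ≡ Δ * (nat 11 * A)
        rhs = trans (cong (nat 11 *_) nat-mass) (shuffle (nat 11) Δ A)
        -- Replacing q by its absolute value costs at most A - M.
        pointwise : ∀ {P : Set} p (i : Dec P) → ∣ p ∣ * nat (𝟙 i) + ∣ p ∣ * nat (𝟙 i)
          ≤ p * (nat (𝟙 i) + nat (𝟙 i) - 1ℚ) + (∣ p ∣ + (∣ p ∣ - p))
        pointwise p (yes _) = ℚ.≤-reflexive (lemma p ∣ p ∣)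
          where
          lemma : ∀ p a → a * 1ℚ + a * 1ℚ ≡ p * (1ℚ + 1ℚ - 1ℚ) + (a + (a - p))
          lemma = S.solve 2 (λ p a → a S.:* S.con 1ℚ S.:+ a S.:* S.con 1ℚ S.:=
            p S.:* (S.con 1ℚ S.:+ S.con 1ℚ S.:- S.con 1ℚ) S.:+ (a S.:+ (a S.:- p))) refl
        pointwise p (no _) = by-diff (∣ p ∣ * 0ℚ + ∣ p ∣ * 0ℚ) (p * (0ℚ + 0ℚ - 1ℚ) + (∣ p ∣ + (∣ p ∣ - p)))
          ((∣ p ∣ - p) + (∣ p ∣ - p)) (lemma p ∣ p ∣)
          (0≤+ (∣ p ∣ - p) (∣ p ∣ - p) (diff-≥0 p ∣ p ∣ (p≤∣p∣ p)) (diff-≥0 p ∣ p ∣ (p≤∣p∣ p)))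
          where
          lemma : ∀ p a → (p * (0ℚ + 0ℚ - 1ℚ) + (a + (a - p))) - (a * 0ℚ + a * 0ℚ) ≡ (a - p) + (a - p)
          lemma = S.solve 2 (λ p a → (p S.:* (S.con 0ℚ S.:+ S.con 0ℚ S.:- S.con 1ℚ) S.:+ (a S.:+ (a S.:- p)))
            S.:- (a S.:* S.con 0ℚ S.:+ a S.:* S.con 0ℚ) S.:= (a S.:- p) S.:+ (a S.:- p)) refl
        Σ-neg : ∀ (g : Carrier X × Carrier Y → ℚ) → Σ L (λ xy → ∣ g xy ∣ - g xy) ≡ Σ L (λ xy → ∣ g xy ∣) - Σ L g
        Σ-neg g = trans (insert (Σ L (λ xy → ∣ g xy ∣ - g xy)) (Σ L g)) (cong (_- Σ L g)
          (trans (sym (Σ-+ L (λ xy → ∣ g xy ∣ - g xy) g)) (Σ-cong L λ xy → restore (∣ g xy ∣) (g xy))))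
          where
          insert : ∀ a b → a ≡ a + b - b
          insert = S.solve 2 (λ a b → a S.:= a S.:+ b S.:- b) refl
          restore : ∀ a b → a - b + b ≡ a
          restore = S.solve 2 (λ a b → a S.:- b S.:+ b S.:= a) refl
        double : I + I ≤ bias τ m + (A + (A - M))
        double = subst₂ _≤_ (Σ-+ L (λ xy → ∣ q xy ∣ * ι xy) (λ xy → ∣ q xy ∣ * ι xy))
          (trans (Σ-+ L (λ xy → q xy * sign (o xy) (f xy)) (λ xy → ∣ q xy ∣ + (∣ q xy ∣ - q xy)))
            (cong (bias τ m +_) (trans (Σ-+ L (λ xy → ∣ q xy ∣) (λ xy → ∣ q xy ∣ - q xy)) (cong (A +_) (Σ-neg q)))))
          (Σ-mono L {λ xy → ∣ q xy ∣ * ι xy + ∣ q xy ∣ * ι xy}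
            {λ xy → q xy * sign (o xy) (f xy) + (∣ q xy ∣ + (∣ q xy ∣ - q xy))}
            λ xy → pointwise (q xy) (o xy Bool.≟ f xy))
        main : nat 20 * I ≤ nat 11 * A
        main = by-diff (nat 20 * I) (nat 11 * A)
          (nat 10 * ((bias τ m + (A + (A - M))) - (I + I)) + nat 10 * (a - (bias τ m + (A - M))) + (A - nat 10 * a))
          (identity I A (bias τ m) M a)
          (0≤+ (nat 10 * ((bias τ m + (A + (A - M))) - (I + I)) + nat 10 * (a - (bias τ m + (A - M)))) (A - nat 10 * a)
            (0≤+ (nat 10 * ((bias τ m + (A + (A - M))) - (I + I))) (nat 10 * (a - (bias τ m + (A - M))))
              (0≤* (nat 10) ((bias τ m + (A + (A - M))) - (I + I)) (nat-nonneg 10) (diff-≥0 (I + I) (bias τ m + (A + (A - M))) double))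
              (0≤* (nat 10) (a - (bias τ m + (A - M))) (nat-nonneg 10) (diff-≥0 (bias τ m + (A - M)) a small)))
            (diff-≥0 (nat 10 * a) A 10a≤A))
          where
          identity : ∀ i A b M a → nat 11 * A - nat 20 * i ≡
            nat 10 * ((b + (A + (A - M))) - (i + i)) + nat 10 * (a - (b + (A - M))) + (A - nat 10 * a)
          identity = S.solve 5 (λ i A b M a → S.con (nat 11) S.:* A S.:- S.con (nat 20) S.:* i S.:=
            S.con (nat 10) S.:* ((b S.:+ (A S.:+ (A S.:- M))) S.:- (i S.:+ i)) S.:+ S.con (nat 10) S.:* (a S.:- (b S.:+ (A S.:- M)))
            S.:+ (A S.:- S.con (nat 10) S.:* a)) refl

-- Transfer of the integer theorem to real distributions.

module Success where

  open import Data.Bool.Base using (Bool; if_then_else_)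
  open import Data.Empty using (⊥)
  open import Data.Nat.Base as ℕ using (ℕ; zero; suc)
  import Data.Nat.Properties as ℕ
  open import Data.Product.Base using (_×_; _,_; proj₁; proj₂)
  open import Data.Rational.Base hiding (floor)
  import Data.Rational.Properties as ℚ
  open import Data.Vec.Base using (Vec; []; _∷_)
  open import Relation.Binary.PropositionalEquality
  open import Relation.Nullary.Decidable.Core using (Dec; yes; no; ⌊_⌋)
  open Sums using (𝟙)
  open Simulation using (Inputs; ⟨_,_⟩)
  open Counting using (weights)
  open DirectProduct
  open Rationals
  open Limits
  open Averaging
  open Hardness
  open import Defs using (ℝ; seq; 0ℝ; 1ℝ; fromℚ; fromℕ; FinSet; Carrier; elements; _×ᶠ_; _^ᶠ_; IsDistribution; ProbSpace; alice; bob; Tree; outcome; bits; Protocol; mapⁿ; massⁿ; _≟ⁿ_)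
  import Defs as ℝ

  indicator : ∀ {P : Set} → Dec P → ℝ
  indicator d = if ⌊ d ⌋ then 1ℝ else 0ℝ

  seq-indicator : ∀ {P : Set} (d : Dec P) m → seq (indicator d) m ≡ nat (𝟙 d)
  seq-indicator (yes _) m = refl
  seq-indicator (no _)  m = refl

  module _ (ρ : ℚ) (10ρ≡9 : nat 10 * ρ ≡ nat 9)
    (X Y : FinSet) (f : Carrier X × Carrier Y → Bool) (μ : Carrier X × Carrier Y → ℝ) (m n : ℕ) where

    private
      L = elements (X ^ᶠ n ×ᶠ Y ^ᶠ n)
      q̂ = μ̂ X Y f μ 0 0ℝ m
      Δ̂ = Δ X Y f μ 0 0ℝ m
      Â = A X Y f μ 0 0ℝ m

    nat-weights : ∀ {n} (v : Vec (Carrier X) n) (v′ : Vec (Carrier Y) n) →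
      nat (weights q̂ v v′) ≡ Δ̂ ^ n * ∣ seq (massⁿ μ n (v , v′)) m ∣
    nat-weights []      []       = refl
    nat-weights {suc n} (x ∷ v) (y ∷ v′) = trans (sym (nat-* (q̂ (x , y)) (weights q̂ v v′)))
      (trans (cong₂ _*_ (μ̂-≡ X Y f μ 0 0ℝ m (x , y)) (nat-weights v v′))
        (trans (interchange Δ̂ (∣ seq (μ (x , y)) m ∣) (Δ̂ ^ n) (∣ ν ∣))
          (cong (Δ̂ * Δ̂ ^ n *_) (sym (ℚ.∣p*q∣≡∣p∣*∣q∣ (seq (μ (x , y)) m) ν)))))
      where
      ν = seq (massⁿ μ n (v , v′)) m
      interchange : ∀ a b c d → a * b * (c * d) ≡ a * c * (b * d)
      interchange = S.solve 4 (λ a b c d → a S.:* b S.:* (c S.:* d) S.:= a S.:* c S.:* (b S.:* d)) refl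

    module _ {r} (t : Tree (Inputs (Vec (Carrier X) n) (Vec (Carrier Y) n)) (Vec Bool n) alice r) where

      hit : Carrier (X ^ᶠ n ×ᶠ Y ^ᶠ n) → ℚ
      hit ω = nat (𝟙 (outcome t ⟨ proj₁ ω , proj₂ ω ⟩ ≟ⁿ mapⁿ f n ω))

      hits : ℚ
      hits = Σ L (λ ω → ∣ seq (massⁿ μ n ω) m ∣ * hit ω)

      nat-correctⁿ : nat (correctⁿ X Y f q̂ t) ≡ Δ̂ ^ n * hits
      nat-correctⁿ = trans (sym (Σ-nat L (λ ω → weights q̂ (proj₁ ω) (proj₂ ω) ℕ.* 𝟙 (outcome t ⟨ proj₁ ω , proj₂ ω ⟩ ≟ⁿ mapⁿ f n ω))))
        (trans (Σ-cong L λ ω → trans (sym (nat-* (weights q̂ (proj₁ ω) (proj₂ ω)) (𝟙 (outcome t ⟨ proj₁ ω , proj₂ ω ⟩ ≟ⁿ mapⁿ f n ω))))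
            (trans (cong (_* hit ω) (nat-weights (proj₁ ω) (proj₂ ω))) (ℚ.*-assoc (Δ̂ ^ n) (∣ seq (massⁿ μ n ω) m ∣) (hit ω))))
          (Σ-*ˡ L (λ ω → ∣ seq (massⁿ μ n ω) m ∣ * hit ω) (Δ̂ ^ n)))

      hits-≤ : 10 ℕ.^ n ℕ.* correctⁿ X Y f q̂ t ℕ.≤ 9 ℕ.^ n ℕ.* mass X Y f q̂ ℕ.^ n → hits ≤ ρ ^ n * Â ^ n
      hits-≤ h = *-cancel hits (ρ ^ n * Â ^ n) (nat 10 ^ n * Δ̂ ^ n)
        (0<* (nat 10 ^ n) (Δ̂ ^ n) (^-pos (nat 10) n (nat-pos 9)) (^-pos Δ̂ n (0<Δ X Y f μ 0 0ℝ m)))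
        (subst₂ _≤_
          (trans (sym (nat-* (10 ℕ.^ n) (correctⁿ X Y f q̂ t))) (trans (cong₂ _*_ (nat-^ 10 n) nat-correctⁿ)
            (sym (ℚ.*-assoc (nat 10 ^ n) (Δ̂ ^ n) hits))))
          (trans (sym (nat-* (9 ℕ.^ n) (mass X Y f q̂ ℕ.^ n))) (trans (cong₂ _*_
              (trans (nat-^ 9 n) (trans (cong (_^ n) (sym 10ρ≡9)) (^-distrib (nat 10) ρ n)))
              (trans (nat-^ (mass X Y f q̂) n) (trans (cong (_^ n) (nat-mass X Y f μ 0 0ℝ m)) (^-distrib Δ̂ Â n))))
            (interchange (nat 10 ^ n) (ρ ^ n) (Δ̂ ^ n) (Â ^ n))))
          (nat-≤ h))
        where
        interchange : ∀ a b c d → a * b * (c * d) ≡ a * c * (b * d)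
        interchange = S.solve 4 (λ a b c d → a S.:* b S.:* (c S.:* d) S.:= a S.:* c S.:* (b S.:* d)) refl

      ∣success∣≤ : ∀ (o : Carrier (X ^ᶠ n ×ᶠ Y ^ᶠ n) → Vec Bool n) → (∀ ω → o ω ≡ outcome t ⟨ proj₁ ω , proj₂ ω ⟩) →
        ∣ mean (X ^ᶠ n ×ᶠ Y ^ᶠ n) (massⁿ μ n) m (λ ω → seq (indicator (o ω ≟ⁿ mapⁿ f n ω)) m) ∣ ≤ hits
      ∣success∣≤ o eq = ℚ.≤-trans
        {∣ Σ L (λ ω → seq (massⁿ μ n ω) m * seq (indicator (o ω ≟ⁿ mapⁿ f n ω)) m) ∣}
        {Σ L (λ ω → ∣ seq (massⁿ μ n ω) m * seq (indicator (o ω ≟ⁿ mapⁿ f n ω)) m ∣)} {hits}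
        (∣Σ∣≤ L (λ ω → seq (massⁿ μ n ω) m * seq (indicator (o ω ≟ⁿ mapⁿ f n ω)) m))
        (ℚ.≤-reflexive (Σ-cong L λ ω → trans (ℚ.∣p*q∣≡∣p∣*∣q∣ (seq (massⁿ μ n ω) m) (seq (indicator (o ω ≟ⁿ mapⁿ f n ω)) m))
          (cong (∣ seq (massⁿ μ n ω) m ∣ *_) (trans
            (cong ∣_∣ (trans (seq-indicator (o ω ≟ⁿ mapⁿ f n ω) m) (cong (λ z → nat (𝟙 (z ≟ⁿ mapⁿ f n ω))) (eq ω))))
            (ℚ.0≤p⇒∣p∣≡p (nat-nonneg (𝟙 (outcome t ⟨ proj₁ ω , proj₂ ω ⟩ ≟ⁿ mapⁿ f n ω))))))))

  module Slack (ρ t β : ℚ) (0≤ρ : 0ℚ ≤ ρ) (1≤t : 1ℚ ≤ t) (enough : ρ * t * (t * t * t) ≤ β) where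

    -- Since t ≥ 1 and n ≥ 1, the three factors `t` of the coins are at most `(t * t * t) ^ n`, so a
    -- comparison for a single copy suffices.
    slack : ∀ n .{{_ : ℕ.NonZero n}} A → 0ℚ ≤ A → A ≤ t → ρ ^ n * A ^ n * t * t * t ≤ β ^ n
    slack n@(suc n₁) A 0≤A A≤t = ℚ.≤-trans {ρ ^ n * A ^ n * t * t * t} {(ρ * t * (t * t * t)) ^ n} {β ^ n}
      (subst₂ _≤_ (regroup (ρ ^ n) (A ^ n) t) (sym (trans (^-distrib (ρ * t) (t * t * t) n) (cong (_* (t * t * t) ^ n) (^-distrib ρ t n))))
        (*-mono (ρ ^ n * A ^ n) (ρ ^ n * t ^ n) (t * t * t) ((t * t * t) ^ n)
          (0≤* (ρ ^ n) (t ^ n) (^-nonneg ρ n 0≤ρ) (^-nonneg t n 0≤t)) 0≤ttt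
          (*-monoˡ (A ^ n) (t ^ n) (ρ ^ n) (^-nonneg ρ n 0≤ρ) (^-mono A t n 0≤A A≤t))
          grows))
      (^-mono (ρ * t * (t * t * t)) β n (0≤* (ρ * t) (t * t * t) (0≤* ρ t 0≤ρ 0≤t) 0≤ttt) enough)
      where
      0≤t = ℚ.≤-trans {0ℚ} {1ℚ} {t} 0≤1 1≤t
      0≤ttt = 0≤* (t * t) t (0≤* t t 0≤t 0≤t) 0≤t
      1≤ttt : 1ℚ ≤ t * t * t
      1≤ttt = *-mono 1ℚ (t * t) 1ℚ t (0≤* t t 0≤t 0≤t) 0≤1 (*-mono 1ℚ t 1ℚ t 0≤t 0≤1 1≤t 1≤t) 1≤t
      1≤power : ∀ k → 1ℚ ≤ (t * t * t) ^ k
      1≤power zero    = ℚ.≤-refl {1ℚ}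
      1≤power (suc k) = *-mono 1ℚ (t * t * t) 1ℚ ((t * t * t) ^ k) 0≤ttt 0≤1 1≤ttt (1≤power k)
      grows : t * t * t ≤ (t * t * t) ^ n
      grows = subst (_≤ (t * t * t) ^ n) (ℚ.*-identityʳ (t * t * t))
        (*-monoˡ 1ℚ ((t * t * t) ^ n₁) (t * t * t) 0≤ttt (1≤power n₁))
      regroup : ∀ a b t → a * b * (t * t * t) ≡ a * b * t * t * t
      regroup = S.solve 3 (λ a b t → a S.:* b S.:* (t S.:* t S.:* t) S.:= a S.:* b S.:* t S.:* t S.:* t) refl

  -- The approximations at a single index may be off by δ in total mass; K bounds
  -- the advantage.
  module Bound (ρ δ β K : ℚ) (10ρ≡9 : nat 10 * ρ ≡ nat 9) (0≤ρ : 0ℚ ≤ ρ) (0<δ : 0ℚ < δ)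
    (enough : ρ * (1ℚ + (δ + δ)) * ((1ℚ + (δ + δ)) * (1ℚ + (δ + δ)) * (1ℚ + (δ + δ))) ≤ β)
    (unbiased : nat 10 * (K + (δ + δ) + δ) ≤ 1ℚ - δ)
    (X Y : FinSet) (f : Carrier X × Carrier Y → Bool) (μ : Carrier X × Carrier Y → ℝ)
    (isD : IsDistribution (X ×ᶠ Y) μ) (n s : ℕ) .{{_ : ℕ.NonZero n}} (C : ℝ)
    (b : ℝ) (b<K : b ℝ.< fromℚ K) (adv≤b : ∀ i → ℝ.Sup.value (ℝ.adv (suc s) X Y μ C f) i ℝ.≤ b)
    (π : Protocol (X ^ᶠ n) (Y ^ᶠ n) (Vec Bool n) (suc s))
    (suitable : (∀ c → (∀ k → k ℕ.≤ c → fromℕ k ℝ.≤ C) × Affordable n s (Protocol.‖_‖ π) c → ⊥) → ⊥)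
    where

    private
      t = 1ℚ + (δ + δ)

    open Protocol π using (publicCoin; privateCoin)

    value : ℝ
    value = Protocol.expect π (massⁿ μ n) (λ ω o → indicator (o ≟ⁿ mapⁿ f n ω))

    norm : ProbSpace → ℕ → ℚ
    norm P m = Σ (elements (ProbSpace.space P)) (λ a → ∣ seq (ProbSpace.mass P a) m ∣)

    norm-small : ∀ P → Eventually (λ m → norm P m ≤ t)
    norm-small P = norm-≤ (ProbSpace.space P) (ProbSpace.mass P) (ProbSpace.isDistribution P) δ 0<δ

    module At (m : ℕ) where

      Â M̂ : ℚ
      Â = A X Y f μ (suc s) C m
      M̂ = M X Y f μ (suc s) C m

      value-≤ : ∀ c → Affordable n s (Protocol.‖_‖ π) c →
        (∀ τ → (∀ v → bits τ v ℕ.≤ c) → bias X Y f μ (suc s) C τ m ≤ K + (δ + δ)) →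
        1ℚ ≤ M̂ + δ → Â ≤ M̂ + δ → Â ≤ t →
        norm publicCoin m ≤ t → norm (privateCoin alice) m ≤ t → norm (privateCoin bob) m ≤ t →
        seq value m ≤ β ^ n
      value-≤ c afford small 1≤ Â≤ Â≤t nω na nb = ℚ.≤-trans {seq value m} {B * t * t * t} {β ^ n}
        (expect-≤ π (massⁿ μ n) (λ ω o → indicator (o ≟ⁿ mapⁿ f n ω)) m t B 0≤B 0≤t nω na nb λ ω α β →
          ℚ.≤-trans {∣ mean (X ^ᶠ n ×ᶠ Y ^ᶠ n) (massⁿ μ n) m (λ xy → seq (indicator
              (outcome (Protocol.tree π ω) (Protocol.view π xy α β) ≟ⁿ mapⁿ f n xy)) m) ∣}
            {hits ρ 10ρ≡9 X Y f μ m n (fixed π ω α β)} {B}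
            (∣success∣≤ ρ 10ρ≡9 X Y f μ m n (fixed π ω α β)
              (λ xy → outcome (Protocol.tree π ω) (Protocol.view π xy α β)) (outcome-fixed π ω α β))
            (hits-≤ ρ 10ρ≡9 X Y f μ m n (fixed π ω α β)
              (directProduct X Y f (μ̂ X Y f μ (suc s) C m) n s (Protocol.‖_‖ π) c (fixed π ω α β) (bits-fixed π ω α β)
                (λ τ short → hard X Y f μ (suc s) C m (K + (δ + δ) + δ) 10a≤Â τ (+-mono (bias X Y f μ (suc s) C τ m)
                  (K + (δ + δ)) (Â - M̂) δ (small τ short) excess)) afford)))
        (Slack.slack ρ t β 0≤ρ 1≤t enough n Â (0≤A X Y f μ (suc s) C m) Â≤t)
        where
        B = ρ ^ n * Â ^ n
        1≤t : 1ℚ ≤ t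
        1≤t = subst (_≤ t) (ℚ.+-identityʳ 1ℚ) (ℚ.+-monoʳ-≤ 1ℚ {0ℚ} {δ + δ} (0≤+ δ δ (ℚ.<⇒≤ 0<δ) (ℚ.<⇒≤ 0<δ)))
        0≤t = ℚ.≤-trans {0ℚ} {1ℚ} {t} 0≤1 1≤t
        0≤B : 0ℚ ≤ B
        0≤B = 0≤* (ρ ^ n) (Â ^ n) (^-nonneg ρ n 0≤ρ)
          (^-nonneg Â n (0≤A X Y f μ (suc s) C m))
        excess : Â - M̂ ≤ δ
        excess = by-diff (Â - M̂) δ (M̂ + δ - Â) (lemma Â M̂ δ) (diff-≥0 Â (M̂ + δ) Â≤)
          where
          lemma : ∀ a m d → d - (a - m) ≡ m + d - a
          lemma = S.solve 3 (λ a m d → d S.:- (a S.:- m) S.:= m S.:+ d S.:- a) refl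
        M̂≤Â : M̂ ≤ Â
        M̂≤Â = ℚ.≤-trans {M̂} {∣ M̂ ∣} {Â} (p≤∣p∣ M̂) (∣Σ∣≤ (elements (X ×ᶠ Y)) (q X Y f μ (suc s) C m))
        10a≤Â : nat 10 * (K + (δ + δ) + δ) ≤ Â
        10a≤Â = ℚ.≤-trans {nat 10 * (K + (δ + δ) + δ)} {1ℚ - δ} {Â}
          unbiased
          (ℚ.≤-trans {1ℚ - δ} {M̂} {Â} (by-diff (1ℚ - δ) M̂ (M̂ + δ - 1ℚ) (lemma M̂ δ) (diff-≥0 1ℚ (M̂ + δ) 1≤)) M̂≤Â)
          where
          lemma : ∀ m d → m - (1ℚ - d) ≡ m + d - 1ℚ
          lemma = S.solve 2 (λ m d → m S.:- (S.con 1ℚ S.:- d) S.:= m S.:+ d S.:- S.con 1ℚ) refl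

    -- A value above `β ^ n` would be so at all late indices. All the other estimates hold at late
    -- indices too, and at a common one the integer theorem contradicts it.
    success-≤ : value ℝ.≤ fromℚ (β ^ n)
    success-≤ β<value = suitable λ c (c≤C , afford) → contradict c afford
      (both (both (bias-bounded X Y f μ (suc s) C b K δ 0<δ b<K c c≤C adv≤b)
          (both (mass-≥ (X ×ᶠ Y) μ isD δ 0<δ) (both (norm-≤-mass (X ×ᶠ Y) μ isD δ 0<δ) (norm-≤ (X ×ᶠ Y) μ isD δ 0<δ))))
        (both (both (norm-small publicCoin) (both (norm-small (privateCoin alice)) (norm-small (privateCoin bob))))
          (<-eventually (fromℚ (β ^ n)) value β<value)))
      where
      contradict : ∀ c → Affordable n s (Protocol.‖_‖ π) c → Eventually (λ m →
        ((∀ τ → (∀ v → bits τ v ℕ.≤ c) → bias X Y f μ (suc s) C τ m ≤ K + (δ + δ)) ×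
          (1ℚ ≤ At.M̂ m + δ × At.Â m ≤ At.M̂ m + δ × At.Â m ≤ t)) ×
        (norm publicCoin m ≤ t × norm (privateCoin alice) m ≤ t × norm (privateCoin bob) m ≤ t) × β ^ n < seq value m) → ⊥
      contradict c afford (m , h) = (λ ((small , 1≤ , Â≤ , Â≤t) , (nω , na , nb) , β<v) → ℚ.<-irrefl {β ^ n} refl
        (ℚ.<-≤-trans {β ^ n} {seq value m} {β ^ n} β<v (At.value-≤ m c afford small 1≤ Â≤ Â≤t nω na nb))) (h m ℕ.≤-refl)

-- Numerical values.

module Constants where

  import Data.Integer.Base as ℤ
  open import Data.Rational.Base using (ℚ; 0ℚ; 1ℚ; _+_; _*_; _-_; _/_)
  import Data.Rational.Properties as ℚ
  open import Relation.Binary.PropositionalEquality using (refl)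
  open import Relation.Nullary.Decidable using (from-yes)
  open Rationals using (nat)
  open Success using (module Bound)

  -- 9/10 times 1.005^4 is below 19/20, and 10 (κ + 3 δ) = 0.085 is below 1 - δ.
  ρ δ β κ t : ℚ
  ρ = ℤ.+ 9 / 10
  δ = ℤ.+ 1 / 400
  β = ℤ.+ 19 / 20
  κ = ℤ.+ 1 / 1000
  t = 1ℚ + (δ + δ)

  module Instance = Bound ρ δ β κ refl (from-yes (0ℚ ℚ.≤? ρ)) (ℚ.positive⁻¹ δ)
    (from-yes (ρ * t * (t * t * t) ℚ.≤? β)) (from-yes (nat 10 * (κ + (δ + δ) + δ) ℚ.≤? 1ℚ - δ))

open import Data.Bool.Base using (Bool)
open import Data.Nat.Base using (ℕ; zero; suc; NonZero)
open import Data.Product.Base using (Σ-syntax; _×_; _,_)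
open import Defs
open Exponential using (exp-lower)
open Affordability using (0<κ; suitable)

corollary17 : Σ[ κ ∈ ℝ ] Σ[ κ>0 ∈ 0ℝ < κ ]
    ((X Y : FinSet) (f : Carrier X × Carrier Y → Bool)
    (μ : Carrier X × Carrier Y → ℝ) → IsDistribution (X ×ᶠ Y) μ →
    (n r : ℕ) .{{_ : NonZero n}} .{{_ : NonZero r}}
    (C : ℝ) → fromℕ 7 * (fromℕ r * log₂ r) * recip κ κ>0 < C →
    adv r X Y μ C f <ˢ κ →
    succ r (X ^ᶠ n) (Y ^ᶠ n) (massⁿ μ n)
    ((κ * C /ⁿ r - log₂ r) * fromℕ n) _≟ⁿ_ (mapⁿ f n)
    <ˢ exp (- (κ * fromℕ n)))
corollary17 = fromℚ Constants.κ , 0<κ , bound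
  where
  bound : (X Y : FinSet) (f : Carrier X × Carrier Y → Bool)
    (μ : Carrier X × Carrier Y → ℝ) → IsDistribution (X ×ᶠ Y) μ →
    (n r : ℕ) .{{_ : NonZero n}} .{{_ : NonZero r}}
    (C : ℝ) → fromℕ 7 * (fromℕ r * log₂ r) * recip (fromℚ Constants.κ) 0<κ < C →
    adv r X Y μ C f <ˢ fromℚ Constants.κ →
    succ r (X ^ᶠ n) (Y ^ᶠ n) (massⁿ μ n)
    ((fromℚ Constants.κ * C /ⁿ r - log₂ r) * fromℕ n) _≟ⁿ_ (mapⁿ f n)
    <ˢ exp (- (fromℚ Constants.κ * fromℕ n))
  -- The relation `<ˢ` asks for a single real strictly below the target; (19/20)^n lies between all
  -- success probabilities and the exponential.
  bound X Y f μ isD n (suc s) C large (b , b<κ , adv≤b) = fromℚ (Constants.β Rationals.^ n) , exp-lower n , λ (π , budget) →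
    Constants.Instance.success-≤ X Y f μ isD n s C b b<κ adv≤b π (suitable n s (Protocol.‖_‖ π) C large budget)
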